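{- Let $k=6$ or $k\ge 8$ be an integer with $k\equiv i \pmod 3$, let $n\ge N(k)$, and let $\pi=(d_1,\ldots,d_n)$ be a graphic sequence with $$\sigma(\pi)>2\left\lfloor\tfrac{2k}{3}\right\rfloor n-2n-\left\lfloor\tfrac{2k}{3}\right\rfloor^2+\left\lfloor\tfrac{2k}{3}\right\rfloor+1-(-1)^i.$$ Then $\pi$ has a realization containing every 2-tree on $k$ vertices as a subgraph. Moreover, the lower bound $2\lfloor\frac{2k}{3}\rfloor n-2n-\lfloor\frac{2k}{3}\rfloor^2+\lfloor\frac{2k}{3}\rfloor+1-(-1)^i$ on $\sigma(\pi)$ is the best possible.
   Context: A simple graph $G$ is a 2-tree if $G=K_3$, or $G$ has a vertex $v$ of degree 2 whose two neighbors are adjacent and $G-v$ is a 2-tree. A non-increasing sequence $\pi=(d_1,\ldots,d_n)$ of nonnegative integers with $d_1\le n-1$ is graphic if it is the degree sequence of some simple graph on $n$ vertices, called a realization of $\pi$. For such a sequence, $\sigma(\pi)=d_1+\cdots+d_n$. For $k=6$ or $k\ge 8$, $N(k)$ is defined by: $N(k)=20\lfloor\frac{k}{3}\rfloor^2-\lfloor\frac{k}{3}\rfloor$ if $k\equiv 0 \pmod 3$; $N(k)=20\lfloor\frac{k}{3}\rfloor^2+23\lfloor\frac{k}{3}\rfloor+5$ if $k\equiv 1 \pmod 3$; $N(k)=20\lfloor\frac{k}{3}\rfloor^2+31\lfloor\frac{k}{3}\rfloor+12$ if $k\equiv 2 \pmod 3$. -}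

module Defs where

open import Data.Nat as ℕ using (ℕ; zero; suc; _+_; _*_; _≤_; _/_; _%_)
open import Data.Integer as ℤ using (ℤ; +_; -_)
open import Data.Fin using (Fin; toℕ; punchIn)
open import Data.Bool using (Bool; true; false; if_then_else_)
open import Data.List using (List; map; allFin)
open import Data.Nat.ListAction using (sum)
open import Data.Product using (Σ; _×_; _,_)
open import Function.Definitions using (Injective)
open import Relation.Binary.PropositionalEquality using (_≡_; _≢_)

record Graph (n : ℕ) : Set where
  field
    adj    : Fin n → Fin n → Bool
    sym    : ∀ i j → adj i j ≡ adj j i
    irrefl : ∀ i → adj i i ≡ false
open Graph public

deg : ∀ {n} → Graph n → Fin n → ℕ
deg {n} G i = sum (map (λ j → if adj G i j then 1 else 0) (allFin n))

delete : ∀ {m} → Graph (suc m) → Fin (suc m) → Graph m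
delete G v = record
  { adj    = λ i j → adj G (punchIn v i) (punchIn v j)
  ; sym    = λ i j → sym G (punchIn v i) (punchIn v j)
  ; irrefl = λ i → irrefl G (punchIn v i) }

Complete : ∀ {n} → Graph n → Set
Complete {n} G = ∀ (a b : Fin n) → a ≢ b → adj G a b ≡ true

data IsTwoTree : (m : ℕ) → Graph m → Set where
  base : (G : Graph 3) → Complete G → IsTwoTree 3 G
  step : ∀ {m} (G : Graph (suc m)) (v : Fin (suc m)) →
         deg G v ≡ 2 →
         (∀ a b → adj G v a ≡ true → adj G v b ≡ true → a ≢ b → adj G a b ≡ true) →
         IsTwoTree m (delete G v) →
         IsTwoTree (suc m) G

_⊆G_ : ∀ {k n} → Graph k → Graph n → Set
_⊆G_ {k} {n} H G = Σ (Fin k → Fin n) λ f →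
  Injective _≡_ _≡_ f × (∀ a b → adj H a b ≡ true → adj G (f a) (f b) ≡ true)

NonIncreasing : ∀ {n} → (Fin n → ℕ) → Set
NonIncreasing {n} π = ∀ (i j : Fin n) → toℕ i ≤ toℕ j → π j ≤ π i

Realization : ∀ {n} → (Fin n → ℕ) → Graph n → Set
Realization {n} π G = ∀ (i : Fin n) → deg G i ≡ π i

-- graphic: non-increasing and has a realization (this implies d_1 ≤ n - 1)
Graphic : ∀ {n} → (Fin n → ℕ) → Set
Graphic {n} π = NonIncreasing π × Σ (Graph n) (Realization π)

σ : ∀ {n} → (Fin n → ℕ) → ℕ
σ {n} π = sum (map π (allFin n))

N : ℕ → ℕ
N k with k % 3
... | 0 = 20 * (q * q) ℕ.∸ q        where q = k / 3
... | 1 = 20 * (q * q) + 23 * q + 5 where q = k / 3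
... | _ = 20 * (q * q) + 31 * q + 12 where q = k / 3

negOnePow : ℕ → ℤ
negOnePow zero = + 1
negOnePow (suc i) = - negOnePow i

bound : ℕ → ℕ → ℤ
bound k n = (+ 2) ℤ.* t ℤ.* (+ n) ℤ.- (+ 2) ℤ.* (+ n) ℤ.- t ℤ.* t ℤ.+ t ℤ.+ (+ 1) ℤ.- negOnePow (k % 3)
  where t = + ((2 * k) / 3)

-- Put t = ⌊2k/3⌋ and τ = t − 1. A 2-tree on k vertices is 3-coloured so that any two colour classes induce a forest,
-- and deleting τ of its vertices can leave isolated vertices together with a copy of a small prescribed graph Γ: an
-- edge, or, when k ≡ 1 (mod 3), a path with two edges or two disjoint edges. So it is enough to find a realization
-- of π with K_τ ∨ Γ on its first k vertices. Start from any realization and exchange edges along alternating cycles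
-- of length 4 and 6; if a wanted edge can no longer be gained, then for a vertex w of the top almost all neighbours of w
-- are confined to few vertices, so too many edges to the top are missing for the degree sum, n being large.
-- If only j < τ degrees reach k − 1, then the sum forces the first k degrees to be at least j + 2(τ − j), and
-- the same argument works with j in place of τ and a larger Γ: a clique, K_{2,2}, K_{3,4} or a path on 5 vertices.
-- The bound is attained by the join of K_τ with an edgeless graph, or with a single edge and isolated vertices when
-- k ≡ 1 (mod 3). Its degree sequence has no other realization, and it does not contain the square of a path on k vertices.
module Submission where

open import Defs
open import Data.Nat hiding (_>_)
open import Data.Nat.Properties
open import Data.Nat.DivMod using (m≡m%n+[m/n]*n; [m+kn]%n≡m%n; m<n⇒m%n≡m)
open import Data.Nat.Tactic.RingSolver using (solve-∀)
import Data.Integer as ℤ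
import Data.Integer.Properties as ℤₚ
open import Data.Integer.Tactic.RingSolver using () renaming (solve-∀ to ℤ-solve-∀)
open import Data.Fin using (Fin; zero; suc; toℕ; fromℕ<; inject≤; punchIn; punchOut)
open import Data.Fin.Properties using (toℕ<n; toℕ-injective; toℕ-fromℕ<; toℕ-inject≤; any?; all?; punchIn-punchOut; punchInᵢ≢i)
open import Data.Bool using (Bool; true; false; if_then_else_; _∧_; _∨_; not; _xor_; T)
open import Data.List using (List; []; _∷_; length; map; allFin; tabulate)
open import Data.List.Properties using (map-tabulate)
import Data.Nat.ListAction as List
open import Data.Product using (Σ; ∃; _×_; _,_; proj₁; proj₂)
open import Data.Sum using (_⊎_; inj₁; inj₂; [_,_]′)
open import Data.Empty using (⊥; ⊥-elim)
open import Data.Unit using (⊤; tt)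
open import Function using (_∘_; id; case_of_)
open import Function.Definitions using (Injective)
open import Relation.Nullary using (¬_; Dec; yes; no; does)
open import Relation.Nullary.Decidable using (_×-dec_; _⊎-dec_; ¬?; dec-true; dec-false)
open import Relation.Binary.PropositionalEquality using (_≡_; _≢_; refl; cong; cong₂; subst; subst₂; trans; module ≡-Reasoning) renaming (sym to ≡-sym)
open import Algebra.Properties.CommutativeMonoid.Sum +-0-commutativeMonoid using () renaming (sum to ∑ₗ; ∑-distrib-+ to ∑ₗ-distrib; ∑-comm to ∑ₗ-comm; sum-remove to ∑ₗ-remove)
open import Algebra.Properties.Semiring.Sum +-*-semiring using () renaming (*-distribʳ-sum to *-distribʳ-∑ₗ)
open import Data.Bool.Properties using (∨-comm; ∧-comm)
open import Data.Vec.Functional using (insertAt)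
open import Data.Vec.Functional.Properties using (insertAt-lookup; insertAt-punchIn)

-- Counting on finite sets

-- At a stuck pair `u v`, four-cycles only compare neighbours of `u` with neighbours of `v`.
-- Hexagons reach the rest of the graph: their middle edge may be any edge with an end beyond the
-- first k vertices. The degree sum becomes the imbalance `1 + 2 * misses ≤ edges` between the edges
-- outside the top and the edges missing to it. Edges at a vertex with many misses are paid for by
-- these misses, and against about n times `# Ω` further misses too few edges remain. The obstacle
-- is that degrees are controlled only beyond the first k vertices: there they are at most 2k - 4,
-- since d_k ≥ 2k - 3 already yields a clique on k vertices. A removable neighbour `b` of `v` among
-- the first k has no such bound and needs its own arguments, depending on whether it is joined to
-- the whole top. The comparison also needs an end of the missing edge of dominating degree; hence
-- the edges at the top are completed before those of Γ, and each edge of Γ must admit a suitable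
-- orientation. The room left by N(k) is small: for k = 6 one of the estimates has no slack.

⟦_⟧ : Bool → ℕ
⟦ b ⟧ = if b then 1 else 0

-- The library sum, made opaque so that its summand can be inferred.
opaque
  ∑ : ∀ {n} → (Fin n → ℕ) → ℕ
  ∑ = ∑ₗ

# : ∀ {n} → (Fin n → Bool) → ℕ
# p = ∑ (λ x → ⟦ p x ⟧)

infix 4 _==_
_==_ : ∀ {n} → Fin n → Fin n → Bool
i == j = does (i Data.Fin.≟ j)

true≢false : ∀ {b} → b ≡ true → b ≡ false → ⊥
true≢false refl ()

==-refl : ∀ {n} (i : Fin n) → (i == i) ≡ true
==-refl i = dec-true (i Data.Fin.≟ i) refl

==⇒≡ : ∀ {n} {i j : Fin n} → (i == j) ≡ true → i ≡ j
==⇒≡ {i = i} {j} e with i Data.Fin.≟ j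
... | yes p = p

≢⇒== : ∀ {n} {i j : Fin n} → i ≢ j → (i == j) ≡ false
≢⇒== {i = i} {j} ne = dec-false (i Data.Fin.≟ j) ne

∧-true : ∀ {a b} → a ≡ true → b ≡ true → a ∧ b ≡ true
∧-true refl refl = refl

∧-fst : ∀ {a b} → a ∧ b ≡ true → a ≡ true
∧-fst {true} _ = refl

∧-snd : ∀ {a b} → a ∧ b ≡ true → b ≡ true
∧-snd {true} e = e

∨-inl : ∀ {a b} → a ≡ true → a ∨ b ≡ true
∨-inl refl = refl

∨-inr : ∀ {a b} → b ≡ true → a ∨ b ≡ true
∨-inr {true} _ = refl
∨-inr {false} e = e

∨-case : ∀ {a b} → a ∨ b ≡ true → a ≡ true ⊎ b ≡ true
∨-case {true} _ = inj₁ refl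
∨-case {false} e = inj₂ e

not-true : ∀ {b} → b ≡ false → not b ≡ true
not-true refl = refl

not⇒false : ∀ {b} → not b ≡ true → b ≡ false
not⇒false {false} _ = refl

bool : ∀ b → b ≡ true ⊎ b ≡ false
bool true = inj₁ refl
bool false = inj₂ refl

¬true⇒false : ∀ {b} → ¬ (b ≡ true) → b ≡ false
¬true⇒false {true} h = ⊥-elim (h refl)
¬true⇒false {false} _ = refl

does-true : ∀ {P : Set} (d : Dec P) → does d ≡ true → P
does-true (yes p) _ = p

⟦⟧-true : ∀ {b} → b ≡ true → ⟦ b ⟧ ≡ 1
⟦⟧-true refl = refl

⟦⟧-false : ∀ {b} → b ≡ false → ⟦ b ⟧ ≡ 0
⟦⟧-false refl = refl

⟦⟧≤1 : ∀ b → ⟦ b ⟧ ≤ 1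
⟦⟧≤1 true = ≤-refl
⟦⟧≤1 false = z≤n

⟦⟧-mono : ∀ {a b} → (a ≡ true → b ≡ true) → ⟦ a ⟧ ≤ ⟦ b ⟧
⟦⟧-mono {false} _ = z≤n
⟦⟧-mono {true} h = ≤-reflexive (≡-sym (⟦⟧-true (h refl)))

infixr 5 _⊕_
_⊕_ : ∀ {a b c d} → a ≤ b → c ≤ d → a + c ≤ b + d
_⊕_ = +-mono-≤

≤-by : ∀ {a b} s → a + s ≡ b → a ≤ b
≤-by {a} s e = subst (a ≤_) e (m≤m+n a s)

-- The form in which arithmetic is done without subtraction: the hypotheses, scaled as needed and
-- added with `⊕`, form `p ≤ q`; `s` is the slack; and the identity is left to the ring solver.
-- Contradictions take `A = 1` and `B = 0`.
linear : ∀ {A B p q} s → p ≤ q → A + q + s ≡ B + p → A ≤ B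
linear {A} {B} {p} {q} s h e = +-cancelʳ-≤ q A B (begin
  A + q ≤⟨ m≤m+n (A + q) s ⟩
  A + q + s ≡⟨ e ⟩
  B + p ≤⟨ +-monoʳ-≤ B h ⟩
  B + q ∎)
  where open ≤-Reasoning

opaque
  unfolding ∑

  ∑-mono : ∀ {n} {f g : Fin n → ℕ} → (∀ x → f x ≤ g x) → ∑ f ≤ ∑ g
  ∑-mono {zero} h = z≤n
  ∑-mono {suc n} h = h zero ⊕ ∑-mono (h ∘ suc)

  ∑-distrib-+ : ∀ {n} (f g : Fin n → ℕ) → ∑ (λ x → f x + g x) ≡ ∑ f + ∑ g
  ∑-distrib-+ = ∑ₗ-distrib

  ∑-comm : ∀ {m n} (f : Fin m → Fin n → ℕ) → ∑ (λ x → ∑ (f x)) ≡ ∑ (λ y → ∑ (λ x → f x y))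
  ∑-comm = ∑ₗ-comm

  ∑-remove : ∀ {n} i (f : Fin (suc n) → ℕ) → ∑ f ≡ f i + ∑ (f ∘ punchIn i)
  ∑-remove i f = ∑ₗ-remove {i = i} f

  ∑-suc : ∀ {n} (f : Fin (suc n) → ℕ) → ∑ f ≡ f zero + ∑ (f ∘ suc)
  ∑-suc f = refl

  ∑-nil : ∀ (f : Fin 0 → ℕ) → ∑ f ≡ 0
  ∑-nil f = refl

  ∑-strict : ∀ {n} (f g : Fin n → ℕ) i → (∀ x → f x ≤ g x) → f i < g i → ∑ f < ∑ g
  ∑-strict f g zero h l = +-mono-<-≤ l (∑-mono (h ∘ suc))
  ∑-strict f g (suc i) h l = +-mono-≤-< (h zero) (∑-strict (f ∘ suc) (g ∘ suc) i (h ∘ suc) l)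

  ∑-cong : ∀ {n} {f g : Fin n → ℕ} → (∀ x → f x ≡ g x) → ∑ f ≡ ∑ g
  ∑-cong {zero} h = refl
  ∑-cong {suc n} h = cong₂ _+_ (h zero) (∑-cong (h ∘ suc))

  ∑-const : ∀ n c → ∑ {n} (λ _ → c) ≡ n * c
  ∑-const zero c = refl
  ∑-const (suc n) c = cong (c +_) (∑-const n c)

  ∑-zero : ∀ n → ∑ {n} (λ _ → 0) ≡ 0
  ∑-zero n = trans (∑-const n 0) (*-zeroʳ n)

  ∑-term : ∀ {n} (f : Fin n → ℕ) i → f i ≤ ∑ f
  ∑-term f zero = m≤m+n _ _
  ∑-term f (suc i) = ≤-trans (∑-term (f ∘ suc) i) (m≤n+m _ _)

  ∑+ : ∀ {n} {f g : Fin n → ℕ} {a b} → ∑ f ≡ a → ∑ g ≡ b → ∑ (λ x → f x + g x) ≡ a + b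
  ∑+ {f = f} {g} refl refl = ∑-distrib-+ f g

  ∑-mono-2-2 : ∀ {n} {f g f' g' : Fin n → ℕ} → (∀ x → f x + g x ≤ f' x + g' x) →
    ∑ f + ∑ g ≤ ∑ f' + ∑ g'
  ∑-mono-2-2 {f = f} {g} {f'} {g'} h = begin
    ∑ f + ∑ g ≡⟨ ≡-sym (∑-distrib-+ f g) ⟩
    ∑ (λ x → f x + g x) ≤⟨ ∑-mono h ⟩
    ∑ (λ x → f' x + g' x) ≡⟨ ∑-distrib-+ f' g' ⟩
    ∑ f' + ∑ g' ∎
    where open ≤-Reasoning

  #-mono : ∀ {n} {p q : Fin n → Bool} → (∀ x → p x ≡ true → q x ≡ true) → # p ≤ # q
  #-mono h = ∑-mono (λ x → ⟦⟧-mono (h x))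

  #-cong : ∀ {n} {p q : Fin n → Bool} → (∀ x → p x ≡ q x) → # p ≡ # q
  #-cong h = ∑-cong (λ x → cong ⟦_⟧ (h x))

  #-single : ∀ {n} (i : Fin n) → # (i ==_) ≡ 1
  #-single {suc n} i = trans (∑-remove i (λ x → ⟦ i == x ⟧))
    (cong₂ _+_ (⟦⟧-true (==-refl i))
      (trans (∑-cong (λ x → ⟦⟧-false (≢⇒== {i = i} (punchInᵢ≢i i x ∘ ≡-sym)))) (∑-zero n)))

  #-⊤ : ∀ n → # {n} (λ _ → true) ≡ n
  #-⊤ n = trans (∑-const n 1) (*-identityʳ n)

  #≤n : ∀ {n} (p : Fin n → Bool) → # p ≤ n
  #≤n {n} p = subst (# p ≤_) (#-⊤ n) (#-mono {n} (λ _ _ → refl))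

  ∃⇒0<# : ∀ {n} {p : Fin n → Bool} i → p i ≡ true → 1 ≤ # p
  ∃⇒0<# {p = p} i e = subst (_≤ # p) (⟦⟧-true e) (∑-term (λ x → ⟦ p x ⟧) i)

  0<#⇒∃ : ∀ {n} (p : Fin n → Bool) → 1 ≤ # p → ∃ λ i → p i ≡ true
  0<#⇒∃ {suc n} p h with bool (p zero)
  ... | inj₁ e = zero , e
  ... | inj₂ e with 0<#⇒∃ (p ∘ suc) (subst (λ b → 1 ≤ ⟦ b ⟧ + # (p ∘ suc)) e h)
  ...   | i , e' = suc i , e'

  #-zero : ∀ {n} {p : Fin n → Bool} → (∀ i → p i ≡ false) → # p ≡ 0
  #-zero {n} h = trans (∑-cong (λ x → ⟦⟧-false (h x))) (∑-zero n)

  ∑-guard : ∀ {n} (p : Fin n → Bool) c → ∑ (λ x → ⟦ p x ⟧ * c) ≡ # p * c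
  ∑-guard p c = ≡-sym (*-distribʳ-∑ₗ c (λ x → ⟦ p x ⟧))

  <ᵇ-true : ∀ {m n} → m < n → (m <ᵇ n) ≡ true
  <ᵇ-true {m} {n} h with m <ᵇ n | <⇒<ᵇ h
  ... | true | _ = refl

  <ᵇ-true⁻ : ∀ {m n} → (m <ᵇ n) ≡ true → m < n
  <ᵇ-true⁻ {m} {n} e = <ᵇ⇒< m n (subst T (≡-sym e) tt)

  <ᵇ-false : ∀ {m n} → n ≤ m → (m <ᵇ n) ≡ false
  <ᵇ-false h = ¬true⇒false (λ e → <⇒≱ (<ᵇ-true⁻ e) h)

  <ᵇ-false⁻ : ∀ {m n} → (m <ᵇ n) ≡ false → n ≤ m
  <ᵇ-false⁻ {m} {n} e = ≮⇒≥ (λ h → true≢false (<ᵇ-true h) e)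

  #-below : ∀ {n} m → m ≤ n → # {n} (λ x → toℕ x <ᵇ m) ≡ m
  #-below {n} zero h = #-zero {n} (λ _ → refl)
  #-below {suc n} (suc m) (s≤s h) = cong suc (#-below {n} m h)

  #-below-≤ : ∀ {n} m → # {n} (λ x → toℕ x <ᵇ m) ≤ m
  #-below-≤ {n} zero = ≤-reflexive (#-zero {n} (λ _ → refl))
  #-below-≤ {zero} (suc m) = z≤n
  #-below-≤ {suc n} (suc m) = s≤s (#-below-≤ {n} m)

  #-interval : ∀ {n} (p : Fin n → Bool) a m → (∀ x → p x ≡ true → a ≤ toℕ x × toℕ x < a + m) → # p ≤ m
  #-interval {n} p zero m h = ≤-trans (#-mono (λ x e → <ᵇ-true (proj₂ (h x e)))) (#-below-≤ {n} m)
  #-interval {zero} p (suc a) m h = z≤n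
  #-interval {suc n} p (suc a) m h with bool (p zero)
  ... | inj₁ e = case proj₁ (h zero e) of λ ()
  ... | inj₂ e = subst (λ b → ⟦ b ⟧ + # (p ∘ suc) ≤ m) (≡-sym e)
          (#-interval (p ∘ suc) a m (λ x e' → s≤s⁻¹ (proj₁ (h (suc x) e')) , s≤s⁻¹ (proj₂ (h (suc x) e'))))

  #≤1 : ∀ {n} (p : Fin n → Bool) → (∀ i j → p i ≡ true → p j ≡ true → i ≡ j) → # p ≤ 1
  #≤1 p h with 1 ≤? # p
  ... | no ¬h = ≤-trans (≤-pred (≰⇒> ¬h)) z≤n
  ... | yes h' = let i , e = 0<#⇒∃ p h' in
    subst (# p ≤_) (#-single i) (#-mono (λ x e' → subst (λ y → (y == x) ≡ true) (h x i e' e) (==-refl x)))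

  #-split : ∀ {n} (p q : Fin n → Bool) → # (λ x → p x ∧ q x) + # (λ x → p x ∧ not (q x)) ≡ # p
  #-split p q = trans (≡-sym (∑-distrib-+ (λ x → ⟦ p x ∧ q x ⟧) (λ x → ⟦ p x ∧ not (q x) ⟧))) (∑-cong λ x → lemma (p x) (q x))
    where
    lemma : ∀ a b → ⟦ a ∧ b ⟧ + ⟦ a ∧ not b ⟧ ≡ ⟦ a ⟧
    lemma true true = refl
    lemma true false = refl
    lemma false _ = refl

  #-compl : ∀ {n} (q : Fin n → Bool) → # q + # (not ∘ q) ≡ n
  #-compl {n} q = trans (#-split (λ _ → true) q) (#-⊤ n)

  #-remove : ∀ {n} (p : Fin n → Bool) i → p i ≡ true → # p ≡ suc (# (λ x → p x ∧ not (i == x)))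
  #-remove p i e = trans (≡-sym (#-split p (i ==_))) (cong (_+ # (λ x → p x ∧ not (i == x)))
    (trans (#-cong (λ x → lemma x)) (#-single i)))
    where
    lemma : ∀ x → p x ∧ (i == x) ≡ (i == x)
    lemma x with bool (i == x)
    ... | inj₁ eq = trans (cong (p x ∧_) eq) (trans (∧-true (subst (λ y → p y ≡ true) (==⇒≡ eq) e) refl) (≡-sym eq))
    ... | inj₂ eq = trans (cong (p x ∧_) eq) (trans (lem (p x)) (≡-sym eq))
      where lem : ∀ b → b ∧ false ≡ false
            lem true = refl
            lem false = refl

  interpolate : ∀ {n} (p q : Fin n → Bool) m → (∀ x → p x ≡ true → q x ≡ true) → # p ≤ m → m ≤ # q →
    Σ (Fin n → Bool) λ r → (∀ x → p x ≡ true → r x ≡ true) × (∀ x → r x ≡ true → q x ≡ true) × # r ≡ m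
  interpolate {zero} p q zero _ _ _ = p , (λ _ e → e) , (λ ()) , refl
  interpolate {suc n} p q m pq l u with bool (p zero) | bool (q zero)
  interpolate {suc n} p q m pq l u | inj₁ ep | inj₂ eq = ⊥-elim (true≢false (pq zero ep) eq)
  interpolate {suc n} p q zero pq l u | inj₁ ep | inj₁ eq =
    ⊥-elim (<⇒≱ (∃⇒0<# {p = p} zero ep) l)
  interpolate {suc n} p q (suc m) pq l u | inj₁ ep | inj₁ eq
    with interpolate (p ∘ suc) (q ∘ suc) m (λ x → pq (suc x))
           (s≤s⁻¹ (subst (λ b → ⟦ b ⟧ + # (p ∘ suc) ≤ suc m) ep l))
           (s≤s⁻¹ (subst (λ b → suc m ≤ ⟦ b ⟧ + # (q ∘ suc)) eq u))
  ... | r , pr , rq , c = (λ { zero → true ; (suc x) → r x }) , (λ { zero _ → refl ; (suc x) → pr x })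
      , (λ { zero _ → eq ; (suc x) → rq x }) , cong suc c
  interpolate {suc n} p q m pq l u | inj₂ ep | inj₂ eq
    with interpolate (p ∘ suc) (q ∘ suc) m (λ x → pq (suc x))
           (subst (λ b → ⟦ b ⟧ + # (p ∘ suc) ≤ m) ep l)
           (subst (λ b → m ≤ ⟦ b ⟧ + # (q ∘ suc)) eq u)
  ... | r , pr , rq , c = (λ { zero → false ; (suc x) → r x })
      , (λ { zero e → ⊥-elim (true≢false e ep) ; (suc x) → pr x }) , (λ { zero () ; (suc x) → rq x }) , c
  interpolate {suc n} p q m pq l u | inj₂ ep | inj₁ eq with m ≤? # (q ∘ suc)
  ... | yes u' with interpolate (p ∘ suc) (q ∘ suc) m (λ x → pq (suc x))
           (subst (λ b → ⟦ b ⟧ + # (p ∘ suc) ≤ m) ep l) u'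
  ...   | r , pr , rq , c = (λ { zero → false ; (suc x) → r x })
      , (λ { zero e → ⊥-elim (true≢false e ep) ; (suc x) → pr x }) , (λ { zero () ; (suc x) → rq x }) , c
  interpolate {suc n} p q m pq l u | inj₂ ep | inj₁ eq | no ¬u =
    q , pq , (λ _ e → e) , ≤-antisym (subst (λ b → ⟦ b ⟧ + # (q ∘ suc) ≤ m) (≡-sym eq) (≰⇒> ¬u)) u

  embed-# : ∀ {n} (p : Fin n → Bool) k → k ≤ # p →
    Σ (Fin k → Fin n) λ f → Injective _≡_ _≡_ f × (∀ i → p (f i) ≡ true)
  embed-# p zero _ = (λ ()) , (λ { {()} }) , (λ ())
  embed-# {n} p (suc k) h with 0<#⇒∃ p (≤-trans (s≤s z≤n) h)
  ... | i , e with embed-# (λ x → p x ∧ not (i == x)) k (s≤s⁻¹ (subst (suc k ≤_) (#-remove p i e) h))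
  ...   | f , inj , ok = g , g-inj , (λ { zero → e ; (suc a) → ∧-fst (ok a) })
    where
    g : Fin (suc k) → Fin n
    g zero = i
    g (suc a) = f a
    i≢f : ∀ a → i ≢ f a
    i≢f a eq = true≢false (subst (λ y → (i == y) ≡ true) eq (==-refl i)) (not⇒false (∧-snd {p (f a)} (ok a)))
    g-inj : Injective _≡_ _≡_ g
    g-inj {zero} {zero} _ = refl
    g-inj {zero} {suc b} eq = ⊥-elim (i≢f b eq)
    g-inj {suc a} {zero} eq = ⊥-elim (i≢f a (≡-sym eq))
    g-inj {suc a} {suc b} eq = cong suc (inj eq)

  list-sum≡∑ : ∀ {n} (f : Fin n → ℕ) → List.sum (map f (allFin n)) ≡ ∑ f
  list-sum≡∑ f = trans (cong List.sum (map-tabulate id f)) (go f)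
    where
    go : ∀ {n} (f : Fin n → ℕ) → List.sum (tabulate f) ≡ ∑ f
    go {zero} f = refl
    go {suc n} f = cong (f zero +_) (go (f ∘ suc))

  deg≡# : ∀ {n} (G : Graph n) i → deg G i ≡ # (adj G i)
  deg≡# G i = list-sum≡∑ (λ j → ⟦ adj G i j ⟧)

  σ≡∑ : ∀ {n} (π : Fin n → ℕ) → σ π ≡ ∑ π
  σ≡∑ π = list-sum≡∑ π

-- Edge switches

#-flip : ∀ {n} (f : Fin n → Bool) b c → b ≢ c → f b ≡ not (f c) →
  # (λ j → ((b == j) ∨ (c == j)) xor f j) ≡ # f
#-flip {n} f b c b≢c e = +-cancelʳ-≡ 1 _ _ (trans left right)
  where
  pick : ∀ (i : Fin n) x → ∑ (λ j → ⟦ i == j ⟧ * x) ≡ x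
  pick i x = trans (∑-guard (i ==_) x) (trans (cong (_* x) (#-single i)) (*-identityˡ x))
  -- `l` carries the old and `r` the new values at `b` and `c`. Added to opposite sides they make
  -- the comparison pointwise; each sums to 1 because `f b` and `f c` differ.
  l r : Fin n → ℕ
  l j = ⟦ b == j ⟧ * ⟦ f b ⟧ + ⟦ c == j ⟧ * ⟦ f c ⟧
  r j = ⟦ b == j ⟧ * ⟦ not (f b) ⟧ + ⟦ c == j ⟧ * ⟦ not (f c) ⟧
  one : ∀ x y → x ≡ not y → ⟦ x ⟧ + ⟦ y ⟧ ≡ 1
  one .true false refl = refl
  one .false true refl = refl
  one' : ∀ x y → x ≡ not y → ⟦ not x ⟧ + ⟦ not y ⟧ ≡ 1
  one' .true false refl = refl
  one' .false true refl = refl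
  xor-not : ∀ x → ⟦ not x ⟧ + (⟦ x ⟧ + 0 + 0) ≡ ⟦ x ⟧ + (⟦ not x ⟧ + 0 + 0)
  xor-not true = refl
  xor-not false = refl
  point : ∀ j → ⟦ ((b == j) ∨ (c == j)) xor f j ⟧ + l j ≡ ⟦ f j ⟧ + r j
  point j with b Data.Fin.≟ j | c Data.Fin.≟ j
  ... | yes refl | yes refl = ⊥-elim (b≢c refl)
  ... | yes refl | no _ = xor-not (f b)
  ... | no _ | yes refl = trans (cong (⟦ not (f c) ⟧ +_) (≡-sym (+-identityʳ _))) (trans (xor-not (f c)) (cong (⟦ f c ⟧ +_) (+-identityʳ _)))
  ... | no _ | no _ = refl
  sl : ∑ l ≡ 1
  sl = trans (∑+ (pick b _) (pick c _)) (one _ _ e)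
  sr : ∑ r ≡ 1
  sr = trans (∑+ (pick b _) (pick c _)) (one' _ _ e)
  left : # (λ j → ((b == j) ∨ (c == j)) xor f j) + 1 ≡ ∑ (λ j → ⟦ f j ⟧ + r j)
  left = trans (≡-sym (∑+ refl sl)) (∑-cong point)
  right : ∑ (λ j → ⟦ f j ⟧ + r j) ≡ # f + 1
  right = ∑+ refl sr

adj-sym : ∀ {n} (G : Graph n) {x y z} → adj G x y ≡ z → adj G y x ≡ z
adj-sym G {x} {y} e = trans (sym G y x) e

adj⇒≢ : ∀ {n} (G : Graph n) {x y} → adj G x y ≡ true → x ≢ y
adj⇒≢ G {x} e refl = true≢false e (irrefl G x)

-- Replaces the edges ab, dc by ac, db: both colour classes of the 4-cycle lie in {a,d} × {b,c}.
module Switch {n} (G : Graph n) (a b c d : Fin n)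
  (ab : adj G a b ≡ true) (dc : adj G d c ≡ true) (ac : adj G a c ≡ false) (db : adj G d b ≡ false)
  (a≢c : a ≢ c) (d≢b : d ≢ b) where

  left right : Fin n → Bool
  left i = (a == i) ∨ (d == i)
  right i = (b == i) ∨ (c == i)

  toggled : Fin n → Fin n → Bool
  toggled i j = (left i ∧ right j) ∨ (right i ∧ left j)

  left-cases : ∀ {i} → left i ≡ true → a ≡ i ⊎ d ≡ i
  left-cases {i} e with ∨-case {a == i} e
  ... | inj₁ e' = inj₁ (==⇒≡ e')
  ... | inj₂ e' = inj₂ (==⇒≡ e')

  right-cases : ∀ {i} → right i ≡ true → b ≡ i ⊎ c ≡ i
  right-cases {i} e with ∨-case {b == i} e
  ... | inj₁ e' = inj₁ (==⇒≡ e')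
  ... | inj₂ e' = inj₂ (==⇒≡ e')

  left⇒¬right : ∀ i → left i ≡ true → right i ≡ false
  left⇒¬right i l = ¬true⇒false λ r → clash (left-cases l) (right-cases r)
    where
    clash : a ≡ i ⊎ d ≡ i → b ≡ i ⊎ c ≡ i → ⊥
    clash (inj₁ refl) (inj₁ e) = adj⇒≢ G ab (≡-sym e)
    clash (inj₁ refl) (inj₂ e) = a≢c (≡-sym e)
    clash (inj₂ refl) (inj₁ e) = d≢b (≡-sym e)
    clash (inj₂ refl) (inj₂ e) = adj⇒≢ G dc (≡-sym e)

  a≢d : a ≢ d
  a≢d refl = true≢false ab db

  b≢c : b ≢ c
  b≢c refl = true≢false ab ac

  switched : Graph n
  switched = record
    { adj = λ i j → toggled i j xor adj G i j
    ; sym = λ i j → cong₂ _xor_ (toggled-sym i j) (sym G i j)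
    ; irrefl = λ i → trans (cong (_xor adj G i i) (toggled-irrefl i)) (irrefl G i) }
    where
    toggled-sym : ∀ i j → toggled i j ≡ toggled j i
    toggled-sym i j = trans (∨-comm (left i ∧ right j) _) (cong₂ _∨_ (∧-comm (right i) _) (∧-comm (left i) _))
    toggled-irrefl : ∀ i → toggled i i ≡ false
    toggled-irrefl i with bool (left i)
    ... | inj₁ l rewrite l | left⇒¬right i l = refl
    ... | inj₂ l rewrite l with right i
    ...   | true = refl
    ...   | false = refl

  switched-deg : ∀ i → deg switched i ≡ deg G i
  switched-deg i = trans (deg≡# switched i) (trans (row i) (≡-sym (deg≡# G i)))
    where
    flip-true : ∀ {x y} → x ≡ true → y ≡ false → x ≡ not y
    flip-true refl refl = refl
    flip-false : ∀ {x y} → x ≡ false → y ≡ true → x ≡ not y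
    flip-false refl refl = refl
    s : ∀ {x y z} → adj G x y ≡ z → adj G y x ≡ z
    s {x} {y} e = trans (sym G y x) e
    row : ∀ i → # (adj switched i) ≡ # (adj G i)
    row i with bool (left i) | bool (right i)
    ... | inj₁ l | _ = trans (#-cong λ j → cong (_xor adj G i j) (eq j)) (#-flip (adj G i) b c b≢c (cond (left-cases l)))
      where
      eq : ∀ j → toggled i j ≡ right j
      eq j rewrite l | left⇒¬right i l with right j
      ... | true = refl
      ... | false = refl
      cond : a ≡ i ⊎ d ≡ i → adj G i b ≡ not (adj G i c)
      cond (inj₁ refl) = flip-true ab ac
      cond (inj₂ refl) = flip-false db dc
    ... | inj₂ l | inj₁ r = trans (#-cong λ j → cong (_xor adj G i j) (eq j)) (#-flip (adj G i) a d a≢d (cond (right-cases r)))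
      where
      eq : ∀ j → toggled i j ≡ left j
      eq j rewrite l | r with left j
      ... | true = refl
      ... | false = refl
      cond : b ≡ i ⊎ c ≡ i → adj G i a ≡ not (adj G i d)
      cond (inj₁ refl) = flip-true (s ab) (s db)
      cond (inj₂ refl) = flip-false (s ac) (s dc)
    ... | inj₂ l | inj₂ r = #-cong λ j → cong (_xor adj G i j) (eq j)
      where
      eq : ∀ j → toggled i j ≡ false
      eq j rewrite l | r = refl

  new-ac : adj switched a c ≡ true
  new-ac rewrite ==-refl a | ==-refl c | ac with b == c
  ... | true = refl
  ... | false = refl

  same : ∀ x y → ¬ ((a ≡ x ⊎ d ≡ x) × (b ≡ y ⊎ c ≡ y)) → ¬ ((b ≡ x ⊎ c ≡ x) × (a ≡ y ⊎ d ≡ y)) →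
    adj switched x y ≡ adj G x y
  same x y h h' = cong (_xor adj G x y) (¬true⇒false λ t → case ∨-case {left x ∧ right y} t of λ
    { (inj₁ e) → h (left-cases (∧-fst e) , right-cases (∧-snd {left x} e))
    ; (inj₂ e) → h' (right-cases (∧-fst e) , left-cases (∧-snd {right x} e)) })

module _ {n} (F : Fin n → Fin n → Bool) where

  -- `F` marks the wanted pairs. Only these are protected, so any other edge of the current
  -- realization may be spent on a switch.
  Keeps : Graph n → Graph n → Set
  Keeps G G' = (∀ i → deg G' i ≡ deg G i) × (∀ x y → F x y ≡ true → adj G x y ≡ true → adj G' x y ≡ true)

  Keeps-trans : ∀ {G G' G''} → Keeps G G' → Keeps G' G'' → Keeps G G''
  Keeps-trans (d , k) (d' , k') = (λ i → trans (d' i) (d i)) , (λ x y f e → k' x y f (k x y f e))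

  Improves : Graph n → Fin n → Fin n → Set
  Improves G u v = Σ (Graph n) λ G' → Keeps G G' × adj G' u v ≡ true

  Removable : Graph n → Fin n → Fin n → Set
  Removable G u r = adj G u r ≡ true × F u r ≡ false

module _ {n} (F : Fin n → Fin n → Bool) (F-sym : ∀ x y → F x y ≡ F y x) where

  -- One switch adds uv and r b at the cost of u r and b v.
  module Swap (G : Graph n) (u r v b : Fin n) (ur : Removable F G u r) (vb : Removable F G v b)
    (u≁v : adj G u v ≡ false) (u≢v : u ≢ v) (r≁b : adj G r b ≡ false) (r≢b : r ≢ b) where

    open Switch G u r v b (proj₁ ur) (trans (sym G b v) (proj₁ vb)) u≁v (trans (sym G b r) r≁b) u≢v (r≢b ∘ ≡-sym)
      using (switched; switched-deg; same; new-ac) public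

    switch-keeps : Keeps F G switched
    switch-keeps = switched-deg , keep
      where
      keep : ∀ x y → F x y ≡ true → adj G x y ≡ true → adj switched x y ≡ true
      keep x y f e = trans (same x y one two) e
        where
        one : ¬ ((u ≡ x ⊎ b ≡ x) × (r ≡ y ⊎ v ≡ y))
        one (inj₁ refl , inj₁ refl) = true≢false f (proj₂ ur)
        one (inj₁ refl , inj₂ refl) = true≢false e u≁v
        one (inj₂ refl , inj₁ refl) = true≢false e (trans (sym G b r) r≁b)
        one (inj₂ refl , inj₂ refl) = true≢false f (trans (F-sym b v) (proj₂ vb))
        two : ¬ ((r ≡ x ⊎ v ≡ x) × (u ≡ y ⊎ b ≡ y))
        two (inj₁ refl , inj₁ refl) = true≢false f (trans (F-sym r u) (proj₂ ur))
        two (inj₁ refl , inj₂ refl) = true≢false e r≁b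
        two (inj₂ refl , inj₁ refl) = true≢false e (trans (sym G v u) u≁v)
        two (inj₂ refl , inj₂ refl) = true≢false f (proj₂ vb)

  improve₂ : ∀ (G : Graph n) u r v b → Removable F G u r → Removable F G v b →
    adj G u v ≡ false → u ≢ v → adj G r b ≡ false → r ≢ b → Improves F G u v
  improve₂ G u r v b ur vb uv u≢v rb r≢b =
    Swap.switched G u r v b ur vb uv u≢v rb r≢b , Swap.switch-keeps G u r v b ur vb uv u≢v rb r≢b ,
    Swap.new-ac G u r v b ur vb uv u≢v rb r≢b

  -- The alternating hexagon u r y x b v; the middle edge xy is first exchanged with u r.
  improve₃ : ∀ (G : Graph n) u r v b x y → Removable F G u r → Removable F G v b →
    adj G u v ≡ false → u ≢ v → Removable F G x y → F u x ≡ false → x ≢ u → x ≢ v →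
    adj G x b ≡ false → x ≢ b → adj G r y ≡ false → r ≢ y → Improves F G u v
  improve₃ G u r v b x y ur vb uv u≢v xy fux x≢u x≢v xb x≢b ry r≢y with bool (adj G u x)
  -- If `u x` is already an edge, it is unwanted and takes the place of `u r`, so one switch is
  -- enough.
  ... | inj₁ ux = improve₂ G u x v b (ux , fux) vb uv u≢v xb x≢b
  ... | inj₂ ux = let G'' , k , new = improve₂ G' u x v b (new₁ , fux) vb' uv' u≢v xb' x≢b in
    G'' , Keeps-trans F {G} {G'} {G''} (Swap.switch-keeps G u r x y ur xy ux u≢x ry r≢y) k , new
    where
    u≢x = x≢u ∘ ≡-sym
    open Switch G u r x y (proj₁ ur) (trans (sym G y x) (proj₁ xy)) ux (trans (sym G y r) ry) u≢x (r≢y ∘ ≡-sym)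
      renaming (switched to G'; new-ac to new₁; same to same₁)
    vu : adj G v u ≡ false
    vu = trans (sym G v u) uv
    -- The first switch only toggles pairs between `u`, `y` and `r`, `x`; what the second one relies
    -- on has to survive it.
    uv' : adj G' u v ≡ false
    uv' = trans (same₁ u v
      (λ { (_ , inj₁ refl) → true≢false (proj₁ ur) uv ; (_ , inj₂ e) → x≢v e })
      (λ { (inj₁ refl , _) → true≢false (proj₁ ur) (irrefl G u) ; (inj₂ e , _) → x≢u e })) uv
    vb' : Removable F G' v b
    vb' = trans (same₁ v b
      (λ { (inj₁ e , _) → u≢v e ; (inj₂ refl , inj₁ refl) → true≢false (trans (sym G r y) (proj₁ vb)) ry
         ; (inj₂ _ , inj₂ e) → x≢b e })
      (λ { (inj₁ refl , _) → true≢false (proj₁ ur) uv ; (inj₂ e , _) → x≢v e })) (proj₁ vb) , proj₂ vb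
    xb' : adj G' x b ≡ false
    xb' = trans (same₁ x b
      (λ { (inj₁ e , _) → u≢x e ; (inj₂ refl , _) → true≢false (proj₁ xy) (irrefl G x) })
      (λ { (inj₁ refl , _) → true≢false (proj₁ ur) ux
         ; (inj₂ _ , inj₁ refl) → true≢false (proj₁ vb) vu
         ; (inj₂ _ , inj₂ refl) → true≢false (proj₁ xy) xb })) xb

-- No alternating path of length three or five closes up with uv; Out x says that x is not used by F.
record Stuck {n} (F : Fin n → Fin n → Bool) (Out : Fin n → Bool) (G : Graph n) (u v : Fin n) : Set where
  field
    complete : ∀ r b → Removable F G u r → Removable F G v b → adj G r b ≡ true ⊎ r ≡ b
    blocked : ∀ r b x y → Removable F G u r → Removable F G v b → adj G x y ≡ true →
      Out x ≡ true ⊎ Out y ≡ true → (adj G b x ≡ true ⊎ b ≡ x) ⊎ (adj G r y ≡ true ⊎ r ≡ y)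
open Stuck public

module _ {n} (F : Fin n → Fin n → Bool) (F-sym : ∀ x y → F x y ≡ F y x) (Out : Fin n → Bool)
  (F-out : ∀ x y → Out x ≡ true → F x y ≡ false) where

  F-out' : ∀ x y → Out y ≡ true → F x y ≡ false
  F-out' x y o = trans (F-sym x y) (F-out y x o)

  -- Exhaustive search, hexagons before four-cycles. An end `x` outside makes both the middle edge
  -- `x y` and the auxiliary pair `u x` unwanted; if only `y` is known to be outside, the hexagon is
  -- read backwards from `v`.
  improve-or-stuck : ∀ G u v → F u v ≡ true → adj G u v ≡ false → u ≢ v → Improves F G u v ⊎ Stuck F Out G u v
  improve-or-stuck G u v fuv uv u≢v with any? (λ r → any? (λ b → any? (λ x → any? (λ y → bad? r b x y))))
    where
    near? : ∀ b x → Dec (adj G b x ≡ true ⊎ b ≡ x)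
    near? b x = (adj G b x Data.Bool.≟ true) ⊎-dec (b Data.Fin.≟ x)
    rem? : ∀ u r → Dec (Removable F G u r)
    rem? u r = (adj G u r Data.Bool.≟ true) ×-dec (F u r Data.Bool.≟ false)
    bad? : ∀ r b x y → Dec (Removable F G u r × Removable F G v b × adj G x y ≡ true ×
      (Out x ≡ true ⊎ Out y ≡ true) × (¬ (adj G b x ≡ true ⊎ b ≡ x)) × (¬ (adj G r y ≡ true ⊎ r ≡ y)))
    bad? r b x y = rem? u r ×-dec rem? v b ×-dec (adj G x y Data.Bool.≟ true) ×-dec
      ((Out x Data.Bool.≟ true) ⊎-dec (Out y Data.Bool.≟ true)) ×-dec ¬? (near? b x) ×-dec ¬? (near? r y)
  ... | yes (r , b , x , y , ur , vb , xy , inj₁ o , xb , ry) = inj₁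
    (improve₃ F F-sym G u r v b x y ur vb uv u≢v (xy , F-out x y o) (F-out' u x o)
      (λ { refl → true≢false fuv (F-out u v o) }) (λ { refl → true≢false fuv (F-out' u v o) })
      (trans (sym G x b) (¬true⇒false (xb ∘ inj₁))) (xb ∘ inj₂ ∘ ≡-sym) (¬true⇒false (ry ∘ inj₁)) (ry ∘ inj₂))
  ... | yes (r , b , x , y , ur , vb , xy , inj₂ o , xb , ry) = inj₁ (back
    (improve₃ F F-sym G v b u r y x vb ur (trans (sym G v u) uv) (u≢v ∘ ≡-sym) (trans (sym G y x) xy , F-out y x o) (F-out' v y o)
      (λ { refl → true≢false fuv (F-out' u v o) }) (λ { refl → true≢false fuv (F-out u v o) })
      (trans (sym G y r) (¬true⇒false (ry ∘ inj₁))) (ry ∘ inj₂ ∘ ≡-sym) (¬true⇒false (xb ∘ inj₁)) (xb ∘ inj₂)))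
    where
    back : Improves F G v u → Improves F G u v
    back (G' , k , e) = G' , k , trans (sym G' u v) e
  ... | no ¬bad with any? (λ r → any? (λ b → gap? r b))
    where
    gap? : ∀ r b → Dec (Removable F G u r × Removable F G v b × adj G r b ≡ false × r ≢ b)
    gap? r b = ((adj G u r Data.Bool.≟ true) ×-dec (F u r Data.Bool.≟ false)) ×-dec
      ((adj G v b Data.Bool.≟ true) ×-dec (F v b Data.Bool.≟ false)) ×-dec
      (adj G r b Data.Bool.≟ false) ×-dec ¬? (r Data.Fin.≟ b)
  ...   | yes (r , b , ur , vb , rb , r≢b) = inj₁ (improve₂ F F-sym G u r v b ur vb uv u≢v rb r≢b)
  ...   | no ¬gap = inj₂ (record { complete = comp ; blocked = blk })
    where
    comp : ∀ r b → Removable F G u r → Removable F G v b → adj G r b ≡ true ⊎ r ≡ b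
    comp r b ur vb with bool (adj G r b) | r Data.Fin.≟ b
    ... | inj₁ e | _ = inj₁ e
    ... | inj₂ e | yes p = inj₂ p
    ... | inj₂ e | no ¬p = ⊥-elim (¬gap (r , b , ur , vb , e , ¬p))
    near : ∀ b x → (adj G b x ≡ true ⊎ b ≡ x) ⊎ (¬ (adj G b x ≡ true ⊎ b ≡ x))
    near b x with bool (adj G b x) | b Data.Fin.≟ x
    ... | inj₁ e | _ = inj₁ (inj₁ e)
    ... | inj₂ e | yes p = inj₁ (inj₂ p)
    ... | inj₂ e | no ¬p = inj₂ [ (λ e' → true≢false e' e) , ¬p ]′
    blk : ∀ r b x y → Removable F G u r → Removable F G v b → adj G x y ≡ true →
      Out x ≡ true ⊎ Out y ≡ true → (adj G b x ≡ true ⊎ b ≡ x) ⊎ (adj G r y ≡ true ⊎ r ≡ y)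
    blk r b x y ur vb xy o with near b x | near r y
    ... | inj₁ p | _ = inj₁ p
    ... | inj₂ _ | inj₁ p = inj₂ p
    ... | inj₂ p | inj₂ q = ⊥-elim (¬bad (r , b , x , y , ur , vb , xy , o , p , q))

  missing : Graph n → ℕ
  missing G = ∑ (λ x → # (λ y → F x y ∧ not (adj G x y)))

  -- Each improvement lowers `missing`, since no wanted edge is lost and `u v` is new. `A` leaves
  -- room for another outcome: `⊥` when a stuck pair is contradictory, a ready clique in
  -- `clique-realization`.
  saturate : ∀ {A : Set} (I : Graph n → Set) → (∀ {G G'} → I G → Keeps F G G' → I G') →
    (∀ G → I G → ∀ u v → F u v ≡ true → adj G u v ≡ false → A ⊎ Improves F G u v) →
    ∀ G → I G → A ⊎ Σ (Graph n) λ G' → I G' × (∀ x y → F x y ≡ true → adj G' x y ≡ true)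
  saturate {A} I pres advance G iG = go (suc (missing G)) G ≤-refl iG
    where
    go : ∀ fuel G → missing G < fuel → I G → A ⊎ Σ (Graph n) λ G' → I G' × (∀ x y → F x y ≡ true → adj G' x y ≡ true)
    go zero G () _
    go (suc fuel) G lt iG with any? (λ u → any? (λ v → (F u v Data.Bool.≟ true) ×-dec (adj G u v Data.Bool.≟ false)))
    ... | no ¬m = inj₂ (G , iG , λ x y f → [ id , (λ e → ⊥-elim (¬m (x , y , f , e))) ]′ (bool (adj G x y)))
    ... | yes (u , v , f , e) with advance G iG u v f e
    ...   | inj₁ a = inj₁ a
    ...   | inj₂ (G' , k , new) = go fuel G' (≤-trans decr (s≤s⁻¹ lt)) (pres iG k)
      where
      cell : ∀ x y → (F x y ∧ not (adj G' x y)) ≡ true → (F x y ∧ not (adj G x y)) ≡ true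
      cell x y c = ∧-true (∧-fst c) (not-true (¬true⇒false λ e →
        true≢false (proj₂ k x y (∧-fst c) e) (not⇒false (∧-snd {F x y} c))))
      rowle : ∀ x → # (λ y → F x y ∧ not (adj G' x y)) ≤ # (λ y → F x y ∧ not (adj G x y))
      rowle x = #-mono (cell x)
      cell-uv : ⟦ F u v ∧ not (adj G' u v) ⟧ ≡ 0
      cell-uv rewrite new | f = refl
      decr : missing G' < missing G
      decr = ∑-strict _ _ u rowle (∑-strict _ _ v (λ y → ⟦⟧-mono (cell u y))
        (subst (_< ⟦ F u v ∧ not (adj G u v) ⟧) (≡-sym cell-uv) (≤-reflexive (≡-sym (⟦⟧-true (∧-true f (not-true e)))))))

-- Degree sums

guard-# : ∀ {n} b (q : Fin n → Bool) → ⟦ b ⟧ * # q ≡ # (λ y → b ∧ q y)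
guard-# true q = +-identityʳ _
guard-# {n} false q = ≡-sym (#-zero {n} (λ _ → refl))

∑-guard-mono : ∀ {n} (p : Fin n → Bool) {f g : Fin n → ℕ} → (∀ x → p x ≡ true → f x ≤ g x) →
  ∑ (λ x → ⟦ p x ⟧ * f x) ≤ ∑ (λ x → ⟦ p x ⟧ * g x)
∑-guard-mono p {f} {g} h = ∑-mono λ x → point x (bool (p x))
  where
  point : ∀ x → p x ≡ true ⊎ p x ≡ false → ⟦ p x ⟧ * f x ≤ ⟦ p x ⟧ * g x
  point x (inj₁ e) = *-monoʳ-≤ ⟦ p x ⟧ (h x e)
  point x (inj₂ e) rewrite e = z≤n

∑-guard-split : ∀ {n} (p : Fin n → Bool) (f : Fin n → ℕ) →
  ∑ (λ x → ⟦ p x ⟧ * f x) + ∑ (λ x → ⟦ not (p x) ⟧ * f x) ≡ ∑ f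
∑-guard-split p f = trans (≡-sym (∑-distrib-+ _ _)) (∑-cong λ x → point (p x) (f x))
  where
  point : ∀ b m → ⟦ b ⟧ * m + ⟦ not b ⟧ * m ≡ m
  point true m = trans (+-identityʳ _) (+-identityʳ m)
  point false m = +-identityʳ m

∑-guard-+ : ∀ {n} (p : Fin n → Bool) (f g : Fin n → ℕ) →
  ∑ (λ x → ⟦ p x ⟧ * (f x + g x)) ≡ ∑ (λ x → ⟦ p x ⟧ * f x) + ∑ (λ x → ⟦ p x ⟧ * g x)
∑-guard-+ p f g = trans (∑-cong λ x → *-distribˡ-+ ⟦ p x ⟧ (f x) (g x)) (∑-distrib-+ _ _)

## : ∀ {m n} → (Fin m → Fin n → Bool) → ℕ
## P = ∑ (λ x → # (P x))

##-swap : ∀ {m n} (P : Fin m → Fin n → Bool) → ## P ≡ ## (λ y x → P x y)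
##-swap P = ∑-comm (λ x y → ⟦ P x y ⟧)

##-guard : ∀ {m n} (p : Fin m → Bool) (P : Fin m → Fin n → Bool) →
  ## (λ x y → p x ∧ P x y) ≡ ∑ (λ x → ⟦ p x ⟧ * # (P x))
##-guard p P = ∑-cong λ x → ≡-sym (guard-# (p x) (P x))

##-product : ∀ {m n} (p : Fin m → Bool) (q : Fin n → Bool) → ## (λ x y → p x ∧ q y) ≡ # p * # q
##-product p q = trans (##-guard p (λ _ → q)) (∑-guard p (# q))

cover₄ : ∀ {a p q r s} → (a ≡ true → p ≡ true ⊎ q ≡ true ⊎ r ≡ true ⊎ s ≡ true) →
  ⟦ a ⟧ ≤ ⟦ p ⟧ + (⟦ q ⟧ + (⟦ r ⟧ + ⟦ s ⟧))
cover₄ {false} h = z≤n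
cover₄ {true} {p} {q} {r} {s} h with h refl
... | inj₁ refl = s≤s z≤n
... | inj₂ (inj₁ refl) = ≤-trans (s≤s z≤n) (m≤n+m (suc (⟦ r ⟧ + ⟦ s ⟧)) ⟦ p ⟧)
... | inj₂ (inj₂ (inj₁ refl)) = ≤-trans (≤-trans (s≤s z≤n) (m≤n+m (suc ⟦ s ⟧) ⟦ q ⟧)) (m≤n+m _ ⟦ p ⟧)
... | inj₂ (inj₂ (inj₂ refl)) = ≤-trans (≤-trans (m≤n+m 1 ⟦ r ⟧) (m≤n+m _ ⟦ q ⟧)) (m≤n+m _ ⟦ p ⟧)

∑-mono-4 : ∀ {n} (f f₁ f₂ f₃ f₄ : Fin n → ℕ) → (∀ x → f x ≤ f₁ x + (f₂ x + (f₃ x + f₄ x))) →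
  ∑ f ≤ ∑ f₁ + (∑ f₂ + (∑ f₃ + ∑ f₄))
∑-mono-4 f f₁ f₂ f₃ f₄ h = subst (∑ f ≤_) (∑+ refl (∑+ refl (∑+ refl refl))) (∑-mono h)

#-cover₄ : ∀ {n} (P P₁ P₂ P₃ P₄ : Fin n → Bool) →
  (∀ x → P x ≡ true → P₁ x ≡ true ⊎ P₂ x ≡ true ⊎ P₃ x ≡ true ⊎ P₄ x ≡ true) →
  # P ≤ # P₁ + (# P₂ + (# P₃ + # P₄))
#-cover₄ P P₁ P₂ P₃ P₄ h = ∑-mono-4 (⟦_⟧ ∘ P) (⟦_⟧ ∘ P₁) (⟦_⟧ ∘ P₂) (⟦_⟧ ∘ P₃) (⟦_⟧ ∘ P₄)
  (λ x → cover₄ {P x} {P₁ x} {P₂ x} {P₃ x} {P₄ x} (h x))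

##-cover₄ : ∀ {m n} (P P₁ P₂ P₃ P₄ : Fin m → Fin n → Bool) →
  (∀ x y → P x y ≡ true → P₁ x y ≡ true ⊎ P₂ x y ≡ true ⊎ P₃ x y ≡ true ⊎ P₄ x y ≡ true) →
  ## P ≤ ## P₁ + (## P₂ + (## P₃ + ## P₄))
##-cover₄ P P₁ P₂ P₃ P₄ h = ∑-mono-4 (# ∘ P) (# ∘ P₁) (# ∘ P₂) (# ∘ P₃) (# ∘ P₄)
  (λ x → #-cover₄ (P x) (P₁ x) (P₂ x) (P₃ x) (P₄ x) (h x))

#-cover₂ : ∀ {n} (P P₁ P₂ : Fin n → Bool) → (∀ x → P x ≡ true → P₁ x ≡ true ⊎ P₂ x ≡ true) → # P ≤ # P₁ + # P₂
#-cover₂ P P₁ P₂ h = subst (# P ≤_) (∑+ refl refl) (∑-mono λ x → point {P x} {P₁ x} {P₂ x} (h x))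
  where
  point : ∀ {a p q} → (a ≡ true → p ≡ true ⊎ q ≡ true) → ⟦ a ⟧ ≤ ⟦ p ⟧ + ⟦ q ⟧
  point {false} _ = z≤n
  point {true} {p} h with h refl
  ... | inj₁ refl = s≤s z≤n
  ... | inj₂ refl = m≤n+m 1 ⟦ p ⟧

every : ∀ {n} → (Fin n → Bool) → Bool
every p = does (all? (λ x → p x Data.Bool.≟ true))

every-elim : ∀ {n} {p : Fin n → Bool} → every p ≡ true → ∀ x → p x ≡ true
every-elim {p = p} e = does-true (all? (λ x → p x Data.Bool.≟ true)) e

every-intro : ∀ {n} {p : Fin n → Bool} → (∀ x → p x ≡ true) → every p ≡ true
every-intro {p = p} h = dec-true (all? (λ x → p x Data.Bool.≟ true)) h

-- The first τ vertices are the top; c, e count the neighbours inside and outside the top, m the non-neighbours in it.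
module Top {n} (G : Graph n) (τ : ℕ) (τ≤n : τ ≤ n) where

  top rest : Fin n → Bool
  top x = toℕ x <ᵇ τ
  rest x = not (top x)

  c e m : Fin n → ℕ
  c x = # (λ y → adj G x y ∧ top y)
  e x = # (λ y → adj G x y ∧ rest y)
  m x = # (λ y → top y ∧ not (adj G x y))

  #top : # top ≡ τ
  #top = #-below τ τ≤n

  top+rest : τ + # rest ≡ n
  top+rest = trans (cong (_+ # rest) (≡-sym #top)) (#-compl top)

  deg-c-e : ∀ x → deg G x ≡ c x + e x
  deg-c-e x = trans (deg≡# G x) (≡-sym (#-split (adj G x) top))

  c+m : ∀ x → c x + m x ≡ τ
  c+m x = trans (cong (_+ m x) (#-cong λ y → ∧-comm (adj G x y) (top y))) (trans (#-split top (adj G x)) #top)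

  misses edges : ℕ
  misses = ∑ (λ x → ⟦ rest x ⟧ * m x)
  edges = ∑ (λ x → ⟦ rest x ⟧ * e x)

  private
    C : ℕ
    C = ∑ (λ x → ⟦ rest x ⟧ * c x)

    C+misses : C + misses ≡ # rest * τ
    C+misses = trans (≡-sym (∑-guard-+ rest c m))
      (trans (∑-cong λ x → cong (⟦ rest x ⟧ *_) (c+m x)) (∑-guard rest τ))

    sum-rest : ∑ (λ x → ⟦ rest x ⟧ * deg G x) ≡ C + edges
    sum-rest = trans (∑-cong λ x → cong (⟦ rest x ⟧ *_) (deg-c-e x)) (∑-guard-+ rest c e)

    across : ∑ (λ x → ⟦ top x ⟧ * e x) ≡ C
    across = begin
      ∑ (λ x → ⟦ top x ⟧ * e x) ≡⟨ ≡-sym (##-guard top _) ⟩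
      ## (λ x y → top x ∧ (adj G x y ∧ rest y)) ≡⟨ ##-swap _ ⟩
      ## (λ y x → top x ∧ (adj G x y ∧ rest y)) ≡⟨ ∑-cong (λ y → #-cong (λ x → shuffle (top x) (sym G x y) (rest y))) ⟩
      ## (λ y x → rest y ∧ (adj G y x ∧ top x)) ≡⟨ ##-guard rest _ ⟩
      C ∎
      where
      open ≡-Reasoning
      shuffle : ∀ a {b b'} → b ≡ b' → ∀ d → a ∧ (b ∧ d) ≡ d ∧ (b' ∧ a)
      shuffle true {true} refl true = refl
      shuffle true {true} refl false = refl
      shuffle true {false} refl true = refl
      shuffle true {false} refl false = refl
      shuffle false {true} refl true = refl
      shuffle false {true} refl false = refl
      shuffle false {false} refl true = refl
      shuffle false {false} refl false = refl

    inside : ∑ (λ x → ⟦ top x ⟧ * c x) + τ ≤ τ * τ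
    inside = begin
      ∑ (λ x → ⟦ top x ⟧ * c x) + τ ≡⟨ cong (∑ (λ x → ⟦ top x ⟧ * c x) +_) (≡-sym (trans (∑-guard top 1) (trans (*-identityʳ _) #top))) ⟩
      ∑ (λ x → ⟦ top x ⟧ * c x) + ∑ (λ x → ⟦ top x ⟧ * 1) ≡⟨ ≡-sym (∑-guard-+ top c (λ _ → 1)) ⟩
      ∑ (λ x → ⟦ top x ⟧ * (c x + 1)) ≤⟨ ∑-guard-mono top (λ x t → small x t) ⟩
      ∑ (λ x → ⟦ top x ⟧ * τ) ≡⟨ trans (∑-guard top τ) (cong (_* τ) #top) ⟩
      τ * τ ∎
      where
      open ≤-Reasoning
      small : ∀ x → top x ≡ true → c x + 1 ≤ τ
      small x t = begin
        c x + 1 ≡⟨ +-comm _ 1 ⟩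
        suc (c x) ≤⟨ s≤s (#-mono λ y e' → ∧-true (∧-snd {adj G x y} e')
            (not-true (≢⇒== {i = x} λ { refl → true≢false (∧-fst e') (irrefl G x) }))) ⟩
        suc (# (λ y → top y ∧ not (x == y))) ≡⟨ ≡-sym (#-remove top x t) ⟩
        # top ≡⟨ #top ⟩
        τ ∎

    total : ∑ (deg G) ≡ ∑ (λ x → ⟦ top x ⟧ * c x) + C + (C + edges)
    total = trans (≡-sym (∑-guard-split top (deg G)))
      (cong₂ _+_ (trans (∑-cong λ x → cong (⟦ top x ⟧ *_) (deg-c-e x))
        (trans (∑-guard-+ top c e) (cong (∑ (λ x → ⟦ top x ⟧ * c x) +_) across))) sum-rest)

  -- At most `τ * τ` - τ comes from inside the top, the edges across it are `# rest * τ` minus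
  -- `misses` and count twice, and `edges` counts ordered pairs outside. With the hypothesis on the
  -- degree sum this becomes `1 + 2 * misses ≤ edges`.
  degree-sum : ∑ (deg G) + τ + 2 * misses ≤ τ * τ + 2 * (# rest * τ) + edges
  degree-sum = subst (_≤ τ * τ + 2 * (# rest * τ) + edges) (cong (λ s → s + τ + 2 * misses) (≡-sym total))
    (subst (λ r → ∑ (λ x → ⟦ top x ⟧ * c x) + C + (C + edges) + τ + 2 * misses ≤ τ * τ + 2 * r + edges) C+misses
      (linear 0 inside (arith _ C misses edges τ)))
    where
    arith : ∀ a C M E t → a + C + (C + E) + t + 2 * M + t * t + 0 ≡ t * t + 2 * (C + M) + E + (a + t)
    arith = solve-∀

  -- The edges across the top are bounded by the degrees of their outer ends.
  degree-sum-rest : ∑ (deg G) + τ ≤ τ * τ + 2 * ∑ (λ x → ⟦ rest x ⟧ * deg G x)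
  degree-sum-rest = subst (λ s → s + τ ≤ τ * τ + 2 * ∑ (λ x → ⟦ rest x ⟧ * deg G x)) (≡-sym total)
    (subst (λ r → ∑ (λ x → ⟦ top x ⟧ * c x) + C + (C + edges) + τ ≤ τ * τ + 2 * r) (≡-sym sum-rest)
      (linear edges inside (arith _ C edges τ)))
    where
    arith : ∀ a C E t → a + C + (C + E) + t + t * t + E ≡ t * t + 2 * (C + E) + (a + t)
    arith = solve-∀

  -- Seen from the top, the edges across are at most `# rest * τ`; seen from outside, they stay
  -- inside the degrees. This charges an excess degree outside once instead of twice.
  degree-sum-mixed : ∑ (deg G) + τ ≤ τ * τ + # rest * τ + ∑ (λ x → ⟦ rest x ⟧ * deg G x)
  degree-sum-mixed = subst₂ (λ s q → s + τ ≤ τ * τ + # rest * τ + q) (≡-sym total) (≡-sym sum-rest)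
    (subst (λ r → ∑ (λ x → ⟦ top x ⟧ * c x) + C + (C + edges) + τ ≤ τ * τ + r + (C + edges)) C+misses
      (linear misses inside (arith _ C misses edges τ)))
    where
    arith : ∀ a C M E t → a + C + (C + E) + t + t * t + M ≡ t * t + (C + M) + (C + E) + (a + t)
    arith = solve-∀

-- The counting arguments at a missing edge

outside : ∀ {n} → ℕ → Fin n → Bool
outside k x = not (toℕ x <ᵇ k)

closed : ∀ {n} → Graph n → Fin n → Fin n → Bool
closed G b x = adj G b x ∨ (b == x)

near⇒closed : ∀ {n} (G : Graph n) {b x} → adj G b x ≡ true ⊎ b ≡ x → closed G b x ≡ true
near⇒closed G (inj₁ e) = ∨-inl e
near⇒closed G {b} {x} (inj₂ refl) = ∨-inr {adj G b b} (==-refl b)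

closed⇒near : ∀ {n} (G : Graph n) {b x} → closed G b x ≡ true → adj G b x ≡ true ⊎ b ≡ x
closed⇒near G {b} {x} e with ∨-case {adj G b x} e
... | inj₁ a = inj₁ a
... | inj₂ a = inj₂ (==⇒≡ a)

∧-∨-intro : ∀ {a b} → (a ≡ true → b ≡ true) → not a ∨ b ≡ true
∧-∨-intro {true} h = h refl
∧-∨-intro {false} h = refl

∧-∨-elim : ∀ {a b} → not a ∨ b ≡ true → a ≡ true → b ≡ true
∧-∨-elim e refl = e

-- Counting in a graph where uv is missing and cannot be gained: R is the set of removable neighbours of u,
-- C the common closed neighbourhood of R outside the top, Ω the top vertices with few neighbours outside F.
module Crowd {n} (G : Graph n) (k τ D κ : ℕ) (τ≤k : τ ≤ k) (τ≤n : τ ≤ n)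
  (F : Fin n → Fin n → Bool) (u v r₀ b : Fin n) (stuck : Stuck F (outside k) G u v)
  (ur₀ : Removable F G u r₀) (vb : Removable F G v b) (b-rest : (toℕ b <ᵇ τ) ≡ false)
  (R-out : ∀ r → Removable F G u r → outside k r ≡ true)
  (u-deg : suc (deg G u) ≤ # (λ r → adj G u r ∧ not (F u r)) + (κ + τ))
  (u-max : ∀ z → (toℕ z <ᵇ τ) ≡ false → deg G z ≤ deg G u)
  (out-deg : ∀ x → outside k x ≡ true → deg G x ≤ D) where

  open Top G τ τ≤n

  R C Q Qr X Ωb Ωr Ω O : Fin n → Bool
  R r = adj G u r ∧ not (F u r)
  C z = rest z ∧ every (λ r → not (R r) ∨ closed G r z)
  Q x = rest x ∧ closed G b x
  Qr x = rest x ∧ closed G r₀ x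
  X x = rest x ∧ (toℕ x <ᵇ k)
  Ωb w = top w ∧ every (λ x → not (outside k x ∧ adj G w x) ∨ closed G b x)
  Ωr w = top w ∧ every (λ x → not (outside k x ∧ adj G w x) ∨ closed G r₀ x)
  Ω w = Ωb w ∨ Ωr w
  O x = outside k x ∧ (not (closed G b x) ∧ not (closed G r₀ x))

  beyond : Fin n → Fin n → Bool
  beyond z y = (adj G z y ∧ rest y) ∧ not (closed G b y)

  removable : ∀ {r} → R r ≡ true → Removable F G u r
  removable {r} e = ∧-fst e , not⇒false (∧-snd {adj G u r} e)

  R-intro : ∀ {r} → Removable F G u r → R r ≡ true
  R-intro (e , f) = ∧-true e (not-true f)

  out⇒rest : ∀ {x} → outside k x ≡ true → rest x ≡ true
  out⇒rest o = not-true (<ᵇ-false (≤-trans τ≤k (<ᵇ-false⁻ (not⇒false o))))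

  R⊆closed-b : ∀ {r} → R r ≡ true → closed G b r ≡ true
  R⊆closed-b {r} e = near⇒closed G ([ inj₁ ∘ adj-sym G , inj₂ ∘ ≡-sym ]′ (complete stuck r b (removable e) vb))

  -- With `x` not in the closed neighbourhood of `b`, `blocked` leaves only the alternative at `y`,
  -- and it does so for every removable `r` at once.
  C-intro : ∀ {x y} → adj G x y ≡ true → outside k x ≡ true ⊎ outside k y ≡ true → closed G b x ≡ false →
    rest y ≡ true → C y ≡ true
  C-intro {x} {y} xy o bx ry = ∧-true ry (every-intro λ r → ∧-∨-intro λ e →
    near⇒closed G ([ (λ q → ⊥-elim (true≢false (near⇒closed G q) bx)) , id ]′ (blocked stuck r b x y (removable e) vb xy o)))

  C⇒closed : ∀ {r z} → C z ≡ true → R r ≡ true → closed G r z ≡ true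
  C⇒closed {r} {z} e er = ∧-∨-elim (every-elim (∧-snd {rest z} e) r) er

  -- Here `blocked` is applied to the edges from outside into `w`: as `w` is not near `r`, their
  -- outer ends must be near `b`. `Ωr-intro` is the same with the roles of `b` and `r₀` exchanged.
  Ωb-intro : ∀ {r w} → R r ≡ true → top w ≡ true → adj G w r ≡ false → Ωb w ≡ true
  Ωb-intro {r} {w} er tw wr = ∧-true tw (every-intro λ x → ∧-∨-intro λ e →
    near⇒closed G ([ id , (λ q → ⊥-elim (absurd q)) ]′
      (blocked stuck r b x w (removable er) vb (adj-sym G (∧-snd {outside k x} e)) (inj₁ (∧-fst e)))))
    where
    absurd : adj G r w ≡ true ⊎ r ≡ w → ⊥
    absurd (inj₁ a) = true≢false (adj-sym G a) wr
    absurd (inj₂ refl) = true≢false tw (not⇒false (out⇒rest (R-out r (removable er))))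

  Ωr-intro : ∀ {w} → top w ≡ true → adj G w b ≡ false → Ωr w ≡ true
  Ωr-intro {w} tw wb = ∧-true tw (every-intro λ x → ∧-∨-intro λ e →
    near⇒closed G ([ (λ q → ⊥-elim (absurd q)) , id ]′
      (blocked stuck r₀ b w x ur₀ vb (∧-snd {outside k x} e) (inj₂ (∧-fst e)))))
    where
    absurd : adj G b w ≡ true ⊎ b ≡ w → ⊥
    absurd (inj₁ a) = true≢false (adj-sym G a) wb
    absurd (inj₂ refl) = true≢false tw b-rest

  Ωb-out : ∀ {w x} → Ωb w ≡ true → outside k x ≡ true → adj G w x ≡ true → closed G b x ≡ true
  Ωb-out {w} {x} e o a = ∧-∨-elim (every-elim (∧-snd {top w} e) x) (∧-true o a)

  Ωr-out : ∀ {w x} → Ωr w ≡ true → outside k x ≡ true → adj G w x ≡ true → closed G r₀ x ≡ true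
  Ωr-out {w} {x} e o a = ∧-∨-elim (every-elim (∧-snd {top w} e) x) (∧-true o a)

  m-r₀≤Ω : m r₀ ≤ # Ω
  m-r₀≤Ω = #-mono λ w e → ∨-inl (Ωb-intro (R-intro ur₀) (∧-fst e) (adj-sym G (not⇒false (∧-snd {top w} e))))

  m-b≤Ω : m b ≤ # Ω
  m-b≤Ω = #-mono λ w e → ∨-inr {Ωb w} (Ωr-intro (∧-fst e) (adj-sym G (not⇒false (∧-snd {top w} e))))

  -- The source of missing edges: outer neighbours of a vertex of Ω are near `b` or near `r₀`, so a
  -- vertex of `O` misses all of Ω. As `O` contains nearly all vertices, already one member of Ω
  -- costs about `n` edges.
  Ω≤m : ∀ {x} → O x ≡ true → # Ω ≤ m x
  Ω≤m {x} e = #-mono λ w ew → [ viab , viar ]′ (∨-case {Ωb w} ew)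
    where
    o = ∧-fst {outside k x} e
    bx = not⇒false (∧-fst {not (closed G b x)} (∧-snd {outside k x} e))
    rx = not⇒false (∧-snd {not (closed G b x)} (∧-snd {outside k x} e))
    viab : ∀ {w} → Ωb w ≡ true → (top w ∧ not (adj G x w)) ≡ true
    viab ew = ∧-true (∧-fst ew) (not-true (¬true⇒false λ a → true≢false (Ωb-out ew o (adj-sym G a)) bx))
    viar : ∀ {w} → Ωr w ≡ true → (top w ∧ not (adj G x w)) ≡ true
    viar ew = ∧-true (∧-fst ew) (not-true (¬true⇒false λ a → true≢false (Ωr-out ew o (adj-sym G a)) rx))

  C⊆closed-r₀ : ∀ {z} → C z ≡ true → closed G r₀ z ≡ true
  C⊆closed-r₀ e = C⇒closed e (R-intro ur₀)

  C⊆Qr : ∀ z → C z ≡ true → Qr z ≡ true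
  C⊆Qr z e = ∧-true (∧-fst e) (C⊆closed-r₀ e)

  closed-rest : ∀ z → # (λ x → rest x ∧ closed G z x) ≤ e z + 1
  closed-rest z = subst (# (λ x → rest x ∧ closed G z x) ≤_) (cong (e z +_) (#-single z))
    (#-cover₂ _ (λ y → adj G z y ∧ rest y) (z ==_) λ x h → lemma x (∧-fst h) (∨-case {adj G z x} (∧-snd {rest x} h)))
    where
    lemma : ∀ x → rest x ≡ true → adj G z x ≡ true ⊎ (z == x) ≡ true → (adj G z x ∧ rest x) ≡ true ⊎ (z == x) ≡ true
    lemma x rx (inj₁ a) = inj₁ (∧-true a rx)
    lemma x rx (inj₂ a) = inj₂ a

  closed-rest-τ : ∀ z → # (λ x → rest x ∧ closed G z x) + τ ≤ deg G z + 1 + m z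
  closed-rest-τ z = subst₂' (closed-rest z) (deg-c-e z) (c+m z)
    where
    subst₂' : ∀ {q t d cz ez mz} → q ≤ ez + 1 → d ≡ cz + ez → cz + mz ≡ t → q + t ≤ d + 1 + mz
    subst₂' {q} {cz = cz} {ez} {mz} h refl refl = linear 0 h (arith q cz ez mz)
      where
      arith : ∀ q c e m → q + (c + m) + (e + 1) + 0 ≡ c + e + 1 + m + q
      arith = solve-∀

  #Q+τ : # Q + τ ≤ deg G b + 1 + # Ω
  #Q+τ = ≤-trans (closed-rest-τ b) (+-monoʳ-≤ _ m-b≤Ω)

  #Qr+τ : # Qr + τ ≤ D + 1 + # Ω
  #Qr+τ = ≤-trans (closed-rest-τ r₀) (+-mono-≤ (+-monoˡ-≤ 1 (out-deg r₀ (R-out r₀ ur₀))) m-r₀≤Ω)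

  -- A vertex z of C is adjacent to all of R, while deg z ≤ deg u; so few of its neighbours lie elsewhere.
  sparse : ∀ (p : Fin n → Bool) z → (∀ y → p y ≡ true → (adj G z y ∧ rest y) ≡ true) → (∀ y → p y ≡ true → R y ≡ false) →
    C z ≡ true → # p ≤ κ + m z
  sparse p z p⊆ p∩R cz = finish count (deg-c-e z) (c+m z) (u-max z (not⇒false (∧-fst cz))) u-deg
    where
    count : # p + # R ≤ e z + 1
    count = subst (# p + # R ≤_) (cong (e z +_) (#-single z)) (∑-mono-2-2 λ y → point y (bool (p y)) (bool (R y)))
      where
      p⇒e : ∀ y → ⟦ p y ⟧ ≤ ⟦ adj G z y ∧ rest y ⟧
      p⇒e y = ⟦⟧-mono (p⊆ y)
      R⇒ : ∀ y → R y ≡ true → 1 ≤ ⟦ adj G z y ∧ rest y ⟧ + ⟦ z == y ⟧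
      R⇒ y ry with closed⇒near G (C⇒closed cz ry)
      ... | inj₁ a = ≤-trans (≤-reflexive (≡-sym (⟦⟧-true (∧-true (adj-sym G a) (out⇒rest (R-out y (removable ry))))))) (m≤m+n _ _)
      ... | inj₂ refl = ≤-trans (≤-reflexive (≡-sym (⟦⟧-true (==-refl y)))) (m≤n+m _ _)
      point : ∀ y → p y ≡ true ⊎ p y ≡ false → R y ≡ true ⊎ R y ≡ false → ⟦ p y ⟧ + ⟦ R y ⟧ ≤ ⟦ adj G z y ∧ rest y ⟧ + ⟦ z == y ⟧
      point y (inj₁ py) (inj₁ ry) = ⊥-elim (true≢false ry (p∩R y py))
      point y (inj₂ py) (inj₁ ry) = subst₂ _≤_ (cong₂ _+_ (≡-sym (⟦⟧-false py)) (≡-sym (⟦⟧-true ry))) refl (R⇒ y ry)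
      point y _ (inj₂ ry) = subst (_≤ ⟦ adj G z y ∧ rest y ⟧ + ⟦ z == y ⟧)
        (trans (≡-sym (+-identityʳ ⟦ p y ⟧)) (cong (⟦ p y ⟧ +_) (≡-sym (⟦⟧-false ry)))) (≤-trans (p⇒e y) (m≤m+n _ _))
    finish : ∀ {q R' ez cz mz t d du} → q + R' ≤ ez + 1 → d ≡ cz + ez → cz + mz ≡ t → d ≤ du → suc du ≤ R' + (κ + t) →
      q ≤ κ + mz
    finish {q} {R'} {ez} {cz} {mz} {du = du} h refl refl h' h'' =
      linear 0 (h ⊕ h' ⊕ h'') (arith q R' ez cz mz du κ)
      where
      arith : ∀ q R' e c m du κ → q + (e + 1 + (du + (R' + (κ + (c + m))))) + 0 ≡ κ + m + (q + R' + (c + e + suc du))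
      arith = solve-∀

  beyond≤ : ∀ z → C z ≡ true → # (beyond z) ≤ κ + m z
  beyond≤ z = sparse (beyond z) z (λ y → ∧-fst)
    λ y e → ¬true⇒false λ ry → true≢false (R⊆closed-b ry) (not⇒false (∧-snd {adj G z y ∧ rest y} e))

  partition : n ≤ k + (# O + (# Q + # Qr))
  partition = ≤-trans (≤-reflexive (≡-sym (#-⊤ n)))
    (≤-trans (#-cover₄ (λ _ → true) (λ x → toℕ x <ᵇ k) O Q Qr λ x _ → cases x (bool (toℕ x <ᵇ k)) (bool (closed G b x)) (bool (closed G r₀ x)))
      (+-monoˡ-≤ _ (#-below-≤ {n} k)))
    where
    cases : ∀ x → (toℕ x <ᵇ k) ≡ true ⊎ (toℕ x <ᵇ k) ≡ false → closed G b x ≡ true ⊎ closed G b x ≡ false →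
      closed G r₀ x ≡ true ⊎ closed G r₀ x ≡ false →
      (toℕ x <ᵇ k) ≡ true ⊎ O x ≡ true ⊎ Q x ≡ true ⊎ Qr x ≡ true
    cases x (inj₁ e) _ _ = inj₁ e
    cases x (inj₂ e) (inj₁ e') _ = inj₂ (inj₂ (inj₁ (∧-true (out⇒rest (not-true e)) e')))
    cases x (inj₂ e) (inj₂ e') (inj₁ e'') = inj₂ (inj₂ (inj₂ (∧-true (out⇒rest (not-true e)) e'')))
    cases x (inj₂ e) (inj₂ e') (inj₂ e'') = inj₂ (inj₁ (∧-true (not-true e) (∧-true (not-true e') (not-true e''))))

  edge : Fin n → Fin n → Bool
  edge x y = rest x ∧ (adj G x y ∧ rest y)

  edges≡ : edges ≡ ## edge
  edges≡ = ≡-sym (##-guard rest (λ x y → adj G x y ∧ rest y))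

  -- If both ends are near `b`, they lie in `Q`. Otherwise the end that is not near `b` puts the
  -- other one into `C`, unless both ends are among the first `k`, where `blocked` says nothing.
  edge-cases : ∀ x y → edge x y ≡ true → (X x ∧ X y) ≡ true ⊎ (Q x ∧ Q y) ≡ true ⊎ (C x ∧ beyond x y) ≡ true ⊎ (C y ∧ beyond y x) ≡ true
  edge-cases x y h = go (bool (outside k x)) (bool (outside k y))
    where
    rx = ∧-fst {rest x} h
    xy = ∧-fst {adj G x y} (∧-snd {rest x} h)
    ry = ∧-snd {adj G x y} (∧-snd {rest x} h)
    Goal : Set
    Goal = (X x ∧ X y) ≡ true ⊎ (Q x ∧ Q y) ≡ true ⊎ (C x ∧ beyond x y) ≡ true ⊎ (C y ∧ beyond y x) ≡ true
    one : outside k x ≡ true ⊎ outside k y ≡ true → closed G b x ≡ true ⊎ closed G b x ≡ false →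
      closed G b y ≡ true ⊎ closed G b y ≡ false → Goal
    one o (inj₁ bx) (inj₁ by) = inj₂ (inj₁ (∧-true (∧-true rx bx) (∧-true ry by)))
    one o (inj₂ bx) _ = inj₂ (inj₂ (inj₂ (∧-true (C-intro xy o bx ry) (∧-true (∧-true (adj-sym G xy) rx) (not-true bx)))))
    one o (inj₁ bx) (inj₂ by) = inj₂ (inj₂ (inj₁ (∧-true (C-intro (adj-sym G xy) ([ inj₂ , inj₁ ]′ o) by rx)
      (∧-true (∧-true xy ry) (not-true by)))))
    inF : ∀ {z} → outside k z ≡ false → (toℕ z <ᵇ k) ≡ true
    inF {z} e with toℕ z <ᵇ k
    ... | true = refl
    go : outside k x ≡ true ⊎ outside k x ≡ false → outside k y ≡ true ⊎ outside k y ≡ false → Goal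
    go (inj₁ o) _ = one (inj₁ o) (bool _) (bool _)
    go (inj₂ _) (inj₁ o) = one (inj₂ o) (bool _) (bool _)
    go (inj₂ ox) (inj₂ oy) = inj₁ (∧-true (∧-true rx (inF ox)) (∧-true ry (inF oy)))

  charge : ∀ (p : Fin n → Bool) (g : Fin n → ℕ) a (P : Fin n → Fin n → Bool) →
    (∀ z → p z ≡ true → # (P z) ≤ a + g z) → ## (λ x y → p x ∧ P x y) ≤ # p * a + ∑ (λ x → ⟦ p x ⟧ * g x)
  charge p g a P h = begin
    ## (λ x y → p x ∧ P x y) ≡⟨ ##-guard p P ⟩
    ∑ (λ x → ⟦ p x ⟧ * # (P x)) ≤⟨ ∑-guard-mono p h ⟩
    ∑ (λ x → ⟦ p x ⟧ * (a + g x)) ≡⟨ ∑-guard-+ p (λ _ → a) g ⟩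
    ∑ (λ x → ⟦ p x ⟧ * a) + ∑ (λ x → ⟦ p x ⟧ * g x) ≡⟨ cong (_+ _) (∑-guard p a) ⟩
    # p * a + ∑ (λ x → ⟦ p x ⟧ * g x) ∎
    where open ≤-Reasoning

  -- A vertex `z` of `C` sends at most `κ + m z` edges beyond the neighbourhood of `b`, and its
  -- `m z` cancels against its own share of `misses`. The set `O` is disjoint from `C`, so its
  -- `# O * # Ω` misses remain uncancelled.
  first-estimate : ∀ χ → # X ≤ χ → 1 + 2 * misses ≤ edges →
    1 + 2 * (# O * # Ω) ≤ χ * χ + # Q * # Q + 2 * (# Qr * κ)
  first-estimate χ hX hE = finish hE upper lower (charge C m κ beyond beyond≤) (*-monoˡ-≤ κ (#-mono C⊆Qr)) (*-mono-≤ hX hX)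
    where
    Cm = ∑ (λ x → ⟦ C x ⟧ * m x)
    upper : edges ≤ # X * # X + (# Q * # Q + (## (λ x y → C x ∧ beyond x y) + ## (λ x y → C x ∧ beyond x y)))
    upper = begin
      edges ≡⟨ edges≡ ⟩
      ## edge ≤⟨ ##-cover₄ edge (λ x y → X x ∧ X y) (λ x y → Q x ∧ Q y) (λ x y → C x ∧ beyond x y) (λ x y → C y ∧ beyond y x) edge-cases ⟩
      _ ≡⟨ cong₂ _+_ (##-product X X) (cong₂ _+_ (##-product Q Q) (cong (## (λ x y → C x ∧ beyond x y) +_) (##-swap _))) ⟩
      # X * # X + (# Q * # Q + (## (λ x y → C x ∧ beyond x y) + ## (λ x y → C x ∧ beyond x y))) ∎
      where open ≤-Reasoning
    lower : Cm + # O * # Ω ≤ misses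
    lower = subst (_≤ misses) (trans (∑-distrib-+ _ _) (cong (Cm +_) (∑-guard O (# Ω))))
      (∑-mono λ x → point x (bool (C x)) (bool (O x)))
      where
      point : ∀ x → C x ≡ true ⊎ C x ≡ false → O x ≡ true ⊎ O x ≡ false → ⟦ C x ⟧ * m x + ⟦ O x ⟧ * # Ω ≤ ⟦ rest x ⟧ * m x
      point x (inj₁ cx) (inj₁ ox) = ⊥-elim (true≢false (C⊆closed-r₀ cx)
        (not⇒false (∧-snd {not (closed G b x)} (∧-snd {outside k x} ox))))
      point x (inj₁ cx) (inj₂ ox) rewrite cx | ox | ∧-fst {rest x} cx = ≤-reflexive (+-identityʳ _)
      point x (inj₂ cx) (inj₁ ox) rewrite cx | ox | out⇒rest {x} (∧-fst {outside k x} ox) = +-monoˡ-≤ 0 (Ω≤m ox)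
      point x (inj₂ cx) (inj₂ ox) rewrite cx | ox = z≤n
    finish : ∀ {E M x q cb cm ow c qr χ²} → 1 + 2 * M ≤ E → E ≤ x + (q + (cb + cb)) → cm + ow ≤ M → cb ≤ c + cm → c ≤ qr →
      x ≤ χ² → 1 + 2 * ow ≤ χ² + q + 2 * qr
    finish {E} {M} {x} {q} {cb} {cm} {ow} {c} {qr} {χ²} h₁ h₂ h₃ h₄ h₅ h₆ =
      linear 0 (h₁ ⊕ h₂ ⊕ h₃ ⊕ h₃ ⊕ h₄ ⊕ h₄ ⊕ h₅ ⊕ h₅ ⊕ h₆) (arith E M x q cb cm ow c qr χ²)
      where
      arith : ∀ E M x q cb cm ow c qr χ² →
        1 + 2 * ow + (E + (x + (q + (cb + cb)) + (M + (M + (c + cm + (c + cm + (qr + (qr + χ²)))))))) + 0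
        ≡ χ² + q + 2 * qr + (1 + 2 * M + (E + (cm + ow + (cm + ow + (cb + (cb + (c + (c + x))))))))
      arith = solve-∀

two⇒2≤# : ∀ {n} (p : Fin n → Bool) a b → a ≢ b → p a ≡ true → p b ≡ true → 2 ≤ # p
two⇒2≤# p a b a≢b ea eb = subst (2 ≤_) (≡-sym (#-remove p a ea))
  (s≤s (∃⇒0<# b (∧-true eb (not-true (≢⇒== a≢b)))))

one-of-three : ∀ {a b c} → a ≡ true ⊎ b ≡ true ⊎ c ≡ true → 1 ≤ ⟦ a ⟧ + (⟦ b ⟧ + ⟦ c ⟧)
one-of-three (inj₁ refl) = s≤s z≤n
one-of-three {a} (inj₂ (inj₁ refl)) = ≤-trans (s≤s z≤n) (m≤n+m _ ⟦ a ⟧)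
one-of-three {a} {b} (inj₂ (inj₂ refl)) = ≤-trans (m≤n+m 1 ⟦ b ⟧) (m≤n+m _ ⟦ a ⟧)

module _ {n} (G : Graph n) (k τ : ℕ) (F : Fin n → Fin n → Bool) (u v : Fin n) (stuck : Stuck F (outside k) G u v)
  (uv : adj G u v ≡ false) (u≢v : u ≢ v)
  (v-free : ∀ y → (toℕ y <ᵇ τ) ≡ false → adj G v y ≡ true → F v y ≡ false) where

  -- Otherwise the neighbourhood of r would properly contain that of v.
  missed : ∀ r → Removable F G u r → deg G r ≤ deg G v →
    ∃ λ w → (toℕ w <ᵇ τ) ≡ true × adj G v w ≡ true × adj G r w ≡ false
  missed r ur le with any? (λ w → ((toℕ w <ᵇ τ) Data.Bool.≟ true) ×-dec (adj G v w Data.Bool.≟ true) ×-dec (adj G r w Data.Bool.≟ false))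
  ... | yes p = p
  ... | no ¬p = ⊥-elim (contra (bool (adj G v r)))
    where
    ru : adj G r u ≡ true
    ru = adj-sym G (proj₁ ur)
    near : ∀ y → adj G v y ≡ true → adj G r y ≡ true ⊎ r ≡ y
    near y e with bool (toℕ y <ᵇ τ)
    ... | inj₁ t = inj₁ ([ id , (λ e' → ⊥-elim (¬p (y , t , e , e'))) ]′ (bool (adj G r y)))
    ... | inj₂ t = complete stuck r y ur (e , v-free y t e)
    le' : # (adj G r) ≤ # (adj G v)
    le' = subst₂ _≤_ (deg≡# G r) (deg≡# G v) le
    contra : adj G v r ≡ true ⊎ adj G v r ≡ false → ⊥
    contra (inj₁ vr) = <⇒≱ (subst (_≤ # (adj G r) + 1) (+-suc _ 1) total) (+-monoˡ-≤ 1 le')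
      where
      point : ∀ y → ⟦ adj G v y ⟧ + (⟦ u == y ⟧ + ⟦ v == y ⟧) ≤ ⟦ adj G r y ⟧ + ⟦ r == y ⟧
      point y with u Data.Fin.≟ y | v Data.Fin.≟ y
      ... | yes refl | yes refl = ⊥-elim (u≢v refl)
      ... | yes refl | no _ rewrite adj-sym G uv | ru = s≤s z≤n
      ... | no _ | yes refl rewrite irrefl G v | adj-sym G vr = s≤s z≤n
      ... | no _ | no _ with bool (adj G v y)
      ...   | inj₂ e rewrite e = z≤n
      ...   | inj₁ e with near y e
      ...     | inj₁ e' rewrite e | e' = s≤s z≤n
      ...     | inj₂ refl rewrite e | ==-refl r = m≤n+m 1 _
      total : # (adj G v) + 2 ≤ # (adj G r) + 1
      total = subst₂ _≤_ (∑+ refl (∑+ (#-single u) (#-single v))) (∑+ refl (#-single r)) (∑-mono point)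
    contra (inj₂ vr) = <⇒≱ (subst (_≤ # (adj G r)) (+-comm _ 1) total) le'
      where
      point : ∀ y → ⟦ adj G v y ⟧ + ⟦ u == y ⟧ ≤ ⟦ adj G r y ⟧
      point y with u Data.Fin.≟ y
      ... | yes refl rewrite adj-sym G uv | ru = ≤-refl
      ... | no _ with bool (adj G v y)
      ...   | inj₂ e rewrite e = z≤n
      ...   | inj₁ e with near y e
      ...     | inj₁ e' rewrite e | e' = ≤-refl
      ...     | inj₂ refl = ⊥-elim (true≢false e vr)
      total : # (adj G v) + 1 ≤ # (adj G r)
      total = subst (_≤ # (adj G r)) (∑+ refl (#-single u)) (∑-mono point)

-- For `b` joined to the whole top. Its degree gives no usable bound on `# Q`; instead `b` itself
-- lies in `C` without misses, so `Q` exceeds `R` by at most `κ + 1` vertices, and `R` is bounded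
-- through Ω.
module CrowdComplete {n} (G : Graph n) (k τ D κ : ℕ) (τ≤k : τ ≤ k) (τ≤n : τ ≤ n)
  (F : Fin n → Fin n → Bool) (u v r₀ b : Fin n) (stuck : Stuck F (outside k) G u v)
  (ur₀ : Removable F G u r₀) (vb : Removable F G v b) (b-rest : (toℕ b <ᵇ τ) ≡ false)
  (R-out : ∀ r → Removable F G u r → outside k r ≡ true)
  (u-deg : suc (deg G u) ≤ # (λ r → adj G u r ∧ not (F u r)) + (κ + τ))
  (u-max : ∀ z → (toℕ z <ᵇ τ) ≡ false → deg G z ≤ deg G u)
  (out-deg : ∀ x → outside k x ≡ true → deg G x ≤ D)
  (b-complete : ∀ w → (toℕ w <ᵇ τ) ≡ true → adj G b w ≡ true)
  (v-rest : (toℕ v <ᵇ τ) ≡ false) (v-in : (toℕ v <ᵇ k) ≡ true)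
  (R-miss : ∀ r → Removable F G u r → ∃ λ w → (toℕ w <ᵇ τ) ≡ true × adj G r w ≡ false)
  (top-max : ∀ w z → (toℕ w <ᵇ τ) ≡ true → (toℕ z <ᵇ τ) ≡ false → deg G z ≤ deg G w)
  (X-size : # {n} (λ x → not (toℕ x <ᵇ τ) ∧ (toℕ x <ᵇ k)) ≤ suc κ) where

  open Top G τ τ≤n
  open Crowd G k τ D κ τ≤k τ≤n F u v r₀ b stuck ur₀ vb b-rest R-out u-deg u-max out-deg

  mb≡0 : m b ≡ 0
  mb≡0 = #-zero λ w → lemma w (bool (top w))
    where
    lemma : ∀ w → top w ≡ true ⊎ top w ≡ false → (top w ∧ not (adj G b w)) ≡ false
    lemma w (inj₁ t) rewrite t | b-complete w t = refl
    lemma w (inj₂ t) rewrite t = refl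

  b∈C : C b ≡ true
  b∈C = ∧-true (not-true b-rest) (every-intro {p = λ r → not (R r) ∨ closed G r b} λ r → ∧-∨-intro λ e →
    near⇒closed G ([ inj₁ ∘ adj-sym G , inj₂ ∘ ≡-sym ]′ (closed⇒near G (R⊆closed-b e))))

  -- The degree of `w` is at least that of `b`, while every neighbour of `w` is near `b` or among
  -- the vertices of `X` not near `b`. So `w` can skip no more of `R` than there are such vertices,
  -- and `v`, a neighbour of `b` in `X`, is not one of them.
  missed-by : ∀ w → Ωb w ≡ true → # (λ r → R r ∧ not (adj G w r)) ≤ κ
  missed-by w ew = finish total (top-max w b (∧-fst ew) b-rest) X-b (deg≡# G b) (deg≡# G w)
    where
    A B : Fin n → Bool
    A r = R r ∧ not (adj G w r)
    B y = X y ∧ not (closed G b y)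
    point : ∀ y → ⟦ A y ⟧ + (⟦ adj G w y ⟧ + ⟦ w == y ⟧) ≤ ⟦ adj G b y ⟧ + (⟦ B y ⟧ + ⟦ b == y ⟧)
    point y with bool (adj G w y)
    ... | inj₁ wy rewrite ≢⇒== {i = w} {y} (adj⇒≢ G wy) = subst₂ _≤_ (≡-sym (lhs wy)) refl (one-of-three {adj G b y} {B y} {b == y} (cases (bool (top y)) (bool (closed G b y)) (bool (toℕ y <ᵇ k))))
      where
      lhs : adj G w y ≡ true → ⟦ A y ⟧ + (⟦ adj G w y ⟧ + 0) ≡ 1
      lhs e rewrite e with R y
      ... | true = refl
      ... | false = refl
      cases : top y ≡ true ⊎ top y ≡ false → closed G b y ≡ true ⊎ closed G b y ≡ false → (toℕ y <ᵇ k) ≡ true ⊎ (toℕ y <ᵇ k) ≡ false →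
        adj G b y ≡ true ⊎ B y ≡ true ⊎ (b == y) ≡ true
      cases (inj₁ t) _ _ = inj₁ (b-complete y t)
      cases (inj₂ t) (inj₁ cy) _ = [ inj₁ , inj₂ ∘ inj₂ ]′ (∨-case {adj G b y} cy)
      cases (inj₂ t) (inj₂ cy) (inj₁ ky) = inj₂ (inj₁ (∧-true (∧-true (not-true t) ky) (not-true cy)))
      cases (inj₂ t) (inj₂ cy) (inj₂ ky) = ⊥-elim (true≢false (Ωb-out ew (not-true ky) wy) cy)
    ... | inj₂ wy with w Data.Fin.≟ y
    ...   | yes refl = subst₂ _≤_ (≡-sym lhs) refl (one-of-three {adj G b w} {B w} {b == w} (inj₁ (b-complete w (∧-fst ew))))
      where
      lhs : ⟦ A w ⟧ + (⟦ adj G w w ⟧ + 1) ≡ 1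
      lhs rewrite irrefl G w | ¬true⇒false {R w} (λ rw → true≢false (∧-fst {top w} ew) (not⇒false (out⇒rest (R-out w (removable rw))))) = refl
    ...   | no _ with bool (R y)
    ...     | inj₂ ry rewrite wy | ry = z≤n
    ...     | inj₁ ry = ≤-trans (≤-reflexive lhs) (one-of-three {adj G b y} {B y} {b == y} ([ inj₁ , inj₂ ∘ inj₂ ]′ (∨-case {adj G b y} (R⊆closed-b ry))))
      where
      lhs : ⟦ A y ⟧ + (⟦ adj G w y ⟧ + 0) ≡ 1
      lhs rewrite wy | ry = refl
    total : # A + (# (adj G w) + 1) ≤ # (adj G b) + (# B + 1)
    total = subst₂ _≤_ (∑+ refl (∑+ refl (#-single w))) (∑+ refl (∑+ refl (#-single b))) (∑-mono point)
    X-b : # B + 1 ≤ suc κ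
    X-b = ≤-trans (subst (# B + 1 ≤_) (≡-sym (#-remove X v (∧-true (not-true v-rest) v-in))) (≤-trans (≤-reflexive (+-comm _ 1)) (s≤s (#-mono sub)))) X-size
      where
      sub : ∀ y → B y ≡ true → (X y ∧ not (v == y)) ≡ true
      sub y e = ∧-true {X y} {not (v == y)} (∧-fst {X y} e) (not-true (≢⇒== {i = v} {y} λ { refl → true≢false
        (near⇒closed G (inj₁ (adj-sym G (proj₁ vb)))) (not⇒false (∧-snd {X v} e)) }))
    finish : ∀ {a w' b' x d d'} → a + (w' + 1) ≤ b' + (x + 1) → d ≤ d' → x + 1 ≤ suc κ → d ≡ b' → d' ≡ w' → a ≤ κ
    finish {a} {w'} {b'} {x} h₁ h₂ h₃ refl refl = linear 0 (h₁ ⊕ h₂ ⊕ h₃) (arith a w' b' x κ)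
      where
      arith : ∀ a w b x κ → a + (b + (x + 1) + (w + suc κ)) + 0 ≡ κ + (a + (w + 1) + (b + (x + 1)))
      arith = solve-∀

  -- Double counting: every `r` in `R` is missed by some top vertex, which then belongs to `Ωb`, and
  -- each of those misses at most `κ` of `R`.
  R-size : # R ≤ # Ω * κ
  R-size = begin
    # R ≤⟨ ∑-mono (λ r → point r (bool (R r))) ⟩
    ## (λ r w → Ωb w ∧ (R r ∧ not (adj G w r))) ≡⟨ ##-swap _ ⟩
    ## (λ w r → Ωb w ∧ (R r ∧ not (adj G w r))) ≡⟨ ##-guard Ωb _ ⟩
    ∑ (λ w → ⟦ Ωb w ⟧ * # (λ r → R r ∧ not (adj G w r))) ≤⟨ ∑-guard-mono Ωb missed-by ⟩
    ∑ (λ w → ⟦ Ωb w ⟧ * κ) ≡⟨ ∑-guard Ωb κ ⟩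
    # Ωb * κ ≤⟨ *-monoˡ-≤ κ (#-mono λ w e → ∨-inl e) ⟩
    # Ω * κ ∎
    where
    open ≤-Reasoning
    point : ∀ r → R r ≡ true ⊎ R r ≡ false → ⟦ R r ⟧ ≤ # (λ w → Ωb w ∧ (R r ∧ not (adj G w r)))
    point r (inj₂ e) rewrite e = z≤n
    point r (inj₁ e) with R-miss r (removable e)
    ... | w , tw , rw = ≤-trans (⟦⟧≤1 (R r)) (∃⇒0<# w (∧-true (Ωb-intro e tw (adj-sym G rw))
            (∧-true e (not-true (adj-sym G rw)))))

  Q' C' : Fin n → Bool
  Q' y = Q y ∧ not (R y)
  C' z = C z ∧ not (R z)

  Q-size : # Q ≤ # R + # Q'
  Q-size = #-cover₂ Q R Q' λ x e → [ inj₁ , (λ rf → inj₂ (∧-true e (not-true rf))) ]′ (bool (R x))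

  Q'-size : # Q' ≤ suc κ
  Q'-size = ≤-trans (subst (# Q' ≤_) (cong (# P +_) (#-single b)) (#-cover₂ Q' P (b ==_) cases))
      (≤-trans (+-monoˡ-≤ 1 (sparse P b (λ y → ∧-fst) (λ y e → not⇒false (∧-snd {adj G b y ∧ rest y} e)) b∈C))
        (≤-reflexive (trans (cong (λ z → κ + z + 1) mb≡0) (trans (cong (_+ 1) (+-identityʳ κ)) (+-comm κ 1)))))
    where
    P : Fin n → Bool
    P y = (adj G b y ∧ rest y) ∧ not (R y)
    cases : ∀ y → Q' y ≡ true → P y ≡ true ⊎ (b == y) ≡ true
    cases y e with ∨-case {adj G b y} (∧-snd {rest y} (∧-fst e))
    ... | inj₁ a = inj₁ (∧-true (∧-true a (∧-fst {rest y} (∧-fst e))) (∧-snd {Q y} e))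
    ... | inj₂ a = inj₂ a

  heavy : Fin n → Fin n → Bool
  heavy x y = (R x ∧ (adj G x y ∧ rest y)) ∨ (C' x ∧ beyond x y)

  edge-cases' : ∀ x y → edge x y ≡ true → (X x ∧ X y) ≡ true ⊎ (Q' x ∧ Q' y) ≡ true ⊎ heavy x y ≡ true ⊎ heavy y x ≡ true
  edge-cases' x y h with bool (R x) | bool (R y)
  ... | inj₁ rx | _ = inj₂ (inj₂ (inj₁ (∨-inl (∧-true rx (∧-snd {rest x} h)))))
  ... | inj₂ _ | inj₁ ry = inj₂ (inj₂ (inj₂ (∨-inl (∧-true ry (∧-true (adj-sym G (∧-fst (∧-snd {rest x} h))) (∧-fst h))))))
  ... | inj₂ rx | inj₂ ry with edge-cases x y h
  ...   | inj₁ e = inj₁ e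
  ...   | inj₂ (inj₁ e) = inj₂ (inj₁ (∧-true {Q' x} {Q' y} (∧-true {Q x} (∧-fst {Q x} e) (not-true rx)) (∧-true {Q y} (∧-snd {Q x} e) (not-true ry))))
  ...   | inj₂ (inj₂ (inj₁ e)) = inj₂ (inj₂ (inj₁ (∨-inr {R x ∧ (adj G x y ∧ rest y)} (∧-true {C' x} (∧-true {C x} (∧-fst {C x} e) (not-true rx)) (∧-snd {C x} e)))))
  ...   | inj₂ (inj₂ (inj₂ e)) = inj₂ (inj₂ (inj₂ (∨-inr {R y ∧ (adj G y x ∧ rest x)} (∧-true {C' y} (∧-true {C y} (∧-fst {C y} e) (not-true ry)) (∧-snd {C y} e)))))

  -- Edges meeting `R` are now charged to their end in `R`, which lies beyond the first `k`: its
  -- degree is at most `E + τ`, so it has at most `E + m r` neighbours outside the top, and `m r`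
  -- cancels against `misses`. Only `Q` without `R` contributes a square.
  second-estimate : ∀ E → D ≡ E + τ → 1 + 2 * misses ≤ edges →
    1 + 2 * (# O * # Ω) ≤ suc κ * suc κ + suc κ * suc κ + 2 * (# R * E + # Qr * κ)
  second-estimate E D≡ hE = finish {rm = Rm} {cm = Cm} {ow = # O * # Ω} {re = # R * E} {c = # C' * κ} hE upper lower heavy≤
      (charge R m E (λ x y → adj G x y ∧ rest y) R-edges)
      (charge C' m κ beyond (λ z e → beyond≤ z (∧-fst e)))
      (*-monoˡ-≤ κ (#-mono λ z e → C⊆Qr z (∧-fst e)))
      (*-mono-≤ X-size X-size) (*-mono-≤ Q'-size Q'-size)
    where
    Rm = ∑ (λ x → ⟦ R x ⟧ * m x)
    Cm = ∑ (λ x → ⟦ C' x ⟧ * m x)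
    R-edges : ∀ x → R x ≡ true → e x ≤ E + m x
    R-edges x rx = lemma (subst (deg G x ≤_) D≡ (out-deg x (R-out x (removable rx)))) (deg-c-e x) (c+m x)
      where
      lemma : ∀ {d c' e' m' t} → d ≤ E + t → d ≡ c' + e' → c' + m' ≡ t → e' ≤ E + m'
      lemma {c' = c'} {e'} {m'} h refl refl = linear 0 h (arith c' e' m' E)
        where
        arith : ∀ c e m E → e + (E + (c + m)) + 0 ≡ E + m + (c + e)
        arith = solve-∀
    upper : edges ≤ # X * # X + (# Q' * # Q' + (## heavy + ## heavy))
    upper = begin
      edges ≡⟨ edges≡ ⟩
      ## edge ≤⟨ ##-cover₄ edge (λ x y → X x ∧ X y) (λ x y → Q' x ∧ Q' y) heavy (λ x y → heavy y x) edge-cases' ⟩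
      _ ≡⟨ cong₂ _+_ (##-product X X) (cong₂ _+_ (##-product Q' Q') (cong (## heavy +_) (##-swap _))) ⟩
      # X * # X + (# Q' * # Q' + (## heavy + ## heavy)) ∎
      where open ≤-Reasoning
    heavy≤ : ## heavy ≤ ## (λ x y → R x ∧ (adj G x y ∧ rest y)) + ## (λ x y → C' x ∧ beyond x y)
    heavy≤ = subst (## heavy ≤_) (∑+ refl refl) (∑-mono λ x → #-cover₂ (heavy x) (λ y → R x ∧ (adj G x y ∧ rest y))
      (λ y → C' x ∧ beyond x y) (λ y → ∨-case))
    lower : Rm + (Cm + # O * # Ω) ≤ misses
    lower = subst (_≤ misses) (∑+ refl (∑+ refl (∑-guard O (# Ω))))
      (∑-mono λ x → point x (bool (R x)) (bool (C' x)) (bool (O x)))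
      where
      point : ∀ x → R x ≡ true ⊎ R x ≡ false → C' x ≡ true ⊎ C' x ≡ false → O x ≡ true ⊎ O x ≡ false →
        ⟦ R x ⟧ * m x + (⟦ C' x ⟧ * m x + ⟦ O x ⟧ * # Ω) ≤ ⟦ rest x ⟧ * m x
      point x (inj₁ rx) (inj₁ cx) _ = ⊥-elim (true≢false rx (not⇒false (∧-snd {C x} cx)))
      point x (inj₁ rx) _ (inj₁ ox) = ⊥-elim (true≢false (R⊆closed-b rx)
        (not⇒false (∧-fst {not (closed G b x)} (∧-snd {outside k x} ox))))
      point x (inj₂ _) (inj₁ cx) (inj₁ ox) = ⊥-elim (true≢false (C⊆closed-r₀ (∧-fst cx))
        (not⇒false (∧-snd {not (closed G b x)} (∧-snd {outside k x} ox))))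
      point x (inj₁ rx) (inj₂ cx) (inj₂ ox) rewrite rx | cx | ox | out⇒rest {x} (R-out x (removable rx)) = ≤-reflexive (+-identityʳ _)
      point x (inj₂ rx) (inj₁ cx) (inj₂ ox) rewrite rx | cx | ox | ∧-fst {rest x} (∧-fst cx) = ≤-reflexive (+-identityʳ _)
      point x (inj₂ rx) (inj₂ cx) (inj₁ ox) rewrite rx | cx | ox | out⇒rest {x} (∧-fst {outside k x} ox) = +-monoˡ-≤ 0 (Ω≤m ox)
      point x (inj₂ rx) (inj₂ cx) (inj₂ ox) rewrite rx | cx | ox = z≤n
    finish : ∀ {Ed M x q H hr hc rm cm ow re c qr χ² χ²'} → 1 + 2 * M ≤ Ed → Ed ≤ x + (q + (H + H)) → rm + (cm + ow) ≤ M →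
      H ≤ hr + hc → hr ≤ re + rm → hc ≤ c + cm → c ≤ qr → x ≤ χ² → q ≤ χ²' → 1 + 2 * ow ≤ χ² + χ²' + 2 * (re + qr)
    finish {Ed} {M} {x} {q} {H} {hr} {hc} {rm} {cm} {ow} {re} {c} {qr} {χ²} {χ²'} h₁ h₂ h₃ h₄ h₅ h₆ h₇ h₈ h₉ =
      linear 0 (h₁ ⊕ h₂ ⊕ (twice h₃ ⊕ twice h₄ ⊕ twice h₅ ⊕ twice h₆ ⊕ twice h₇) ⊕ h₈ ⊕ h₉)
        (arith Ed M x q H hr hc rm cm ow re c qr χ² χ²')
      where
      twice : ∀ {a b} → a ≤ b → 2 * a ≤ 2 * b
      twice = *-monoʳ-≤ 2
      arith : ∀ E M x q H hr hc rm cm ow re c qr χ² χ²' →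
        1 + 2 * ow + (E + (x + (q + (H + H)) + ((2 * M + (2 * (hr + hc) + (2 * (re + rm) + (2 * (c + cm) + 2 * qr)))) + (χ² + χ²')))) + 0
        ≡ χ² + χ²' + 2 * (re + qr) + (1 + 2 * M + (E + ((2 * (rm + (cm + ow)) + (2 * H + (2 * hr + (2 * hc + 2 * c)))) + (x + q))))
      arith = solve-∀

-- Patterns on the first k vertices, and when they are stuck

record Shape {n} (k τ : ℕ) (F : Fin n → Fin n → Bool) : Set where
  field
    F-sym : ∀ x y → F x y ≡ F y x
    F-out : ∀ x y → outside k x ≡ true → F x y ≡ false
    F-irrefl : ∀ x → F x x ≡ false
    F-top : ∀ x y → (toℕ x <ᵇ τ) ≡ true → (toℕ x <ᵇ k) ≡ true → (toℕ y <ᵇ k) ≡ true → x ≢ y → F x y ≡ true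

Realizes : ∀ {n} → (Fin n → ℕ) → Graph n → Set
Realizes π G = ∀ i → deg G i ≡ π i

Realizes-keeps : ∀ {n} {π : Fin n → ℕ} (F : Fin n → Fin n → Bool) {G G'} → Realizes π G → Keeps F G G' → Realizes π G'
Realizes-keeps F r (d , _) i = trans (d i) (r i)

-- The gain of one is `v` itself: it is counted by `F u` without being a neighbour of `u`.
removable-count : ∀ {n} (F : Fin n → Fin n → Bool) (G : Graph n) u v → F u v ≡ true → adj G u v ≡ false →
  suc (deg G u) ≤ # (λ r → adj G u r ∧ not (F u r)) + # (F u)
removable-count F G u v fuv uv = subst (_≤ # (λ r → adj G u r ∧ not (F u r)) + # (F u)) (trans (+-comm _ 1) (cong suc (≡-sym (deg≡# G u))))
  (subst₂ _≤_ (∑+ refl (#-single v)) (∑+ refl refl) (∑-mono point))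
  where
  point : ∀ y → ⟦ adj G u y ⟧ + ⟦ v == y ⟧ ≤ ⟦ adj G u y ∧ not (F u y) ⟧ + ⟦ F u y ⟧
  point y with v Data.Fin.≟ y
  ... | yes refl rewrite uv | fuv = ≤-refl
  ... | no _ with adj G u y | F u y
  ...   | true | true = ≤-refl
  ...   | true | false = ≤-refl
  ...   | false | _ = z≤n

∃-removable : ∀ {n} (F : Fin n → Fin n → Bool) (G : Graph n) u v → F u v ≡ true → adj G u v ≡ false → # (F u) ≤ deg G u →
  ∃ λ r → Removable F G u r
∃-removable F G u v fuv uv le with 0<#⇒∃ (λ r → adj G u r ∧ not (F u r))
  (+-cancelʳ-≤ (# (F u)) 1 _ (≤-trans (s≤s le) (removable-count F G u v fuv uv)))
... | r , e = r , ∧-fst e , not⇒false (∧-snd {adj G u r} e)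

module _ {n} {k τ : ℕ} {F : Fin n → Fin n → Bool} (S : Shape k τ F) where
  open Shape S

  F⇒in : ∀ {x y} → F x y ≡ true → (toℕ x <ᵇ k) ≡ true
  F⇒in {x} {y} f with bool (toℕ x <ᵇ k)
  ... | inj₁ e = e
  ... | inj₂ e = ⊥-elim (true≢false f (F-out x y (not-true e)))

  F⇒≢ : ∀ {x y} → F x y ≡ true → x ≢ y
  F⇒≢ {x} f refl = true≢false f (F-irrefl x)

  F-deg : k ≤ n → ∀ x → (toℕ x <ᵇ k) ≡ true → suc (# (F x)) ≤ k
  F-deg k≤n x xk = begin
    suc (# (F x)) ≤⟨ s≤s (#-mono λ y f → ∧-true (F⇒in (trans (F-sym y x) f)) (not-true (≢⇒== (F⇒≢ f)))) ⟩
    suc (# (λ y → (toℕ y <ᵇ k) ∧ not (x == y))) ≡⟨ ≡-sym (#-remove (λ y → toℕ y <ᵇ k) x xk) ⟩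
    # {n} (λ y → toℕ y <ᵇ k) ≤⟨ #-below-≤ {n} k ⟩
    k ∎
    where open ≤-Reasoning

  removable⇒rest : τ ≤ k → ∀ {G : Graph n} {u r} → (toℕ u <ᵇ k) ≡ true → Removable F G u r → (toℕ r <ᵇ τ) ≡ false
  removable⇒rest τ≤k {G} {u} {r} uk (ur , f) = ¬true⇒false λ t →
    true≢false (trans (F-sym u r) (F-top r u t (<ᵇ-true (<-≤-trans (<ᵇ-true⁻ t) τ≤k)) uk (adj⇒≢ G ur ∘ ≡-sym))) f

  top-removable⇒out : ∀ {G : Graph n} {u r} → (toℕ u <ᵇ τ) ≡ true → (toℕ u <ᵇ k) ≡ true → Removable F G u r → outside k r ≡ true
  top-removable⇒out {G} {u} {r} ut uk (ur , f) = not-true (¬true⇒false λ e → true≢false (F-top u r ut uk e (adj⇒≢ G ur)) f)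

  module _ (k₂ : ℕ) (τ≤k : τ ≤ k) (τ≤n : τ ≤ n) (G : Graph n) (low : ∀ x → (toℕ x <ᵇ τ) ≡ false → deg G x ≤ k₂) where
    open Top G τ τ≤n

    -- Reading `blocked` in both directions of an edge with an end outside: either both ends are
    -- near `b` or one of them is near `r`. With all degrees outside the top at most `k₂`, this
    -- bounds `edges` independently of `n`.
    stuck-low : ∀ {u v} → Stuck F (outside k) G u v → F u v ≡ true → adj G u v ≡ false → # (F u) ≤ deg G u → # (F v) ≤ deg G v →
      ∀ χ → # {n} (λ x → rest x ∧ (toℕ x <ᵇ k)) ≤ χ → edges ≤ χ * χ + (suc k₂ * suc k₂ + 2 * (suc k₂ * k₂))
    stuck-low {u} {v} stuck fuv uv fu fv χ hX = go (∃-removable F G u v fuv uv fu)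
        (∃-removable F G v u (trans (F-sym v u) fuv) (adj-sym G uv) fv)
      where
      go : (∃ λ r → Removable F G u r) → (∃ λ b → Removable F G v b) → edges ≤ χ * χ + (suc k₂ * suc k₂ + 2 * (suc k₂ * k₂))
      go (r , ur) (b , vb) = begin
        edges ≡⟨ ≡-sym (##-guard rest (λ x y → adj G x y ∧ rest y)) ⟩
        ## edge ≤⟨ ##-cover₄ edge (λ x y → X x ∧ X y) (λ x y → Q b x ∧ Q b y) spread (λ x y → spread y x) cases ⟩
        _ ≡⟨ cong₂ _+_ (##-product X X) (cong₂ _+_ (##-product (Q b) (Q b)) (cong (## spread +_) (##-swap _))) ⟩
        # X * # X + (# (Q b) * # (Q b) + (## spread + ## spread)) ≤⟨ *-mono-≤ hX hX ⊕ *-mono-≤ (size vb) (size vb) ⊕ spread≤ ⊕ spread≤ ⟩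
        χ * χ + (suc k₂ * suc k₂ + (suc k₂ * k₂ + suc k₂ * k₂)) ≡⟨ cong (λ z → χ * χ + (suc k₂ * suc k₂ + (suc k₂ * k₂ + z))) (≡-sym (+-identityʳ (suc k₂ * k₂))) ⟩
        χ * χ + (suc k₂ * suc k₂ + 2 * (suc k₂ * k₂)) ∎
        where
        open ≤-Reasoning
        X : Fin n → Bool
        X x = rest x ∧ (toℕ x <ᵇ k)
        Q : Fin n → Fin n → Bool
        Q z x = rest x ∧ closed G z x
        edge spread : Fin n → Fin n → Bool
        edge x y = rest x ∧ (adj G x y ∧ rest y)
        spread x y = Q r x ∧ (adj G x y ∧ rest y)
        e≤ : ∀ x → rest x ≡ true → e x ≤ k₂
        e≤ x rx = ≤-trans (m≤n+m (e x) (c x)) (subst (_≤ k₂) (deg-c-e x) (low x (not⇒false rx)))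
        size : ∀ {w z} → Removable F G w z → {{(toℕ w <ᵇ k) ≡ true}} → # (Q z) ≤ suc k₂
        size {w} {z} wz {{wk}} = ≤-trans (subst (# (Q z) ≤_) (cong (e z +_) (#-single z))
          (#-cover₂ (Q z) (λ y → adj G z y ∧ rest y) (z ==_) λ y h →
            [ (λ a → inj₁ (∧-true a (∧-fst {rest y} h))) , inj₂ ]′ (∨-case {adj G z y} (∧-snd {rest y} h))))
          (≤-trans (+-monoˡ-≤ 1 (e≤ z (not-true (removable⇒rest τ≤k {G} wk wz)))) (≤-reflexive (+-comm k₂ 1)))
        instance
          uk : (toℕ u <ᵇ k) ≡ true
          uk = F⇒in fuv
          vk : (toℕ v <ᵇ k) ≡ true
          vk = F⇒in (trans (F-sym v u) fuv)
        spread≤ : ## spread ≤ suc k₂ * k₂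
        spread≤ = begin
          ## spread ≡⟨ ##-guard (Q r) (λ x y → adj G x y ∧ rest y) ⟩
          ∑ (λ x → ⟦ Q r x ⟧ * e x) ≤⟨ ∑-guard-mono (Q r) (λ x h → e≤ x (∧-fst h)) ⟩
          ∑ (λ x → ⟦ Q r x ⟧ * k₂) ≡⟨ ∑-guard (Q r) k₂ ⟩
          # (Q r) * k₂ ≤⟨ *-monoˡ-≤ k₂ (size ur) ⟩
          suc k₂ * k₂ ∎
        inF : ∀ {z} → outside k z ≡ false → (toℕ z <ᵇ k) ≡ true
        inF {z} h with toℕ z <ᵇ k
        ... | true = refl
        cases : ∀ x y → edge x y ≡ true → (X x ∧ X y) ≡ true ⊎ (Q b x ∧ Q b y) ≡ true ⊎ spread x y ≡ true ⊎ spread y x ≡ true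
        cases x y h = out (bool (outside k x)) (bool (outside k y))
          where
          rx = ∧-fst {rest x} h
          xy = ∧-fst {adj G x y} (∧-snd {rest x} h)
          ry = ∧-snd {adj G x y} (∧-snd {rest x} h)
          Goal : Set
          Goal = (X x ∧ X y) ≡ true ⊎ (Q b x ∧ Q b y) ≡ true ⊎ spread x y ≡ true ⊎ spread y x ≡ true
          one : outside k x ≡ true ⊎ outside k y ≡ true → Goal
          one o with blocked stuck r b x y ur vb xy o | blocked stuck r b y x ur vb (adj-sym G xy) ([ inj₂ , inj₁ ]′ o)
          ... | inj₁ p | inj₁ q = inj₂ (inj₁ (∧-true (∧-true rx (near⇒closed G p)) (∧-true ry (near⇒closed G q))))
          ... | inj₂ p | _ = inj₂ (inj₂ (inj₂ (∧-true (∧-true ry (near⇒closed G p)) (∧-true (adj-sym G xy) rx))))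
          ... | inj₁ _ | inj₂ q = inj₂ (inj₂ (inj₁ (∧-true (∧-true rx (near⇒closed G q)) (∧-true xy ry))))
          out : outside k x ≡ true ⊎ outside k x ≡ false → outside k y ≡ true ⊎ outside k y ≡ false → Goal
          out (inj₁ o) _ = one (inj₁ o)
          out (inj₂ _) (inj₁ o) = one (inj₂ o)
          out (inj₂ ox) (inj₂ oy) = inj₁ (∧-true (∧-true rx (inF ox)) (∧-true ry (inF oy)))

-- A clique on k vertices when the first k degrees are at least 2k - 3

Clique : ∀ {n} → Graph n → (Fin n → Bool) → Set
Clique G p = ∀ x y → p x ≡ true → p y ≡ true → x ≢ y → adj G x y ≡ true

clique-shape : ∀ {n} k → Shape {n} k k (λ x y → ((toℕ x <ᵇ k) ∧ (toℕ y <ᵇ k)) ∧ not (x == y))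
clique-shape k = record
  { F-sym = λ x y → cong₂ (λ a b → a ∧ not b) (∧-comm (toℕ x <ᵇ k) (toℕ y <ᵇ k)) (==-sym x y)
  ; F-out = λ x y o → ¬true⇒false λ e → true≢false (∧-fst (∧-fst e)) (not⇒false o)
  ; F-irrefl = λ x → ¬true⇒false λ e → true≢false (==-refl x) (not⇒false (∧-snd {(toℕ x <ᵇ k) ∧ (toℕ x <ᵇ k)} e))
  ; F-top = λ x y _ xk yk x≢y → ∧-true (∧-true xk yk) (not-true (≢⇒== x≢y)) }
  where
  ==-sym : ∀ {n} (x y : Fin n) → (x == y) ≡ (y == x)
  ==-sym x y with bool (x == y) | bool (y == x)
  ... | inj₁ e | inj₁ e' = trans e (≡-sym e')
  ... | inj₂ e | inj₂ e' = trans e (≡-sym e')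
  ... | inj₁ e | inj₂ e' = ⊥-elim (true≢false (subst (λ z → (z == x) ≡ true) (==⇒≡ {i = x} {y} e) (==-refl x)) e')
  ... | inj₂ e | inj₁ e' = ⊥-elim (true≢false (subst (λ z → (z == y) ≡ true) (==⇒≡ {i = y} {x} e') (==-refl y)) e)

-- When the clique on the first k vertices cannot be completed at uv, the removable neighbours of u or of v form one.
clique-realization : ∀ {n} (π : Fin n → ℕ) k → k ≤ n → (∀ x → (toℕ x <ᵇ k) ≡ true → k + k ≤ π x + 3) →
  ∀ G → Realizes π G → Σ (Graph n) λ G' → Realizes π G' × Σ (Fin n → Bool) λ p → k ≤ # p × Clique G' p
clique-realization {n} π k k≤n big G real = finish (saturate F F-sym (outside k) F-out (Realizes π) (λ {G} {G'} → Realizes-keeps F {G} {G'}) attempt G real)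
  where
  F : Fin n → Fin n → Bool
  F x y = ((toℕ x <ᵇ k) ∧ (toℕ y <ᵇ k)) ∧ not (x == y)
  S = clique-shape {n} k
  open Shape S
  Found : Set
  Found = Σ (Graph n) λ G' → Realizes π G' × Σ (Fin n → Bool) λ p → k ≤ # p × Clique G' p
  finish : Found ⊎ (Σ (Graph n) λ G' → Realizes π G' × (∀ x y → F x y ≡ true → adj G' x y ≡ true)) → Found
  finish (inj₁ a) = a
  finish (inj₂ (G' , r , h)) = G' , r , (λ x → toℕ x <ᵇ k) , ≤-reflexive (≡-sym (#-below k k≤n)) ,
    λ x y xk yk x≢y → h x y (∧-true (∧-true xk yk) (not-true (≢⇒== x≢y)))
  gap? : ∀ G u → Dec (∃ λ r → ∃ λ r' → Removable F G u r × Removable F G u r' × adj G r r' ≡ false × r ≢ r')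
  gap? G u = any? λ r → any? λ r' → rem? r ×-dec rem? r' ×-dec (adj G r r' Data.Bool.≟ false) ×-dec ¬? (r Data.Fin.≟ r')
    where
    rem? : ∀ r → Dec (Removable F G u r)
    rem? r = (adj G u r Data.Bool.≟ true) ×-dec (F u r Data.Bool.≟ false)
  around : ∀ G → Realizes π G → ∀ u v → F u v ≡ true → adj G u v ≡ false →
    ¬ (∃ λ r → ∃ λ r' → Removable F G u r × Removable F G u r' × adj G r r' ≡ false × r ≢ r') → Found
  around G real u v fuv uv ¬gap = G , real , p , size , clique
    where
    R p : Fin n → Bool
    R r = adj G u r ∧ not (F u r)
    p r = R r ∨ (u == r)
    -- The degree of `u` is at least 2k - 3 and at most k - 1 wanted pairs meet `u`, one of them
    -- missing; so at least k - 1 neighbours are removable, and `u` completes the clique.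
    size : k ≤ # p
    size = subst (k ≤_) (≡-sym (#-remove p u (∨-inr {R u} (==-refl u))))
        (arith (removable-count F G u v fuv uv) (F-deg S k≤n u (F⇒in S fuv)) (subst (λ d → k + k ≤ d + 3) (≡-sym (real u)) (big u (F⇒in S fuv)))
        (#-mono λ r e → ∧-true (∨-inl e) (not-true (≢⇒== (adj⇒≢ G (∧-fst e))))))
      where
      arith : ∀ {d r f q} → suc d ≤ r + f → suc f ≤ k → k + k ≤ d + 3 → r ≤ q → k ≤ suc q
      arith {d} {r} {f} {q} h₁ h₂ h₃ h₄ = linear 0 (h₁ ⊕ h₂ ⊕ h₃ ⊕ h₄) (lem d r f q k)
        where
        lem : ∀ d r f q k → k + (r + f + (k + (d + 3 + q))) + 0 ≡ suc q + (suc d + (suc f + (k + k + r)))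
        lem = solve-∀
    rem : ∀ {r} → R r ≡ true → Removable F G u r
    rem {r} e = ∧-fst e , not⇒false (∧-snd {adj G u r} e)
    clique : Clique G p
    clique x y ex ey x≢y with ∨-case {R x} ex | ∨-case {R y} ey
    ... | inj₁ rx | inj₁ ry = [ id , (λ e → ⊥-elim (¬gap (x , y , rem rx , rem ry , e , x≢y))) ]′ (bool (adj G x y))
    ... | inj₁ rx | inj₂ uy = subst (λ z → adj G x z ≡ true) (==⇒≡ uy) (adj-sym G (proj₁ (rem rx)))
    ... | inj₂ ux | inj₁ ry = subst (λ z → adj G z y ≡ true) (==⇒≡ ux) (proj₁ (rem ry))
    ... | inj₂ ux | inj₂ uy = ⊥-elim (x≢y (trans (≡-sym (==⇒≡ {i = u} ux)) (==⇒≡ {i = u} uy)))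
  attempt : ∀ G → Realizes π G → ∀ u v → F u v ≡ true → adj G u v ≡ false → Found ⊎ Improves F G u v
  attempt G real u v fuv uv with improve-or-stuck F F-sym (outside k) F-out G u v fuv uv (F⇒≢ S fuv) | gap? G u | gap? G v
  ... | inj₁ i | _ | _ = inj₂ i
  ... | inj₂ _ | no ¬g | _ = inj₁ (around G real u v fuv uv ¬g)
  ... | inj₂ _ | yes _ | no ¬g = inj₁ (around G real v u (trans (F-sym v u) fuv) (adj-sym G uv) ¬g)
  ... | inj₂ s | yes (r , r' , ur , ur' , rr' , r≢r') | yes (b , b' , vb , vb' , bb' , b≢b') = ⊥-elim (contra (complete s r' b' ur' vb'))
    where
    far : ¬ (adj G r r' ≡ true ⊎ r ≡ r')
    far = [ (λ e → true≢false e rr') , r≢r' ]′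
    -- A non-adjacent pair on each side is impossible: the edge between `b'` and `r'` serves as the
    -- middle edge of a hexagon, and `blocked` would join `b` to `b'` or `r` to `r'`.
    contra : adj G r' b' ≡ true ⊎ r' ≡ b' → ⊥
    contra (inj₂ refl) = far (complete s r r' ur vb')
    contra (inj₁ e) with blocked s r b b' r' ur vb (adj-sym G e)
      (inj₂ (top-removable⇒out S {G} (F⇒in S fuv) (F⇒in S fuv) ur'))
    ... | inj₁ q = [ (λ e' → true≢false e' bb') , b≢b' ]′ q
    ... | inj₂ q = far q

-- What the counting asks of `n`, with `ω`, `o`, `q`, `qr`, `R` the sizes of Ω, `O`, `Q`, `Qr`, `R`.
-- The three contradictions are for `b` joined to the whole top, for `b` beyond the first `k`, and
-- for `b` among the first `k` (of degree `d`) with a top vertex missing. `D` bounds the degrees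
-- beyond the first `k`.
record Large (n k τ κ D E : ℕ) : Set where
  field
    k≡ : k ≡ τ + suc κ
    D≡ : D ≡ E + τ
    complete-large : ∀ ω o q qr R → 1 ≤ ω → ω ≤ τ → n ≤ k + (o + (q + qr)) → q ≤ R + suc κ → R ≤ ω * κ → qr + τ ≤ D + 1 + ω →
      1 + 2 * (o * ω) ≤ suc κ * suc κ + suc κ * suc κ + 2 * (R * E + qr * κ) → ⊥
    out-large : ∀ ω o q qr → 1 ≤ ω → ω ≤ τ → n ≤ k + (o + (q + qr)) → q + τ ≤ D + 1 + ω → qr + τ ≤ D + 1 + ω →
      1 + 2 * (o * ω) ≤ suc κ * suc κ + q * q + 2 * (qr * κ) → ⊥
    in-large : ∀ ω o q qr d → 2 ≤ ω → ω ≤ τ → n ≤ k + (o + (q + qr)) → q + τ ≤ d + 1 + ω → 2 + d ≤ k + qr → qr + τ ≤ D + 1 + ω →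
      1 + 2 * (o * ω) ≤ suc κ * suc κ + q * q + 2 * (qr * κ) → ⊥

module Completion {n k τ κ D E : ℕ} (L : Large n k τ κ D E) (k≤n : k ≤ n) {F : Fin n → Fin n → Bool} (S : Shape k τ F)
  (G : Graph n) (sorted : ∀ x y → toℕ x ≤ toℕ y → deg G y ≤ deg G x)
  (out-deg : ∀ x → outside k x ≡ true → deg G x ≤ D)
  (fits : ∀ x → (toℕ x <ᵇ k) ≡ true → # (F x) ≤ deg G x)
  (many : 1 + 2 * Top.misses G τ (≤-trans (subst (τ ≤_) (≡-sym (Large.k≡ L)) (m≤m+n τ (suc κ))) k≤n)
    ≤ Top.edges G τ (≤-trans (subst (τ ≤_) (≡-sym (Large.k≡ L)) (m≤m+n τ (suc κ))) k≤n)) where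
  open Large L
  open Shape S

  τ≤k : τ ≤ k
  τ≤k = subst (τ ≤_) (≡-sym k≡) (m≤m+n τ (suc κ))

  τ≤n : τ ≤ n
  τ≤n = ≤-trans τ≤k k≤n

  top⇒in : ∀ {x : Fin n} → (toℕ x <ᵇ τ) ≡ true → (toℕ x <ᵇ k) ≡ true
  top⇒in t = <ᵇ-true (<-≤-trans (<ᵇ-true⁻ t) τ≤k)

  top-max : ∀ w z → (toℕ w <ᵇ τ) ≡ true → (toℕ z <ᵇ τ) ≡ false → deg G z ≤ deg G w
  top-max w z t r = sorted w z (≤-trans (<⇒≤ (<ᵇ-true⁻ {n = τ} t)) (<ᵇ-false⁻ r))

  X-size : # {n} (λ x → not (toℕ x <ᵇ τ) ∧ (toℕ x <ᵇ k)) ≤ suc κ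
  X-size = #-interval _ τ (suc κ) λ x e → <ᵇ-false⁻ (not⇒false (∧-fst e)) ,
    subst (toℕ x <_) k≡ (<ᵇ-true⁻ (∧-snd {not (toℕ x <ᵇ τ)} e))

  Ω≤τ : ∀ (p : Fin n → Bool) → (∀ x → p x ≡ true → (toℕ x <ᵇ τ) ≡ true) → # p ≤ τ
  Ω≤τ p h = ≤-trans (#-mono h) (#-below-≤ {n} τ)

  u-deg : ∀ u v → F u v ≡ true → adj G u v ≡ false → suc (deg G u) ≤ # (λ r → adj G u r ∧ not (F u r)) + (κ + τ)
  u-deg u v fuv uv = ≤-trans (removable-count F G u v fuv uv) (+-monoʳ-≤ _ (s≤s⁻¹ (subst (suc (# (F u)) ≤_)
    (trans k≡ (trans (+-suc τ κ) (cong suc (+-comm τ κ)))) (F-deg S k≤n u (F⇒in S fuv)))))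

  module _ {u v : Fin n} (stuck : Stuck F (outside k) G u v) (fuv : F u v ≡ true) (uv : adj G u v ≡ false)
    (R-out : ∀ r → Removable F G u r → outside k r ≡ true)
    (u-max : ∀ z → (toℕ z <ᵇ τ) ≡ false → deg G z ≤ deg G u) where

    module _ {r b : Fin n} (ur : Removable F G u r) (vb : Removable F G v b) where

      b-rest : (toℕ b <ᵇ τ) ≡ false
      b-rest = removable⇒rest S τ≤k {G} (F⇒in S (trans (F-sym v u) fuv)) vb

      open Crowd G k τ D κ τ≤k τ≤n F u v r b stuck ur vb b-rest R-out (u-deg u v fuv uv) u-max out-deg public

      Ω-size : # Ω ≤ τ
      Ω-size = Ω≤τ Ω λ x e → [ ∧-fst , ∧-fst ]′ (∨-case {Ωb x} e)

      -- Outer neighbours of `u` are removable, and `complete` puts every removable one near `b`.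
      u∈Ω : (toℕ u <ᵇ τ) ≡ true → Ωb u ≡ true
      u∈Ω t = ∧-true t (every-intro λ x → ∧-∨-intro λ e → R⊆closed-b (∧-true (∧-snd {outside k x} e)
        (not-true (trans (F-sym u x) (F-out x u (∧-fst e))))))

      out-contra : 1 ≤ # Ω → outside k b ≡ true → ⊥
      out-contra 1≤ bo = out-large (# Ω) (# O) (# Q) (# Qr) 1≤ Ω-size partition
        (≤-trans #Q+τ (+-monoˡ-≤ _ (+-monoˡ-≤ 1 (out-deg b bo)))) #Qr+τ (first-estimate (suc κ) X-size many)

      -- The degree of `b` is bounded through the top vertex `w` that it misses: `w` is in `Ωr`, so
      -- its neighbours are near `r₀` or among the first `k` without `w` and `b`. This bound is
      -- weaker than the one beyond the first `k`, which is made up for by two members of Ω.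
      in-contra : 2 ≤ # Ω → (toℕ b <ᵇ k) ≡ true → ∀ w → (toℕ w <ᵇ τ) ≡ true → adj G b w ≡ false → ⊥
      in-contra 2≤ bk w tw bw = in-large (# Ω) (# O) (# Q) (# Qr) (deg G b) 2≤ Ω-size partition #Q+τ
          (≤-trans (s≤s (s≤s (top-max w b tw b-rest))) bound-w) #Qr+τ (first-estimate (suc κ) X-size many)
        where
        inF p : Fin n → Bool
        inF x = toℕ x <ᵇ k
        p x = (inF x ∧ not (w == x)) ∧ not (b == x)
        w≢b : w ≢ b
        w≢b refl = true≢false tw b-rest
        cases : ∀ x → adj G w x ≡ true → p x ≡ true ⊎ Qr x ≡ true
        cases x wx with bool (inF x)
        ... | inj₁ xk = inj₁ (∧-true (∧-true xk (not-true (≢⇒== (adj⇒≢ G wx))))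
          (not-true (≢⇒== {i = b} λ { refl → true≢false (adj-sym G wx) bw })))
        ... | inj₂ xo = inj₂ (∧-true (not-true (<ᵇ-false (≤-trans τ≤k (<ᵇ-false⁻ xo))))
          (Ωr-out (Ωr-intro tw (adj-sym G bw)) (not-true xo) wx))
        bound-w : 2 + deg G w ≤ k + # Qr
        bound-w = begin
          2 + deg G w ≡⟨ cong (2 +_) (deg≡# G w) ⟩
          2 + # (adj G w) ≤⟨ +-monoʳ-≤ 2 (#-cover₂ (adj G w) p Qr cases) ⟩
          2 + # p + # Qr ≡⟨ cong (λ z → suc z + # Qr) (≡-sym (#-remove (λ x → inF x ∧ not (w == x)) b (∧-true bk (not-true (≢⇒== w≢b))))) ⟩
          suc (# (λ x → inF x ∧ not (w == x))) + # Qr ≡⟨ cong (_+ # Qr) (≡-sym (#-remove inF w (top⇒in tw))) ⟩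
          # inF + # Qr ≤⟨ +-monoˡ-≤ (# Qr) (#-below-≤ {n} k) ⟩
          k + # Qr ∎
          where open ≤-Reasoning

    -- The missing edge joins v, outside the top, to u.
    rest-contra : (toℕ v <ᵇ τ) ≡ false →
      (∀ y → (toℕ y <ᵇ τ) ≡ false → adj G v y ≡ true → F v y ≡ false) →
      (∀ r → Removable F G u r → deg G r ≤ deg G v) →
      (toℕ u <ᵇ τ) ≡ true ⊎ (∀ x w → (toℕ x <ᵇ k) ≡ true → (toℕ w <ᵇ τ) ≡ true → x ≢ w → adj G x w ≡ true) → ⊥
    rest-contra v-rest v-free r≤v alt with ∃-removable F G u v fuv uv (fits u (F⇒in S fuv))
      | ∃-removable F G v u (trans (F-sym v u) fuv) (adj-sym G uv) (fits v (F⇒in S (trans (F-sym v u) fuv)))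
    -- The split follows the fields of `Large`. In the last case, `b` among the first `k`, the
    -- second alternative of `alt` contradicts the missing top vertex at once.
    ... | r , ur | b , vb with any? (λ w → ((toℕ w <ᵇ τ) Data.Bool.≟ true) ×-dec (adj G b w Data.Bool.≟ false))
    ...   | no ¬w = complete-large (# (Ω ur vb)) (# (O ur vb)) (# (Q ur vb)) (# (Qr ur vb)) (# (R ur vb)) Ω≥1 (Ω-size ur vb) (partition ur vb)
            (≤-trans C.Q-size (+-monoʳ-≤ _ C.Q'-size)) C.R-size (#Qr+τ ur vb) (C.second-estimate E D≡ many)
      where
      miss : ∀ r → Removable F G u r → ∃ λ w → (toℕ w <ᵇ τ) ≡ true × adj G v w ≡ true × adj G r w ≡ false
      miss r ur = missed G k τ F u v stuck uv (F⇒≢ S fuv) v-free r ur (r≤v r ur)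
      unjoined : ∀ r → Removable F G u r → ∃ λ w → (toℕ w <ᵇ τ) ≡ true × adj G r w ≡ false
      unjoined r ur = let w , t , _ , e = miss r ur in w , t , e
      b-complete : ∀ w → (toℕ w <ᵇ τ) ≡ true → adj G b w ≡ true
      b-complete w t = [ id , (λ e → ⊥-elim (¬w (w , t , e))) ]′ (bool (adj G b w))
      module C = CrowdComplete G k τ D κ τ≤k τ≤n F u v r b stuck ur vb (b-rest ur vb) R-out (u-deg u v fuv uv) u-max out-deg
        b-complete v-rest (F⇒in S (trans (F-sym v u) fuv))
        unjoined top-max X-size
      Ω≥1 : 1 ≤ # (Ω ur vb)
      Ω≥1 = let w , t , _ , e = miss r ur in ∃⇒0<# w (∨-inl (Ωb-intro ur vb (R-intro ur vb ur) t (adj-sym G e)))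
    ...   | yes (w' , tw' , bw') with bool (toℕ b <ᵇ k)
    ...     | inj₂ bo = out-contra ur vb (∃⇒0<# w' (∨-inr {Ωb ur vb w'} (Ωr-intro ur vb tw' (adj-sym G bw')))) (not-true bo)
    ...     | inj₁ bk = [ via-top , (λ h → true≢false (h b w' bk tw' (λ { refl → true≢false tw' (b-rest ur vb) })) bw') ]′ alt
      where
      -- The two members of Ω are `u` and the top vertex given by `missed`; they differ because the
      -- latter is a neighbour of `v`.
      via-top : (toℕ u <ᵇ τ) ≡ true → ⊥
      via-top tu = let w , t , vw , e = missed G k τ F u v stuck uv (F⇒≢ S fuv) v-free r ur (r≤v r ur) in
        in-contra ur vb (two⇒2≤# (Ω ur vb) u w (λ eq → true≢false (subst (λ z → adj G v z ≡ true) (≡-sym eq) vw) (adj-sym G uv)) (∨-inl (u∈Ω ur vb tu))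
          (∨-inl (Ωb-intro ur vb (R-intro ur vb ur) t (adj-sym G e)))) bk w' tw' bw'

  -- Removable neighbours of a top vertex lie beyond the first `k`, so `b` has bounded degree, and
  -- `u` itself is a member of Ω.
  top-contra : ∀ {u v} → Stuck F (outside k) G u v → F u v ≡ true → adj G u v ≡ false →
    (toℕ u <ᵇ τ) ≡ true → (toℕ v <ᵇ τ) ≡ true → ⊥
  top-contra {u} {v} stuck fuv uv tu tv with ∃-removable F G u v fuv uv (fits u (F⇒in S fuv))
      | ∃-removable F G v u (trans (F-sym v u) fuv) (adj-sym G uv) (fits v (F⇒in S (trans (F-sym v u) fuv)))
  ... | r , ur | b , vb = out-contra stuck fuv uv (λ r → top-removable⇒out S {G} tu (top⇒in tu)) (λ z → top-max u z tu) ur vb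
          (∃⇒0<# u (∨-inl (u∈Ω stuck fuv uv (λ r → top-removable⇒out S {G} tu (top⇒in tu)) (λ z → top-max u z tu) ur vb tu)))
          (top-removable⇒out S {G} tv (top⇒in tv) vb)

  -- With all wanted edges at the top present, a removable neighbour of `u` among the first `k`
  -- would be joined to the whole top, against `missed`; hence `R` lies outside.
  rest-rest-contra : ∀ {u v} → Stuck F (outside k) G u v → F u v ≡ true → adj G u v ≡ false → (toℕ v <ᵇ τ) ≡ false →
    (∀ x w → (toℕ x <ᵇ k) ≡ true → (toℕ w <ᵇ τ) ≡ true → x ≢ w → adj G x w ≡ true) →
    (∀ z → (toℕ z <ᵇ τ) ≡ false → deg G z ≤ deg G u) →
    (∀ y → (toℕ y <ᵇ τ) ≡ false → adj G v y ≡ true → F v y ≡ false) →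
    (∀ r → Removable F G u r → deg G r ≤ deg G v) → ⊥
  rest-rest-contra {u} {v} stuck fuv uv v-rest done u-max v-free r≤v =
    rest-contra stuck fuv uv R-out u-max v-rest v-free r≤v (inj₂ done)
    where
    R-out : ∀ r → Removable F G u r → outside k r ≡ true
    R-out r ur = not-true (¬true⇒false λ rk → let w , t , _ , e = missed G k τ F u v stuck uv (F⇒≢ S fuv) v-free r ur (r≤v r ur) in
      true≢false (done r w rk t (λ eq → true≢false (subst (λ z → (toℕ z <ᵇ τ) ≡ true) (≡-sym eq) t) (removable⇒rest S τ≤k {G} (F⇒in S fuv) ur))) e)

-- 2-trees

punchIn-view : ∀ {m} (v x : Fin (suc m)) → x ≡ v ⊎ ∃ λ y → x ≡ punchIn v y
punchIn-view v x with v Data.Fin.≟ x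
... | yes p = inj₁ (≡-sym p)
... | no ¬p = inj₂ (punchOut ¬p , ≡-sym (punchIn-punchOut ¬p))

#-punchIn : ∀ {m} (v : Fin (suc m)) (p : Fin (suc m) → Bool) → # p ≡ ⟦ p v ⟧ + # (p ∘ punchIn v)
#-punchIn v p = ∑-remove v (λ x → ⟦ p x ⟧)

##-punchIn : ∀ {m} (v : Fin (suc m)) (P : Fin (suc m) → Fin (suc m) → Bool) → P v v ≡ false →
  ## P ≡ # (λ y → P v (punchIn v y)) + (# (λ x → P (punchIn v x) v) + ## (λ x y → P (punchIn v x) (punchIn v y)))
##-punchIn v P vv = trans (∑-remove v (λ x → # (P x))) (cong₂ _+_
  (trans (#-punchIn v (P v)) (cong (λ b → ⟦ b ⟧ + # (λ y → P v (punchIn v y))) vv))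
  (trans (∑-cong λ x → #-punchIn v (P (punchIn v x))) (∑-distrib-+ _ _)))

three⇒3≤# : ∀ {n} (p : Fin n → Bool) a b c → a ≢ b → a ≢ c → b ≢ c → p a ≡ true → p b ≡ true → p c ≡ true → 3 ≤ # p
three⇒3≤# p a b c ab ac bc ea eb ec = subst (3 ≤_) (≡-sym (#-remove p a ea)) (s≤s (two⇒2≤# _ b c bc
  (∧-true eb (not-true (≢⇒== ab))) (∧-true ec (not-true (≢⇒== ac)))))

-- A proper 3-colouring in which any two classes induce a forest; the forest is only ever used through its edge count.
record Coloured {m} (H : Graph m) : Set where
  field
    col : Fin m → Fin 3
    proper : ∀ a b → adj H a b ≡ true → col a ≢ col b
    forest : ∀ c d → c ≢ d → ∀ (P Q : Fin m → Bool) → (∀ x → P x ≡ true → col x ≡ c) → (∀ x → Q x ≡ true → col x ≡ d) →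
      1 ≤ # P → 1 ≤ # Q → suc (## (λ x y → P x ∧ (Q y ∧ adj H x y))) ≤ # P + # Q

module _ {m} (H : Graph (suc m)) (v : Fin (suc m)) (deg-v : deg H v ≡ 2)
  (simplicial : ∀ a b → adj H v a ≡ true → adj H v b ≡ true → a ≢ b → adj H a b ≡ true)
  (IH : Coloured (delete H v)) where
  private module C = Coloured IH

  free-colour : ∃ λ c → ∀ y → adj H v (punchIn v y) ≡ true → C.col y ≢ c
  free-colour with used? zero | used? (suc zero) | used? (suc (suc zero))
    where
    used? : ∀ c → Dec (∃ λ y → adj H v (punchIn v y) ≡ true × C.col y ≡ c)
    used? c = any? λ y → (adj H v (punchIn v y) Data.Bool.≟ true) ×-dec (C.col y Data.Fin.≟ c)
  ... | no ¬u | _ | _ = zero , λ y e c → ¬u (y , e , c)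
  ... | yes _ | no ¬u | _ = suc zero , λ y e c → ¬u (y , e , c)
  ... | yes _ | yes _ | no ¬u = suc (suc zero) , λ y e c → ¬u (y , e , c)
  ... | yes (x , ex , cx) | yes (y , ey , cy) | yes (z , ez , cz) = ⊥-elim (<⇒≱ (three⇒3≤# (λ w → adj H v (punchIn v w)) x y z
      (λ { refl → case trans (≡-sym cx) cy of λ () }) (λ { refl → case trans (≡-sym cx) cz of λ () })
      (λ { refl → case trans (≡-sym cy) cz of λ () }) ex ey ez)
      (≤-trans (m≤n+m _ ⟦ adj H v v ⟧) (≤-reflexive (trans (≡-sym (#-punchIn v (adj H v))) (trans (≡-sym (deg≡# H v)) deg-v)))))

  extend-colouring : Coloured H
  extend-colouring = record { col = col ; proper = proper ; forest = forest }
    where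
    c₀ = proj₁ free-colour
    fresh = proj₂ free-colour
    col : Fin (suc m) → Fin 3
    col = insertAt C.col v c₀
    col-v : col v ≡ c₀
    col-v = insertAt-lookup C.col v c₀
    col-in : ∀ y → col (punchIn v y) ≡ C.col y
    col-in = insertAt-punchIn C.col v c₀
    proper : ∀ a b → adj H a b ≡ true → col a ≢ col b
    proper a b e eq with punchIn-view v a | punchIn-view v b
    ... | inj₁ refl | inj₁ refl = true≢false e (irrefl H v)
    ... | inj₁ refl | inj₂ (y , refl) = fresh y e (trans (≡-sym (col-in y)) (trans (≡-sym eq) col-v))
    ... | inj₂ (x , refl) | inj₁ refl = fresh x (adj-sym H e) (trans (≡-sym (col-in x)) (trans eq col-v))
    ... | inj₂ (x , refl) | inj₂ (y , refl) = C.proper x y e (trans (≡-sym (col-in x)) (trans eq (col-in y)))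
    forest : ∀ c d → c ≢ d → ∀ (P Q : Fin (suc m) → Bool) → (∀ x → P x ≡ true → col x ≡ c) → (∀ x → Q x ≡ true → col x ≡ d) →
      1 ≤ # P → 1 ≤ # Q → suc (## (λ x y → P x ∧ (Q y ∧ adj H x y))) ≤ # P + # Q
    forest c d c≢d P Q Pc Qd P≥1 Q≥1 = subst (λ e → suc e ≤ # P + # Q) (≡-sym (##-punchIn v PQ PQvv)) main
      where
      PQ : Fin (suc m) → Fin (suc m) → Bool
      PQ x y = P x ∧ (Q y ∧ adj H x y)
      PQvv : PQ v v ≡ false
      PQvv = ¬true⇒false λ e → true≢false (∧-snd {Q v} (∧-snd {P v} e)) (irrefl H v)
      P' Q' : Fin m → Bool
      P' = P ∘ punchIn v
      Q' = Q ∘ punchIn v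
      row = # (λ y → PQ v (punchIn v y))
      column = # (λ x → PQ (punchIn v x) v)
      inner = ## (λ x y → PQ (punchIn v x) (punchIn v y))
      nbr≤1 : ∀ (p : Fin m → Bool) f → (∀ y → p y ≡ true → adj H v (punchIn v y) ≡ true × C.col y ≡ f) → # p ≤ 1
      nbr≤1 p f h = #≤1 p unique
        where
        unique : ∀ i j → p i ≡ true → p j ≡ true → i ≡ j
        unique i j pi pj with i Data.Fin.≟ j
        ... | yes e = e
        ... | no ne = ⊥-elim (C.proper i j (simplicial _ _ (proj₁ (h i pi)) (proj₁ (h j pj)) (ne ∘ Data.Fin.Properties.punchIn-injective v i j))
                (trans (proj₂ (h i pi)) (≡-sym (proj₂ (h j pj)))))
      row≤ : row ≤ ⟦ P v ⟧
      row≤ with bool (P v)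
      ... | inj₁ e rewrite e = nbr≤1 _ d λ y h → ∧-snd {Q (punchIn v y)} h , trans (≡-sym (col-in y)) (Qd _ (∧-fst h))
      ... | inj₂ e = ≤-trans (≤-reflexive (#-zero λ y → ¬true⇒false λ h → true≢false (∧-fst h) e)) z≤n
      column≤ : column ≤ ⟦ Q v ⟧
      column≤ with bool (Q v)
      ... | inj₁ e = ≤-trans (nbr≤1 _ c λ x h → adj-sym H (∧-snd {Q v} (∧-snd {P (punchIn v x)} h)) , trans (≡-sym (col-in x)) (Pc _ (∧-fst h)))
          (≤-reflexive (≡-sym (⟦⟧-true e)))
      ... | inj₂ e = ≤-trans (≤-reflexive (#-zero λ x → ¬true⇒false λ h → true≢false (∧-fst {Q v} (∧-snd {P (punchIn v x)} h)) e)) z≤n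
      main : suc (row + (column + inner)) ≤ # P + # Q
      main with 1 ≤? # P' | 1 ≤? # Q'
      ... | yes p | yes q = arith row≤ column≤ (C.forest c d c≢d P' Q' (λ x e → trans (≡-sym (col-in x)) (Pc _ e))
              (λ x e → trans (≡-sym (col-in x)) (Qd _ e)) p q) (#-punchIn v P) (#-punchIn v Q)
        where
        arith : ∀ {r s i p q p' q' a b} → r ≤ p → s ≤ q → suc i ≤ p' + q' → a ≡ p + p' → b ≡ q + q' → suc (r + (s + i)) ≤ a + b
        arith {r} {s} {i} {p} {q} {p'} {q'} h₁ h₂ h₃ refl refl = linear 0 (h₁ ⊕ h₂ ⊕ h₃) (lem r s i p q p' q')
          where
          lem : ∀ r s i p q p' q' → suc (r + (s + i)) + (p + (q + (p' + q'))) + 0 ≡ p + p' + (q + q') + (r + (s + suc i))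
          lem = solve-∀
      ... | no ¬p | _ = ≤-trans (s≤s (+-mono-≤ (≤-trans row≤ (⟦⟧≤1 (P v)))
            (≤-reflexive (cong₂ _+_ (#-zero λ x → ¬true⇒false λ h → ¬p (∃⇒0<# x (∧-fst {P (punchIn v x)} h)))
              (trans (∑-cong λ x → #-zero λ y → ¬true⇒false λ h → ¬p (∃⇒0<# x (∧-fst {P (punchIn v x)} h))) (∑-zero m)))))) (P≥1 ⊕ Q≥1)
      ... | yes _ | no ¬q = ≤-trans (s≤s (≤-trans (+-mono-≤ (≤-reflexive (#-zero λ y → ¬true⇒false λ h → ¬q (∃⇒0<# y (∧-fst {Q (punchIn v y)} (∧-snd {P v} h)))))
            (+-mono-≤ (≤-trans column≤ (⟦⟧≤1 (Q v)))
              (≤-reflexive (trans (∑-cong λ x → #-zero λ y → ¬true⇒false λ h → ¬q (∃⇒0<# y (∧-fst {Q (punchIn v y)} (∧-snd {P (punchIn v x)} h)))) (∑-zero m)))))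
            (≤-reflexive (+-identityʳ 1)))) (P≥1 ⊕ Q≥1)

coloured : ∀ {m} {H : Graph m} → IsTwoTree m H → Coloured H
coloured (base G comp) = record { col = id ; proper = λ a b e → adj⇒≢ G e ; forest = forest }
  where
  forest : ∀ c d → c ≢ d → ∀ (P Q : Fin 3 → Bool) → (∀ x → P x ≡ true → x ≡ c) → (∀ x → Q x ≡ true → x ≡ d) →
    1 ≤ # P → 1 ≤ # Q → suc (## (λ x y → P x ∧ (Q y ∧ adj G x y))) ≤ # P + # Q
  forest c d _ P Q Pc Qd P≥1 Q≥1 = ≤-trans (s≤s (begin
    ## (λ x y → P x ∧ (Q y ∧ adj G x y)) ≤⟨ ∑-mono (λ x → #-mono λ y e → ∧-true {P x} {Q y} (∧-fst e) (∧-fst (∧-snd {P x} e))) ⟩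
    ## (λ x y → P x ∧ Q y) ≡⟨ ##-product P Q ⟩
    # P * # Q ≤⟨ *-mono-≤ (#≤1 P λ i j a b → trans (Pc i a) (≡-sym (Pc j b))) (#≤1 Q λ i j a b → trans (Qd i a) (≡-sym (Qd j b))) ⟩
    1 ∎)) (P≥1 ⊕ Q≥1)
    where open ≤-Reasoning
coloured (step G v d s t) = extend-colouring G v d s (coloured t)

-- Take the member of `Z` that is removed first when the 2-tree is dismantled, stopping at the
-- triangle.
two-degenerate : ∀ {m} {H : Graph m} → IsTwoTree m H → ∀ (Z : Fin m → Bool) → 1 ≤ # Z →
  ∃ λ v → Z v ≡ true × # (λ y → Z y ∧ adj H v y) ≤ 2
two-degenerate (base G _) Z h with 0<#⇒∃ Z h
... | v , zv = v , zv , ≤-trans (#-mono λ y e → not-true (≢⇒== (adj⇒≢ G (∧-snd {Z y} e))))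
      (≤-reflexive (suc-injective (trans (≡-sym (#-remove (λ _ → true) v refl)) (#-⊤ 3))))
two-degenerate (step G v d s t) Z h with bool (Z v)
... | inj₁ zv = v , zv , ≤-trans (#-mono λ y → ∧-snd {Z y}) (≤-reflexive (trans (≡-sym (deg≡# G v)) d))
... | inj₂ zv with two-degenerate t (Z ∘ punchIn v) (subst (1 ≤_) (trans (#-punchIn v Z) (cong (λ b → ⟦ b ⟧ + # (Z ∘ punchIn v)) zv)) h)
...   | w , zw , le = punchIn v w , zw , ≤-trans (≤-reflexive (trans (#-punchIn v (λ y → Z y ∧ adj G (punchIn v w) y))
        (cong (_+ # (λ y → Z (punchIn v y) ∧ adj G (punchIn v w) (punchIn v y)))
          (⟦⟧-false (¬true⇒false λ e → true≢false (∧-fst e) zv))))) le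

-- Deleting `M` isolates `I`. Each round takes a vertex with at most two neighbours among those not
-- yet in `I` or `M` and moves these neighbours to `M`; the bound on `ι` leaves a vertex available,
-- as three per round are used up.
greedy-independent : ∀ {k} {H : Graph k} → IsTwoTree k H → ∀ ι → 3 * ι ≤ k + 2 →
  Σ (Fin k → Bool) λ I → Σ (Fin k → Bool) λ M → # I ≡ ι × # M ≤ 2 * ι × (∀ x → I x ≡ true → M x ≡ false) ×
    (∀ x y → I x ≡ true → adj H x y ≡ true → M y ≡ true)
greedy-independent {k} tt' zero _ = (λ _ → false) , (λ _ → false) , #-zero {k} (λ _ → refl) ,
  ≤-reflexive (#-zero {k} (λ _ → refl)) , (λ _ ()) , (λ _ _ ())
greedy-independent {k} {H} tree (suc ι) h with greedy-independent tree ι (≤-trans (*-monoʳ-≤ 3 (n≤1+n ι)) h)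
... | I , M , #I , #M , I∩M , N⊆M = extend (two-degenerate tree Z Z≥1)
  where
  Z : Fin k → Bool
  Z x = not (I x) ∧ not (M x)
  Z≥1 : 1 ≤ # Z
  Z≥1 = arith h #I #M (≤-trans (≤-reflexive (≡-sym (#-⊤ k))) (subst (# {k} (λ _ → true) ≤_) refl
      (#-cover₄ (λ _ → true) I M Z Z λ x _ → [ inj₁ , (λ i → [ inj₂ ∘ inj₁ , (λ j → inj₂ (inj₂ (inj₁ (∧-true (not-true i) (not-true j))))) ]′ (bool (M x))) ]′ (bool (I x)))))
    where
    arith : ∀ {i m z} → 3 * suc ι ≤ k + 2 → i ≡ ι → m ≤ 2 * ι → k ≤ i + (m + (z + z)) → 1 ≤ z
    arith {m = m} {suc z} _ _ _ _ = s≤s z≤n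
    arith {m = m} {zero} h₁ refl h₂ h₃ = ⊥-elim (<⇒≱ {ι + (2 * ι)} {3 * suc ι ∸ 2} (≤-reflexive (lem ι)) (≤-trans (∸-monoˡ-≤ 2 h₁)
        (≤-trans (≤-reflexive (m+n∸n≡m k 2)) (≤-trans h₃ (+-monoʳ-≤ ι (≤-trans (≤-reflexive (+-identityʳ m)) h₂))))))
      where
      lem : ∀ ι → suc (ι + 2 * ι) ≡ 3 * suc ι ∸ 2
      lem ι = ≡-sym (trans (cong (_∸ 2) (lem' ι)) (m+n∸n≡m _ 2))
        where
        lem' : ∀ ι → 3 * suc ι ≡ suc (ι + 2 * ι) + 2
        lem' = solve-∀
  extend : (∃ λ v → Z v ≡ true × # (λ y → Z y ∧ adj H v y) ≤ 2) →
    Σ (Fin k → Bool) λ I → Σ (Fin k → Bool) λ M → # I ≡ suc ι × # M ≤ 2 * suc ι × (∀ x → I x ≡ true → M x ≡ false) ×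
      (∀ x y → I x ≡ true → adj H x y ≡ true → M y ≡ true)
  extend (v , zv , le) = I' , M' , size , size' , disj , nbrs
    where
    I' M' : Fin k → Bool
    I' x = I x ∨ (v == x)
    M' x = M x ∨ (Z x ∧ adj H v x)
    Iv : I v ≡ false
    Iv = not⇒false (∧-fst zv)
    Mv : M v ≡ false
    Mv = not⇒false (∧-snd {not (I v)} zv)
    size : # I' ≡ suc ι
    size = trans (#-remove I' v (∨-inr {I v} (==-refl v))) (cong suc (trans (#-cong same) #I))
      where
      same : ∀ x → I' x ∧ not (v == x) ≡ I x
      same x with v Data.Fin.≟ x
      ... | yes refl rewrite Iv = refl
      ... | no _ with I x
      ...   | true = refl
      ...   | false = refl
    size' : # M' ≤ 2 * suc ι
    size' = ≤-trans (#-cover₂ M' M (λ x → Z x ∧ adj H v x) (λ x → ∨-case)) (≤-trans (#M ⊕ le) (≤-reflexive (lem ι)))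
      where
      lem : ∀ ι → 2 * ι + 2 ≡ 2 * suc ι
      lem = solve-∀
    disj : ∀ x → I' x ≡ true → M' x ≡ false
    disj x e = ¬true⇒false λ e' → clash (∨-case {I x} e) (∨-case {M x} e')
      where
      clash : I x ≡ true ⊎ (v == x) ≡ true → M x ≡ true ⊎ (Z x ∧ adj H v x) ≡ true → ⊥
      clash (inj₁ i) (inj₁ j) = true≢false j (I∩M x i)
      clash (inj₁ i) (inj₂ j) = true≢false i (not⇒false (∧-fst {not (I x)} (∧-fst {Z x} j)))
      clash (inj₂ vx) j with ==⇒≡ {i = v} vx
      clash (inj₂ vx) (inj₁ j) | refl = true≢false j Mv
      clash (inj₂ vx) (inj₂ j) | refl = true≢false (∧-snd {Z v} j) (irrefl H v)
    nbrs : ∀ x y → I' x ≡ true → adj H x y ≡ true → M' y ≡ true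
    nbrs x y e a with ∨-case {I x} e
    ... | inj₁ i = ∨-inl (N⊆M x y i a)
    ... | inj₂ vx with ==⇒≡ {i = v} vx
    ...   | refl with bool (M y)
    ...     | inj₁ my = ∨-inl my
    ...     | inj₂ my = ∨-inr {M y} (∧-true (∧-true (not-true (¬true⇒false λ iy → true≢false (N⊆M y v iy (adj-sym H a)) Mv)) (not-true my)) a)

-- Placing a 2-tree in a pattern

-- The pattern: the first τ positions are joined to everything, and Γ lives on the remaining ones, renumbered from 0.
place : ℕ → (ℕ → ℕ → Bool) → ℕ → ℕ → Bool
place τ Γ i j = not (i ≡ᵇ j) ∧ ((i <ᵇ τ) ∨ ((j <ᵇ τ) ∨ Γ (i ∸ τ) (j ∸ τ)))

pattern-on : ∀ {n} → ℕ → ℕ → (ℕ → ℕ → Bool) → Fin n → Fin n → Bool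
pattern-on k τ Γ x y = ((toℕ x <ᵇ k) ∧ (toℕ y <ᵇ k)) ∧ place τ Γ (toℕ x) (toℕ y)

≡ᵇ-false : ∀ {i j} → i ≢ j → (i ≡ᵇ j) ≡ false
≡ᵇ-false {i} {j} ne = ¬true⇒false λ e → ne (≡ᵇ⇒≡ i j (subst T (≡-sym e) tt))

≡ᵇ-true : ∀ {i j} → i ≡ j → (i ≡ᵇ j) ≡ true
≡ᵇ-true {zero} refl = refl
≡ᵇ-true {suc i} refl = ≡ᵇ-true {i} refl

≡ᵇ-sym : ∀ i j → (i ≡ᵇ j) ≡ (j ≡ᵇ i)
≡ᵇ-sym zero zero = refl
≡ᵇ-sym zero (suc j) = refl
≡ᵇ-sym (suc i) zero = refl
≡ᵇ-sym (suc i) (suc j) = ≡ᵇ-sym i j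

place-top : ∀ {τ Γ i j} → i ≢ j → i < τ → place τ Γ i j ≡ true
place-top ne l = ∧-true (not-true (≡ᵇ-false ne)) (∨-inl (<ᵇ-true l))

place-topʳ : ∀ {τ Γ i j} → i ≢ j → j < τ → place τ Γ i j ≡ true
place-topʳ {τ} {Γ} {i} ne l = ∧-true (not-true (≡ᵇ-false ne)) (∨-inr {i <ᵇ τ} (∨-inl (<ᵇ-true l)))

place-Γ : ∀ {τ Γ i j} → i ≢ j → Γ (i ∸ τ) (j ∸ τ) ≡ true → place τ Γ i j ≡ true
place-Γ {τ} {Γ} {i} {j} ne g = ∧-true (not-true (≡ᵇ-false ne)) (∨-inr {i <ᵇ τ} (∨-inr {j <ᵇ τ} g))

place-cases : ∀ {τ Γ i j} → place τ Γ i j ≡ true → (i <ᵇ τ) ≡ true ⊎ (j <ᵇ τ) ≡ true ⊎ Γ (i ∸ τ) (j ∸ τ) ≡ true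
place-cases {τ} {Γ} {i} {j} e with ∨-case {i <ᵇ τ} (∧-snd {not (i ≡ᵇ j)} e)
... | inj₁ a = inj₁ a
... | inj₂ a = inj₂ (∨-case {j <ᵇ τ} a)

pattern-shape : ∀ {n} k τ Γ → (∀ i j → Γ i j ≡ Γ j i) → Shape {n} k τ (pattern-on k τ Γ)
pattern-shape k τ Γ Γ-sym = record
  { F-sym = λ x y → cong₂ _∧_ (∧-comm (toℕ x <ᵇ k) _) (cong₂ (λ a b → not a ∧ b) (≡ᵇ-sym (toℕ x) (toℕ y))
      (swap-∨ (toℕ x <ᵇ τ) (toℕ y <ᵇ τ) (Γ-sym _ _)))
  ; F-out = λ x y o → ¬true⇒false λ e → true≢false (∧-fst {toℕ x <ᵇ k} (∧-fst e)) (not⇒false o)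
  ; F-irrefl = λ x → ¬true⇒false λ e → true≢false (≡ᵇ-true {toℕ x} refl)
      (not⇒false (∧-fst {not (toℕ x ≡ᵇ toℕ x)} (∧-snd {(toℕ x <ᵇ k) ∧ (toℕ x <ᵇ k)} e)))
  ; F-top = λ x y t xk yk x≢y → ∧-true (∧-true xk yk) (place-top {τ} {Γ} (x≢y ∘ toℕ-injective) (<ᵇ-true⁻ t)) }
  where
  swap-∨ : ∀ a b {c c'} → c ≡ c' → a ∨ (b ∨ c) ≡ b ∨ (a ∨ c')
  swap-∨ true true refl = refl
  swap-∨ true false refl = refl
  swap-∨ false true refl = refl
  swap-∨ false false refl = refl

pattern-cases : ∀ {n} k τ Γ {x y : Fin n} → pattern-on k τ Γ x y ≡ true → (toℕ x <ᵇ τ) ≡ false →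
  (toℕ y <ᵇ τ) ≡ true ⊎ ((toℕ y <ᵇ τ) ≡ false × Γ (toℕ x ∸ τ) (toℕ y ∸ τ) ≡ true)
pattern-cases k τ Γ {x} {y} e r with place-cases {τ} {Γ} {toℕ x} {toℕ y} (∧-snd {(toℕ x <ᵇ k) ∧ (toℕ y <ᵇ k)} e)
... | inj₁ a = ⊥-elim (true≢false a r)
... | inj₂ (inj₁ a) = inj₁ a
... | inj₂ (inj₂ g) with bool (toℕ y <ᵇ τ)
...   | inj₁ t = inj₁ t
...   | inj₂ t = inj₂ (t , g)

pattern-deg : ∀ {n} k τ Γ (x : Fin n) a len → (toℕ x <ᵇ τ) ≡ false →
  (∀ l → Γ (toℕ x ∸ τ) l ≡ true → a ≤ l × l < a + len) → # {n} (pattern-on k τ Γ x) ≤ τ + len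
pattern-deg {n} k τ Γ x a len r h = ≤-trans (#-cover₂ (pattern-on k τ Γ x) (λ y → toℕ y <ᵇ τ)
    (λ y → not (toℕ y <ᵇ τ) ∧ Γ (toℕ x ∸ τ) (toℕ y ∸ τ)) cases)
  (#-below-≤ {n} τ ⊕ #-interval _ (τ + a) len λ y e → interval (<ᵇ-false⁻ {toℕ y} {τ} (not⇒false (∧-fst e))) (h _ (∧-snd {not (toℕ y <ᵇ τ)} e)))
  where
  cases : ∀ y → pattern-on k τ Γ x y ≡ true → (toℕ y <ᵇ τ) ≡ true ⊎ (not (toℕ y <ᵇ τ) ∧ Γ (toℕ x ∸ τ) (toℕ y ∸ τ)) ≡ true
  cases y e with pattern-cases k τ Γ {x} {y} e r
  ... | inj₁ t = inj₁ t
  ... | inj₂ (t , g) = inj₂ (∧-true (not-true t) g)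
  interval : ∀ {y} → τ ≤ y → a ≤ y ∸ τ × y ∸ τ < a + len → τ + a ≤ y × y < τ + a + len
  interval {y} le (p , q) = subst (τ + a ≤_) (m+[n∸m]≡n le) (+-monoʳ-≤ τ p) ,
    subst₂ _<_ (m+[n∸m]≡n le) (≡-sym (+-assoc τ a len)) (+-monoʳ-< τ q)

Fits : ∀ {k} → Graph k → ℕ → (ℕ → ℕ → Bool) → Set
Fits {k} H τ Γ = Σ (Fin k → Fin k) λ φ → Injective _≡_ _≡_ φ × (∀ a b → adj H a b ≡ true → place τ Γ (toℕ (φ a)) (toℕ (φ b)) ≡ true)

Universal : ℕ → ℕ → (ℕ → ℕ → Bool) → Set
Universal k τ Γ = ∀ H → IsTwoTree k H → Fits H τ Γ

fits⇒⊆G : ∀ {k n} {H : Graph k} {G : Graph n} {τ Γ} → k ≤ n → Fits H τ Γ →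
  (∀ x y → pattern-on k τ Γ x y ≡ true → adj G x y ≡ true) → H ⊆G G
fits⇒⊆G {k} {n} {H} {G} {τ} {Γ} k≤n (φ , inj , ok) sub = f , f-inj , edge
  where
  f : Fin k → Fin n
  f a = inject≤ (φ a) k≤n
  f-inj : Injective _≡_ _≡_ f
  f-inj {a} {b} e = inj (toℕ-injective (trans (≡-sym (toℕ-inject≤ (φ a) k≤n)) (trans (cong toℕ e) (toℕ-inject≤ (φ b) k≤n))))
  edge : ∀ a b → adj H a b ≡ true → adj G (f a) (f b) ≡ true
  edge a b e = sub (f a) (f b) (subst₂ (λ i j → ((i <ᵇ k) ∧ (j <ᵇ k)) ∧ place τ Γ i j ≡ true)
    (≡-sym (toℕ-inject≤ (φ a) k≤n)) (≡-sym (toℕ-inject≤ (φ b) k≤n))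
    (∧-true (∧-true (<ᵇ-true (toℕ<n (φ a))) (<ᵇ-true (toℕ<n (φ b)))) (ok a b e)))

clique⇒⊆G : ∀ {k n} {H : Graph k} {G : Graph n} (p : Fin n → Bool) → k ≤ # p → Clique G p → H ⊆G G
clique⇒⊆G {k} {H = H} {G} p k≤ clique = let f , inj , ok = embed-# p k k≤ in
  f , inj , λ a b e → clique (f a) (f b) (ok a) (ok b) (λ eq → adj⇒≢ H e (inj eq))

-- Sorting the vertices by class puts class c on the positions from below c up to below (suc c).
module Sort {k} (cls : Fin k → ℕ) where

  below : ℕ → ℕ
  below c = # (λ w → cls w <ᵇ c)

  private
    -- The vertex number breaks ties, so the keys are distinct and the number of smaller keys is a
    -- permutation sorted by class.
    key : Fin k → ℕ
    key v = cls v * k + toℕ v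

    rank : Fin k → ℕ
    rank v = # (λ w → key w <ᵇ key v)

    cls<⇒key< : ∀ {u v} → cls u < cls v → key u < key v
    cls<⇒key< {u} {v} h = begin-strict
      cls u * k + toℕ u <⟨ +-monoʳ-< (cls u * k) (toℕ<n u) ⟩
      cls u * k + k ≡⟨ +-comm (cls u * k) k ⟩
      suc (cls u) * k ≤⟨ *-monoˡ-≤ k h ⟩
      cls v * k ≤⟨ m≤m+n _ (toℕ v) ⟩
      cls v * k + toℕ v ∎
      where open ≤-Reasoning

    key≤⇒cls≤ : ∀ {u v} → key u < key v → cls u ≤ cls v
    key≤⇒cls≤ {u} {v} h = ≮⇒≥ λ l → <-asym h (cls<⇒key< {v} {u} l)

    key-injective : ∀ {u v} → key u ≡ key v → u ≡ v
    key-injective {u} {v} e = toℕ-injective (+-cancelˡ-≡ (cls u * k) _ _ (trans e (cong (λ c → c * k + toℕ v) (≡-sym same-cls))))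
      where
      same-cls : cls u ≡ cls v
      same-cls = ≤-antisym (≮⇒≥ λ l → <-irrefl (≡-sym e) (cls<⇒key< {v} {u} l)) (≮⇒≥ λ l → <-irrefl e (cls<⇒key< {u} {v} l))

    rank-strict : ∀ {v} (p : Fin k → Bool) → p v ≡ true → (∀ u → key u < key v → p u ≡ true) → rank v < # p
    rank-strict {v} p pv h = subst (rank v <_) (≡-sym (#-remove p v pv)) (s≤s (#-mono λ u e →
      ∧-true (h u (<ᵇ-true⁻ e)) (not-true (≢⇒== {i = v} λ { refl → <-irrefl refl (<ᵇ-true⁻ {key v} e) }))))

    rank-injective : ∀ {u v} → rank u ≡ rank v → u ≡ v
    rank-injective {u} {v} e = key-injective (≤-antisym
      (≮⇒≥ λ l → <-irrefl (≡-sym e) (rank-strict {v} (λ w → key w <ᵇ key u) (<ᵇ-true l) (λ w h → <ᵇ-true (<-trans h l))))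
      (≮⇒≥ λ l → <-irrefl e (rank-strict {u} (λ w → key w <ᵇ key v) (<ᵇ-true l) (λ w h → <ᵇ-true (<-trans h l)))))

    rank<k : ∀ v → rank v < k
    rank<k v = subst (rank v <_) (#-⊤ k) (rank-strict {v} (λ _ → true) refl (λ _ _ → refl))

  position : Fin k → Fin k
  position v = fromℕ< (rank<k v)

  position-injective : Injective _≡_ _≡_ position
  position-injective {u} {v} e = rank-injective (trans (≡-sym (toℕ-fromℕ< (rank<k u))) (trans (cong toℕ e) (toℕ-fromℕ< (rank<k v))))

  position-≥ : ∀ v → below (cls v) ≤ toℕ (position v)
  position-≥ v = subst (below (cls v) ≤_) (≡-sym (toℕ-fromℕ< (rank<k v)))
    (#-mono λ u e → <ᵇ-true (cls<⇒key< {u} {v} (<ᵇ-true⁻ e)))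

  position-< : ∀ v c → cls v < c → toℕ (position v) < below c
  position-< v c l = subst (_< below c) (≡-sym (toℕ-fromℕ< (rank<k v)))
    (rank-strict {v} _ (<ᵇ-true l) (λ u h → <ᵇ-true (≤-<-trans (key≤⇒cls≤ {u} {v} h) l)))

module SortFits {k} (H : Graph k) (cls : Fin k → ℕ) (τ : ℕ) (Γ : ℕ → ℕ → Bool) where
  open Sort cls

  -- Class 0 is the set of deleted vertices: it fills the top, where every pair is joined, so Γ has
  -- to be checked on positive classes only.
  sort-fits : below 1 ≡ τ →
    (∀ a b → adj H a b ≡ true → 1 ≤ cls a → 1 ≤ cls b → Γ (toℕ (position a) ∸ τ) (toℕ (position b) ∸ τ) ≡ true) → Fits H τ Γ
  sort-fits b₁ h = position , position-injective , ok
    where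
    ok : ∀ a b → adj H a b ≡ true → place τ Γ (toℕ (position a)) (toℕ (position b)) ≡ true
    ok a b e with 1 ≤? cls a | 1 ≤? cls b
    ... | no p | _ = place-top {τ} {Γ} (adj⇒≢ H e ∘ position-injective ∘ toℕ-injective)
      (subst (toℕ (position a) <_) b₁ (position-< a 1 (≰⇒> p)))
    ... | yes _ | no q = place-topʳ {τ} {Γ} (adj⇒≢ H e ∘ position-injective ∘ toℕ-injective)
      (subst (toℕ (position b) <_) b₁ (position-< b 1 (≰⇒> q)))
    ... | yes p | yes q = place-Γ {τ} {Γ} (adj⇒≢ H e ∘ position-injective ∘ toℕ-injective) (h a b e p q)

  offset-≥ : ∀ v {c m} → cls v ≡ c → below c ≡ τ + m → m ≤ toℕ (position v) ∸ τ
  offset-≥ v {c} {m} refl b = subst (_≤ toℕ (position v) ∸ τ) (trans (cong (_∸ τ) b) (m+n∸m≡n τ m)) (∸-monoˡ-≤ τ (position-≥ v))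

  offset-< : ∀ v {c m} → cls v < c → τ ≤ toℕ (position v) → below c ≤ τ + m → toℕ (position v) ∸ τ < m
  offset-< v {c} {m} l t b = subst (toℕ (position v) ∸ τ <_) (m+n∸m≡n τ m) (∸-monoˡ-< (<-≤-trans (position-< v c l) b) t)

  offset-≡ : ∀ v {c m} → cls v ≡ c → below c ≡ τ + m → below (suc c) ≡ τ + suc m → toℕ (position v) ∸ τ ≡ m
  offset-≡ v {c} {m} e b b' = ≤-antisym (s≤s⁻¹ (offset-< v {suc c} (s≤s (≤-reflexive e))
      (≤-trans (m≤m+n τ m) (subst (_≤ toℕ (position v)) (trans (cong below e) b) (position-≥ v))) (≤-reflexive b')))
    (offset-≥ v e b)

#-disjoint : ∀ {n} (p q : Fin n → Bool) → (∀ x → p x ≡ true → q x ≡ false) → # (λ x → p x ∨ q x) ≡ # p + # q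
#-disjoint p q h = trans (∑-cong λ x → point (p x) (q x) (h x)) (∑-distrib-+ _ _)
  where
  point : ∀ a b → (a ≡ true → b ≡ false) → ⟦ a ∨ b ⟧ ≡ ⟦ a ⟧ + ⟦ b ⟧
  point true b h rewrite h refl = refl
  point false b h = refl

-- Remainders after deletion: independent sets, complete bipartite graphs, cliques

bipartite : ℕ → ℕ → ℕ → ℕ → Bool
bipartite m g i l = side i l ∨ side l i
  where
  side : ℕ → ℕ → Bool
  side i l = (i <ᵇ m) ∧ (not (l <ᵇ m) ∧ (l <ᵇ m + g))

complete-on : ℕ → ℕ → ℕ → Bool
complete-on w i l = (i <ᵇ w) ∧ (l <ᵇ w)

bipartite-intro : ∀ m g {i l} → i < m → m ≤ l → l < m + g → bipartite m g i l ≡ true × bipartite m g l i ≡ true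
bipartite-intro m g {i} {l} a b c = ∨-inl s , ∨-inr {(l <ᵇ m) ∧ (not (i <ᵇ m) ∧ (i <ᵇ m + g))} s
  where
  s : (i <ᵇ m) ∧ (not (l <ᵇ m) ∧ (l <ᵇ m + g)) ≡ true
  s = ∧-true (<ᵇ-true a) (∧-true (not-true (<ᵇ-false b)) (<ᵇ-true c))

module _ {k} (H : Graph k) where

  Independent : (Fin k → Bool) → Set
  Independent I = ∀ x y → I x ≡ true → I y ≡ true → adj H x y ≡ false

  independent-fits : ∀ {τ Γ} (I : Fin k → Bool) → Independent I → τ + # I ≡ k → Fits H τ Γ
  independent-fits {τ} {Γ} I ind size = sort-fits below₁ λ a b e la lb →
      ⊥-elim (true≢false e (ind a b (in-I a la) (in-I b lb)))
    where
    open SortFits H (λ x → ⟦ I x ⟧) τ Γ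
    below₁ : # (λ x → ⟦ I x ⟧ <ᵇ 1) ≡ τ
    below₁ = +-cancelʳ-≡ (# I) _ τ (trans (trans (+-comm _ (# I)) (trans (cong (# I +_) (#-cong λ x → point (I x))) (#-compl I))) (≡-sym size))
      where
      point : ∀ b → (⟦ b ⟧ <ᵇ 1) ≡ not b
      point true = refl
      point false = refl
    in-I : ∀ x → 1 ≤ ⟦ I x ⟧ → I x ≡ true
    in-I x l with I x
    ... | true = refl

  hit : (Fin k → Bool) → Fin k → Bool
  hit S a = does (any? (λ y → (S y ∧ adj H y a) Data.Bool.≟ true))

  hit-intro : ∀ {S a y} → S y ≡ true → adj H y a ≡ true → hit S a ≡ true
  hit-intro {S} {a} {y} s e = dec-true (any? (λ y → (S y ∧ adj H y a) Data.Bool.≟ true)) (y , ∧-true s e)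

  hit-elim : ∀ {S a} → hit S a ≡ true → ∃ λ y → S y ≡ true × adj H y a ≡ true
  hit-elim {S} {a} e = let y , f = does-true (any? (λ y → (S y ∧ adj H y a) Data.Bool.≟ true)) e in
    y , ∧-fst f , ∧-snd {S y} f

  -- A is independent, S is independent, and e vertices of A without neighbours in S are moved to the side of S.
  bipartite-fits : ∀ {τ} m g e (A S : Fin k → Bool) → (∀ x → S x ≡ true → A x ≡ false) → Independent A → Independent S →
    τ + (# A + # S) ≡ k → # S + e ≡ m → # (λ a → A a ∧ hit S a) ≤ g → # (λ a → A a ∧ hit S a) + e ≤ # A → Fits H τ (bipartite m g)
  bipartite-fits {τ} m g e A S disj indA indS size #S+e N≤g room
    with interpolate (λ _ → false) (λ a → A a ∧ not (hit S a)) e (λ _ ())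
      (≤-trans (≤-reflexive (#-zero {k} (λ _ → refl))) z≤n)
      (+-cancelˡ-≤ _ e _ (≤-trans room (≤-reflexive (≡-sym (#-split A (hit S))))))
  ... | E , _ , E⊆ , #E = sort-fits b₁ edges-ok
    where
    J Nb : Fin k → Bool
    J x = not (A x ∨ S x)
    Nb a = A a ∧ hit S a
    -- Class 0 is deleted, class 1 is the side of `S` filled up by `E`, class 2 the neighbours of
    -- `S`, and class 3 what stays isolated.
    cls : Fin k → ℕ
    cls x = if J x then 0 else (if S x ∨ E x then 1 else (if Nb x then 2 else 3))
    open SortFits H cls τ (bipartite m g)
    open Sort cls
    split-J : # (λ x → A x ∨ S x) + τ ≡ k
    split-J = trans (cong (_+ τ) (trans (#-disjoint A S λ x a → ¬true⇒false λ s → true≢false a (disj x s)) refl)) (trans (+-comm _ τ) size)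
    b₁ : below 1 ≡ τ
    b₁ = +-cancelˡ-≡ (# (λ x → A x ∨ S x)) _ τ (trans (cong (# (λ x → A x ∨ S x) +_) (#-cong λ x → point (J x) (S x ∨ E x) (Nb x)))
        (trans (#-compl (λ x → A x ∨ S x)) (≡-sym split-J)))
      where
      point : ∀ j s n → ((if j then 0 else (if s then 1 else (if n then 2 else 3))) <ᵇ 1) ≡ j
      point true s n = refl
      point false true n = refl
      point false false true = refl
      point false false false = refl
    J⇒¬SE : ∀ x → J x ≡ true → S x ∨ E x ≡ false
    J⇒¬SE x j = ¬true⇒false λ s → true≢false ([ ∨-inr {A x} , (λ ex → ∨-inl {A x} (∧-fst {A x} (E⊆ x ex))) ]′ (∨-case {S x} s)) (not⇒false j)
    #SE : # (λ x → S x ∨ E x) ≡ m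
    #SE = trans (#-disjoint S E λ x s → ¬true⇒false λ ex → true≢false (∧-fst (E⊆ x ex)) (disj x s)) (trans (cong (# S +_) #E) #S+e)
    b₂ : below 2 ≡ τ + m
    b₂ = trans (#-cong λ x → point (J x) (S x ∨ E x) (Nb x)) (trans (#-disjoint J (λ x → S x ∨ E x) J⇒¬SE)
      (cong₂ _+_ (trans (#-cong λ x → ≡-sym (point₁ (J x) (S x ∨ E x) (Nb x))) b₁) #SE))
      where
      point₁ : ∀ j s n → ((if j then 0 else (if s then 1 else (if n then 2 else 3))) <ᵇ 1) ≡ j
      point₁ true s n = refl
      point₁ false true n = refl
      point₁ false false true = refl
      point₁ false false false = refl
      point : ∀ j s n → ((if j then 0 else (if s then 1 else (if n then 2 else 3))) <ᵇ 2) ≡ j ∨ s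
      point true s n = refl
      point false true n = refl
      point false false true = refl
      point false false false = refl
    b₃ : below 3 ≤ τ + (m + g)
    b₃ = ≤-trans (#-cover₂ _ (λ x → cls x <ᵇ 2) Nb λ x → point (J x) (S x ∨ E x) (Nb x))
      (≤-trans (≤-reflexive b₂ ⊕ N≤g) (≤-reflexive (+-assoc τ m g)))
      where
      point : ∀ j s n → ((if j then 0 else (if s then 1 else (if n then 2 else 3))) <ᵇ 3) ≡ true →
        ((if j then 0 else (if s then 1 else (if n then 2 else 3))) <ᵇ 2) ≡ true ⊎ n ≡ true
      point true s n _ = inj₁ refl
      point false true n _ = inj₁ refl
      point false false true _ = inj₂ refl
    cls-S : ∀ {x} → S x ≡ true → cls x ≡ 1
    cls-S {x} s rewrite s | disj x s = refl
    cls-N : ∀ {x} → Nb x ≡ true → cls x ≡ 2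
    cls-N {x} nx = go (∧-fst nx) (¬true⇒false λ s → true≢false (∧-fst nx) (disj x s))
        (¬true⇒false λ ex → true≢false (∧-snd {A x} nx) (not⇒false (∧-snd {A x} (E⊆ x ex)))) (∧-snd {A x} nx)
      where
      go : A x ≡ true → S x ≡ false → E x ≡ false → hit S x ≡ true → cls x ≡ 2
      go a s e h rewrite a | s | e | h = refl
    not-J : ∀ {x} → 1 ≤ cls x → (A x ≡ true) ⊎ (S x ≡ true)
    not-J {x} l with A x | S x
    ... | true | _ = inj₁ refl
    ... | false | true = inj₂ refl
    above : ∀ {x} → 1 ≤ cls x → τ ≤ toℕ (position x)
    above {x} l = subst (_≤ toℕ (position x)) b₁ (≤-trans (#-mono λ w e → <ᵇ-true (<-≤-trans (<ᵇ-true⁻ e) l)) (position-≥ x))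
    pair : ∀ s a → S s ≡ true → A a ≡ true → adj H s a ≡ true → 1 ≤ cls s → 1 ≤ cls a →
      bipartite m g (toℕ (position s) ∸ τ) (toℕ (position a) ∸ τ) ≡ true × bipartite m g (toℕ (position a) ∸ τ) (toℕ (position s) ∸ τ) ≡ true
    pair s a ss aa e ls la = bipartite-intro m g (offset-< s (s≤s (≤-reflexive (cls-S ss))) (above ls) (≤-reflexive b₂))
        (offset-≥ a na b₂) (offset-< a (s≤s (≤-reflexive na)) (above la) b₃)
      where
      na : cls a ≡ 2
      na = cls-N (∧-true aa (hit-intro {S} ss e))
    edges-ok : ∀ a b → adj H a b ≡ true → 1 ≤ cls a → 1 ≤ cls b → bipartite m g (toℕ (position a) ∸ τ) (toℕ (position b) ∸ τ) ≡ true
    edges-ok a b e la lb with not-J la | not-J lb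
    ... | inj₁ x | inj₁ y = ⊥-elim (true≢false e (indA a b x y))
    ... | inj₂ x | inj₂ y = ⊥-elim (true≢false e (indS a b x y))
    ... | inj₂ x | inj₁ y = proj₁ (pair a b x y e la lb)
    ... | inj₁ x | inj₂ y = proj₂ (pair b a y x (adj-sym H e) lb la)

-- Delete the neighbourhood `M` of a greedy independent set of size `ι`, enlarged to `τ` vertices
-- away from that set. The remaining `w` vertices may be joined in any way, which is why the pattern
-- is a clique on them.
clique-universal : ∀ k τ w ι → k ≡ τ + (w + ι) → 2 * ι ≤ τ → 3 * ι ≤ k + 2 → Universal k τ (complete-on w)
clique-universal k τ w ι k≡ 2ι≤τ 3ι≤ H tree with greedy-independent tree ι 3ι≤
... | I , M , #I , #M , I∩M , N⊆M with interpolate M (not ∘ I) τ (λ x e → not-true (¬true⇒false λ i → true≢false e (I∩M x i)))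
        (≤-trans #M 2ι≤τ) (+-cancelˡ-≤ ι τ _ (≤-trans (≤-reflexive (+-comm ι τ)) (≤-trans (+-monoʳ-≤ τ (m≤n+m ι w))
          (≤-reflexive (trans (≡-sym k≡) (trans (≡-sym (#-compl I)) (cong (_+ # (not ∘ I)) #I)))))))
...   | J , M⊆J , J⊆ , #J = sort-fits b₁ ok
  where
  cls : Fin k → ℕ
  cls x = if J x then 0 else (if I x then 2 else 1)
  open SortFits H cls τ (complete-on w)
  open Sort cls
  b₁ : below 1 ≡ τ
  b₁ = trans (#-cong λ x → point (J x) (I x)) #J
    where
    point : ∀ j i → ((if j then 0 else (if i then 2 else 1)) <ᵇ 1) ≡ j
    point true i = refl
    point false true = refl
    point false false = refl
  b₂ : below 2 ≤ τ + w
  b₂ = +-cancelˡ-≤ ι _ _ (≤-trans (≤-trans (+-monoʳ-≤ ι (#-mono λ x → point (J x) (I x) (J⊆ x)))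
      (≤-reflexive (trans (cong (_+ # (not ∘ I)) (≡-sym #I)) (trans (#-compl I) k≡)))) (≤-reflexive (lem τ w ι)))
    where
    point : ∀ j i → (j ≡ true → not i ≡ true) → ((if j then 0 else (if i then 2 else 1)) <ᵇ 2) ≡ true → not i ≡ true
    point true i h _ = h refl
    point false false h _ = refl
    lem : ∀ τ w ι → τ + (w + ι) ≡ ι + (τ + w)
    lem = solve-∀
  class : ∀ x → 1 ≤ cls x → J x ≡ false × (cls x ≡ 2 × I x ≡ true ⊎ cls x ≡ 1)
  class x l with J x | I x
  ... | false | true = refl , inj₁ (refl , refl)
  ... | false | false = refl , inj₂ refl
  above : ∀ {x} → 1 ≤ cls x → τ ≤ toℕ (position x)
  above {x} l = subst (_≤ toℕ (position x)) b₁ (≤-trans (#-mono λ w e → <ᵇ-true (<-≤-trans (<ᵇ-true⁻ e) l)) (position-≥ x))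
  ok : ∀ a b → adj H a b ≡ true → 1 ≤ cls a → 1 ≤ cls b → complete-on w (toℕ (position a) ∸ τ) (toℕ (position b) ∸ τ) ≡ true
  ok a b e la lb with class a la | class b lb
  ... | ja , inj₁ (_ , ia) | jb , _ = ⊥-elim (true≢false (M⊆J b (N⊆M a b ia e)) jb)
  ... | ja , inj₂ _ | jb , inj₁ (_ , ib) = ⊥-elim (true≢false (M⊆J a (N⊆M b a ib (adj-sym H e))) ja)
  ... | ja , inj₂ ca | jb , inj₂ cb = ∧-true (<ᵇ-true (offset-< a (s≤s (≤-reflexive ca)) (above la) b₂))
    (<ᵇ-true (offset-< b (s≤s (≤-reflexive cb)) (above lb) b₂))

-- Colour classes and the forests between them

module Classes {k} {H : Graph k} (C : Coloured H) where
  open Coloured C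

  class : Fin 3 → Fin k → Bool
  class c x = does (col x Data.Fin.≟ c)

  class⇒ : ∀ {c x} → class c x ≡ true → col x ≡ c
  class⇒ {c} {x} = does-true (col x Data.Fin.≟ c)

  class-independent : ∀ c → Independent H (class c)
  class-independent c x y ex ey = ¬true⇒false λ e → proper x y e (trans (class⇒ ex) (≡-sym (class⇒ ey)))

  -- The third class is at most the second, so `k` is at most the largest plus twice the second;
  -- nothing else about the third class is kept.
  two-largest : ∃ λ p → ∃ λ q → p ≢ q × # (class q) ≤ # (class p) × k ≤ # (class p) + (# (class q) + # (class q))
  two-largest = order (≤-total c₀ c₁) (≤-total c₀ c₂) (≤-total c₁ c₂)
    where
    c₀ = # (class zero)
    c₁ = # (class (suc zero))
    c₂ = # (class (suc (suc zero)))
    total : k ≤ c₀ + (c₁ + c₂)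
    total = subst₂ _≤_ (#-⊤ k) (cong (λ z → c₀ + (c₁ + z)) (trans (cong (c₂ +_) (#-zero {k} (λ _ → refl))) (+-identityʳ c₂)))
      (#-cover₄ (λ _ → true) (class zero) (class (suc zero)) (class (suc (suc zero))) (λ _ → false) λ x _ → which x)
      where
      which : ∀ x → class zero x ≡ true ⊎ class (suc zero) x ≡ true ⊎ class (suc (suc zero)) x ≡ true ⊎ false ≡ true
      which x with col x
      ... | zero = inj₁ refl
      ... | suc zero = inj₂ (inj₁ refl)
      ... | suc (suc zero) = inj₂ (inj₂ (inj₁ refl))
    permute : ∀ x y z x' y' z' → x + (y + z) ≡ x' + (y' + z') → z' ≤ y' → k ≤ x + (y + z) → k ≤ x' + (y' + y')
    permute x y z x' y' z' e l h = ≤-trans h (≤-trans (≤-reflexive e) (+-monoʳ-≤ x' (+-monoʳ-≤ y' l)))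
    swap₂₃ : ∀ a b c → a + (b + c) ≡ a + (c + b)
    swap₂₃ = solve-∀
    swap₁₂ : ∀ a b c → a + (b + c) ≡ b + (a + c)
    swap₁₂ = solve-∀
    rot : ∀ a b c → a + (b + c) ≡ b + (c + a)
    rot = solve-∀
    rot' : ∀ a b c → a + (b + c) ≡ c + (a + b)
    rot' = solve-∀
    rev : ∀ a b c → a + (b + c) ≡ c + (b + a)
    rev = solve-∀
    order : c₀ ≤ c₁ ⊎ c₁ ≤ c₀ → c₀ ≤ c₂ ⊎ c₂ ≤ c₀ → c₁ ≤ c₂ ⊎ c₂ ≤ c₁ →
      ∃ λ p → ∃ λ q → p ≢ q × # (class q) ≤ # (class p) × k ≤ # (class p) + (# (class q) + # (class q))
    order (inj₁ a) _ (inj₁ c) = suc (suc zero) , suc zero , (λ ()) , c , permute c₀ c₁ c₂ c₂ c₁ c₀ (rev c₀ c₁ c₂) a total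
    order (inj₁ a) (inj₁ b) (inj₂ c) = suc zero , suc (suc zero) , (λ ()) , c , permute c₀ c₁ c₂ c₁ c₂ c₀ (rot c₀ c₁ c₂) b total
    order (inj₁ a) (inj₂ b) (inj₂ c) = suc zero , zero , (λ ()) , a , permute c₀ c₁ c₂ c₁ c₀ c₂ (swap₁₂ c₀ c₁ c₂) b total
    order (inj₂ a) (inj₁ b) (inj₁ c) = suc (suc zero) , zero , (λ ()) , b , permute c₀ c₁ c₂ c₂ c₀ c₁ (rot' c₀ c₁ c₂) a total
    order (inj₂ a) (inj₁ b) (inj₂ c) = suc (suc zero) , zero , (λ ()) , b , permute c₀ c₁ c₂ c₂ c₀ c₁ (rot' c₀ c₁ c₂) a total
    order (inj₂ a) (inj₂ b) (inj₁ c) = zero , suc (suc zero) , (λ ()) , b , permute c₀ c₁ c₂ c₀ c₂ c₁ (swap₂₃ c₀ c₁ c₂) c total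
    order (inj₂ a) (inj₂ b) (inj₂ c) = zero , suc zero , (λ ()) , a , permute c₀ c₁ c₂ c₀ c₁ c₂ refl c total

  module Pair (p q : Fin 3) (p≢q : p ≢ q) where

    A B : Fin k → Bool
    A = class p
    B = class q

    B⇒¬A : ∀ x → B x ≡ true → A x ≡ false
    B⇒¬A x e = ¬true⇒false λ e' → p≢q (trans (≡-sym (class⇒ e')) (class⇒ e))

    Nb : (Fin k → Bool) → Fin k → Bool
    Nb S a = A a ∧ hit H S a

    -- A forest in which every vertex of N has two neighbours in S has #N < #S.
    private-neighbour : ∀ S → (∀ x → S x ≡ true → B x ≡ true) → 1 ≤ # S → # S ≤ # (Nb S) →
      ∃ λ a → Nb S a ≡ true × # (λ y → S y ∧ adj H y a) ≤ 1
    private-neighbour S S⊆B S≥1 le with any? (λ a → (Nb S a Data.Bool.≟ true) ×-dec (# (λ y → S y ∧ adj H y a) ≤? 1))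
    ... | yes r = r
    ... | no ¬r = ⊥-elim (<⇒≱ (forest q p (p≢q ∘ ≡-sym) S (Nb S) (λ x e → class⇒ (S⊆B x e)) (λ x e → class⇒ (∧-fst e)) S≥1 (≤-trans S≥1 le))
        (≤-trans (+-monoˡ-≤ (# (Nb S)) le) (begin
          # (Nb S) + # (Nb S) ≡⟨ trans (cong (# (Nb S) +_) (≡-sym (+-identityʳ _))) (*-comm 2 (# (Nb S))) ⟩
          # (Nb S) * 2 ≡⟨ ≡-sym (∑-guard (Nb S) 2) ⟩
          ∑ (λ a → ⟦ Nb S a ⟧ * 2) ≤⟨ ∑-guard-mono (Nb S) (λ a e → ≰⇒> λ l → ¬r (a , e , l)) ⟩
          ∑ (λ a → ⟦ Nb S a ⟧ * # (λ y → S y ∧ adj H y a)) ≡⟨ ≡-sym (##-guard (Nb S) _) ⟩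
          ## (λ a y → Nb S a ∧ (S y ∧ adj H y a)) ≡⟨ ##-swap _ ⟩
          ## (λ y a → Nb S a ∧ (S y ∧ adj H y a)) ≡⟨ ∑-cong (λ y → #-cong λ a → shuffle (Nb S a) (S y) (adj H y a)) ⟩
          ## (λ y a → S y ∧ (Nb S a ∧ adj H y a)) ∎)))
      where
      open ≤-Reasoning
      shuffle : ∀ a b c → a ∧ (b ∧ c) ≡ b ∧ (a ∧ c)
      shuffle true b c = refl
      shuffle false true c = refl
      shuffle false false c = refl

    -- Drop the vertices of `B` one by one. If the neighbourhood is already small enough, any vertex
    -- may go; otherwise it is at least as large as `S`, and dropping the only neighbour of a
    -- private vertex `a` removes `a` from it.
    shrink : ∀ D → # A ≤ # B + D → ∀ j m → m + j ≡ # B →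
      Σ (Fin k → Bool) λ S → (∀ x → S x ≡ true → B x ≡ true) × # S ≡ m × # (Nb S) ≤ m + D
    shrink D le zero m e = B , (λ _ e → e) , ≡-sym (trans (≡-sym (+-identityʳ m)) e) ,
      ≤-trans (#-mono λ x → ∧-fst) (≤-trans le (≤-reflexive (cong (_+ D) (trans (≡-sym e) (+-identityʳ m)))))
    shrink D le (suc j) m e with shrink D le j (suc m) (trans (≡-sym (+-suc m j)) e)
    ... | S , S⊆B , #S , #N with # (Nb S) ≤? m + D
    ...   | yes small = let y , sy = 0<#⇒∃ S (subst (1 ≤_) (≡-sym #S) (s≤s z≤n)) in drop y sy
      where
      drop : ∀ y → S y ≡ true → Σ (Fin k → Bool) λ S → (∀ x → S x ≡ true → B x ≡ true) × # S ≡ m × # (Nb S) ≤ m + D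
      drop y sy = (λ x → S x ∧ not (y == x)) , (λ x e → S⊆B x (∧-fst e)) , suc-injective (trans (≡-sym (#-remove S y sy)) #S) ,
        ≤-trans (#-mono λ a e → let z , sz , za = hit-elim H (∧-snd {A a} e) in ∧-true (∧-fst e) (hit-intro H {S} (∧-fst sz) za)) small
    ...   | no large with private-neighbour S S⊆B (subst (1 ≤_) (≡-sym #S) (s≤s z≤n))
              (≤-trans (≤-reflexive #S) (≤-trans (s≤s (m≤m+n m D)) (≰⇒> large)))
    ...     | a , na , one = let y , sy , ya = hit-elim H (∧-snd {A a} na) in drop y sy ya
      where
      drop : ∀ y → S y ≡ true → adj H y a ≡ true → Σ (Fin k → Bool) λ S → (∀ x → S x ≡ true → B x ≡ true) × # S ≡ m × # (Nb S) ≤ m + D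
      drop y sy ya = S' , (λ x e → S⊆B x (∧-fst e)) , suc-injective (trans (≡-sym (#-remove S y sy)) #S) ,
          s≤s⁻¹ (≤-trans (s≤s (#-mono sub)) (≤-trans (≤-reflexive (≡-sym (#-remove (Nb S) a na))) #N))
        where
        S' : Fin k → Bool
        S' x = S x ∧ not (y == x)
        sub : ∀ x → Nb S' x ≡ true → (Nb S x ∧ not (a == x)) ≡ true
        sub x e with hit-elim H {S'} (∧-snd {A x} e)
        ... | z , sz , zx = ∧-true {Nb S x} (∧-true (∧-fst e) (hit-intro H {S} (∧-fst sz) zx)) (not-true (≢⇒== {i = a} λ { refl →
              <⇒≱ (two⇒2≤# (λ w → S w ∧ adj H w a) y z (λ { refl → true≢false (==-refl y) (not⇒false (∧-snd {S y} sz)) })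
                (∧-true sy ya) (∧-true (∧-fst sz) zx)) one }))

    -- Otherwise the forest on `S` and `A` would have at least `(c + 1) * # S` edges, no fewer than
    -- its vertices.
    average : ∀ c S → (∀ x → S x ≡ true → B x ≡ true) → 1 ≤ # S → 1 ≤ # A → # A ≤ c * # S →
      ∃ λ y → S y ≡ true × # (λ a → A a ∧ adj H y a) ≤ c
    average c S S⊆B S≥1 A≥1 le with any? (λ y → (S y Data.Bool.≟ true) ×-dec (# (λ a → A a ∧ adj H y a) ≤? c))
    ... | yes r = r
    ... | no ¬r = ⊥-elim (<⇒≱ (forest q p (p≢q ∘ ≡-sym) S A (λ x e → class⇒ (S⊆B x e)) (λ x e → class⇒ e) S≥1 A≥1) (begin
        # S + # A ≤⟨ +-monoʳ-≤ (# S) le ⟩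
        suc c * # S ≡⟨ trans (*-comm (suc c) (# S)) (≡-sym (∑-guard S (suc c))) ⟩
        ∑ (λ y → ⟦ S y ⟧ * suc c) ≤⟨ ∑-guard-mono S (λ y e → ≰⇒> λ l → ¬r (y , e , l)) ⟩
        ∑ (λ y → ⟦ S y ⟧ * # (λ a → A a ∧ adj H y a)) ≡⟨ ≡-sym (##-guard S _) ⟩
        ## (λ y a → S y ∧ (A a ∧ adj H y a)) ∎))
      where open ≤-Reasoning

    hit-single : ∀ y a → Nb (y ==_) a ≡ true → (A a ∧ adj H y a) ≡ true
    hit-single y a e with hit-elim H {y ==_} (∧-snd {A a} e)
    ... | z , yz , za = ∧-true (∧-fst e) (subst (λ w → adj H w a ≡ true) (≡-sym (==⇒≡ {i = y} yz)) za)

    set-fits : ∀ {τ} m g e S → (∀ x → S x ≡ true → B x ≡ true) → τ + (# A + # S) ≡ k → # S + e ≡ m →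
      # (Nb S) ≤ g → g + e ≤ # A → Fits H τ (bipartite m g)
    set-fits {τ} m g e S S⊆B size sum N≤ room = bipartite-fits H {τ} m g e A S (λ x s → B⇒¬A x (S⊆B x s)) (class-independent p)
      (λ x y sx sy → class-independent q x y (S⊆B x sx) (S⊆B y sy)) size sum N≤ (≤-trans (+-monoˡ-≤ e N≤) room)

    vertex-fits : ∀ {τ} m g e y → B y ≡ true → τ + (# A + 1) ≡ k → suc e ≡ m →
      # (λ a → A a ∧ adj H y a) ≤ g → g + e ≤ # A → Fits H τ (bipartite m g)
    vertex-fits {τ} m g e y by size sum N≤ room = set-fits {τ} m g e (y ==_) (λ x yx → subst (λ w → B w ≡ true) (==⇒≡ {i = y} yx) by)
      (trans (cong (λ s → τ + (# A + s)) (#-single y)) size) (trans (cong (_+ e) (#-single y)) sum)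
      (≤-trans (#-mono (hit-single y)) N≤) room

    large-fits : ∀ {τ Γ} r → τ + r ≡ k → r ≤ # A → Fits H τ Γ
    large-fits {τ} {Γ} r size le with interpolate (λ _ → false) A r (λ _ ()) (≤-trans (≤-reflexive (#-zero {k} (λ _ → refl))) z≤n) le
    ... | I , _ , I⊆A , #I = independent-fits H {τ} {Γ} I (λ x y ix iy → class-independent p x y (I⊆A x ix) (I⊆A y iy))
      (trans (cong (τ +_) #I) size)

-- Stars and small complete bipartite graphs fit every 2-tree

data Excess (a h : ℕ) : Set where
  short : a < h → Excess a h
  exceeds : ∀ j → a ≡ h + j → Excess a h

excess : ∀ a h → Excess a h
excess a h with h ≤? a
... | yes le = exceeds (a ∸ h) (≡-sym (m+[n∸m]≡n le))
... | no nle = short (≰⇒> nle)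

-- With k ≤ a + 2b and b ≤ a, the largest class has at least ⌈k/3⌉ vertices.
largest : ∀ {k a b h} → 3 * h ≤ k + 2 → b ≤ a → k ≤ a + (b + b) → ¬ (a < h)
largest {k} {a} {b} {h} h₁ h₂ h₃ h₄ = <-irrefl refl (linear {A = 1} {B = 0} 0 (h₁ ⊕ h₂ ⊕ h₂ ⊕ h₃ ⊕ *-monoʳ-≤ 3 h₄) (lem k a b h))
  where
  lem : ∀ k a b h → 1 + (k + 2 + (a + (a + (a + (b + b) + 3 * h)))) + 0 ≡ 0 + (3 * h + (b + (b + (k + 3 * suc a))))
  lem = solve-∀

half-≤ : ∀ {x y} → x + x ≤ suc (y + y) → x ≤ y
half-≤ {x} {y} h = ≮⇒≥ λ l → <-irrefl refl (≤-trans (s≤s h) (≤-trans (≤-reflexive (lem y)) (l ⊕ l)))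
  where
  lem : ∀ y → suc (suc (y + y)) ≡ suc y + suc y
  lem = solve-∀

-- The `h + 1` undeleted vertices come from the largest class. If it has only `h` vertices, a vertex
-- of the second class with at most `g` neighbours in it is added as the centre.
star-universal : ∀ g k τ h → k ≡ τ + suc h → 3 * h ≤ k + 2 → g ≤ h → (∀ b → k ≤ h + (b + b) → 1 ≤ b × h ≤ g * b) → 1 ≤ h →
  Universal k τ (bipartite 1 g)
star-universal g k τ h k≡ 3h≤ g≤h avg h≥1 H tree with Classes.two-largest (coloured tree)
... | p , q , p≢q , b≤a , k≤ = go (excess (# A) h)
  where
  open Classes (coloured tree)
  open Pair p q p≢q
  go : Excess (# A) h → Fits H τ (bipartite 1 g)
  go (short l) = ⊥-elim (largest {h = h} 3h≤ b≤a k≤ l)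
  go (exceeds zero e) = finish (average g B (λ _ e → e) (proj₁ bounds) (subst (1 ≤_) (≡-sym a≡h) h≥1) (subst (_≤ g * # B) (≡-sym a≡h) (proj₂ bounds)))
    where
    a≡h : # A ≡ h
    a≡h = trans e (+-identityʳ h)
    bounds : 1 ≤ # B × h ≤ g * # B
    bounds = avg (# B) (subst (λ a → k ≤ a + (# B + # B)) a≡h k≤)
    finish : (∃ λ y → B y ≡ true × # (λ a → A a ∧ adj H y a) ≤ g) → Fits H τ (bipartite 1 g)
    finish (y , by , dy) = vertex-fits {τ} 1 g 0 y by (trans (cong (λ a → τ + (a + 1)) a≡h) (trans (cong (τ +_) (+-comm h 1)) (≡-sym k≡)))
          refl dy (subst₂ _≤_ (≡-sym (+-identityʳ g)) (≡-sym a≡h) g≤h)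
  go (exceeds (suc j) e) = large-fits {τ} {bipartite 1 g} (suc h) (≡-sym k≡) (≤-trans (≤-trans (s≤s (m≤m+n h j)) (≤-reflexive (≡-sym (+-suc h j)))) (≤-reflexive (≡-sym e)))

-- By the size of the largest class: `h` needs two vertices of the second class with at most two
-- neighbours jointly; `h + 1` needs one with at most two, and an isolated vertex of the largest
-- class completes its side; `h + 2` is independent already.
bipartite₂₂-universal : ∀ k τ h → k ≡ τ + (2 + h) → 3 * h ≤ k + 1 → 3 ≤ h → Universal k τ (bipartite 2 2)
bipartite₂₂-universal k τ h k≡ 3h≤ h≥3 H tree with Classes.two-largest (coloured tree)
... | p , q , p≢q , b≤a , k≤ = go (excess (# A) h)
  where
  open Classes (coloured tree)
  open Pair p q p≢q
  go : Excess (# A) h → Fits H τ (bipartite 2 2)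
  go (short l) = ⊥-elim (largest {h = h} (≤-trans 3h≤ (+-monoʳ-≤ k (s≤s z≤n))) b≤a k≤ l)
  go (exceeds zero e) = let S , S⊆B , #S , N≤ = shrink 0 (subst₂ _≤_ (≡-sym (trans e (+-identityʳ h))) (≡-sym (+-identityʳ _)) h≤b) (# B ∸ 2) 2 (m+[n∸m]≡n (≤-trans (≤-trans (n≤1+n 2) h≥3) h≤b)) in
      set-fits {τ} 2 2 0 S S⊆B (trans (cong₂ (λ a s → τ + (a + s)) (trans e (+-identityʳ h)) #S) (trans (cong (τ +_) (+-comm h 2)) (≡-sym k≡)))
        (trans (+-identityʳ _) #S) N≤ (≤-trans (≤-trans (n≤1+n 2) h≥3) (≤-reflexive (≡-sym (trans e (+-identityʳ h)))))
    where
    h≤b : h ≤ # B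
    h≤b = half-≤ (linear 0 (3h≤ ⊕ subst (λ a → k ≤ a + (# B + # B)) (trans e (+-identityʳ h)) k≤) (lem h k (# B)))
      where
      lem : ∀ h k b → h + h + (k + 1 + (h + (b + b))) + 0 ≡ suc (b + b) + (3 * h + k)
      lem = solve-∀
  go (exceeds (suc zero) e) = finish (average 2 B (λ _ e → e) b≥1 (subst (1 ≤_) (≡-sym e) (m≤n+m 1 h))
        (subst (_≤ 2 * # B) (≡-sym e) (≤-trans (≤-trans (≤-reflexive (+-comm h 1)) many) (≤-reflexive (cong (# B +_) (≡-sym (+-identityʳ _)))))))
    where
    many : suc h ≤ # B + # B
    many = linear 0 (3h≤ ⊕ subst (λ a → k ≤ a + (# B + # B)) e k≤ ⊕ h≥3) (lem h k (# B))
      where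
      lem : ∀ h k b → suc h + (k + 1 + (h + 1 + (b + b) + h)) + 0 ≡ b + b + (3 * h + (k + 3))
      lem = solve-∀
    b≥1 : 1 ≤ # B
    b≥1 = n≢0⇒n>0 λ z → <⇒≱ (≤-trans (s≤s z≤n) many) (≤-reflexive (cong₂ _+_ z z))
    finish : (∃ λ y → B y ≡ true × # (λ a → A a ∧ adj H y a) ≤ 2) → Fits H τ (bipartite 2 2)
    finish (y , by , dy) = vertex-fits {τ} 2 2 1 y by (trans (cong (λ a → τ + (a + 1)) e) (trans (lem τ h) (≡-sym k≡))) refl dy
          (≤-trans (≤-trans h≥3 (m≤m+n h 1)) (≤-reflexive (≡-sym e)))
      where
      lem : ∀ τ h → τ + (h + 1 + 1) ≡ τ + (2 + h)
      lem = solve-∀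
  go (exceeds (suc (suc j)) e) = large-fits {τ} {bipartite 2 2} (2 + h) (≡-sym k≡) (≤-trans (≤-trans (m≤m+n (2 + h) j) (≤-reflexive (lem h j))) (≤-reflexive (≡-sym e)))
    where
    lem : ∀ h j → 2 + h + j ≡ h + suc (suc j)
    lem = solve-∀

-- Here the second class may be smaller than the largest, and `shrink` loses that difference: three
-- vertices have at most 3 + 1 joint neighbours, two have at most 2 + 2, and a single one has at
-- most 4 by averaging. Hence the side of four.
bipartite₃₄-universal : ∀ k τ h → k ≡ τ + (3 + h) → 3 * h ≤ k + 2 → 4 ≤ h → Universal k τ (bipartite 3 4)
bipartite₃₄-universal k τ h k≡ 3h≤ h≥4 H tree with Classes.two-largest (coloured tree)
... | p , q , p≢q , b≤a , k≤ = go (excess (# A) h)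
  where
  open Classes (coloured tree)
  open Pair p q p≢q
  2b≥ : ∀ {a} → # A ≡ a → h + h + h ≤ a + (# B + # B) + 2
  2b≥ refl = linear 0 (3h≤ ⊕ k≤) (lem h k (# A) (# B))
    where
    lem : ∀ h k a b → h + h + h + (k + 2 + (a + (b + b))) + 0 ≡ a + (b + b) + 2 + (3 * h + k)
    lem = solve-∀
  go : Excess (# A) h → Fits H τ (bipartite 3 4)
  go (short l) = ⊥-elim (largest {h = h} 3h≤ b≤a k≤ l)
  go (exceeds zero e) = let S , S⊆B , #S , N≤ = shrink 1 (subst (_≤ # B + 1) (≡-sym (trans e (+-identityʳ h))) h≤b) (# B ∸ 3) 3 (m+[n∸m]≡n (+-cancelʳ-≤ 1 3 _ (≤-trans h≥4 h≤b))) in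
      set-fits {τ} 3 4 0 S S⊆B (trans (cong₂ (λ a s → τ + (a + s)) (trans e (+-identityʳ h)) #S) (trans (cong (τ +_) (+-comm h 3)) (≡-sym k≡)))
        (trans (+-identityʳ _) #S) N≤ (≤-trans h≥4 (≤-reflexive (≡-sym (trans e (+-identityʳ h)))))
    where
    h≤b : h ≤ # B + 1
    h≤b = half-≤ (linear 1 (2b≥ (trans e (+-identityʳ h))) (lem h (# B)))
      where
      lem : ∀ h b → h + h + (h + (b + b) + 2) + 1 ≡ suc (b + 1 + (b + 1)) + (h + h + h)
      lem = solve-∀
  go (exceeds (suc zero) e) = let S , S⊆B , #S , N≤ = shrink 2 (subst (_≤ # B + 2) (≡-sym e) h≤b) (# B ∸ 2) 2 (m+[n∸m]≡n (+-cancelʳ-≤ 2 2 _ (≤-trans (≤-trans h≥4 (m≤m+n h 1)) h≤b))) in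
      set-fits {τ} 3 4 1 S S⊆B (trans (cong₂ (λ a s → τ + (a + s)) e #S) (trans (lem' τ h) (≡-sym k≡)))
        (cong (_+ 1) #S) N≤ (≤-trans (+-monoˡ-≤ 1 h≥4) (≤-reflexive (≡-sym e)))
    where
    h≤b : h + 1 ≤ # B + 2
    h≤b = half-≤ (linear 0 (2b≥ e) (lem h (# B)))
      where
      lem : ∀ h b → h + 1 + (h + 1) + (h + 1 + (b + b) + 2) + 0 ≡ suc (b + 2 + (b + 2)) + (h + h + h)
      lem = solve-∀
    lem' : ∀ τ h → τ + (h + 1 + 2) ≡ τ + (3 + h)
    lem' = solve-∀
  go (exceeds (suc (suc zero)) e) = finish (average 4 B (λ _ e → e) (+-cancelʳ-≤ 2 1 _ (≤-trans (≤-trans (n≤1+n 3) h≥4) h≤b))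
        (subst (1 ≤_) (≡-sym e) (≤-trans (s≤s z≤n) (m≤n+m 2 h)))
        (subst (_≤ 4 * # B) (≡-sym e) (linear 2 (h≤b ⊕ h≤b ⊕ h≤b ⊕ h≤b ⊕ h≥4 ⊕ h≥4 ⊕ h≥4) (lem h (# B)))))
    where
    h≤b : h ≤ # B + 2
    h≤b = half-≤ (linear 1 (2b≥ e) (lem' h (# B)))
      where
      lem' : ∀ h b → h + h + (h + 2 + (b + b) + 2) + 1 ≡ suc (b + 2 + (b + 2)) + (h + h + h)
      lem' = solve-∀
    lem : ∀ h b → h + 2 + (b + 2 + (b + 2 + (b + 2 + (b + 2 + (h + (h + h)))))) + 2 ≡ 4 * b + (h + (h + (h + (h + (4 + (4 + 4))))))
    lem = solve-∀
    finish : (∃ λ y → B y ≡ true × # (λ a → A a ∧ adj H y a) ≤ 4) → Fits H τ (bipartite 3 4)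
    finish (y , by , dy) = vertex-fits {τ} 3 4 2 y by (trans (cong (λ a → τ + (a + 1)) e) (trans (lem₂ τ h) (≡-sym k≡))) refl dy
          (≤-trans (+-monoˡ-≤ 2 h≥4) (≤-reflexive (≡-sym e)))
      where
      lem₂ : ∀ τ h → τ + (h + 2 + 1) ≡ τ + (3 + h)
      lem₂ = solve-∀
  go (exceeds (suc (suc (suc j))) e) = large-fits {τ} {bipartite 3 4} (3 + h) (≡-sym k≡) (≤-trans (≤-trans (m≤m+n (3 + h) j) (≤-reflexive (lem h j))) (≤-reflexive (≡-sym e)))
    where
    lem : ∀ h j → 3 + h + j ≡ h + suc (suc (suc j))
    lem = solve-∀

#-cover₃ : ∀ {n} (P P₁ P₂ P₃ : Fin n → Bool) → (∀ x → P x ≡ true → P₁ x ≡ true ⊎ P₂ x ≡ true ⊎ P₃ x ≡ true) →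
  # P ≤ # P₁ + (# P₂ + # P₃)
#-cover₃ {n} P P₁ P₂ P₃ h = subst (λ z → # P ≤ # P₁ + (# P₂ + z)) (trans (cong (# P₃ +_) (#-zero {n} (λ _ → refl))) (+-identityʳ _))
  (#-cover₄ P P₁ P₂ P₃ (λ _ → false) λ x e → [ inj₁ , (λ r → inj₂ ([ inj₁ , inj₂ ∘ inj₁ ]′ r)) ]′ (h x e))

-- A class function given by a list of disjoint sets: the class is the index of the first set
-- containing the vertex. The offsets of all classes then follow from the sizes in the list.
module Parts {k : ℕ} where

  part : List (Fin k → Bool) → Fin k → ℕ
  part [] x = 0
  part (p ∷ ps) x = if p x then 0 else suc (part ps x)

  Off : List (Fin k → Bool) → Fin k → Set
  Off [] x = ⊤
  Off (p ∷ ps) x = p x ≡ false × Off ps x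

  Disjoint : List (Fin k → Bool) → Set
  Disjoint [] = ⊤
  Disjoint (p ∷ ps) = (∀ x → p x ≡ true → Off ps x) × Disjoint ps

  size : List (Fin k → Bool) → ℕ → ℕ
  size ps zero = 0
  size [] (suc c) = 0
  size (p ∷ ps) (suc c) = # p + size ps c

  part-off : ∀ ps x → Off ps x → part ps x ≡ length ps
  part-off [] x _ = refl
  part-off (p ∷ ps) x (e , o) rewrite e = cong suc (part-off ps x o)

  below-size : ∀ ps c → c ≤ length ps → Disjoint ps → # (λ x → part ps x <ᵇ c) ≡ size ps c
  below-size ps zero _ _ = #-zero {k} (λ _ → refl)
  below-size (p ∷ ps) (suc c) (s≤s le) (d , ds) = trans (#-cong λ x → point (p x) (part ps x))
      (trans (#-disjoint p (λ x → part ps x <ᵇ c) λ x e → <ᵇ-false (≤-trans le (≤-reflexive (≡-sym (part-off ps x (d x e))))))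
        (cong (# p +_) (below-size ps c le ds)))
    where
    point : ∀ b m → ((if b then 0 else suc m) <ᵇ suc c) ≡ b ∨ (m <ᵇ c)
    point true m = refl
    point false m = refl

-- The path on five vertices and two disjoint edges as remainders

step-edges : ℕ → ℕ → Bool
step-edges 0 2 = true
step-edges 0 3 = true
step-edges 1 3 = true
step-edges 1 4 = true
step-edges _ _ = false

-- The path 2, 0, 3, 1, 4.
path₅ : ℕ → ℕ → Bool
path₅ i l = step-edges i l ∨ step-edges l i

match-edges : ℕ → ℕ → Bool
match-edges 0 1 = true
match-edges 2 3 = true
match-edges _ _ = false

matching₂ : ℕ → ℕ → Bool
matching₂ i l = match-edges i l ∨ match-edges l i

module _ {k} (H : Graph k) (A : Fin k → Bool) (indA : Independent H A) where

  nbr : Fin k → Fin k → Bool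
  nbr x a = A a ∧ adj H x a

  single : ∀ (p q : Fin k → Bool) → (∀ x → p x ≡ true → q x ≡ true) → # p ≤ 1 → 1 ≤ # q →
    Σ (Fin k → Bool) λ r → (∀ x → p x ≡ true → r x ≡ true) × (∀ x → r x ≡ true → q x ≡ true) × # r ≡ 1
  single p q = interpolate p q 1

  -- The middle vertex C of the path contains the common neighbours of x and y.
  middle : ∀ x y → # (nbr x) ≤ 2 → # (nbr y) ≤ 2 → # (λ a → nbr x a ∨ nbr y a) ≤ 3 → 3 ≤ # A →
    # (nbr x) + # (nbr y) ≤ # (λ a → nbr x a ∨ nbr y a) + 1 →
    Σ (Fin k → Bool) λ C → (∀ a → C a ≡ true → A a ≡ true) × # C ≡ 1 × (∀ a → nbr x a ≡ true → nbr y a ≡ true → C a ≡ true) ×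
      # (λ a → nbr x a ∧ not (C a)) ≤ 1 × # (λ a → nbr y a ∧ not (C a)) ≤ 1
  middle x y x≤2 y≤2 U≤3 A≥3 sum = by-size (# I) refl
    where
    I : Fin k → Bool
    I a = nbr x a ∧ nbr y a
    U : Fin k → Bool
    U a = nbr x a ∨ nbr y a
    inclusion : # U + # I ≡ # (nbr x) + # (nbr y)
    inclusion = trans (≡-sym (∑-distrib-+ _ _)) (trans (∑-cong λ a → point (nbr x a) (nbr y a)) (∑-distrib-+ _ _))
      where
      point : ∀ a b → ⟦ a ∨ b ⟧ + ⟦ a ∧ b ⟧ ≡ ⟦ a ⟧ + ⟦ b ⟧
      point true true = refl
      point true false = refl
      point false true = refl
      point false false = refl
    Result : Set
    Result = Σ (Fin k → Bool) λ C → (∀ a → C a ≡ true → A a ≡ true) × # C ≡ 1 × (∀ a → nbr x a ≡ true → nbr y a ≡ true → C a ≡ true) ×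
      # (λ a → nbr x a ∧ not (C a)) ≤ 1 × # (λ a → nbr y a ∧ not (C a)) ≤ 1
    without : ∀ (p C : Fin k → Bool) → (∀ a → C a ≡ true → p a ≡ true) → # C ≡ 1 → # p ≤ 2 → # (λ a → p a ∧ not (C a)) ≤ 1
    without p C C⊆p #C p≤2 = s≤s⁻¹ (≤-trans (≤-reflexive (trans (cong (_+ # (λ a → p a ∧ not (C a)))
      (trans (≡-sym #C) (#-cong λ a → ≡-sym (point a)))) (#-split p C))) p≤2)
      where
      point : ∀ a → p a ∧ C a ≡ C a
      point a with bool (C a)
      ... | inj₁ e = trans (∧-true (C⊆p a e) e) (≡-sym e)
      ... | inj₂ e rewrite e with p a
      ...   | true = refl
      ...   | false = refl
    fewer : ∀ (p C : Fin k → Bool) → # (λ a → p a ∧ not (C a)) ≤ # p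
    fewer p C = #-mono λ a → ∧-fst
    disjoint : # I ≡ 0 → ∀ a → nbr x a ≡ true → nbr y a ≡ true → ⊥
    disjoint z a ex ey = <⇒≱ (∃⇒0<# {p = I} a (∧-true ex ey)) (≤-reflexive z)
    by-size : ∀ i → # I ≡ i → Result
    by-size (suc (suc i)) e = ⊥-elim (<⇒≱ (≤-trans (s≤s (s≤s z≤n)) (≤-reflexive (≡-sym e)))
      (+-cancelˡ-≤ (# U) _ 1 (≤-trans (≤-reflexive inclusion) sum)))
    by-size (suc zero) e = I , (λ a i → ∧-fst (∧-fst i)) , e , (λ a → ∧-true) ,
      without (nbr x) I (λ a → ∧-fst) e x≤2 , without (nbr y) I (λ a → ∧-snd {nbr x a}) e y≤2
    -- Without a common neighbour, `C` is taken from a vertex that has two neighbours, if there is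
    -- one; the union having at most three, the other then has at most one.
    by-size zero e with # (nbr x) ≤? 1 | # (nbr y) ≤? 1
    ... | no x>1 | _ = let C , _ , C⊆ , #C = single (λ _ → false) (nbr x) (λ _ ()) (≤-trans (≤-reflexive (#-zero {k} (λ _ → refl))) z≤n) (<⇒≤ (≰⇒> x>1)) in
        C , (λ a c → ∧-fst (C⊆ a c)) , #C , (λ a ex ey → ⊥-elim (disjoint e a ex ey)) , without (nbr x) C C⊆ #C x≤2 ,
        ≤-trans (fewer (nbr y) C) (+-cancelˡ-≤ 2 _ 1 (≤-trans (+-monoˡ-≤ _ (≰⇒> x>1)) (≤-trans (≤-reflexive (≡-sym inclusion))
          (≤-trans (≤-reflexive (trans (cong (# U +_) e) (+-identityʳ _))) U≤3))))
    ... | yes x≤1 | no y>1 = let C , _ , C⊆ , #C = single (λ _ → false) (nbr y) (λ _ ()) (≤-trans (≤-reflexive (#-zero {k} (λ _ → refl))) z≤n) (<⇒≤ (≰⇒> y>1)) in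
        C , (λ a c → ∧-fst (C⊆ a c)) , #C , (λ a ex ey → ⊥-elim (disjoint e a ex ey)) , ≤-trans (fewer (nbr x) C) x≤1 ,
        without (nbr y) C C⊆ #C y≤2
    ... | yes x≤1 | yes y≤1 = let C , _ , C⊆ , #C = single (λ _ → false) A (λ _ ()) (≤-trans (≤-reflexive (#-zero {k} (λ _ → refl))) z≤n) (≤-trans (s≤s z≤n) A≥3) in
        C , C⊆ , #C , (λ a ex ey → ⊥-elim (disjoint e a ex ey)) , ≤-trans (fewer (nbr x) C) x≤1 , ≤-trans (fewer (nbr y) C) y≤1

  -- The path runs through `P`, `x`, `C`, `y`, `R`. After `middle` has fixed `C`, each of `x` and
  -- `y` has at most one further neighbour; `P` and `R` contain it, or an arbitrary free vertex of
  -- `A` if there is none.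
  path₅-fits : ∀ {τ} x y → A x ≡ false → A y ≡ false → x ≢ y → adj H x y ≡ false → τ + (2 + # A) ≡ k →
    # (nbr x) ≤ 2 → # (nbr y) ≤ 2 → # (λ a → nbr x a ∨ nbr y a) ≤ 3 → 3 ≤ # A →
    # (nbr x) + # (nbr y) ≤ # (λ a → nbr x a ∨ nbr y a) + 1 → Fits H τ path₅
  path₅-fits {τ} x y ax ay x≢y xy sz x≤2 y≤2 U≤3 A≥3 sum with middle x y x≤2 y≤2 U≤3 A≥3 sum
  ... | C , C⊆A , #C , I⊆C , xC , yC with single (λ a → nbr x a ∧ not (C a)) (λ a → A a ∧ (not (C a) ∧ not (nbr y a)))
        (λ a e → ∧-true {A a} (∧-fst {A a} (∧-fst {nbr x a} e)) (∧-true (∧-snd {nbr x a} e) (not-true (¬true⇒false λ ey →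
          true≢false (I⊆C a (∧-fst {nbr x a} e) ey) (not⇒false (∧-snd {nbr x a} e)))))) xC
        (+-cancelˡ-≤ 2 1 _ (≤-trans A≥3 (≤-trans (#-cover₃ A C (λ a → nbr y a ∧ not (C a)) (λ a → A a ∧ (not (C a) ∧ not (nbr y a)))
            λ a e → [ inj₁ , (λ c → [ (λ ey → inj₂ (inj₁ (∧-true ey (not-true c)))) ,
              (λ ey → inj₂ (inj₂ (∧-true e (∧-true (not-true c) (not-true ey))))) ]′ (bool (nbr y a))) ]′ (bool (C a)))
          (≤-reflexive #C ⊕ +-monoˡ-≤ _ yC))))
  ...   | P , xP , P⊆ , #P with single (λ a → nbr y a ∧ not (C a)) (λ a → A a ∧ (not (C a) ∧ not (P a)))
          (λ a e → ∧-true {A a} (∧-fst {A a} (∧-fst {nbr y a} e)) (∧-true (∧-snd {nbr y a} e) (not-true (¬true⇒false λ pa →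
            true≢false (∧-fst {nbr y a} e) (not⇒false (∧-snd {not (C a)} (∧-snd {A a} (P⊆ a pa)))))))) yC
          (+-cancelˡ-≤ 2 1 _ (≤-trans A≥3 (≤-trans (#-cover₃ A C P (λ a → A a ∧ (not (C a) ∧ not (P a)))
              λ a e → [ inj₁ , (λ c → [ inj₂ ∘ inj₁ ,
                (λ pa → inj₂ (inj₂ (∧-true e (∧-true (not-true c) (not-true pa))))) ]′ (bool (P a))) ]′ (bool (C a)))
            (≤-reflexive #C ⊕ +-monoˡ-≤ _ (≤-reflexive #P)))))
  ...     | R , yR , R⊆ , #R = sort-fits b₁ ok
    where
    J : Fin k → Bool
    J z = not (A z ∨ ((x == z) ∨ (y == z)))
    open Parts {k}
    ps : List (Fin k → Bool)
    ps = J ∷ (x ==_) ∷ (y ==_) ∷ P ∷ C ∷ R ∷ []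
    open SortFits H (part ps) τ path₅
    open Sort (part ps)
    A⇒ : ∀ {z} → A z ≡ true → J z ≡ false × (x == z) ≡ false × (y == z) ≡ false
    A⇒ {z} a = cong (λ b → not (b ∨ ((x == z) ∨ (y == z)))) a , ≢⇒== {i = x} {z} (λ { refl → true≢false a ax }) , ≢⇒== {i = y} {z} (λ { refl → true≢false a ay })
    A-C : ∀ {z} → C z ≡ true → A z ≡ true
    A-C {z} = C⊆A z
    A-P : ∀ {z} → P z ≡ true → A z ≡ true
    A-P {z} e = ∧-fst (P⊆ z e)
    A-R : ∀ {z} → R z ≡ true → A z ≡ true
    A-R {z} e = ∧-fst (R⊆ z e)
    notP : ∀ {z} → A z ≡ false → P z ≡ false × C z ≡ false × R z ≡ false
    notP a = (¬true⇒false λ e → true≢false (A-P e) a) , (¬true⇒false λ e → true≢false (A-C e) a) , (¬true⇒false λ e → true≢false (A-R e) a)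
    P⇒ : ∀ {z} → P z ≡ true → C z ≡ false × R z ≡ false
    P⇒ {z} e = not⇒false (∧-fst (∧-snd {A z} (P⊆ z e))) , ¬true⇒false λ r → true≢false e (not⇒false (∧-snd {not (C z)} (∧-snd {A z} (R⊆ z r))))
    C⇒R : ∀ {z} → C z ≡ true → R z ≡ false
    C⇒R {z} e = ¬true⇒false λ r → true≢false e (not⇒false (∧-fst (∧-snd {A z} (R⊆ z r))))
    y≢ : (y == x) ≡ false
    y≢ = ≢⇒== (x≢y ∘ ≡-sym)
    J⇒A : ∀ z → J z ≡ true → A z ≡ false × (x == z) ≡ false × (y == z) ≡ false
    J⇒A z j with A z | x == z | y == z
    ... | false | false | false = refl , refl , refl
    disj : Disjoint ps
    disj = (λ z j → let a , ex , ey = J⇒A z j ; p , c , r = notP a in ex , ey , p , c , r , tt) ,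
      (λ z e → off-x z (==⇒≡ e)) , (λ z e → let p , c , r = notP (subst (λ w → A w ≡ false) (==⇒≡ e) ay) in p , c , r , tt) ,
      (λ z e → let c , r = P⇒ e in c , r , tt) , (λ z e → C⇒R e , tt) , (λ _ _ → tt) , tt
      where
      off-x : ∀ z → x ≡ z → Off ((y ==_) ∷ P ∷ C ∷ R ∷ []) z
      off-x z refl = let p , c , r = notP ax in y≢ , p , c , r , tt
    #J : # J ≡ τ
    #J = +-cancelˡ-≡ (# (λ z → A z ∨ ((x == z) ∨ (y == z)))) _ τ (trans (#-compl (λ z → A z ∨ ((x == z) ∨ (y == z)))) (≡-sym (trans (cong (_+ τ)
      (trans (#-disjoint A (λ z → (x == z) ∨ (y == z)) λ z a → let _ , ex , ey = A⇒ a in trans (cong (_∨ (y == z)) ex) ey)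
        (cong (# A +_) (trans (#-disjoint (x ==_) (y ==_) λ z e → subst (λ w → (y == w) ≡ false) (==⇒≡ e) y≢)
          (cong₂ _+_ (#-single x) (#-single y)))))) (trans (lem (# A) τ) sz))))
      where
      lem : ∀ a τ → a + 2 + τ ≡ τ + (2 + a)
      lem = solve-∀
    b : ∀ c → c ≤ 6 → below c ≡ size ps c
    b c le = below-size ps c le disj
    b₁ : below 1 ≡ τ
    b₁ = trans (b 1 (s≤s z≤n)) (trans (+-identityʳ _) #J)
    b₂ : below 2 ≡ τ + 1
    b₂ = trans (b 2 (s≤s (s≤s z≤n))) (cong₂ _+_ #J (cong (_+ 0) (#-single x)))
    b₃ : below 3 ≡ τ + 2
    b₃ = trans (b 3 (s≤s (s≤s (s≤s z≤n)))) (cong₂ _+_ #J (cong₂ _+_ (#-single x) (cong (_+ 0) (#-single y))))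
    b₄ : below 4 ≡ τ + 3
    b₄ = trans (b 4 (s≤s (s≤s (s≤s (s≤s z≤n))))) (cong₂ _+_ #J (cong₂ _+_ (#-single x) (cong₂ _+_ (#-single y) (cong (_+ 0) #P))))
    b₅ : below 5 ≡ τ + 4
    b₅ = trans (b 5 (s≤s (s≤s (s≤s (s≤s (s≤s z≤n)))))) (cong₂ _+_ #J (cong₂ _+_ (#-single x) (cong₂ _+_ (#-single y) (cong₂ _+_ #P (cong (_+ 0) #C)))))
    b₆ : below 6 ≡ τ + 5
    b₆ = trans (b 6 ≤-refl) (cong₂ _+_ #J (cong₂ _+_ (#-single x) (cong₂ _+_ (#-single y) (cong₂ _+_ #P (cong₂ _+_ #C (cong (_+ 0) #R))))))
    off : Fin k → ℕ
    off z = toℕ (position z) ∸ τ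
    off-x : off x ≡ 0
    off-x = offset-≡ x cls (trans b₁ (≡-sym (+-identityʳ τ))) b₂
      where
      cls : part ps x ≡ 1
      cls rewrite ax | ==-refl x = refl
    off-y : off y ≡ 1
    off-y = offset-≡ y cls b₂ b₃
      where
      cls : part ps y ≡ 2
      cls rewrite ay | ==-refl y | ≢⇒== x≢y = refl
    off-P : ∀ {z} → P z ≡ true → off z ≡ 2
    off-P {z} e = offset-≡ z (cls (A⇒ (A-P e)) (A-P e)) b₃ b₄
      where
      cls : J z ≡ false × (x == z) ≡ false × (y == z) ≡ false → A z ≡ true → part ps z ≡ 3
      cls (_ , ex , ey) a rewrite a | ex | ey | e = refl
    off-C : ∀ {z} → C z ≡ true → off z ≡ 3
    off-C {z} e = offset-≡ z (cls (A⇒ (A-C e)) (A-C e) (¬true⇒false λ p → true≢false e (proj₁ (P⇒ p)))) b₄ b₅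
      where
      cls : J z ≡ false × (x == z) ≡ false × (y == z) ≡ false → A z ≡ true → P z ≡ false → part ps z ≡ 4
      cls (_ , ex , ey) a p rewrite a | ex | ey | p | e = refl
    off-R : ∀ {z} → R z ≡ true → off z ≡ 4
    off-R {z} e = offset-≡ z (cls (A⇒ (A-R e)) (A-R e) (¬true⇒false λ p → true≢false e (proj₂ (P⇒ p)))
        (¬true⇒false λ c → true≢false e (C⇒R c))) b₅ b₆
      where
      cls : J z ≡ false × (x == z) ≡ false × (y == z) ≡ false → A z ≡ true → P z ≡ false → C z ≡ false → part ps z ≡ 5
      cls (_ , ex , ey) a p c rewrite a | ex | ey | p | c | e = refl
    Kind : Fin k → Set
    Kind z = A z ≡ true ⊎ x ≡ z ⊎ y ≡ z
    kind : ∀ z → 1 ≤ part ps z → Kind z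
    kind z l with bool (A z) | bool (x == z) | bool (y == z)
    ... | inj₁ a | _ | _ = inj₁ a
    ... | inj₂ _ | inj₁ ex | _ = inj₂ (inj₁ (==⇒≡ ex))
    ... | inj₂ _ | inj₂ _ | inj₁ ey = inj₂ (inj₂ (==⇒≡ ey))
    ... | inj₂ a | inj₂ ex | inj₂ ey = ⊥-elim (<⇒≱ l (≤-reflexive cls))
      where
      cls : part ps z ≡ 0
      cls rewrite a | ex | ey = refl
    Both : ℕ → ℕ → Set
    Both i l = path₅ i l ≡ true × path₅ l i ≡ true
    with-x : ∀ a → A a ≡ true → adj H x a ≡ true → Both (off x) (off a)
    with-x a aa e rewrite off-x with bool (C a)
    ... | inj₁ c rewrite off-C c = refl , refl
    ... | inj₂ c rewrite off-P (xP a (∧-true (∧-true aa e) (not-true c))) = refl , refl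
    with-y : ∀ a → A a ≡ true → adj H y a ≡ true → Both (off y) (off a)
    with-y a aa e rewrite off-y with bool (C a)
    ... | inj₁ c rewrite off-C c = refl , refl
    ... | inj₂ c rewrite off-R (yR a (∧-true (∧-true aa e) (not-true c))) = refl , refl
    ok : ∀ a b → adj H a b ≡ true → 1 ≤ part ps a → 1 ≤ part ps b → path₅ (off a) (off b) ≡ true
    ok a b e la lb with kind a la | kind b lb
    ... | inj₁ aa | inj₁ ab = ⊥-elim (true≢false e (indA a b aa ab))
    ... | inj₁ aa | inj₂ (inj₁ refl) = proj₂ (with-x a aa (adj-sym H e))
    ... | inj₁ aa | inj₂ (inj₂ refl) = proj₂ (with-y a aa (adj-sym H e))
    ... | inj₂ (inj₁ refl) | inj₁ ab = proj₁ (with-x b ab e)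
    ... | inj₂ (inj₂ refl) | inj₁ ab = proj₁ (with-y b ab e)
    ... | inj₂ (inj₁ refl) | inj₂ (inj₁ refl) = ⊥-elim (adj⇒≢ H e refl)
    ... | inj₂ (inj₁ refl) | inj₂ (inj₂ refl) = ⊥-elim (true≢false e xy)
    ... | inj₂ (inj₂ refl) | inj₂ (inj₁ refl) = ⊥-elim (true≢false (adj-sym H e) xy)
    ... | inj₂ (inj₂ refl) | inj₂ (inj₂ refl) = ⊥-elim (adj⇒≢ H e refl)

fits-mono : ∀ {k} {H : Graph k} {τ Γ Γ'} → (∀ i l → Γ i l ≡ true → Γ' i l ≡ true) → Fits H τ Γ → Fits H τ Γ'
fits-mono {τ = τ} {Γ} {Γ'} h (φ , inj , ok) = φ , inj , λ a b e → lift (toℕ (φ a)) (toℕ (φ b)) (ok a b e)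
  where
  lift : ∀ i j → place τ Γ i j ≡ true → place τ Γ' i j ≡ true
  lift i j e = ∧-true (∧-fst e) (go (∨-case {i <ᵇ τ} (∧-snd {not (i ≡ᵇ j)} e)))
    where
    go : (i <ᵇ τ) ≡ true ⊎ ((j <ᵇ τ) ∨ Γ (i ∸ τ) (j ∸ τ)) ≡ true → ((i <ᵇ τ) ∨ ((j <ᵇ τ) ∨ Γ' (i ∸ τ) (j ∸ τ))) ≡ true
    go (inj₁ a) = ∨-inl a
    go (inj₂ a) = ∨-inr {i <ᵇ τ} ([ ∨-inl , (λ g → ∨-inr {j <ᵇ τ} (h _ _ g)) ]′ (∨-case {j <ᵇ τ} a))

module _ {k} (H : Graph k) (B : Fin k → Bool) (indB : Independent H B) where

  -- The two edges are `x P` and `y R`. Having no common neighbour lets `P` avoid the neighbour of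
  -- `y`; a missing partner is replaced by any free vertex of `B`.
  matching₂-fits : ∀ {τ} x y → B x ≡ false → B y ≡ false → x ≢ y → adj H x y ≡ false → τ + (2 + # B) ≡ k →
    # (nbr H B indB x) ≤ 1 → # (nbr H B indB y) ≤ 1 → 2 ≤ # B → (∀ a → nbr H B indB x a ≡ true → nbr H B indB y a ≡ true → ⊥) → Fits H τ matching₂
  matching₂-fits {τ} x y bx by x≢y xy sz x≤1 y≤1 B≥2 disjoint with single H B indB (nbr H B indB x) (λ a → B a ∧ not (nbr H B indB y a))
        (λ a e → ∧-true {B a} (∧-fst e) (not-true (¬true⇒false (disjoint a e)))) x≤1
        (+-cancelˡ-≤ 1 1 _ (≤-trans B≥2 (≤-trans (#-cover₂ B (nbr H B indB y) (λ a → B a ∧ not (nbr H B indB y a))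
          λ a e → [ inj₁ , (λ f → inj₂ (∧-true e (not-true f))) ]′ (bool (nbr H B indB y a))) (+-monoˡ-≤ _ y≤1))))
  ... | P , xP , P⊆ , #P with single H B indB (nbr H B indB y) (λ a → B a ∧ not (P a))
        (λ a e → ∧-true {B a} (∧-fst e) (not-true (¬true⇒false λ pa → true≢false e (not⇒false (∧-snd {B a} (P⊆ a pa)))))) y≤1
        (+-cancelˡ-≤ 1 1 _ (≤-trans B≥2 (≤-trans (#-cover₂ B P (λ a → B a ∧ not (P a))
          λ a e → [ inj₁ , (λ f → inj₂ (∧-true e (not-true f))) ]′ (bool (P a))) (+-monoˡ-≤ _ (≤-reflexive #P)))))
  ...   | R , yR , R⊆ , #R = sort-fits b₁ ok
    where
    J : Fin k → Bool
    J z = not (B z ∨ ((x == z) ∨ (y == z)))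
    open Parts {k}
    ps : List (Fin k → Bool)
    ps = J ∷ (x ==_) ∷ P ∷ (y ==_) ∷ R ∷ []
    open SortFits H (part ps) τ matching₂
    open Sort (part ps)
    B⇒ : ∀ {z} → B z ≡ true → (x == z) ≡ false × (y == z) ≡ false
    B⇒ {z} a = ≢⇒== {i = x} {z} (λ { refl → true≢false a bx }) , ≢⇒== {i = y} {z} (λ { refl → true≢false a by })
    B-P : ∀ {z} → P z ≡ true → B z ≡ true
    B-P {z} e = ∧-fst (P⊆ z e)
    B-R : ∀ {z} → R z ≡ true → B z ≡ true
    B-R {z} e = ∧-fst (R⊆ z e)
    ¬B⇒ : ∀ {z} → B z ≡ false → P z ≡ false × R z ≡ false
    ¬B⇒ a = (¬true⇒false λ e → true≢false (B-P e) a) , (¬true⇒false λ e → true≢false (B-R e) a)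
    R⇒P : ∀ {z} → R z ≡ true → P z ≡ false
    R⇒P {z} e = not⇒false (∧-snd {B z} (R⊆ z e))
    J⇒B : ∀ z → J z ≡ true → B z ≡ false × (x == z) ≡ false × (y == z) ≡ false
    J⇒B z j with B z | x == z | y == z
    ... | false | false | false = refl , refl , refl
    disj : Disjoint ps
    disj = (λ z j → let a , ex , ey = J⇒B z j ; p , r = ¬B⇒ a in ex , p , ey , r , tt) ,
      (λ z e → off-x z (==⇒≡ e)) ,
      (λ z e → proj₂ (B⇒ (B-P e)) , (¬true⇒false λ r → true≢false e (R⇒P r)) , tt) ,
      (λ z e → proj₂ (¬B⇒ (subst (λ w → B w ≡ false) (==⇒≡ e) by)) , tt) , (λ _ _ → tt) , tt
      where
      off-x : ∀ z → x ≡ z → Off (P ∷ (y ==_) ∷ R ∷ []) z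
      off-x z refl = proj₁ (¬B⇒ bx) , ≢⇒== {i = y} (x≢y ∘ ≡-sym) , proj₂ (¬B⇒ bx) , tt
    #J : # J ≡ τ
    #J = +-cancelˡ-≡ (# (λ z → B z ∨ ((x == z) ∨ (y == z)))) _ τ (trans (#-compl (λ z → B z ∨ ((x == z) ∨ (y == z)))) (≡-sym (trans (cong (_+ τ)
      (trans (#-disjoint B (λ z → (x == z) ∨ (y == z)) λ z a → let ex , ey = B⇒ a in trans (cong (_∨ (y == z)) ex) ey)
        (cong (# B +_) (trans (#-disjoint (x ==_) (y ==_) λ z e → ≢⇒== {i = y} {z} λ f → x≢y (trans (==⇒≡ {i = x} e) (≡-sym f)))
          (cong₂ _+_ (#-single x) (#-single y)))))) (trans (lem (# B) τ) sz))))
      where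
      lem : ∀ a τ → a + 2 + τ ≡ τ + (2 + a)
      lem = solve-∀
    b : ∀ c → c ≤ 5 → below c ≡ size ps c
    b c le = below-size ps c le disj
    b₁ : below 1 ≡ τ
    b₁ = trans (b 1 (s≤s z≤n)) (trans (+-identityʳ _) #J)
    b₂ : below 2 ≡ τ + 1
    b₂ = trans (b 2 (s≤s (s≤s z≤n))) (cong₂ _+_ #J (cong (_+ 0) (#-single x)))
    b₃ : below 3 ≡ τ + 2
    b₃ = trans (b 3 (s≤s (s≤s (s≤s z≤n)))) (cong₂ _+_ #J (cong₂ _+_ (#-single x) (cong (_+ 0) #P)))
    b₄ : below 4 ≡ τ + 3
    b₄ = trans (b 4 (s≤s (s≤s (s≤s (s≤s z≤n))))) (cong₂ _+_ #J (cong₂ _+_ (#-single x) (cong₂ _+_ #P (cong (_+ 0) (#-single y)))))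
    b₅ : below 5 ≡ τ + 4
    b₅ = trans (b 5 ≤-refl) (cong₂ _+_ #J (cong₂ _+_ (#-single x) (cong₂ _+_ #P (cong₂ _+_ (#-single y) (cong (_+ 0) #R)))))
    off : Fin k → ℕ
    off z = toℕ (position z) ∸ τ
    off-x : off x ≡ 0
    off-x = offset-≡ x cls (trans b₁ (≡-sym (+-identityʳ τ))) b₂
      where
      cls : part ps x ≡ 1
      cls rewrite bx | ==-refl x = refl
    off-y : off y ≡ 2
    off-y = offset-≡ y (cls (proj₁ (¬B⇒ by))) b₃ b₄
      where
      cls : P y ≡ false → part ps y ≡ 3
      cls p rewrite by | ==-refl y | ≢⇒== x≢y | p = refl
    off-P : ∀ {z} → P z ≡ true → off z ≡ 1
    off-P {z} e = offset-≡ z (cls (B⇒ (B-P e)) (B-P e)) b₂ b₃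
      where
      cls : (x == z) ≡ false × (y == z) ≡ false → B z ≡ true → part ps z ≡ 2
      cls (ex , ey) a rewrite a | ex | ey | e = refl
    off-R : ∀ {z} → R z ≡ true → off z ≡ 3
    off-R {z} e = offset-≡ z (cls (B⇒ (B-R e)) (B-R e) (R⇒P e)) b₄ b₅
      where
      cls : (x == z) ≡ false × (y == z) ≡ false → B z ≡ true → P z ≡ false → part ps z ≡ 4
      cls (ex , ey) a p rewrite a | ex | ey | p | e = refl
    kind : ∀ z → 1 ≤ part ps z → B z ≡ true ⊎ x ≡ z ⊎ y ≡ z
    kind z l with bool (B z) | bool (x == z) | bool (y == z)
    ... | inj₁ a | _ | _ = inj₁ a
    ... | inj₂ _ | inj₁ ex | _ = inj₂ (inj₁ (==⇒≡ ex))
    ... | inj₂ _ | inj₂ _ | inj₁ ey = inj₂ (inj₂ (==⇒≡ ey))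
    ... | inj₂ a | inj₂ ex | inj₂ ey = ⊥-elim (<⇒≱ l (≤-reflexive cls))
      where
      cls : part ps z ≡ 0
      cls rewrite a | ex | ey = refl
    Both : ℕ → ℕ → Set
    Both i l = matching₂ i l ≡ true × matching₂ l i ≡ true
    with-x : ∀ a → B a ≡ true → adj H x a ≡ true → Both (off x) (off a)
    with-x a aa e rewrite off-x | off-P (xP a (∧-true aa e)) = refl , refl
    with-y : ∀ a → B a ≡ true → adj H y a ≡ true → Both (off y) (off a)
    with-y a aa e rewrite off-y | off-R (yR a (∧-true aa e)) = refl , refl
    ok : ∀ a b → adj H a b ≡ true → 1 ≤ part ps a → 1 ≤ part ps b → matching₂ (off a) (off b) ≡ true
    ok a b e la lb with kind a la | kind b lb
    ... | inj₁ aa | inj₁ ab = ⊥-elim (true≢false e (indB a b aa ab))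
    ... | inj₁ aa | inj₂ (inj₁ refl) = proj₂ (with-x a aa (adj-sym H e))
    ... | inj₁ aa | inj₂ (inj₂ refl) = proj₂ (with-y a aa (adj-sym H e))
    ... | inj₂ (inj₁ refl) | inj₁ ab = proj₁ (with-x b ab e)
    ... | inj₂ (inj₂ refl) | inj₁ ab = proj₁ (with-y b ab e)
    ... | inj₂ (inj₁ refl) | inj₂ (inj₁ refl) = ⊥-elim (adj⇒≢ H e refl)
    ... | inj₂ (inj₁ refl) | inj₂ (inj₂ refl) = ⊥-elim (true≢false e xy)
    ... | inj₂ (inj₂ refl) | inj₂ (inj₁ refl) = ⊥-elim (true≢false (adj-sym H e) xy)
    ... | inj₂ (inj₂ refl) | inj₂ (inj₂ refl) = ⊥-elim (adj⇒≢ H e refl)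

module _ {k} {H : Graph k} (C : Coloured H) (p q : Fin 3) (p≢q : p ≢ q) where
  open Coloured C
  open Classes C
  open Pair p q p≢q

  -- In a forest two vertices have at most one common neighbour: the edges from `x` and `y` to their
  -- joint neighbourhood `U` number at most `# U + 1`.
  joint-neighbours : ∀ x y → B x ≡ true → B y ≡ true → x ≢ y →
    # (λ a → A a ∧ adj H x a) + # (λ a → A a ∧ adj H y a) ≤ # (λ a → (A a ∧ adj H x a) ∨ (A a ∧ adj H y a)) + 1
  joint-neighbours x y bx by x≢y with 1 ≤? # (λ a → (A a ∧ adj H x a) ∨ (A a ∧ adj H y a))
  ... | no ¬u = ≤-trans (≤-trans (#-mono (λ a → ∨-inl) ⊕ #-mono (λ a e → ∨-inr {A a ∧ adj H x a} e))
        (≤-reflexive (cong₂ _+_ (n<1⇒n≡0 (≰⇒> ¬u)) (n<1⇒n≡0 (≰⇒> ¬u))))) z≤n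
  ... | yes u≥1 = s≤s⁻¹ (≤-trans (s≤s lower) (≤-trans (forest q p (p≢q ∘ ≡-sym) P U (λ z e → class⇒ (P⊆B z e))
          (λ a e → class⇒ ([ ∧-fst , ∧-fst ]′ (∨-case {A a ∧ adj H x a} e))) (subst (1 ≤_) (≡-sym #P) (s≤s z≤n)) u≥1)
          (≤-reflexive (trans (cong (_+ # U) #P) (cong suc (+-comm 1 (# U)))))))
    where
    P U : Fin k → Bool
    P z = (x == z) ∨ (y == z)
    U a = (A a ∧ adj H x a) ∨ (A a ∧ adj H y a)
    P⊆B : ∀ z → P z ≡ true → B z ≡ true
    P⊆B z e with ∨-case {x == z} e
    ... | inj₁ ex = subst (λ w → B w ≡ true) (==⇒≡ {i = x} ex) bx
    ... | inj₂ ey = subst (λ w → B w ≡ true) (==⇒≡ {i = y} ey) by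
    #P : # P ≡ 2
    #P = trans (#-disjoint (x ==_) (y ==_) λ z e → ≢⇒== {i = y} {z} λ f → x≢y (trans (==⇒≡ {i = x} e) (≡-sym f)))
      (cong₂ _+_ (#-single x) (#-single y))
    dx = # (λ a → A a ∧ adj H x a)
    dy = # (λ a → A a ∧ adj H y a)
    pick : ∀ z d → ∑ (λ w → ⟦ z == w ⟧ * d) ≡ d
    pick z d = trans (∑-guard (z ==_) d) (trans (cong (_* d) (#-single z)) (*-identityˡ d))
    lower : dx + dy ≤ ## (λ z a → P z ∧ (U a ∧ adj H z a))
    lower = subst₂ _≤_ (∑+ (pick x dx) (pick y dy)) (≡-sym (##-guard P _)) (∑-mono point)
      where
      point : ∀ z → ⟦ x == z ⟧ * dx + ⟦ y == z ⟧ * dy ≤ ⟦ P z ⟧ * # (λ a → U a ∧ adj H z a)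
      point z with x Data.Fin.≟ z | y Data.Fin.≟ z
      ... | yes refl | yes refl = ⊥-elim (x≢y refl)
      ... | yes refl | no _ = ≤-trans (≤-reflexive (trans (+-identityʳ _) (*-identityˡ dx))) (≤-trans (#-mono λ a e → ∧-true (∨-inl e) (∧-snd {A a} e)) (≤-reflexive (≡-sym (*-identityˡ _))))
      ... | no _ | yes refl = ≤-trans (≤-reflexive (*-identityˡ dy)) (≤-trans (#-mono λ a e → ∧-true (∨-inr {A a ∧ adj H x a} e) (∧-snd {A a} e)) (≤-reflexive (≡-sym (*-identityˡ _))))
      ... | no _ | no _ = z≤n

  -- Shrinking gives two vertices with at most three joint neighbours. If one of them has three, the
  -- other has at most one by `joint-neighbours`, and averaging over the rest of `B` finds it a new
  -- partner with at most two.
  two-light : # A ≤ # B + 1 → 3 ≤ # B → 1 ≤ # A → ∃ λ x → ∃ λ y → B x ≡ true × B y ≡ true × x ≢ y ×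
    # (λ a → A a ∧ adj H x a) ≤ 2 × # (λ a → A a ∧ adj H y a) ≤ 2 × # (λ a → (A a ∧ adj H x a) ∨ (A a ∧ adj H y a)) ≤ 3
  two-light a≤ b≥3 a≥1 with shrink 1 a≤ (# B ∸ 2) 2 (m+[n∸m]≡n (≤-trans (n≤1+n 2) b≥3))
  ... | S , S⊆B , #S , N≤ with 0<#⇒∃ S (subst (1 ≤_) (≡-sym #S) (s≤s z≤n))
  ...   | x , sx with 0<#⇒∃ (λ z → S z ∧ not (x == z)) (s≤s⁻¹ (subst (2 ≤_) (#-remove S x sx) (≤-reflexive (≡-sym #S))))
  ...     | y , sy' = choose (# (λ a → A a ∧ adj H x a) ≤? 2) (# (λ a → A a ∧ adj H y a) ≤? 2)
    where
    sy = ∧-fst sy'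
    x≢y : x ≢ y
    x≢y e = true≢false (subst (λ z → (x == z) ≡ true) e (==-refl x)) (not⇒false (∧-snd {S y} sy'))
    U≤3 : # (λ a → (A a ∧ adj H x a) ∨ (A a ∧ adj H y a)) ≤ 3
    U≤3 = ≤-trans (#-mono λ a e → [ (λ ex → ∧-true (∧-fst ex) (hit-intro H {S} sx (∧-snd {A a} ex))) ,
      (λ ey → ∧-true (∧-fst ey) (hit-intro H {S} sy (∧-snd {A a} ey))) ]′ (∨-case {A a ∧ adj H x a} e)) N≤
    Goal : Set
    Goal = ∃ λ x → ∃ λ y → B x ≡ true × B y ≡ true × x ≢ y ×
      # (λ a → A a ∧ adj H x a) ≤ 2 × # (λ a → A a ∧ adj H y a) ≤ 2 × # (λ a → (A a ∧ adj H x a) ∨ (A a ∧ adj H y a)) ≤ 3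
    pair-with-leaf : ∀ w → B w ≡ true → # (λ a → A a ∧ adj H w a) ≤ 1 → Goal
    pair-with-leaf w bw one with average 2 (λ z → B z ∧ not (w == z)) (λ z → ∧-fst)
        (s≤s⁻¹ (≤-trans (≤-trans (n≤1+n 2) b≥3) (≤-reflexive (#-remove B w bw)))) a≥1
        (≤-trans a≤ (subst (λ b → b + 1 ≤ 2 * # (λ z → B z ∧ not (w == z))) (≡-sym (#-remove B w bw))
          (linear 0 (s≤s⁻¹ (subst (3 ≤_) (#-remove B w bw) b≥3)) (lem (# (λ z → B z ∧ not (w == z)))))))
      where
      lem : ∀ b → suc b + 1 + b + 0 ≡ 2 * b + 2
      lem = solve-∀
    ... | z , bz , dz = z , w , ∧-fst bz , bw , (λ e → true≢false (subst (λ s → (w == s) ≡ true) (≡-sym e) (==-refl w)) (not⇒false (∧-snd {B z} bz))) ,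
      dz , ≤-trans one (s≤s z≤n) , ≤-trans (#-cover₂ _ _ _ (λ a → ∨-case)) (dz ⊕ one)
    leaf : ∀ {a b u} → a + b ≤ u + 1 → u ≤ 3 → 3 ≤ a → b ≤ 1
    leaf {a} {b} {u} h₁ h₂ h₃ = linear 0 (h₁ ⊕ h₂ ⊕ h₃) (lem a b u)
      where
      lem : ∀ a b u → b + (u + 1 + (3 + a)) + 0 ≡ 1 + (a + b + (u + 3))
      lem = solve-∀
    choose : Dec (# (λ a → A a ∧ adj H x a) ≤ 2) → Dec (# (λ a → A a ∧ adj H y a) ≤ 2) → Goal
    choose (yes px) (yes py) = x , y , S⊆B x sx , S⊆B y sy , x≢y , px , py , U≤3
    choose (no px) _ = pair-with-leaf y (S⊆B y sy) (leaf (joint-neighbours x y (S⊆B x sx) (S⊆B y sy) x≢y) U≤3 (≰⇒> px))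
    choose (yes _) (no py) = pair-with-leaf x (S⊆B x sx)
      (leaf (≤-trans (≤-reflexive (+-comm _ (# (λ a → A a ∧ adj H x a)))) (joint-neighbours x y (S⊆B x sx) (S⊆B y sy) x≢y)) U≤3 (≰⇒> py))

  -- An edge count for forests, twice. With fewer than two leaves in `A`, the others number at least
  -- `# B` and send out two edges each, too many for a forest. A common neighbour of the two leaves
  -- is excluded in the same way.
  two-leaves : # A ≡ suc (# B) → 3 ≤ # B → (∀ y → B y ≡ true → 2 ≤ # (λ a → A a ∧ adj H y a)) →
    ∃ λ x → ∃ λ y → A x ≡ true × A y ≡ true × x ≢ y × # (λ b → B b ∧ adj H x b) ≤ 1 × # (λ b → B b ∧ adj H y b) ≤ 1 ×
      (∀ b → B b ∧ adj H x b ≡ true → B b ∧ adj H y b ≡ true → ⊥)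
  two-leaves a≡ b≥3 deg≥2 = from-two (0<#⇒∃ L (≤-trans (s≤s z≤n) L≥2))
    where
    light : Fin k → Bool
    light x = does (# (λ b → B b ∧ adj H x b) ≤? 1)
    L K : Fin k → Bool
    L x = A x ∧ light x
    K x = A x ∧ not (light x)
    L≥2 : 2 ≤ # L
    L≥2 with 2 ≤? # L
    ... | yes p = p
    ... | no ¬p = ⊥-elim (<⇒≱ (forest p q p≢q K B (λ x e → class⇒ (∧-fst e)) (λ x e → class⇒ e) K≥1 (≤-trans (s≤s z≤n) b≥3)) (begin
        # K + # B ≤⟨ +-monoʳ-≤ (# K) b≤K ⟩
        # K + # K ≡⟨ trans (cong (# K +_) (≡-sym (+-identityʳ _))) (*-comm 2 (# K)) ⟩
        # K * 2 ≡⟨ ≡-sym (∑-guard K 2) ⟩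
        ∑ (λ x → ⟦ K x ⟧ * 2) ≤⟨ ∑-guard-mono K (λ x e → ≰⇒> λ l → true≢false (dec-true (# (λ b → B b ∧ adj H x b) ≤? 1) l) (not⇒false (∧-snd {A x} e))) ⟩
        ∑ (λ x → ⟦ K x ⟧ * # (λ b → B b ∧ adj H x b)) ≡⟨ ≡-sym (##-guard K _) ⟩
        ## (λ x b → K x ∧ (B b ∧ adj H x b)) ∎))
      where
      open ≤-Reasoning
      b≤K : # B ≤ # K
      b≤K = +-cancelˡ-≤ 1 _ _ (≤-trans (≤-reflexive (≡-sym a≡)) (≤-trans (≤-reflexive (≡-sym (#-split A light))) (+-monoˡ-≤ (# K) (s≤s⁻¹ (≰⇒> ¬p)))))
      K≥1 : 1 ≤ # K
      K≥1 = ≤-trans (≤-trans (s≤s z≤n) b≥3) b≤K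
    L⇒ : ∀ x → L x ≡ true → # (λ b → B b ∧ adj H x b) ≤ 1
    L⇒ x e = does-true (# (λ b → B b ∧ adj H x b) ≤? 1) (∧-snd {A x} e)
    Goal : Set
    Goal = ∃ λ x → ∃ λ y → A x ≡ true × A y ≡ true × x ≢ y × # (λ b → B b ∧ adj H x b) ≤ 1 × # (λ b → B b ∧ adj H y b) ≤ 1 ×
      (∀ b → B b ∧ adj H x b ≡ true → B b ∧ adj H y b ≡ true → ⊥)
    from-two : (∃ λ x → L x ≡ true) → Goal
    from-two (x , lx) with 0<#⇒∃ (λ z → L z ∧ not (x == z)) (s≤s⁻¹ (subst (2 ≤_) (#-remove L x lx) L≥2))
    ... | y , ly' = x , y , ∧-fst lx , ∧-fst (∧-fst ly') , x≢y , L⇒ x lx , L⇒ y ly , clash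
      where
      ly = ∧-fst ly'
      x≢y : x ≢ y
      x≢y e = true≢false (subst (λ z → (x == z) ≡ true) e (==-refl x)) (not⇒false (∧-snd {L y} ly'))
      clash : ∀ b → B b ∧ adj H x b ≡ true → B b ∧ adj H y b ≡ true → ⊥
      -- Delete the two leaves and their common neighbour `b`. Every other vertex of `B` keeps its
      -- two neighbours, while both sides now have equal size, so there are as many edges as
      -- vertices.
      clash b ex ey = <⇒≱ (forest q p (p≢q ∘ ≡-sym) B' A' (λ z e → class⇒ (∧-fst e)) (λ z e → class⇒ (∧-fst (∧-fst e)))
          (s≤s⁻¹ (≤-trans (≤-trans (n≤1+n 2) b≥3) (≤-reflexive #B))) (≤-trans (s≤s z≤n) (s≤s⁻¹ (s≤s⁻¹ (≤-trans (s≤s b≥3) (≤-reflexive (trans (≡-sym a≡) #A)))))))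
          (begin
            # B' + # A' ≤⟨ +-monoʳ-≤ (# B') (s≤s⁻¹ (s≤s⁻¹ (≤-reflexive (trans (≡-sym #A) (trans a≡ (cong suc #B)))))) ⟩
            # B' + # B' ≡⟨ trans (cong (# B' +_) (≡-sym (+-identityʳ _))) (*-comm 2 (# B')) ⟩
            # B' * 2 ≡⟨ ≡-sym (∑-guard B' 2) ⟩
            ∑ (λ z → ⟦ B' z ⟧ * 2) ≤⟨ ∑-guard-mono B' (λ z e → ≤-trans (deg≥2 z (∧-fst e)) (#-mono (keep z e))) ⟩
            ∑ (λ z → ⟦ B' z ⟧ * # (λ a → A' a ∧ adj H z a)) ≡⟨ ≡-sym (##-guard B' _) ⟩
            ## (λ z a → B' z ∧ (A' a ∧ adj H z a)) ∎)
        where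
        open ≤-Reasoning
        A' B' : Fin k → Bool
        B' z = B z ∧ not (b == z)
        A' a = (A a ∧ not (x == a)) ∧ not (y == a)
        #B : # B ≡ suc (# B')
        #B = #-remove B b (∧-fst ex)
        #A : # A ≡ suc (suc (# A'))
        #A = trans (#-remove A x (∧-fst lx)) (cong suc (#-remove (λ a → A a ∧ not (x == a)) y (∧-true (∧-fst ly) (not-true (≢⇒== x≢y)))))
        only : ∀ w → # (λ c → B c ∧ adj H w c) ≤ 1 → B b ∧ adj H w b ≡ true → ∀ z → B' z ≡ true → adj H z w ≡ true → ⊥
        only w one ew z bz zw = <⇒≱ (two⇒2≤# (λ c → B c ∧ adj H w c) b z
          (λ e → true≢false (subst (λ s → (b == s) ≡ true) e (==-refl b)) (not⇒false (∧-snd {B z} bz))) ew (∧-true (∧-fst bz) (adj-sym H zw))) one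
        keep : ∀ z → B' z ≡ true → ∀ a → A a ∧ adj H z a ≡ true → A' a ∧ adj H z a ≡ true
        keep z bz a e = ∧-true {A' a} (∧-true (∧-true (∧-fst e)
          (not-true (≢⇒== {i = x} λ { refl → only x (L⇒ x lx) ex z bz (∧-snd {A x} e) })))
          (not-true (≢⇒== {i = y} λ { refl → only y (L⇒ y ly) ey z bz (∧-snd {A y} e) }))) (∧-snd {A a} e)

-- If the largest class has `h` vertices, two light vertices of the second class are added. If it
-- has one more, one light vertex `y` is added, and the second inner vertex of the path is a
-- non-neighbour `f` of `y` inside the class, which has no neighbours there.
path₅-universal : ∀ k τ h → k ≡ τ + (2 + h) → 3 * h ≤ k + 2 → 4 ≤ h → Universal k τ path₅
path₅-universal k τ h k≡ 3h≤ h≥4 H tree with Classes.two-largest (coloured tree)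
... | p , q , p≢q , b≤a , k≤ = go (excess (# A) h)
  where
  open Classes (coloured tree)
  open Pair p q p≢q
  2b≥ : ∀ {a} → # A ≡ a → h + h + h ≤ a + (# B + # B) + 2
  2b≥ refl = linear 0 (3h≤ ⊕ k≤) (lem h k (# A) (# B))
    where
    lem : ∀ h k a b → h + h + h + (k + 2 + (a + (b + b))) + 0 ≡ a + (b + b) + 2 + (3 * h + k)
    lem = solve-∀
  module Balanced (a≡h : # A ≡ h) where
    h≤b : h ≤ # B + 1
    h≤b = half-≤ (linear 1 (2b≥ a≡h) (lem h (# B)))
      where
      lem : ∀ h b → h + h + (h + (b + b) + 2) + 1 ≡ suc (b + 1 + (b + 1)) + (h + h + h)
      lem = solve-∀
    pair : ∃ λ x → ∃ λ y → B x ≡ true × B y ≡ true × x ≢ y ×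
      # (λ a → A a ∧ adj H x a) ≤ 2 × # (λ a → A a ∧ adj H y a) ≤ 2 × # (λ a → (A a ∧ adj H x a) ∨ (A a ∧ adj H y a)) ≤ 3
    pair = two-light (coloured tree) p q p≢q (subst (_≤ # B + 1) (≡-sym a≡h) h≤b) (+-cancelʳ-≤ 1 3 _ (≤-trans h≥4 h≤b))
      (subst (1 ≤_) (≡-sym a≡h) (≤-trans (s≤s z≤n) h≥4))
    fits : Fits H τ path₅
    fits = let x , y , bx , by , x≢y , dx , dy , u = pair in
      path₅-fits H A (class-independent p) {τ} x y (B⇒¬A x bx) (B⇒¬A y by) x≢y
        (class-independent q x y bx by) (trans (cong (λ a → τ + (2 + a)) a≡h) (≡-sym k≡)) dx dy u
        (subst (3 ≤_) (≡-sym a≡h) (≤-trans (n≤1+n 3) h≥4)) (joint-neighbours (coloured tree) p q p≢q x y bx by x≢y)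
  module Unbalanced (e : # A ≡ h + 1) where
    big : h + 1 ≤ # B + # B
    big = linear 0 (2b≥ e ⊕ h≥4) (lem h (# B))
      where
      lem : ∀ h b → h + 1 + (h + 1 + (b + b) + 2 + h) + 0 ≡ b + b + (h + h + h + 4)
      lem = solve-∀
    b≥1 : 1 ≤ # B
    b≥1 = n≢0⇒n>0 λ z → <⇒≱ (≤-trans (m≤n+m 1 h) big) (≤-reflexive (cong₂ _+_ z z))
    light : ∃ λ y → B y ≡ true × # (λ a → A a ∧ adj H y a) ≤ 2
    light = average 2 B (λ _ e → e) b≥1 (subst (1 ≤_) (≡-sym e) (m≤n+m 1 h))
      (subst (_≤ 2 * # B) (≡-sym e) (≤-trans big (≤-reflexive (cong (# B +_) (≡-sym (+-identityʳ _))))))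
    free : ∀ y → # (λ a → A a ∧ adj H y a) ≤ 2 → ∃ λ f → (A f ∧ not (adj H y f)) ≡ true
    free y dy = 0<#⇒∃ (λ a → A a ∧ not (adj H y a)) (+-cancelˡ-≤ 2 1 _
      (≤-trans (≤-trans (≤-trans (n≤1+n 3) h≥4) (≤-trans (m≤m+n h 1) (≤-reflexive (≡-sym e))))
          (≤-trans (≤-reflexive (≡-sym (#-split A (adj H y)))) (+-monoˡ-≤ _ dy))))
    fits : ∀ y f → B y ≡ true → # (λ a → A a ∧ adj H y a) ≤ 2 → A f ≡ true → adj H y f ≡ false → Fits H τ path₅
    fits y f by dy af yf = path₅-fits H A₀ ind {τ} y f (cong (_∧ not (f == y)) (B⇒¬A y by))
          (¬true⇒false λ t → true≢false (==-refl f) (not⇒false (∧-snd {A f} t))) (λ { refl → true≢false af (B⇒¬A y by) }) yf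
          (trans (cong (λ a → τ + (2 + a)) #A₀) (≡-sym k≡)) dy' (≤-trans (≤-reflexive none) z≤n)
          (≤-trans (#-cover₂ (λ a → nbr H A₀ ind y a ∨ nbr H A₀ ind f a) (nbr H A₀ ind y) (nbr H A₀ ind f) (λ a → ∨-case))
            (≤-trans (dy' ⊕ ≤-reflexive none) (s≤s (s≤s z≤n)))) (subst (3 ≤_) (≡-sym #A₀) (≤-trans (n≤1+n 3) h≥4))
          (≤-trans (+-monoʳ-≤ (# (nbr H A₀ ind y)) (≤-reflexive none)) (≤-trans (≤-reflexive (+-identityʳ _))
            (≤-trans (#-mono {p = nbr H A₀ ind y} λ a → ∨-inl) (m≤m+n _ 1))))
      where
      A₀ : Fin k → Bool
      A₀ a = A a ∧ not (f == a)
      #A₀ : # A₀ ≡ h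
      #A₀ = suc-injective (trans (≡-sym (#-remove A f af)) (trans e (+-comm h 1)))
      ind : Independent H A₀
      ind a b ea eb = class-independent p a b (∧-fst ea) (∧-fst eb)
      dy' : # (nbr H A₀ ind y) ≤ 2
      dy' = ≤-trans (#-mono λ a t → ∧-true {A a} {adj H y a} (∧-fst (∧-fst {A₀ a} t)) (∧-snd {A₀ a} t)) dy
      none : # (nbr H A₀ ind f) ≡ 0
      none = #-zero λ a → ¬true⇒false λ t → true≢false (∧-snd {A₀ a} t) (class-independent p f a af (∧-fst (∧-fst {A₀ a} t)))
  go : Excess (# A) h → Fits H τ path₅
  go (short l) = ⊥-elim (largest {h = h} 3h≤ b≤a k≤ l)
  go (exceeds zero e) = Balanced.fits (trans e (+-identityʳ h))
  go (exceeds (suc zero) e) = let y , by , dy = Unbalanced.light e ; f , ef = Unbalanced.free e y dy in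
    Unbalanced.fits e y f by dy (∧-fst ef) (not⇒false (∧-snd {A f} ef))
  go (exceeds (suc (suc j)) e) = large-fits {τ} {path₅} (2 + h) (≡-sym k≡) (≤-trans (≤-trans (m≤m+n (2 + h) j) (≤-reflexive (lem h j))) (≤-reflexive (≡-sym e)))
    where
    lem : ∀ h j → 2 + h + j ≡ h + suc (suc j)
    lem = solve-∀

-- In the critical case the largest class `A` has `h` vertices. A vertex of `B` with at most one
-- neighbour in it gives a single edge. Otherwise averaging forces `# B` to be `h − 1`, and the
-- roles change: `B` is kept and two leaves from `A` are added.
matching₂-universal : ∀ k τ h → k ≡ τ + suc h → 3 * h ≤ k + 2 → 4 ≤ h → Universal k τ matching₂
matching₂-universal k τ h k≡ 3h≤ h≥4 H tree with Classes.two-largest (coloured tree)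
... | p , q , p≢q , b≤a , k≤ = go (excess (# A) h)
  where
  open Classes (coloured tree)
  open Pair p q p≢q
  star⊆ : ∀ i l → bipartite 1 1 i l ≡ true → matching₂ i l ≡ true
  star⊆ 0 1 _ = refl
  star⊆ 1 0 _ = refl
  star⊆ 0 0 ()
  star⊆ 0 (suc (suc l)) ()
  star⊆ 1 (suc l) ()
  star⊆ (suc (suc i)) 0 ()
  star⊆ (suc (suc i)) (suc l) ()
  go : Excess (# A) h → Fits H τ matching₂
  go (short l) = ⊥-elim (largest {h = h} 3h≤ b≤a k≤ l)
  go (exceeds (suc j) e) = large-fits {τ} {matching₂} (suc h) (≡-sym k≡) (≤-trans (≤-trans (s≤s (m≤m+n h j)) (≤-reflexive (≡-sym (+-suc h j)))) (≤-reflexive (≡-sym e)))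
  go (exceeds zero e) = decide (any? (λ y → (B y Data.Bool.≟ true) ×-dec (# (λ a → A a ∧ adj H y a) ≤? 1)))
    where
    a≡h : # A ≡ h
    a≡h = trans e (+-identityʳ h)
    Leaf : Set
    Leaf = ∃ λ y → B y ≡ true × # (λ a → A a ∧ adj H y a) ≤ 1
    h≤b : h ≤ # B + 1
    h≤b = half-≤ (linear 1 (3h≤ ⊕ subst (λ a → k ≤ a + (# B + # B)) a≡h k≤) (lem h k (# B)))
      where
      lem : ∀ h k b → h + h + (k + 2 + (h + (b + b))) + 1 ≡ suc (b + 1 + (b + 1)) + (3 * h + k)
      lem = solve-∀
    few⇒ : ¬ Leaf → # B < h
    few⇒ ¬leaf = ≰⇒> λ le → ¬leaf (average 1 B (λ _ e → e) (≤-trans (≤-trans (s≤s z≤n) h≥4) le)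
      (subst (1 ≤_) (≡-sym a≡h) (≤-trans (s≤s z≤n) h≥4)) (subst₂ _≤_ (≡-sym a≡h) (≡-sym (+-identityʳ _)) le))
    finish : h ≡ suc (# B) → (∃ λ x → ∃ λ y → A x ≡ true × A y ≡ true × x ≢ y × # (λ b → B b ∧ adj H x b) ≤ 1 × # (λ b → B b ∧ adj H y b) ≤ 1 ×
      (∀ b → B b ∧ adj H x b ≡ true → B b ∧ adj H y b ≡ true → ⊥)) → Fits H τ matching₂
    finish h≡ (x , y , ax , ay , x≢y , dx , dy , dis) = matching₂-fits H B (class-independent q) {τ} x y
      (¬true⇒false λ b → true≢false ax (B⇒¬A x b)) (¬true⇒false λ b → true≢false ay (B⇒¬A y b)) x≢y (class-independent p x y ax ay)
      (trans (cong (λ z → τ + suc z) (≡-sym h≡)) (≡-sym k≡)) dx dy (≤-trans (s≤s (s≤s z≤n)) (s≤s⁻¹ (subst (4 ≤_) h≡ h≥4))) dis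
    decide : Dec Leaf → Fits H τ matching₂
    decide (yes (y , by , dy)) = fits-mono {H = H} {τ} {bipartite 1 1} {matching₂} star⊆ (vertex-fits {τ} 1 1 0 y by
        (trans (cong (λ a → τ + (a + 1)) a≡h) (trans (cong (τ +_) (+-comm h 1)) (≡-sym k≡))) refl dy
        (≤-trans (≤-trans (s≤s z≤n) h≥4) (≤-reflexive (≡-sym a≡h))))
    decide (no ¬leaf) = finish h≡ (two-leaves (coloured tree) p q p≢q (trans a≡h h≡) (s≤s⁻¹ (subst (4 ≤_) h≡ h≥4))
        (λ y by → ≰⇒> λ l → ¬leaf (y , by , l)))
      where
      h≡ : h ≡ suc (# B)
      h≡ = ≤-antisym (≤-trans h≤b (≤-reflexive (+-comm _ 1))) (few⇒ ¬leaf)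

-- Degree sequences

handshake : ∀ {n} (G : Graph n) → ∃ λ m → ∑ (deg G) ≡ m + m
handshake {zero} G = 0 , ∑-nil (deg G)
handshake {suc n} G with handshake (delete G zero)
... | m , e = # (λ y → adj G zero (suc y)) + m , (begin
    ∑ (deg G) ≡⟨ ∑-cong (deg≡# G) ⟩
    ## (adj G) ≡⟨ ##-punchIn zero (adj G) (irrefl G zero) ⟩
    row + (# (λ x → adj G (suc x) zero) + ## (λ x y → adj G (suc x) (suc y))) ≡⟨ cong (row +_) (cong₂ _+_ (#-cong λ x → sym G (suc x) zero)
      (trans (∑-cong λ x → ≡-sym (deg≡# (delete G zero) x)) e)) ⟩
    row + (row + (m + m)) ≡⟨ lem row m ⟩
    row + m + (row + m) ∎)
  where
  open ≡-Reasoning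
  row = # (λ y → adj G zero (suc y))
  lem : ∀ r m → r + (r + (m + m)) ≡ r + m + (r + m)
  lem = solve-∀

Sorted : ∀ {n} → (Fin n → ℕ) → Set
Sorted π = ∀ i j → toℕ i ≤ toℕ j → π j ≤ π i

-- A dichotomy at the p-th largest degree, which sits at index p - 1; hence `p ≤ suc (toℕ x)` in the
-- second alternative.
level : ∀ {n} (π : Fin n → ℕ) → Sorted π → ∀ p c → p ≤ n →
  (∀ x → (toℕ x <ᵇ p) ≡ true → c ≤ π x) ⊎ (∀ x → p ≤ suc (toℕ x) → π x < c)
level π s zero c _ = inj₁ λ x ()
level π s (suc p) c p<n with c ≤? π (fromℕ< p<n)
... | yes le = inj₁ λ x e → ≤-trans le (s x (fromℕ< p<n) (subst (toℕ x ≤_) (≡-sym (toℕ-fromℕ< p<n)) (s≤s⁻¹ (<ᵇ-true⁻ {n = suc p} e))))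
... | no nle = inj₂ λ x l → ≤-<-trans (s (fromℕ< p<n) x (subst (_≤ toℕ x) (≡-sym (toℕ-fromℕ< p<n)) (s≤s⁻¹ l))) (≰⇒> nle)

threshold : ∀ {n} (π : Fin n → ℕ) → Sorted π → ∀ c p → p ≤ n → (∀ x → p ≤ toℕ x → π x < c) →
  ∃ λ j → j ≤ p × (∀ x → (toℕ x <ᵇ j) ≡ true → c ≤ π x) × (∀ x → j ≤ toℕ x → π x < c)
threshold π s c zero _ h = 0 , z≤n , (λ x ()) , h
threshold π s c (suc p) p<n h with level π s (suc p) c p<n
... | inj₁ up = suc p , ≤-refl , up , h
... | inj₂ down with threshold π s c p (<⇒≤ p<n) (λ x l → down x (s≤s l))
...   | j , j≤p , a , b = j , ≤-trans j≤p (n≤1+n p) , a , b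

module _ {n} (π : Fin n → ℕ) (G : Graph n) (real : Realizes π G) (p : ℕ) (p≤n : p ≤ n) where
  open Top G p p≤n

  sum-π : ∑ (deg G) ≡ ∑ π
  sum-π = ∑-cong real

  rest-sum≤ : ∀ B → (∀ x → p ≤ toℕ x → π x ≤ B) → ∑ (λ x → ⟦ rest x ⟧ * deg G x) ≤ # rest * B
  rest-sum≤ B h = ≤-trans (∑-guard-mono rest λ x r → subst (_≤ B) (≡-sym (real x)) (h x (<ᵇ-false⁻ (not⇒false r)))) (≤-reflexive (∑-guard rest B))

  tail-bound : ∀ B → (∀ x → p ≤ toℕ x → π x ≤ B) → ∑ π + p + 2 * (p * B) ≤ p * p + 2 * (n * B)
  tail-bound B h = subst₂ (λ s m → s + p + 2 * (p * B) ≤ p * p + 2 * (m * B)) sum-π top+rest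
    (linear 0 (degree-sum-rest ⊕ *-monoʳ-≤ 2 (rest-sum≤ B h)) (lem (∑ (deg G)) p B (# rest) (∑ (λ x → ⟦ rest x ⟧ * deg G x))))
    where
    lem : ∀ s p B r q → s + p + 2 * (p * B) + (p * p + 2 * q + 2 * (r * B)) + 0 ≡ p * p + 2 * ((p + r) * B) + (s + p + 2 * q)
    lem = solve-∀

  mixed-bound : ∀ q B → (∀ x → p ≤ toℕ x → π x ≤ ⟦ toℕ x <ᵇ p + q ⟧ + B) → ∑ π + p ≤ p * p + # rest * p + (q + # rest * B)
  mixed-bound q B h = subst (λ s → s + p ≤ p * p + # rest * p + (q + # rest * B)) sum-π
    (≤-trans degree-sum-mixed (+-monoʳ-≤ (p * p + # rest * p) (≤-trans (∑-guard-mono rest λ x r → subst (_≤ ⟦ toℕ x <ᵇ p + q ⟧ + B) (≡-sym (real x)) (h x (<ᵇ-false⁻ (not⇒false r))))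
      (≤-trans (≤-reflexive (∑-guard-+ rest (λ x → ⟦ toℕ x <ᵇ p + q ⟧) (λ _ → B))) (+-mono-≤ specials (≤-reflexive (∑-guard rest B)))))))
    where
    specials : ∑ (λ x → ⟦ rest x ⟧ * ⟦ toℕ x <ᵇ p + q ⟧) ≤ q
    specials = ≤-trans (≤-reflexive (∑-cong λ x → point (rest x) (toℕ x <ᵇ p + q)))
      (#-interval (λ x → rest x ∧ (toℕ x <ᵇ p + q)) p q λ x e → <ᵇ-false⁻ (not⇒false (∧-fst e)) , <ᵇ-true⁻ (∧-snd {rest x} e))
      where
      point : ∀ a b → ⟦ a ⟧ * ⟦ b ⟧ ≡ ⟦ a ∧ b ⟧
      point true b = +-identityʳ _
      point false b = refl

-- Degrees required by the patterns

Contains : ∀ {n} → ℕ → (Fin n → ℕ) → Set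
Contains {n} k π = Σ (Graph n) λ G → Realizes π G × (∀ (H : Graph k) → IsTwoTree k H → H ⊆G G)

no-pattern : ℕ → ℕ → Bool
no-pattern _ _ = false

record LowPattern (k τ d : ℕ) : Set where
  field
    Γ : ℕ → ℕ → Bool
    Γ-sym : ∀ i l → Γ i l ≡ Γ l i
    universal : Universal k τ Γ
    Γ-deg : ∀ {n} (x : Fin n) → (toℕ x <ᵇ τ) ≡ false → # {n} (pattern-on k τ Γ x) ≤ τ + d

bipartite-sym : ∀ m g i l → bipartite m g i l ≡ bipartite m g l i
bipartite-sym m g i l = ∨-comm ((i <ᵇ m) ∧ (not (l <ᵇ m) ∧ (l <ᵇ m + g))) _

bipartite-cases : ∀ m g i l → bipartite m g i l ≡ true → (i < m × m ≤ l × l < m + g) ⊎ (l < m × m ≤ i × i < m + g)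
bipartite-cases m g i l e with ∨-case {(i <ᵇ m) ∧ (not (l <ᵇ m) ∧ (l <ᵇ m + g))} e
... | inj₁ s = inj₁ (<ᵇ-true⁻ (∧-fst s) , <ᵇ-false⁻ {l} {m} (not⇒false (∧-fst (∧-snd {i <ᵇ m} s))) , <ᵇ-true⁻ (∧-snd {not (l <ᵇ m)} (∧-snd {i <ᵇ m} s)))
... | inj₂ s = inj₂ (<ᵇ-true⁻ (∧-fst s) , <ᵇ-false⁻ {i} {m} (not⇒false (∧-fst (∧-snd {l <ᵇ m} s))) , <ᵇ-true⁻ (∧-snd {not (i <ᵇ m)} (∧-snd {l <ᵇ m} s)))

bipartite-low : ∀ k τ m g d → m ≤ d → g ≤ d → Universal k τ (bipartite m g) → LowPattern k τ d
bipartite-low k τ m g d m≤d g≤d U = record { Γ = bipartite m g ; Γ-sym = bipartite-sym m g ; universal = U ; Γ-deg = degs }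
  where
  degs : ∀ {n} (x : Fin n) → (toℕ x <ᵇ τ) ≡ false → # {n} (pattern-on k τ (bipartite m g) x) ≤ τ + d
  degs x r with (toℕ x ∸ τ) <? m
  ... | yes l = ≤-trans (pattern-deg k τ (bipartite m g) x m g r λ y e → [ proj₂ , (λ q → ⊥-elim (<⇒≱ l (proj₁ (proj₂ q)))) ]′ (bipartite-cases m g (toℕ x ∸ τ) y e)) (+-monoʳ-≤ τ g≤d)
  ... | no nl = ≤-trans (pattern-deg k τ (bipartite m g) x 0 m r λ y e → z≤n , [ (λ q → ⊥-elim (nl (proj₁ q))) , proj₁ ]′ (bipartite-cases m g (toℕ x ∸ τ) y e)) (+-monoʳ-≤ τ m≤d)

clique-low : ∀ k τ d → Universal k τ (complete-on (suc d)) → LowPattern k τ d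
clique-low k τ d U = record { Γ = complete-on (suc d) ; Γ-sym = λ i l → ∧-comm (i <ᵇ suc d) (l <ᵇ suc d) ; universal = U ; Γ-deg = degs }
  where
  degs : ∀ {n} (x : Fin n) → (toℕ x <ᵇ τ) ≡ false → # {n} (pattern-on k τ (complete-on (suc d)) x) ≤ τ + d
  degs {n} x r with bool (toℕ x <ᵇ τ + suc d)
  ... | inj₁ xw = s≤s⁻¹ (≤-trans (s≤s (#-mono sub)) (≤-trans (≤-reflexive (≡-sym (#-remove {n} (λ y → toℕ y <ᵇ τ + suc d) x xw))) (≤-trans (#-below-≤ {n} (τ + suc d)) (≤-reflexive (+-suc τ d)))))
    where
    near : ∀ {y} → (toℕ y <ᵇ τ) ≡ true ⊎ ((toℕ y <ᵇ τ) ≡ false × complete-on (suc d) (toℕ x ∸ τ) (toℕ y ∸ τ) ≡ true) → toℕ y < τ + suc d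
    near {y} (inj₁ t) = <-≤-trans (<ᵇ-true⁻ {n = τ} t) (m≤m+n τ (suc d))
    near {y} (inj₂ (r , g)) = subst (_< τ + suc d) (m+[n∸m]≡n (<ᵇ-false⁻ {toℕ y} {τ} r)) (+-monoʳ-< τ (<ᵇ-true⁻ (∧-snd {toℕ x ∸ τ <ᵇ suc d} g)))
    sub : ∀ y → pattern-on k τ (complete-on (suc d)) x y ≡ true → ((toℕ y <ᵇ τ + suc d) ∧ not (x == y)) ≡ true
    sub y e = ∧-true (<ᵇ-true (near {y} (pattern-cases k τ (complete-on (suc d)) {x} {y} e r))) (not-true (≢⇒== {i = x} {y}
      λ { refl → true≢false e (Shape.F-irrefl (pattern-shape k τ (complete-on (suc d)) (λ i l → ∧-comm (i <ᵇ suc d) (l <ᵇ suc d))) x) }))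
  ... | inj₂ xw = ≤-trans (pattern-deg k τ (complete-on (suc d)) x 0 0 r λ l e → ⊥-elim (<⇒≱ (<ᵇ-true⁻ (∧-fst e))
      (subst (_≤ toℕ x ∸ τ) (m+n∸m≡n τ (suc d)) (∸-monoˡ-≤ τ (<ᵇ-false⁻ {toℕ x} {τ + suc d} xw))))) (+-monoʳ-≤ τ z≤n)

-- The numbering 2, 0, 3, 1, 4 along the path is chosen so that every neighbourhood is an interval
-- of positions, as `pattern-deg` wants it.
path₅-low : ∀ k τ → Universal k τ path₅ → LowPattern k τ 2
path₅-low k τ U = record { Γ = path₅ ; Γ-sym = λ i l → ∨-comm (step-edges i l) (step-edges l i) ; universal = U
  ; Γ-deg = λ x r → pattern-deg k τ path₅ x (start (toℕ x ∸ τ)) 2 r (interval (toℕ x ∸ τ)) }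
  where
  start : ℕ → ℕ
  start 0 = 2
  start 1 = 3
  start _ = 0
  interval : ∀ i l → path₅ i l ≡ true → start i ≤ l × l < start i + 2
  interval 0 2 _ = ≤-refl , s≤s (s≤s (s≤s z≤n))
  interval 0 3 _ = s≤s (s≤s z≤n) , ≤-refl
  interval 1 3 _ = ≤-refl , s≤s (s≤s (s≤s (s≤s z≤n)))
  interval 1 4 _ = s≤s (s≤s (s≤s z≤n)) , ≤-refl
  interval 2 0 _ = z≤n , s≤s z≤n
  interval 3 0 _ = z≤n , s≤s z≤n
  interval 3 1 _ = z≤n , ≤-refl
  interval 4 1 _ = z≤n , ≤-refl
  interval 0 0 ()
  interval 0 1 ()
  interval 0 (suc (suc (suc (suc l)))) ()
  interval 1 0 ()
  interval 1 1 ()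
  interval 1 2 ()
  interval 1 (suc (suc (suc (suc (suc l))))) ()
  interval 2 1 ()
  interval 2 (suc (suc l)) ()
  interval 3 (suc (suc l)) ()
  interval 4 0 ()
  interval 4 (suc (suc l)) ()
  interval (suc (suc (suc (suc (suc i))))) 0 ()
  interval (suc (suc (suc (suc (suc i))))) 1 ()
  interval (suc (suc (suc (suc (suc i))))) (suc (suc l)) ()

mate-unique : ∀ i l m → matching₂ i l ≡ true → matching₂ l m ≡ true → m ≡ i
mate-unique 0 1 0 _ _ = refl
mate-unique 1 0 1 _ _ = refl
mate-unique 2 3 2 _ _ = refl
mate-unique 3 2 3 _ _ = refl
mate-unique 0 0 m ()
mate-unique 0 2 m ()
mate-unique 0 (suc (suc (suc l))) m ()
mate-unique 1 1 m ()
mate-unique 1 2 m ()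
mate-unique 1 (suc (suc (suc l))) m ()
mate-unique 2 0 m ()
mate-unique 2 1 m ()
mate-unique 2 2 m ()
mate-unique 2 (suc (suc (suc (suc l)))) m ()
mate-unique 3 0 m ()
mate-unique 3 1 m ()
mate-unique 3 (suc (suc (suc l))) m ()
mate-unique (suc (suc (suc (suc i)))) 0 m ()
mate-unique (suc (suc (suc (suc i)))) 1 m ()
mate-unique (suc (suc (suc (suc i)))) 2 m ()
mate-unique (suc (suc (suc (suc i)))) (suc (suc (suc l))) m ()
mate-unique 0 1 1 _ ()
mate-unique 0 1 2 _ ()
mate-unique 0 1 (suc (suc (suc m))) _ ()
mate-unique 1 0 0 _ ()
mate-unique 1 0 2 _ ()
mate-unique 1 0 (suc (suc (suc m))) _ ()
mate-unique 2 3 0 _ ()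
mate-unique 2 3 1 _ ()
mate-unique 2 3 (suc (suc (suc m))) _ ()
mate-unique 3 2 0 _ ()
mate-unique 3 2 1 _ ()
mate-unique 3 2 2 _ ()
mate-unique 3 2 (suc (suc (suc (suc m)))) _ ()

matching₂-<4 : ∀ i l → matching₂ i l ≡ true → i < 4
matching₂-<4 0 l _ = s≤s z≤n
matching₂-<4 1 l _ = s≤s (s≤s z≤n)
matching₂-<4 2 l _ = s≤s (s≤s (s≤s z≤n))
matching₂-<4 3 l _ = ≤-refl
matching₂-<4 (suc (suc (suc (suc i)))) 0 ()
matching₂-<4 (suc (suc (suc (suc i)))) 1 ()
matching₂-<4 (suc (suc (suc (suc i)))) 2 ()
matching₂-<4 (suc (suc (suc (suc i)))) (suc (suc (suc l))) ()

matching₂-interval : ∀ i → ∃ λ a → ∀ l → matching₂ i l ≡ true → a ≤ l × l < a + 1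
matching₂-interval i = mate i , λ l e → ok i l e
  where
  mate : ℕ → ℕ
  mate 0 = 1
  mate 1 = 0
  mate 2 = 3
  mate 3 = 2
  mate _ = 0
  ok : ∀ i l → matching₂ i l ≡ true → mate i ≤ l × l < mate i + 1
  ok 0 1 _ = ≤-refl , ≤-refl
  ok 1 0 _ = ≤-refl , ≤-refl
  ok 2 3 _ = ≤-refl , ≤-refl
  ok 3 2 _ = ≤-refl , ≤-refl
  ok 0 0 ()
  ok 0 2 ()
  ok 0 (suc (suc (suc l))) ()
  ok 1 1 ()
  ok 1 2 ()
  ok 1 (suc (suc (suc l))) ()
  ok 2 0 ()
  ok 2 1 ()
  ok 2 2 ()
  ok 2 (suc (suc (suc (suc l)))) ()
  ok 3 0 ()
  ok 3 1 ()
  ok 3 (suc (suc (suc l))) ()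
  ok (suc (suc (suc (suc i)))) 0 ()
  ok (suc (suc (suc (suc i)))) 1 ()
  ok (suc (suc (suc (suc i)))) 2 ()
  ok (suc (suc (suc (suc i)))) (suc (suc (suc l))) ()

odd≢even : ∀ {x y} → x + x ≡ suc (y + y) → ⊥
odd≢even {suc x} {suc y} e = odd≢even {x} {y} (suc-injective (trans (≡-sym (+-suc x x)) (trans (suc-injective e) (cong suc (+-suc y y)))))
odd≢even {suc x} {zero} e = case trans (≡-sym (+-suc x x)) (suc-injective e) of λ ()

pronic-even : ∀ t → ∃ λ w → suc t * t ≡ w + w
pronic-even zero = 0 , refl
pronic-even (suc t) with pronic-even t
... | w , e = w + suc t , trans (lem t) (trans (cong (_+ (suc t + suc t)) e) (lem' w t))
  where
  lem : ∀ t → suc (suc t) * suc t ≡ suc t * t + (suc t + suc t)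
  lem = solve-∀
  lem' : ∀ w t → w + w + (suc t + suc t) ≡ w + suc t + (w + suc t)
  lem' = solve-∀

-- Existence, by the number of degrees that reach k - 1

module Positive {n} (k₂ t'' h E : ℕ) (k≡ : suc (suc k₂) ≡ suc t'' + suc h) (k≤n : suc (suc k₂) ≤ n)
  (large₁ : suc k₂ * k₂ + suc (suc t'') * suc t'' ≤ n)
  (large₂ : ∀ s → 1 ≤ s → suc s ≤ h →
    (h + suc s) * (h + suc s) + (suc k₂ * suc k₂ + 2 * (suc k₂ * k₂)) + (2 * (suc t'' * s) + s) ≤ 2 * (s * n))
  (large₃ : Large n (suc (suc k₂)) (suc t'') h (k₂ + k₂) E)
  (π : Fin n → ℕ) (sorted : Sorted π) (G₀ : Graph n) (real₀ : Realizes π G₀)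
  (big : 2 * (suc t'' * n) + 1 ≤ ∑ π + suc (suc t'') * suc t'') where

  k t' : ℕ
  k = suc (suc k₂)
  t' = suc t''

  t'≤k : t' ≤ k
  t'≤k = subst (t' ≤_) (≡-sym k≡) (m≤m+n t' (suc h))

  π<n : ∀ x → π x ≤ n
  π<n x = subst (_≤ n) (trans (≡-sym (deg≡# G₀ x)) (real₀ x)) (#≤n (adj G₀ x))

  -- With a top of only `j` vertices, the degree sum leaves about `2 * s * n` ordered pairs of
  -- adjacent vertices outside it, whereas `stuck-low` allows a number depending on k alone.
  low-case : ∀ j s → j + s ≡ t' → 1 ≤ s → LowPattern k j (2 * s) → suc s ≤ h →
    (∀ x → (toℕ x <ᵇ j) ≡ true → suc k₂ ≤ π x) → (∀ x → j ≤ toℕ x → π x < suc k₂) →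
    (∀ x → (toℕ x <ᵇ k) ≡ true → j + 2 * s ≤ π x) → Contains k π
  low-case j s j+s s≥1 P s<h hi lo enough = finish
      (saturate F F-sym (outside k) F-out {A = ⊥} (Realizes π) (λ {G} {G'} → Realizes-keeps F {G} {G'}) attempt G₀ real₀)
    where
    open LowPattern P
    F : Fin n → Fin n → Bool
    F = pattern-on k j Γ
    S : Shape k j F
    S = pattern-shape k j Γ Γ-sym
    open Shape S
    j≤k : j ≤ k
    j≤k = ≤-trans (m≤m+n j s) (≤-trans (≤-reflexive j+s) t'≤k)
    j≤n = ≤-trans j≤k k≤n
    finish : ⊥ ⊎ (Σ (Graph n) λ G' → Realizes π G' × (∀ x y → F x y ≡ true → adj G' x y ≡ true)) → Contains k π
    finish (inj₂ (G , real , sub)) = G , real , λ H tree → fits⇒⊆G {H = H} {G} {j} {Γ} k≤n (universal H tree) sub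
    attempt : ∀ G → Realizes π G → ∀ u v → F u v ≡ true → adj G u v ≡ false → ⊥ ⊎ Improves F G u v
    attempt G real u v fuv uv with improve-or-stuck F F-sym (outside k) F-out G u v fuv uv (F⇒≢ S fuv)
    ... | inj₁ i = inj₂ i
    ... | inj₂ stuck = inj₁ (contra (stuck-low S k₂ j≤k j≤n G low stuck fuv uv (fits u (F⇒in S {u} {v} fuv)) (fits v (F⇒in S {v} {u} (trans (F-sym v u) fuv)))
            (h + suc s) (#-interval _ j (h + suc s) λ x e → <ᵇ-false⁻ (not⇒false (∧-fst e)) ,
              subst (toℕ x <_) (trans k≡ (trans (cong (_+ suc h) (≡-sym j+s)) (lem₀ j s h))) (<ᵇ-true⁻ (∧-snd {not (toℕ x <ᵇ j)} e))))
            degree-sum top+rest (large₂ s s≥1 s<h))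
      where
      open Top G j j≤n
      lem₀ : ∀ j s h → j + s + suc h ≡ j + (h + suc s)
      lem₀ = solve-∀
      low : ∀ x → (toℕ x <ᵇ j) ≡ false → deg G x ≤ k₂
      low x e = subst (_≤ k₂) (≡-sym (real x)) (s≤s⁻¹ (lo x (<ᵇ-false⁻ e)))
      fits : ∀ x → (toℕ x <ᵇ k) ≡ true → # (F x) ≤ deg G x
      fits x xk with bool (toℕ x <ᵇ j)
      ... | inj₁ xj = subst (# (F x) ≤_) (≡-sym (real x)) (≤-trans (s≤s⁻¹ (F-deg S k≤n x xk)) (hi x xj))
      ... | inj₂ xj = subst (# (F x) ≤_) (≡-sym (real x)) (≤-trans (Γ-deg x xj) (enough x xk))
      contra : edges ≤ (h + suc s) * (h + suc s) + (suc k₂ * suc k₂ + 2 * (suc k₂ * k₂)) →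
        ∑ (deg G) + j + 2 * misses ≤ j * j + 2 * (# rest * j) + edges → j + # rest ≡ n →
        (h + suc s) * (h + suc s) + (suc k₂ * suc k₂ + 2 * (suc k₂ * k₂)) + (2 * (t' * s) + s) ≤ 2 * (s * n) → ⊥
      contra h₁ h₂ h₃ h₄ = arith {m = misses} j+s h₁ (subst (λ z → z + j + 2 * misses ≤ j * j + 2 * (# rest * j) + edges) (∑-cong real) h₂) h₃ h₄ big
        where
        arith : ∀ {t n c e m r Σπ} → j + s ≡ t → e ≤ c → Σπ + j + 2 * m ≤ j * j + 2 * (r * j) + e → j + r ≡ n →
          c + (2 * (t * s) + s) ≤ 2 * (s * n) → 2 * (t * n) + 1 ≤ Σπ + suc t * t → ⊥
        arith {c = c} {e} {m} {r} {Σπ} refl h₁ h₂ refl h₄ h₅ = <-irrefl refl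
          (linear {1} {0} (2 * m + s * s) (h₁ ⊕ h₂ ⊕ h₄ ⊕ h₅) (lem c e m r Σπ j s))
          where
          lem : ∀ c e m r Σπ j s → 1 + (c + (j * j + 2 * (r * j) + e + (2 * (s * (j + r)) + (Σπ + suc (j + s) * (j + s))))) + (2 * m + s * s)
            ≡ 0 + (e + (Σπ + j + 2 * m + (c + (2 * ((j + s) * s) + s) + (2 * ((j + s) * (j + r)) + 1))))
          lem = solve-∀

  -- Otherwise `j` degrees are at most `n` and all but k - 1 of the degrees are at most
  -- `j + 2 * s − 1`, so `n` has the coefficient 2τ - 1 in the upper bound of the sum, one less than
  -- required. This is where the degree `2 * s` allowed to Γ comes from.
  enough-low : ∀ j s → j + s ≡ t' → 1 ≤ s → (∀ x → j ≤ toℕ x → π x < suc k₂) →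
    (∀ x → k ≤ suc (toℕ x) → π x < j + 2 * s) → ⊥
  enough-low j (suc s) j+s _ lo few = arith j+s count large₁ big
    where
    d = j + suc (s + s)
    point : ∀ x → π x ≤ ⟦ toℕ x <ᵇ j ⟧ * n + (⟦ toℕ x <ᵇ suc k₂ ⟧ * k₂ + d)
    point x with bool (toℕ x <ᵇ j) | bool (toℕ x <ᵇ suc k₂)
    ... | inj₁ e | _ rewrite e = ≤-trans (π<n x) (≤-trans (≤-reflexive (≡-sym (+-identityʳ n))) (m≤m+n _ _))
    ... | inj₂ e | inj₁ e' rewrite e | e' = ≤-trans (s≤s⁻¹ (lo x (<ᵇ-false⁻ e))) (≤-trans (≤-reflexive (≡-sym (+-identityʳ k₂))) (m≤m+n _ _))
    ... | inj₂ e | inj₂ e' rewrite e | e' = s≤s⁻¹ (≤-trans (few x (s≤s (<ᵇ-false⁻ e'))) (≤-reflexive (lem j s)))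
      where
      lem : ∀ j s → j + 2 * suc s ≡ suc (j + suc (s + s))
      lem = solve-∀
    count : ∑ π ≤ j * n + (suc k₂ * k₂ + n * d)
    count = ≤-trans (subst (∑ π ≤_) (∑+ (∑-guard (λ x → toℕ x <ᵇ j) n) (∑+ (∑-guard (λ x → toℕ x <ᵇ suc k₂) k₂) (∑-const n d))) (∑-mono point))
      (*-monoˡ-≤ n (#-below-≤ {n} j) ⊕ *-monoˡ-≤ k₂ (#-below-≤ {n} (suc k₂)) ⊕ ≤-refl)
    arith : ∀ {t Σπ q} → j + suc s ≡ t → Σπ ≤ j * n + (q + n * d) → q + suc t * t ≤ n → 2 * (t * n) + 1 ≤ Σπ + suc t * t → ⊥
    arith {Σπ = Σπ} {q} refl h₁ h₂ h₃ = <-irrefl refl (linear {1} {0} 0 (h₁ ⊕ h₂ ⊕ h₃) (lem Σπ q n j s))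
      where
      lem : ∀ Σπ q n j s → 1 + (j * n + (q + n * (j + suc (s + s))) + (n + (Σπ + suc (j + suc s) * (j + suc s)))) + 0
        ≡ 0 + (Σπ + (q + suc (j + suc s) * (j + suc s) + (2 * ((j + suc s) * n) + 1)))
      lem = solve-∀

  -- An edge uv outside the top, ordered so that the counting argument applies at u.
  Oriented : (ℕ → ℕ → Bool) → Fin n → Fin n → Set
  Oriented Γ u v = (∀ z → (toℕ z <ᵇ t') ≡ false → π z ≤ π u) ×
    (∀ y → (toℕ y <ᵇ t') ≡ false → pattern-on k t' Γ v y ≡ true → y ≡ u) ×
    (∀ r → (toℕ r <ᵇ t') ≡ false → pattern-on k t' Γ u r ≡ false → u ≢ r → π r ≤ π v)

  record HighPattern : Set where
    field
      Γ : ℕ → ℕ → Bool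
      Γ-sym : ∀ i l → Γ i l ≡ Γ l i
      universal : Universal k t' Γ
      Γ-fits : ∀ x → (toℕ x <ᵇ t') ≡ false → (toℕ x <ᵇ k) ≡ true → # {n} (pattern-on k t' Γ x) ≤ π x
      Γ-orient : ∀ u v → (toℕ u <ᵇ t') ≡ false → (toℕ v <ᵇ t') ≡ false → pattern-on k t' Γ u v ≡ true → Oriented Γ u v ⊎ Oriented Γ v u

  -- Two saturations. The first joins the top to all of the first `k` vertices; the second adds Γ
  -- with these joins as part of its invariant, so that a vertex among the first `k` can no longer
  -- miss a top vertex.
  high-case : HighPattern → (∀ x → (toℕ x <ᵇ t') ≡ true → suc k₂ ≤ π x) → (∀ x → (toℕ x <ᵇ k) ≡ true → t' ≤ π x) →
    (∀ x → k ≤ toℕ x → π x ≤ k₂ + k₂) → Contains k π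
  high-case P hi enough lo = finish (saturate F₁ S₁.F-sym (outside k) S₁.F-out {A = ⊥} (Realizes π) (λ {G} {G'} → Realizes-keeps F₁ {G} {G'}) first G₀ real₀)
    where
    open HighPattern P
    F₁ F₂ : Fin n → Fin n → Bool
    F₁ = pattern-on k t' no-pattern
    F₂ = pattern-on k t' Γ
    shape₁ : Shape k t' F₁
    shape₁ = pattern-shape k t' no-pattern (λ _ _ → refl)
    shape₂ : Shape k t' F₂
    shape₂ = pattern-shape k t' Γ Γ-sym
    module S₁ = Shape shape₁
    module S₂ = Shape shape₂
    sorted-deg : ∀ G → Realizes π G → ∀ x y → toℕ x ≤ toℕ y → deg G y ≤ deg G x
    sorted-deg G real x y l = subst₂ _≤_ (≡-sym (real y)) (≡-sym (real x)) (sorted x y l)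
    out-deg : ∀ G → Realizes π G → ∀ x → outside k x ≡ true → deg G x ≤ k₂ + k₂
    out-deg G real x o = subst (_≤ k₂ + k₂) (≡-sym (real x)) (lo x (<ᵇ-false⁻ (not⇒false o)))
    top⇒within : ∀ {x : Fin n} → (toℕ x <ᵇ t') ≡ true → (toℕ x <ᵇ k) ≡ true
    top⇒within {x} t = <ᵇ-true (<-≤-trans (<ᵇ-true⁻ {toℕ x} {t'} t) t'≤k)
    top-first : ∀ {x y : Fin n} → (toℕ x <ᵇ t') ≡ true → (toℕ y <ᵇ t') ≡ false → toℕ x ≤ toℕ y
    top-first t r = ≤-trans (<⇒≤ (<ᵇ-true⁻ {n = t'} t)) (<ᵇ-false⁻ r)
    rest-order : ∀ {x y : Fin n} → (toℕ x <ᵇ k) ≡ true → outside k y ≡ true → toℕ x ≤ toℕ y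
    rest-order xk yo = ≤-trans (<⇒≤ (<ᵇ-true⁻ {n = k} xk)) (<ᵇ-false⁻ (not⇒false yo))
    t'≤n : t' ≤ n
    t'≤n = ≤-trans (subst (t' ≤_) (≡-sym (Large.k≡ large₃)) (m≤m+n t' (suc h))) k≤n
    many : ∀ G → Realizes π G → 1 + 2 * Top.misses G t' t'≤n ≤ Top.edges G t' t'≤n
    many G real = arith {∑ π} {misses} {edges} {# rest} {t'} (subst (λ s → s + t' + 2 * misses ≤ t' * t' + 2 * (# rest * t') + edges) (∑-cong real) degree-sum) top+rest big
      where
      open Top G t' t'≤n
      arith : ∀ {Σπ M E r t n} → Σπ + t + 2 * M ≤ t * t + 2 * (r * t) + E → t + r ≡ n → 2 * (t * n) + 1 ≤ Σπ + suc t * t → 1 + 2 * M ≤ E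
      arith {Σπ} {M} {E} {r} {t} h₁ refl h₂ = linear 0 (h₁ ⊕ h₂) (lem Σπ M E r t)
        where
        lem : ∀ S M E r t → 1 + 2 * M + (t * t + 2 * (r * t) + E + (S + suc t * t)) + 0 ≡ E + (S + t + 2 * M + (2 * (t * (t + r)) + 1))
        lem = solve-∀
    fits₁ : ∀ G → Realizes π G → ∀ x → (toℕ x <ᵇ k) ≡ true → # (F₁ x) ≤ deg G x
    fits₁ G real x xk with bool (toℕ x <ᵇ t')
    ... | inj₁ t = subst (# (F₁ x) ≤_) (≡-sym (real x)) (≤-trans (s≤s⁻¹ (F-deg shape₁ k≤n x xk)) (hi x t))
    ... | inj₂ r = subst (# (F₁ x) ≤_) (≡-sym (real x)) (≤-trans (pattern-deg k t' no-pattern x 0 0 r (λ _ ())) (≤-trans (≤-reflexive (+-identityʳ t')) (enough x xk)))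
    fits₂ : ∀ G → Realizes π G → ∀ x → (toℕ x <ᵇ k) ≡ true → # (F₂ x) ≤ deg G x
    fits₂ G real x xk with bool (toℕ x <ᵇ t')
    ... | inj₁ t = subst (# (F₂ x) ≤_) (≡-sym (real x)) (≤-trans (s≤s⁻¹ (F-deg shape₂ k≤n x xk)) (hi x t))
    ... | inj₂ r = subst (# (F₂ x) ≤_) (≡-sym (real x)) (Γ-fits x r xk)
    no-F₁ : ∀ x y → (toℕ x <ᵇ t') ≡ false → (toℕ y <ᵇ t') ≡ false → F₁ x y ≡ false
    no-F₁ x y rx ry = ¬true⇒false λ f → [ (λ t → true≢false t ry) , (λ { (_ , ()) }) ]′ (pattern-cases k t' no-pattern {x} {y} f rx)
    first : ∀ G → Realizes π G → ∀ u v → F₁ u v ≡ true → adj G u v ≡ false → ⊥ ⊎ Improves F₁ G u v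
    first G real u v fuv uv = split (bool (toℕ u <ᵇ t')) (bool (toℕ v <ᵇ t'))
      where
      back : Improves F₁ G v u → Improves F₁ G u v
      back (G' , kp , e) = G' , kp , adj-sym G' e
      mixed : ∀ u v → F₁ u v ≡ true → adj G u v ≡ false → (toℕ u <ᵇ t') ≡ true → (toℕ v <ᵇ t') ≡ false → Improves F₁ G u v
      mixed u v fuv uv tu rv with improve-or-stuck F₁ S₁.F-sym (outside k) S₁.F-out G u v fuv uv (F⇒≢ shape₁ fuv)
      ... | inj₁ i = i
      ... | inj₂ st = ⊥-elim (Completion.rest-contra large₃ k≤n shape₁ G (sorted-deg G real) (out-deg G real) (fits₁ G real) (many G real) st fuv uv R-out (λ z rz → sorted-deg G real u z (top-first tu rz)) rv (λ y ry _ → no-F₁ v y rv ry)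
              (λ r ur → sorted-deg G real v r (rest-order (F⇒in shape₁ {v} {u} (trans (S₁.F-sym v u) fuv)) (R-out r ur))) (inj₁ tu))
        where
        R-out : ∀ r → Removable F₁ G u r → outside k r ≡ true
        R-out r = top-removable⇒out shape₁ {G} tu (top⇒within {u} tu)
      split : (toℕ u <ᵇ t') ≡ true ⊎ (toℕ u <ᵇ t') ≡ false → (toℕ v <ᵇ t') ≡ true ⊎ (toℕ v <ᵇ t') ≡ false → ⊥ ⊎ Improves F₁ G u v
      split (inj₁ tu) (inj₁ tv) with improve-or-stuck F₁ S₁.F-sym (outside k) S₁.F-out G u v fuv uv (F⇒≢ shape₁ fuv)
      ... | inj₁ i = inj₂ i
      ... | inj₂ st = inj₁ (Completion.top-contra large₃ k≤n shape₁ G (sorted-deg G real) (out-deg G real) (fits₁ G real) (many G real) st fuv uv tu tv)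
      split (inj₁ tu) (inj₂ rv) = inj₂ (mixed u v fuv uv tu rv)
      split (inj₂ ru) (inj₁ tv) = inj₂ (back (mixed v u (trans (S₁.F-sym v u) fuv) (adj-sym G uv) tv ru))
      split (inj₂ ru) (inj₂ rv) = ⊥-elim (true≢false fuv (no-F₁ u v ru rv))
    Inv : Graph n → Set
    Inv G = Realizes π G × (∀ x y → F₁ x y ≡ true → adj G x y ≡ true)
    F₁⊆F₂ : ∀ x y → F₁ x y ≡ true → F₂ x y ≡ true
    F₁⊆F₂ x y f = ∧-true {(toℕ x <ᵇ k) ∧ (toℕ y <ᵇ k)} (∧-fst f) (∧-true {not (toℕ x ≡ᵇ toℕ y)} (∧-fst {not (toℕ x ≡ᵇ toℕ y)} e) (lift (∧-snd {not (toℕ x ≡ᵇ toℕ y)} e)))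
      where
      e = ∧-snd {(toℕ x <ᵇ k) ∧ (toℕ y <ᵇ k)} f
      lift : ((toℕ x <ᵇ t') ∨ ((toℕ y <ᵇ t') ∨ false)) ≡ true → ((toℕ x <ᵇ t') ∨ ((toℕ y <ᵇ t') ∨ Γ (toℕ x ∸ t') (toℕ y ∸ t'))) ≡ true
      lift h with toℕ x <ᵇ t' | toℕ y <ᵇ t'
      ... | true | _ = refl
      ... | false | true = refl
    second : ∀ G → Inv G → ∀ u v → F₂ u v ≡ true → adj G u v ≡ false → ⊥ ⊎ Improves F₂ G u v
    second G (real , sub) u v fuv uv = inj₂ ([ (λ o → oriented u v fuv uv ru rv o) , (λ o → back (oriented v u fvu (adj-sym G uv) rv ru o)) ]′ (Γ-orient u v ru rv fuv))
      where
      fvu = trans (S₂.F-sym v u) fuv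
      top-free : ∀ x y → F₂ x y ≡ true → adj G x y ≡ false → (toℕ x <ᵇ t') ≡ false
      top-free x y f a = ¬true⇒false λ t → true≢false (sub x y (S₁.F-top x y t (F⇒in shape₂ {x} {y} f)
        (F⇒in shape₂ {y} {x} (trans (S₂.F-sym y x) f)) (F⇒≢ shape₂ f))) a
      ru : (toℕ u <ᵇ t') ≡ false
      ru = top-free u v fuv uv
      rv : (toℕ v <ᵇ t') ≡ false
      rv = top-free v u fvu (adj-sym G uv)
      back : Improves F₂ G v u → Improves F₂ G u v
      back (G' , kp , e) = G' , kp , adj-sym G' e
      oriented : ∀ u v → F₂ u v ≡ true → adj G u v ≡ false → (toℕ u <ᵇ t') ≡ false → (toℕ v <ᵇ t') ≡ false → Oriented Γ u v → Improves F₂ G u v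
      oriented u v fuv uv ru rv (u-max , v-only , r≤v) with improve-or-stuck F₂ S₂.F-sym (outside k) S₂.F-out G u v fuv uv (F⇒≢ shape₂ fuv)
      ... | inj₁ i = i
      ... | inj₂ st = ⊥-elim (Completion.rest-rest-contra large₃ k≤n shape₂ G (sorted-deg G real) (out-deg G real) (fits₂ G real) (many G real) st fuv uv rv
              (λ x w xk tw x≢w → adj-sym G (sub w x (S₁.F-top w x tw (top⇒within {w} tw) xk (x≢w ∘ ≡-sym))))
              (λ z rz → subst₂ _≤_ (≡-sym (real z)) (≡-sym (real u)) (u-max z rz))
              (λ y ry vy → ¬true⇒false λ f → true≢false (subst (λ w → adj G v w ≡ true) (v-only y ry f) vy) (adj-sym G uv))
              (λ r ur → subst₂ _≤_ (≡-sym (real r)) (≡-sym (real v)) (r≤v r (removable⇒rest shape₂ t'≤k {G} (F⇒in shape₂ {u} {v} fuv) ur) (proj₂ ur) (adj⇒≢ G (proj₁ ur)))))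
    finish : ⊥ ⊎ (Σ (Graph n) λ G' → Realizes π G' × (∀ x y → F₁ x y ≡ true → adj G' x y ≡ true)) → Contains k π
    finish (inj₂ (G₁ , real₁ , sub₁)) = conclude (saturate F₂ S₂.F-sym (outside k) S₂.F-out {A = ⊥} Inv
        (λ {G} {G'} inv kp → Realizes-keeps F₂ {G} {G'} (proj₁ inv) kp , λ x y f → proj₂ kp x y (F₁⊆F₂ x y f) (proj₂ inv x y f)) second G₁ (real₁ , sub₁))
      where
      conclude : ⊥ ⊎ (Σ (Graph n) λ G' → Inv G' × (∀ x y → F₂ x y ≡ true → adj G' x y ≡ true)) → Contains k π
      conclude (inj₂ (G , (real , _) , sub)) = G , real , λ H tree → fits⇒⊆G {H = H} {G} {t'} {Γ} k≤n (universal H tree) sub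

  offset-injective : ∀ {x y : Fin n} → (toℕ x <ᵇ t') ≡ false → (toℕ y <ᵇ t') ≡ false → toℕ x ∸ t' ≡ toℕ y ∸ t' → x ≡ y
  offset-injective {x} {y} rx ry e = toℕ-injective (∸-cancelʳ-≡ (<ᵇ-false⁻ {toℕ x} {t'} rx) (<ᵇ-false⁻ {toℕ y} {t'} ry) e)

  offset-bound : ∀ {x : Fin n} m → (toℕ x <ᵇ t') ≡ false → toℕ x ∸ t' < m → (toℕ x <ᵇ t' + m) ≡ true
  offset-bound {x} m rx l = <ᵇ-true (subst (_< t' + m) (m+[n∸m]≡n (<ᵇ-false⁻ {toℕ x} {t'} rx)) (+-monoʳ-< t' l))

  -- The centre stands at the first position after the top and so has the largest degree there. A
  -- leaf has no other partner in Γ, and every removable neighbour of the centre comes after all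
  -- leaves, hence has no larger degree.
  star-high : ∀ g → Universal k t' (bipartite 1 g) → (∀ x → (toℕ x <ᵇ t' + 1) ≡ true → t' + g ≤ π x) →
    (∀ x → (toℕ x <ᵇ t' + suc g) ≡ true → t' + 1 ≤ π x) → (∀ x → (toℕ x <ᵇ k) ≡ true → t' ≤ π x) → HighPattern
  star-high g U centre leaf enough = record { Γ = bipartite 1 g ; Γ-sym = bipartite-sym 1 g ; universal = U ; Γ-fits = fits ; Γ-orient = orient }
    where
    F : Fin n → Fin n → Bool
    F = pattern-on k t' (bipartite 1 g)
    S : Shape k t' F
    S = pattern-shape k t' (bipartite 1 g) (bipartite-sym 1 g)
    fits : ∀ x → (toℕ x <ᵇ t') ≡ false → (toℕ x <ᵇ k) ≡ true → # (F x) ≤ π x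
    fits x r xk with (toℕ x ∸ t') <? 1 | (toℕ x ∸ t') <? suc g
    ... | yes l | _ = ≤-trans (pattern-deg k t' (bipartite 1 g) x 1 g r λ y e → [ proj₂ , (λ q → ⊥-elim (<⇒≱ l (proj₁ (proj₂ q)))) ]′ (bipartite-cases 1 g (toℕ x ∸ t') y e))
            (centre x (offset-bound {x} 1 r l))
    ... | no nl | yes l = ≤-trans (pattern-deg k t' (bipartite 1 g) x 0 1 r λ y e → z≤n , [ (λ q → ⊥-elim (nl (proj₁ q))) , proj₁ ]′ (bipartite-cases 1 g (toℕ x ∸ t') y e))
            (leaf x (offset-bound {x} (suc g) r l))
    ... | no nl | no nl' = ≤-trans (pattern-deg k t' (bipartite 1 g) x 0 0 r λ y e → ⊥-elim ([ (λ q → nl (proj₁ q)) , (λ q → nl' (proj₂ (proj₂ q))) ]′ (bipartite-cases 1 g (toℕ x ∸ t') y e)))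
            (≤-trans (≤-reflexive (+-identityʳ t')) (enough x xk))
    oriented : ∀ u v → (toℕ u <ᵇ t') ≡ false → (toℕ v <ᵇ t') ≡ false → (toℕ v <ᵇ k) ≡ true → (toℕ u <ᵇ k) ≡ true → toℕ u ∸ t' < 1 → 1 ≤ toℕ v ∸ t' → toℕ v ∸ t' < 1 + g → Oriented (bipartite 1 g) u v
    oriented u v ru rv vk uk u0 v1 vg = (λ z rz → sorted u z (≤-trans (≤-reflexive u≡t') (<ᵇ-false⁻ {toℕ z} {t'} rz))) , only , last
      where
      u≡0 : toℕ u ∸ t' ≡ 0
      u≡0 = n<1⇒n≡0 u0
      u≡t' : toℕ u ≡ t'
      u≡t' = trans (≡-sym (m+[n∸m]≡n (<ᵇ-false⁻ {toℕ u} {t'} ru))) (trans (cong (t' +_) u≡0) (+-identityʳ t'))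
      only : ∀ y → (toℕ y <ᵇ t') ≡ false → F v y ≡ true → y ≡ u
      only y ry f = [ (λ t → ⊥-elim (true≢false t ry)) , (λ q → [ (λ s → ⊥-elim (<⇒≱ (proj₁ s) v1)) , (λ s → offset-injective {y} {u} ry ru (trans (n<1⇒n≡0 (proj₁ s)) (≡-sym u≡0))) ]′
        (bipartite-cases 1 g (toℕ v ∸ t') (toℕ y ∸ t') (proj₂ q))) ]′ (pattern-cases k t' (bipartite 1 g) {v} {y} f rv)
      last : ∀ r → (toℕ r <ᵇ t') ≡ false → F u r ≡ false → u ≢ r → π r ≤ π v
      last r rr f u≢r = sorted v r (≮⇒≥ λ r<v → true≢false (∧-true (∧-true uk (<ᵇ-true (<-trans r<v (<ᵇ-true⁻ {n = k} vk))))
        (place-Γ {t'} {bipartite 1 g} (u≢r ∘ toℕ-injective) (proj₁ (bipartite-intro 1 g u0 (n≢0⇒n>0 λ r0 → u≢r (offset-injective {u} {r} ru rr (trans u≡0 (≡-sym r0))))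
          (≤-<-trans (∸-monoˡ-≤ t' (<⇒≤ r<v)) vg))))) f)
    orient : ∀ u v → (toℕ u <ᵇ t') ≡ false → (toℕ v <ᵇ t') ≡ false → F u v ≡ true → Oriented (bipartite 1 g) u v ⊎ Oriented (bipartite 1 g) v u
    orient u v ru rv f = [ (λ t → ⊥-elim (true≢false t rv)) , (λ q → [ (λ s → inj₁ (oriented u v ru rv vk uk (proj₁ s) (proj₁ (proj₂ s)) (proj₂ (proj₂ s)))) ,
        (λ s → inj₂ (oriented v u rv ru uk vk (proj₁ s) (proj₁ (proj₂ s)) (proj₂ (proj₂ s)))) ]′ (bipartite-cases 1 g (toℕ u ∸ t') (toℕ v ∸ t') (proj₂ q))) ]′ (pattern-cases k t' (bipartite 1 g) {u} {v} f ru)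
      where
      uk = F⇒in S {u} {v} f
      vk = F⇒in S {v} {u} (trans (Shape.F-sym S v u) f)

  -- The four matched vertices have degree exactly `t' + 1`, the maximum outside the top, so all
  -- degree comparisons hold in either orientation.
  matching-high : Universal k t' matching₂ → (∀ x → (toℕ x <ᵇ t') ≡ false → π x ≤ t' + 1) →
    (∀ x → (toℕ x <ᵇ t' + 4) ≡ true → t' + 1 ≤ π x) → (∀ x → (toℕ x <ᵇ k) ≡ true → t' ≤ π x) → HighPattern
  matching-high U low special enough = record { Γ = matching₂ ; Γ-sym = m-sym ; universal = U ; Γ-fits = fits ; Γ-orient = λ u v ru rv f → inj₁ (orient u v ru rv f) }
    where
    m-sym : ∀ i l → matching₂ i l ≡ matching₂ l i
    m-sym i l = ∨-comm (match-edges i l) (match-edges l i)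
    F : Fin n → Fin n → Bool
    F = pattern-on k t' matching₂
    fits : ∀ x → (toℕ x <ᵇ t') ≡ false → (toℕ x <ᵇ k) ≡ true → # (F x) ≤ π x
    fits x r xk with (toℕ x ∸ t') <? 4
    ... | yes l = ≤-trans (pattern-deg k t' matching₂ x (proj₁ (matching₂-interval (toℕ x ∸ t'))) 1 r (proj₂ (matching₂-interval (toℕ x ∸ t')))) (special x (offset-bound {x} 4 r l))
    ... | no nl = ≤-trans (pattern-deg k t' matching₂ x 0 0 r λ y e → ⊥-elim (nl (matching₂-<4 _ y e))) (≤-trans (≤-reflexive (+-identityʳ t')) (enough x xk))
    Γ-of : ∀ u v → (toℕ u <ᵇ t') ≡ false → (toℕ v <ᵇ t') ≡ false → F u v ≡ true → matching₂ (toℕ u ∸ t') (toℕ v ∸ t') ≡ true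
    Γ-of u v ru rv f = [ (λ t → ⊥-elim (true≢false t rv)) , proj₂ ]′ (pattern-cases k t' matching₂ {u} {v} f ru)
    orient : ∀ u v → (toℕ u <ᵇ t') ≡ false → (toℕ v <ᵇ t') ≡ false → F u v ≡ true → Oriented matching₂ u v
    orient u v ru rv f = (λ z rz → ≤-trans (low z rz) (special u (offset-bound {u} 4 ru (matching₂-<4 _ _ g)))) ,
        (λ y ry f' → offset-injective {y} {u} ry ru (mate-unique _ _ _ g (Γ-of v y rv ry f'))) ,
        (λ r rr _ _ → ≤-trans (low r rr) (special v (offset-bound {v} 4 rv (matching₂-<4 _ _ (trans (m-sym (toℕ v ∸ t') (toℕ u ∸ t')) g)))))
      where
      g = Γ-of u v ru rv f

  enough-high : (∀ x → k ≤ suc (toℕ x) → π x < t') → ⊥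
  enough-high few = arith (tail-bound π G₀ real₀ (suc k₂) (≤-trans (n≤1+n _) k≤n) t'' (λ x l → s≤s⁻¹ (few x (s≤s l)))) large₁ big
    where
    arith : ∀ {Σπ} → Σπ + suc k₂ + 2 * (suc k₂ * t'') ≤ suc k₂ * suc k₂ + 2 * (n * t'') → suc k₂ * k₂ + suc (suc t'') * suc t'' ≤ n →
      2 * (suc t'' * n) + 1 ≤ Σπ + suc (suc t'') * suc t'' → ⊥
    arith {Σπ} h₁ h₂ h₃ = <-irrefl refl (linear {1} {0} (n + 2 * (suc k₂ * t'')) (h₁ ⊕ h₂ ⊕ h₃) (lem Σπ k₂ t'' n))
      where
      lem : ∀ S k t n → 1 + (suc k * suc k + 2 * (n * t) + (n + (S + suc (suc t) * suc t))) + (n + 2 * (suc k * t))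
        ≡ 0 + (S + suc k + 2 * (suc k * t) + (suc k * k + suc (suc t) * suc t + (2 * (suc t * n) + 1)))
      lem = solve-∀

  -- Were only the first `t' + 1 + q` degrees above `t'`, the sum would be largest with a clique on
  -- these vertices and degree `t'` elsewhere. For `q = 0` and `q = 1` this is exactly the value
  -- that the strict hypothesis excludes.
  above-top : ∀ q → (q ≡ 0 ⊎ (q ≡ 1 × 2 * (t' * n) + 3 ≤ ∑ π + suc t' * t')) → t' + (2 + q) ≤ n → ∀ x → (toℕ x <ᵇ t' + (2 + q)) ≡ true → t' + 1 ≤ π x
  above-top q hq le with level π sorted (t' + (2 + q)) (t' + 1) le
  ... | inj₁ ok = ok
  ... | inj₂ few = ⊥-elim (arith (tail-bound π G₀ real₀ (t' + (1 + q)) (≤-trans (+-monoʳ-≤ t' (n≤1+n _)) le) t'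
          (λ x l → s≤s⁻¹ (≤-trans (few x (≤-trans (≤-reflexive (+-suc t' (1 + q))) (s≤s l))) (≤-reflexive (+-comm t' 1))))) hq)
    where
    arith : ∑ π + (t' + (1 + q)) + 2 * ((t' + (1 + q)) * t') ≤ (t' + (1 + q)) * (t' + (1 + q)) + 2 * (n * t') →
      (q ≡ 0 ⊎ (q ≡ 1 × 2 * (t' * n) + 3 ≤ ∑ π + suc t' * t')) → ⊥
    arith h₁ (inj₁ refl) = <-irrefl refl (linear {1} {0} 0 (h₁ ⊕ big) (lem (∑ π) t' n))
      where
      lem : ∀ S t n → 1 + ((t + 1) * (t + 1) + 2 * (n * t) + (S + suc t * t)) + 0 ≡ 0 + (S + (t + 1) + 2 * ((t + 1) * t) + (2 * (t * n) + 1))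
      lem = solve-∀
    arith h₁ (inj₂ (refl , big')) = <-irrefl refl (linear {1} {0} 0 (h₁ ⊕ big') (lem (∑ π) t' n))
      where
      lem : ∀ S t n → 1 + ((t + 2) * (t + 2) + 2 * (n * t) + (S + suc t * t)) + 0 ≡ 0 + (S + (t + 2) + 2 * ((t + 2) * t) + (2 * (t * n) + 3))
      lem = solve-∀

  -- Equality in the degree sum would make it odd.
  four-special : 2 * (t' * n) + 3 ≤ ∑ π + suc t' * t' → t' + 4 ≤ n → (∀ x → (toℕ x <ᵇ t') ≡ false → π x ≤ t' + 1) →
    ∀ x → (toℕ x <ᵇ t' + 4) ≡ true → t' + 1 ≤ π x
  four-special big' le low with level π sorted (t' + 4) (t' + 1) le
  ... | inj₁ ok = ok
  ... | inj₂ few = ⊥-elim (odd (mixed-bound π G₀ real₀ t' t'≤n 3 t' bound-x) (Top.top+rest G₀ t' t'≤n) (handshake G₀) (pronic-even t'))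
    where
    t'≤n : t' ≤ n
    t'≤n = ≤-trans (m≤m+n t' 4) le
    bound-x : ∀ x → t' ≤ toℕ x → π x ≤ ⟦ toℕ x <ᵇ t' + 3 ⟧ + t'
    bound-x x l with bool (toℕ x <ᵇ t' + 3)
    ... | inj₁ e = ≤-trans (low x (<ᵇ-false l)) (≤-reflexive (trans (+-comm t' 1) (cong (_+ t') (≡-sym (⟦⟧-true e)))))
    ... | inj₂ e = ≤-trans (s≤s⁻¹ (≤-trans (few x (≤-trans (≤-reflexive (+-suc t' 3)) (s≤s (<ᵇ-false⁻ {toℕ x} {t' + 3} e)))) (≤-reflexive (+-comm t' 1)))) (m≤n+m t' _)
    odd : ∀ {r} → ∑ π + t' ≤ t' * t' + r * t' + (3 + r * t') → t' + r ≡ n → (∃ λ m → ∑ (deg G₀) ≡ m + m) → (∃ λ w → suc t' * t' ≡ w + w) → ⊥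
    odd {r} h₁ h₂ (m , em) (w , ew) = odd≢even {m + w} {t' * n + 1} (≤-antisym
        (≤-trans (≤-reflexive (trans (lem₁ m w) (cong₂ _+_ (trans (≡-sym em) (∑-cong real₀)) (≡-sym ew)))) upper)
        (≤-trans (≤-reflexive (lem₂ (t' * n))) (≤-trans big' (≤-reflexive (≡-sym (trans (lem₁ m w) (cong₂ _+_ (trans (≡-sym em) (∑-cong real₀)) (≡-sym ew))))))))
      where
      lem₁ : ∀ m w → m + w + (m + w) ≡ m + m + (w + w)
      lem₁ = solve-∀
      lem₂ : ∀ a → suc (a + 1 + (a + 1)) ≡ 2 * a + 3
      lem₂ = solve-∀
      upper : ∑ π + suc t' * t' ≤ suc (t' * n + 1 + (t' * n + 1))
      upper = subst (λ z → ∑ π + suc t' * t' ≤ suc (t' * z + 1 + (t' * z + 1))) h₂ (linear 0 h₁ (lem (∑ π) t' r))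
        where
        lem : ∀ S t r → S + suc t * t + (t * t + r * t + (3 + r * t)) + 0 ≡ suc (t * (t + r) + 1 + (t * (t + r) + 1)) + (S + t)
        lem = solve-∀

  -- The first split is at d_k ≥ 2k - 3, which gives a clique on k vertices and otherwise the bound
  -- 2k - 4 beyond the first k; the second is at the τ-th degree reaching k - 1.
  assemble : (∀ j s → j + s ≡ t' → 1 ≤ s → suc s ≤ h → LowPattern k j (2 * s)) → ((∀ x → (toℕ x <ᵇ k) ≡ true → t' ≤ π x) → HighPattern) → Contains k π
  assemble lows high with level π sorted k (suc (k₂ + k₂)) k≤n
  ... | inj₁ huge = let G , real , p , k≤p , clique = clique-realization π k k≤n (λ x e → ≤-trans (≤-reflexive (lem k₂)) (+-monoˡ-≤ 3 (huge x e))) G₀ real₀ in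
      G , real , λ H _ → clique⇒⊆G {H = H} {G} p k≤p clique
    where
    lem : ∀ k₂ → suc (suc k₂) + suc (suc k₂) ≡ suc (k₂ + k₂) + 3
    lem = solve-∀
  ... | inj₂ lo with level π sorted t' (suc k₂) (≤-trans (≤-trans (m≤m+n t' (suc h)) (≤-reflexive (≡-sym k≡))) k≤n)
  ...   | inj₁ hi = high-case (high enough) hi enough (λ x l → s≤s⁻¹ (lo x (≤-trans l (n≤1+n _))))
    where
    enough : ∀ x → (toℕ x <ᵇ k) ≡ true → t' ≤ π x
    enough with level π sorted k t' k≤n
    ... | inj₁ ok = ok
    ... | inj₂ few = ⊥-elim (enough-high few)
  ...   | inj₂ few with threshold π sorted (suc k₂) t'' (≤-trans (n≤1+n t'') (≤-trans (≤-trans (m≤m+n t' (suc h)) (≤-reflexive (≡-sym k≡))) k≤n)) (λ x l → few x (s≤s l))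
  ...     | j , j≤ , hi , low = finish (level π sorted k (j + 2 * s) k≤n)
    where
    s = suc t'' ∸ j
    j+s : j + s ≡ t'
    j+s = m+[n∸m]≡n (≤-trans j≤ (n≤1+n t''))
    s≥1 : 1 ≤ s
    s≥1 = m<n⇒0<n∸m (s≤s j≤)
    j<k : j < k
    j<k = ≤-trans (s≤s j≤) (≤-trans (m≤m+n t' (suc h)) (≤-reflexive (≡-sym k≡)))
    finish : (∀ x → (toℕ x <ᵇ k) ≡ true → j + 2 * s ≤ π x) ⊎ (∀ x → k ≤ suc (toℕ x) → π x < j + 2 * s) → Contains k π
    finish (inj₂ few') = ⊥-elim (enough-low j s j+s s≥1 low few')
    finish (inj₁ enough) = low-case j s j+s s≥1 (lows j s j+s s≥1 s<h) s<h hi low enough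
      where
      j<n : j < n
      j<n = <-≤-trans j<k k≤n
      x₀ : Fin n
      x₀ = fromℕ< j<n
      -- The entry at index `j` is at least `j + 2 * s` but below k - 1, which limits `s`.
      s<h : suc s ≤ h
      s<h = arith (≤-trans (enough x₀ (<ᵇ-true (subst (_< k) (≡-sym (toℕ-fromℕ< j<n)) j<k)))
          (s≤s⁻¹ (low x₀ (≤-reflexive (≡-sym (toℕ-fromℕ< j<n)))))) (trans k≡ (cong (_+ suc h) (≡-sym j+s)))
        where
        arith : ∀ {s} → j + 2 * s ≤ k₂ → suc (suc k₂) ≡ j + s + suc h → suc s ≤ h
        arith {s} h₁ h₂ = linear 0 (h₁ ⊕ ≤-reflexive h₂) (lem j s h k₂)
          where
          lem : ∀ j s h k → suc s + (k + (j + s + suc h)) + 0 ≡ h + (j + 2 * s + suc (suc k))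
          lem = solve-∀

  module _ (lows : ∀ j s → j + s ≡ t' → 1 ≤ s → suc s ≤ h → LowPattern k j (2 * s)) (t'+4≤n : t' + 4 ≤ n) where

    shorter : ∀ {m} → m ≤ 4 → t' + m ≤ n
    shorter m≤4 = ≤-trans (+-monoʳ-≤ t' m≤4) t'+4≤n

    contains-all : Universal k t' (bipartite 1 1) → Contains k π
    contains-all star₁ = assemble lows (star-high 1 star₁ (λ x e → top x (<ᵇ-true {toℕ x} {t' + 2} (<-≤-trans (<ᵇ-true⁻ {toℕ x} {t' + 1} e) (+-monoʳ-≤ t' (n≤1+n 1))))) top)
      where
      top : ∀ x → (toℕ x <ᵇ t' + 2) ≡ true → t' + 1 ≤ π x
      top = above-top 0 (inj₁ refl) (shorter (s≤s (s≤s z≤n)))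

    -- For k ≡ 1 (mod 3) a single edge does not suffice. If the degree after the top is at least
    -- `t' + 2`, a path with two edges is placed with its centre there; if not, no degree outside
    -- the top exceeds `t' + 1` and two disjoint edges are used.
    contains-all⁺ : Universal k t' (bipartite 1 2) → Universal k t' matching₂ → 2 * (t' * n) + 3 ≤ ∑ π + suc t' * t' → Contains k π
    contains-all⁺ star₂ matching big' = assemble lows (high (level π sorted (t' + 1) (t' + 2) (shorter (s≤s z≤n))))
      where
      high : (∀ x → (toℕ x <ᵇ t' + 1) ≡ true → t' + 2 ≤ π x) ⊎ (∀ x → t' + 1 ≤ suc (toℕ x) → π x < t' + 2) →
        (∀ x → (toℕ x <ᵇ k) ≡ true → t' ≤ π x) → HighPattern
      high (inj₁ centre) = star-high 2 star₂ centre (above-top 1 (inj₂ (refl , big')) (shorter (n≤1+n 3)))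
      high (inj₂ few) = matching-high matching low (four-special big' t'+4≤n low)
        where
        low : ∀ x → (toℕ x <ᵇ t') ≡ false → π x ≤ t' + 1
        low x e = s≤s⁻¹ (≤-trans (few x (≤-trans (≤-reflexive (+-comm t' 1)) (s≤s (<ᵇ-false⁻ {toℕ x} {t'} e)))) (≤-reflexive (+-suc t' 1)))

-- Numerical estimates

-- Write `s` as `suc r`. The first hypothesis is the case `r = 0`, the second bounds the growth per
-- unit of `r`, with the quadratic term absorbed by `r ≤ h`.
large-step : ∀ {n h k₂ t''} →
  (h + 2) * (h + 2) + (suc k₂ * suc k₂ + 2 * (suc k₂ * k₂)) + (2 * suc t'' + 1) ≤ 2 * n →
  2 * (h + 2) + h + (2 * suc t'' + 1) ≤ 2 * n →
  ∀ s → 1 ≤ s → suc s ≤ h →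
  (h + suc s) * (h + suc s) + (suc k₂ * suc k₂ + 2 * (suc k₂ * k₂)) + (2 * (suc t'' * s) + s) ≤ 2 * (s * n)
large-step {n} {h} {k₂} {t''} c₀ c₁ (suc r) _ s<h =
  linear 0 (c₀ ⊕ *-monoʳ-≤ r c₁ ⊕ *-monoʳ-≤ r (≤-trans (≤-trans (n≤1+n r) (n≤1+n (suc r))) s<h)) (lem h r (suc k₂ * suc k₂ + 2 * (suc k₂ * k₂)) t'' n)
  where
  lem : ∀ h r K t n → (h + suc (suc r)) * (h + suc (suc r)) + K + (2 * (suc t * suc r) + suc r) + (2 * n + (r * (2 * n) + r * h)) + 0
    ≡ 2 * (suc r * n) + ((h + 2) * (h + 2) + K + (2 * suc t + 1) + (r * (2 * (h + 2) + h + (2 * suc t + 1)) + r * r))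
  lem = solve-∀

-- In each estimate Y is a lower bound for the number o of outside vertices, attained at ω = τ; the rest is
-- linear or quadratic in ω and compared coefficientwise.
large-from : ∀ {n} h τ E Y →
  Y + (τ + suc h + 2 * (E + 1 + τ)) ≤ n →
  (h + 1) * (h + 1) + (E + 2) * (E + 2) + 2 * ((E + 2) * h) ≤ 2 * Y →
  τ + 2 * (E + 2) + 2 * h ≤ 2 * Y →
  Y + (τ + suc h + (τ * h + h + 1) + (E + 1 + τ)) ≤ n →
  2 * ((h + 1) * (h + 1)) + 2 * (h * E) + 2 * ((E + 2) * h) ≤ 2 * Y →
  2 * (h * E) + 2 * h ≤ 2 * Y →
  Y + (τ + suc h + (E + h + 1 + 2 * τ) + (E + 1 + τ)) ≤ n →
  (h + 1) * (h + 1) + (E + h + 5) * (E + h + 5) + 2 * ((E + 3) * h) ≤ 4 * Y →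
  4 * (E + h + 5) + 4 * τ + 2 * h ≤ 2 * Y →
  Large n (τ + suc h) τ h (E + τ) E
large-from {n} h τ E Y out₀ out₁ out₂ com₀ com₁ com₂ in₀ in₁ in₂ = record
  { k≡ = refl ; D≡ = refl ; complete-large = full ; out-large = out ; in-large = inside }
  where
  out : ∀ ω o q qr → 1 ≤ ω → ω ≤ τ → n ≤ τ + suc h + (o + (q + qr)) → q + τ ≤ E + τ + 1 + ω → qr + τ ≤ E + τ + 1 + ω →
    1 + 2 * (o * ω) ≤ suc h * suc h + q * q + 2 * (qr * h) → ⊥
  out (suc w) o q qr _ w<τ h₁ h₂ h₃ h₄ = <-irrefl refl (linear {1} {0} 0
      (h₄ ⊕ *-mono-≤ q≤ q≤ ⊕ *-monoʳ-≤ 2 (*-monoˡ-≤ h qr≤) ⊕ *-monoʳ-≤ 2 (*-monoˡ-≤ (suc w) Y≤o) ⊕ *-monoʳ-≤ w (<⇒≤ w<τ) ⊕ out₁ ⊕ *-monoʳ-≤ w out₂)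
      (lem h τ E Y w o q qr))
    where
    bounded : ∀ {x} → x + τ ≤ E + τ + 1 + suc w → x ≤ E + 2 + w
    bounded {x} h = linear 0 h (lem₁ x τ E w)
      where
      lem₁ : ∀ x τ E w → x + (E + τ + 1 + suc w) + 0 ≡ E + 2 + w + (x + τ)
      lem₁ = solve-∀
    q≤ : q ≤ E + 2 + w
    q≤ = bounded h₂
    qr≤ : qr ≤ E + 2 + w
    qr≤ = bounded h₃
    Y≤o : Y ≤ o
    Y≤o = linear 0 (out₀ ⊕ h₁ ⊕ q≤ ⊕ qr≤ ⊕ w<τ ⊕ w<τ) (lem₁ Y o q qr τ h E w n)
      where
      lem₁ : ∀ Y o q qr τ h E w n → Y + (n + (τ + suc h + (o + (q + qr)) + (E + 2 + w + (E + 2 + w + (τ + τ))))) + 0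
        ≡ o + (Y + (τ + suc h + 2 * (E + 1 + τ)) + (n + (q + (qr + (suc w + suc w)))))
      lem₁ = solve-∀
    lem : ∀ h τ E Y w o q qr →
      1 + (suc h * suc h + q * q + 2 * (qr * h) + ((E + 2 + w) * (E + 2 + w) + (2 * ((E + 2 + w) * h) + (2 * (o * suc w) + (w * τ + (2 * Y + w * (2 * Y))))))) + 0
      ≡ 0 + (1 + 2 * (o * suc w) + (q * q + (2 * (qr * h) + (2 * (Y * suc w) + (w * w + ((h + 1) * (h + 1) + (E + 2) * (E + 2) + 2 * ((E + 2) * h) + w * (τ + 2 * (E + 2) + 2 * h)))))))
    lem = solve-∀
  full : ∀ ω o q qr R → 1 ≤ ω → ω ≤ τ → n ≤ τ + suc h + (o + (q + qr)) → q ≤ R + suc h → R ≤ ω * h → qr + τ ≤ E + τ + 1 + ω →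
    1 + 2 * (o * ω) ≤ suc h * suc h + suc h * suc h + 2 * (R * E + qr * h) → ⊥
  full (suc w) o q qr R _ w<τ h₁ h₂ h₃ h₄ h₅ = <-irrefl refl (linear {1} {0} 0
      (h₅ ⊕ *-monoʳ-≤ 2 (*-monoˡ-≤ E h₃) ⊕ *-monoʳ-≤ 2 (*-monoˡ-≤ h qr≤) ⊕ *-monoʳ-≤ 2 (*-monoˡ-≤ (suc w) Y≤o) ⊕ com₁ ⊕ *-monoʳ-≤ w com₂)
      (lem h E Y w o R qr))
    where
    qr≤ : qr ≤ E + 2 + w
    qr≤ = linear 0 h₄ (lem₁ qr τ E w)
      where
      lem₁ : ∀ q τ E w → q + (E + τ + 1 + suc w) + 0 ≡ E + 2 + w + (q + τ)
      lem₁ = solve-∀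
    Y≤o : Y ≤ o
    Y≤o = linear 0 (com₀ ⊕ h₁ ⊕ h₂ ⊕ h₃ ⊕ qr≤ ⊕ w<τ ⊕ *-monoˡ-≤ h w<τ) (lem₁ Y o q qr R τ h E w n)
      where
      lem₁ : ∀ Y o q qr R τ h E w n → Y + (n + (τ + suc h + (o + (q + qr)) + (R + suc h + (suc w * h + (E + 2 + w + (τ + τ * h)))))) + 0
        ≡ o + (Y + (τ + suc h + (τ * h + h + 1) + (E + 1 + τ)) + (n + (q + (R + (qr + (suc w + suc w * h))))))
      lem₁ = solve-∀
    lem : ∀ h E Y w o R qr →
      1 + (suc h * suc h + suc h * suc h + 2 * (R * E + qr * h) + (2 * (suc w * h * E) + (2 * ((E + 2 + w) * h) + (2 * (o * suc w) + (2 * Y + w * (2 * Y)))))) + 0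
      ≡ 0 + (1 + 2 * (o * suc w) + (2 * (R * E) + (2 * (qr * h) + (2 * (Y * suc w) + (2 * ((h + 1) * (h + 1)) + 2 * (h * E) + 2 * ((E + 2) * h) + w * (2 * (h * E) + 2 * h))))))
    lem = solve-∀
  inside : ∀ ω o q qr d → 2 ≤ ω → ω ≤ τ → n ≤ τ + suc h + (o + (q + qr)) → q + τ ≤ d + 1 + ω → 2 + d ≤ τ + suc h + qr → qr + τ ≤ E + τ + 1 + ω →
    1 + 2 * (o * ω) ≤ suc h * suc h + q * q + 2 * (qr * h) → ⊥
  inside (suc zero) o q qr d (s≤s ()) w<τ h₁ h₂ h₃ h₄ h₅
  inside (suc (suc w)) o q qr d _ w<τ h₁ h₂ h₃ h₄ h₅ = <-irrefl refl (linear {1} {0} 0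
      (h₅ ⊕ *-mono-≤ q≤ q≤ ⊕ *-monoʳ-≤ 2 (*-monoˡ-≤ h qr≤) ⊕ *-monoʳ-≤ 2 (*-monoˡ-≤ (suc (suc w)) Y≤o) ⊕ *-monoʳ-≤ 4 (*-monoʳ-≤ w (≤-trans (n≤1+n w) (<⇒≤ w<τ))) ⊕ in₁ ⊕ *-monoʳ-≤ w in₂)
      (lem h τ E Y w o q qr))
    where
    qr≤ : qr ≤ E + 3 + w
    qr≤ = linear 0 h₄ (lem₁ qr τ E w)
      where
      lem₁ : ∀ q τ E w → q + (E + τ + 1 + suc (suc w)) + 0 ≡ E + 3 + w + (q + τ)
      lem₁ = solve-∀
    q≤ : q ≤ E + h + 5 + 2 * w
    q≤ = linear 0 (h₂ ⊕ h₃ ⊕ qr≤) (lem₁ q d qr τ h E w)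
      where
      lem₁ : ∀ q d qr τ h E w → q + (d + 1 + suc (suc w) + (τ + suc h + qr + (E + 3 + w))) + 0 ≡ E + h + 5 + 2 * w + (q + τ + (2 + d + qr))
      lem₁ = solve-∀
    Y≤o : Y ≤ o
    Y≤o = linear 0 (in₀ ⊕ h₁ ⊕ q≤ ⊕ qr≤ ⊕ *-monoʳ-≤ 3 w<τ) (lem₁ Y o q qr τ h E w n)
      where
      lem₁ : ∀ Y o q qr τ h E w n → Y + (n + (τ + suc h + (o + (q + qr)) + (E + h + 5 + 2 * w + (E + 3 + w + 3 * τ)))) + 0
        ≡ o + (Y + (τ + suc h + (E + h + 1 + 2 * τ) + (E + 1 + τ)) + (n + (q + (qr + 3 * suc (suc w)))))
      lem₁ = solve-∀
    lem : ∀ h τ E Y w o q qr →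
      1 + (suc h * suc h + q * q + 2 * (qr * h) + ((E + h + 5 + 2 * w) * (E + h + 5 + 2 * w) + (2 * ((E + 3 + w) * h) + (2 * (o * suc (suc w)) + (4 * (w * τ) + (4 * Y + w * (2 * Y))))))) + 0
      ≡ 0 + (1 + 2 * (o * suc (suc w)) + (q * q + (2 * (qr * h) + (2 * (Y * suc (suc w)) + (4 * (w * w) + ((h + 1) * (h + 1) + (E + h + 5) * (E + h + 5) + 2 * ((E + 3) * h) + w * (4 * (E + h + 5) + 4 * τ + 2 * h)))))))
    lem = solve-∀

-- k = 6 + 2i + 3g: the residue of k modulo 3 is fixed by i ≤ 2. Every estimate becomes an inequality between
-- polynomials in i and g, certified coefficientwise.
module Family (i g n : ℕ) (N≤n : 78 + 79 * g + 20 * (g * g) + 64 * i + 32 * (i * g) + 12 * (i * i) ≤ n) where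

  t'' τ h k₂ E Y : ℕ
  t'' = 2 + i + 2 * g
  τ = suc t''
  h = 2 + i + g
  k₂ = 4 + 2 * i + 3 * g
  E = 5 + 3 * i + 4 * g
  -- Chosen coefficientwise as large as possible below the bound for `n`: the quadratic part is
  -- limited by `com₀`, the constant and linear part by `in₀`. For `i = g = 0`, that is k = 6, `in₀`
  -- is an equality of 78 with 78.
  Y = 49 + 61 * g + 18 * (g * g) + 52 * i + 29 * (i * g) + 11 * (i * i)

  out₀ : Y + (τ + (1 + h) + 2 * (E + 1 + τ)) ≤ n
  out₀ = ≤-trans (≤-by (5 + 3 * g + 2 * (g * g) + 2 * i + 3 * (i * g) + (i * i)) (lem i g)) N≤n
    where
    lem : ∀ i g → (49 + 61 * g + 18 * (g * g) + 52 * i + 29 * (i * g) + 11 * (i * i)) + ((3 + i + 2 * g) + (1 + (2 + i + g)) + 2 * ((5 + 3 * i + 4 * g) + 1 + (3 + i + 2 * g))) + (5 + 3 * g + 2 * (g * g) + 2 * i + 3 * (i * g) + (i * i))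
      ≡ (78 + 79 * g + 20 * (g * g) + 64 * i + 32 * (i * g) + 12 * (i * i))
    lem = solve-∀

  out₁ : (h + 1) * (h + 1) + (E + 2) * (E + 2) + 2 * ((E + 2) * h) ≤ 2 * Y
  out₁ = ≤-by (12 + 30 * g + 11 * (g * g) + 30 * i + 18 * (i * g) + 6 * (i * i)) (lem i g)
    where
    lem : ∀ i g → ((2 + i + g) + 1) * ((2 + i + g) + 1) + ((5 + 3 * i + 4 * g) + 2) * ((5 + 3 * i + 4 * g) + 2) + 2 * (((5 + 3 * i + 4 * g) + 2) * (2 + i + g)) + (12 + 30 * g + 11 * (g * g) + 30 * i + 18 * (i * g) + 6 * (i * i))
      ≡ 2 * (49 + 61 * g + 18 * (g * g) + 52 * i + 29 * (i * g) + 11 * (i * i))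
    lem = solve-∀

  out₂ : τ + 2 * (E + 2) + 2 * h ≤ 2 * Y
  out₂ = ≤-by (77 + 110 * g + 36 * (g * g) + 95 * i + 58 * (i * g) + 22 * (i * i)) (lem i g)
    where
    lem : ∀ i g → (3 + i + 2 * g) + 2 * ((5 + 3 * i + 4 * g) + 2) + 2 * (2 + i + g) + (77 + 110 * g + 36 * (g * g) + 95 * i + 58 * (i * g) + 22 * (i * i))
      ≡ 2 * (49 + 61 * g + 18 * (g * g) + 52 * i + 29 * (i * g) + 11 * (i * i))
    lem = solve-∀

  com₀ : Y + (τ + (1 + h) + (τ * h + h + 1) + (E + 1 + τ)) ≤ n
  com₀ = ≤-trans (≤-by (5 + g) (lem i g)) N≤n
    where
    lem : ∀ i g → (49 + 61 * g + 18 * (g * g) + 52 * i + 29 * (i * g) + 11 * (i * i)) + ((3 + i + 2 * g) + (1 + (2 + i + g)) + ((3 + i + 2 * g) * (2 + i + g) + (2 + i + g) + 1) + ((5 + 3 * i + 4 * g) + 1 + (3 + i + 2 * g))) + (5 + g)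
      ≡ (78 + 79 * g + 20 * (g * g) + 64 * i + 32 * (i * g) + 12 * (i * i))
    lem = solve-∀

  com₁ : 2 * ((h + 1) * (h + 1)) + 2 * (h * E) + 2 * ((E + 2) * h) ≤ 2 * Y
  com₁ = ≤-by (32 + 54 * g + 18 * (g * g) + 44 * i + 26 * (i * g) + 8 * (i * i)) (lem i g)
    where
    lem : ∀ i g → 2 * (((2 + i + g) + 1) * ((2 + i + g) + 1)) + 2 * ((2 + i + g) * (5 + 3 * i + 4 * g)) + 2 * (((5 + 3 * i + 4 * g) + 2) * (2 + i + g)) + (32 + 54 * g + 18 * (g * g) + 44 * i + 26 * (i * g) + 8 * (i * i))
      ≡ 2 * (49 + 61 * g + 18 * (g * g) + 52 * i + 29 * (i * g) + 11 * (i * i))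
    lem = solve-∀

  com₂ : 2 * (h * E) + 2 * h ≤ 2 * Y
  com₂ = ≤-by (74 + 94 * g + 28 * (g * g) + 80 * i + 44 * (i * g) + 16 * (i * i)) (lem i g)
    where
    lem : ∀ i g → 2 * ((2 + i + g) * (5 + 3 * i + 4 * g)) + 2 * (2 + i + g) + (74 + 94 * g + 28 * (g * g) + 80 * i + 44 * (i * g) + 16 * (i * i))
      ≡ 2 * (49 + 61 * g + 18 * (g * g) + 52 * i + 29 * (i * g) + 11 * (i * i))
    lem = solve-∀

  in₀ : Y + (τ + (1 + h) + (E + h + 1 + 2 * τ) + (E + 1 + τ)) ≤ n
  in₀ = ≤-trans (≤-by (2 * (g * g) + 3 * (i * g) + (i * i)) (lem i g)) N≤n
    where
    lem : ∀ i g → (49 + 61 * g + 18 * (g * g) + 52 * i + 29 * (i * g) + 11 * (i * i)) + ((3 + i + 2 * g) + (1 + (2 + i + g)) + ((5 + 3 * i + 4 * g) + (2 + i + g) + 1 + 2 * (3 + i + 2 * g)) + ((5 + 3 * i + 4 * g) + 1 + (3 + i + 2 * g))) + (2 * (g * g) + 3 * (i * g) + (i * i))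
      ≡ (78 + 79 * g + 20 * (g * g) + 64 * i + 32 * (i * g) + 12 * (i * i))
    lem = solve-∀

  in₁ : (h + 1) * (h + 1) + (E + h + 5) * (E + h + 5) + 2 * ((E + 3) * h) ≤ 4 * Y
  in₁ = ≤-by (11 + 86 * g + 38 * (g * g) + 78 * i + 60 * (i * g) + 21 * (i * i)) (lem i g)
    where
    lem : ∀ i g → ((2 + i + g) + 1) * ((2 + i + g) + 1) + ((5 + 3 * i + 4 * g) + (2 + i + g) + 5) * ((5 + 3 * i + 4 * g) + (2 + i + g) + 5) + 2 * (((5 + 3 * i + 4 * g) + 3) * (2 + i + g)) + (11 + 86 * g + 38 * (g * g) + 78 * i + 60 * (i * g) + 21 * (i * i))
      ≡ 4 * (49 + 61 * g + 18 * (g * g) + 52 * i + 29 * (i * g) + 11 * (i * i))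
    lem = solve-∀

  in₂ : 4 * (E + h + 5) + 4 * τ + 2 * h ≤ 2 * Y
  in₂ = ≤-by (34 + 92 * g + 36 * (g * g) + 82 * i + 58 * (i * g) + 22 * (i * i)) (lem i g)
    where
    lem : ∀ i g → 4 * ((5 + 3 * i + 4 * g) + (2 + i + g) + 5) + 4 * (3 + i + 2 * g) + 2 * (2 + i + g) + (34 + 92 * g + 36 * (g * g) + 82 * i + 58 * (i * g) + 22 * (i * i))
      ≡ 2 * (49 + 61 * g + 18 * (g * g) + 52 * i + 29 * (i * g) + 11 * (i * i))
    lem = solve-∀

  large₁ : (1 + k₂) * k₂ + (1 + τ) * τ ≤ n
  large₁ = ≤-trans (≤-by (46 + 38 * g + 7 * (g * g) + 39 * i + 16 * (i * g) + 7 * (i * i)) (lem i g)) N≤n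
    where
    lem : ∀ i g → (1 + (4 + 2 * i + 3 * g)) * (4 + 2 * i + 3 * g) + (1 + (3 + i + 2 * g)) * (3 + i + 2 * g) + (46 + 38 * g + 7 * (g * g) + 39 * i + 16 * (i * g) + 7 * (i * i))
      ≡ (78 + 79 * g + 20 * (g * g) + 64 * i + 32 * (i * g) + 12 * (i * i))
    lem = solve-∀

  step₀ : (h + 2) * (h + 2) + ((1 + k₂) * (1 + k₂) + 2 * ((1 + k₂) * k₂)) + (2 * τ + 1) ≤ 2 * n
  step₀ = ≤-trans (≤-by (68 + 62 * g + 12 * (g * g) + 62 * i + 26 * (i * g) + 11 * (i * i)) (lem i g)) (*-monoʳ-≤ 2 N≤n)
    where
    lem : ∀ i g → ((2 + i + g) + 2) * ((2 + i + g) + 2) + ((1 + (4 + 2 * i + 3 * g)) * (1 + (4 + 2 * i + 3 * g)) + 2 * ((1 + (4 + 2 * i + 3 * g)) * (4 + 2 * i + 3 * g))) + (2 * (3 + i + 2 * g) + 1) + (68 + 62 * g + 12 * (g * g) + 62 * i + 26 * (i * g) + 11 * (i * i))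
      ≡ 2 * (78 + 79 * g + 20 * (g * g) + 64 * i + 32 * (i * g) + 12 * (i * i))
    lem = solve-∀

  step₁ : 2 * (h + 2) + h + (2 * τ + 1) ≤ 2 * n
  step₁ = ≤-trans (≤-by (139 + 151 * g + 40 * (g * g) + 123 * i + 64 * (i * g) + 24 * (i * i)) (lem i g)) (*-monoʳ-≤ 2 N≤n)
    where
    lem : ∀ i g → 2 * ((2 + i + g) + 2) + (2 + i + g) + (2 * (3 + i + 2 * g) + 1) + (139 + 151 * g + 40 * (g * g) + 123 * i + 64 * (i * g) + 24 * (i * i))
      ≡ 2 * (78 + 79 * g + 20 * (g * g) + 64 * i + 32 * (i * g) + 12 * (i * i))
    lem = solve-∀

  k≤N : 2 + k₂ ≤ n
  k≤N = ≤-trans (≤-by (72 + 76 * g + 20 * (g * g) + 62 * i + 32 * (i * g) + 12 * (i * i)) (lem i g)) N≤n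
    where
    lem : ∀ i g → 2 + (4 + 2 * i + 3 * g) + (72 + 76 * g + 20 * (g * g) + 62 * i + 32 * (i * g) + 12 * (i * i))
      ≡ (78 + 79 * g + 20 * (g * g) + 64 * i + 32 * (i * g) + 12 * (i * i))
    lem = solve-∀

  T≤N : τ + 4 ≤ n
  T≤N = ≤-trans (≤-by (71 + 77 * g + 20 * (g * g) + 63 * i + 32 * (i * g) + 12 * (i * i)) (lem i g)) N≤n
    where
    lem : ∀ i g → (3 + i + 2 * g) + 4 + (71 + 77 * g + 20 * (g * g) + 63 * i + 32 * (i * g) + 12 * (i * i))
      ≡ (78 + 79 * g + 20 * (g * g) + 64 * i + 32 * (i * g) + 12 * (i * i))
    lem = solve-∀


  k≡τ+suc-h : suc (suc k₂) ≡ τ + suc h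
  k≡τ+suc-h = lem i g
    where
    lem : ∀ i g → 6 + 2 * i + 3 * g ≡ 3 + i + 2 * g + (3 + i + g)
    lem = solve-∀

  large₃ : Large n (suc (suc k₂)) τ h (k₂ + k₂) E
  large₃ = subst₂ (λ k D → Large n k τ h D E) (≡-sym k≡τ+suc-h) (lem i g)
      (large-from h τ E Y out₀ out₁ out₂ com₀ com₁ com₂ in₀ in₁ in₂)
    where
    lem : ∀ i g → 5 + 3 * i + 4 * g + (3 + i + 2 * g) ≡ 4 + 2 * i + 3 * g + (4 + 2 * i + 3 * g)
    lem = solve-∀

  -- The clique has `2 * s + 1` vertices and leaves `h − s` isolated ones, whose neighbourhoods of
  -- up to `2 * (h − s)` vertices must fit into the `j` deleted ones. Since `2 * h − τ` is `1 + i`,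
  -- this is the condition `1 + i ≤ s`.
  clique-case : ∀ j s → j + s ≡ τ → 1 + i ≤ s → suc s ≤ h → LowPattern (suc (suc k₂)) j (2 * s)
  clique-case j s e i<s s<h = clique-low _ j (2 * s) (clique-universal (suc (suc k₂)) j (suc (2 * s)) ι
      (lem₁ (m∸n+n≡m (<⇒≤ s<h)) e)
      (linear 0 (i<s ⊕ ≤-reflexive (m∸n+n≡m (<⇒≤ s<h)) ⊕ ≤-reflexive (m∸n+n≡m (<⇒≤ s<h)) ⊕ ≤-reflexive (≡-sym e)) (lem₂ ι j s i g))
      (linear (5 + 2 * i) (*-monoʳ-≤ 3 i<s ⊕ *-monoʳ-≤ 3 (≤-reflexive (m∸n+n≡m (<⇒≤ s<h)))) (lem₃ ι s i g)))
    where
    ι = h ∸ s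
    lem₁ : ∀ {j s ι} → ι + s ≡ h → j + s ≡ τ → suc (suc k₂) ≡ j + (suc (2 * s) + ι)
    lem₁ {j} {s} {ι} a b = trans k≡τ+suc-h (trans (cong₂ (λ x y → x + suc y) (≡-sym b) (≡-sym a)) (lem j s ι))
      where
      lem : ∀ j s ι → j + s + suc (ι + s) ≡ j + (suc (2 * s) + ι)
      lem = solve-∀
    lem₂ : ∀ ι j s i g → 2 * ι + (s + (2 + i + g + (2 + i + g + (j + s)))) + 0 ≡ j + (1 + i + (ι + s + (ι + s + (3 + i + 2 * g))))
    lem₂ = solve-∀
    lem₃ : ∀ ι s i g → 3 * ι + (3 * s + 3 * (2 + i + g)) + (5 + 2 * i) ≡ 6 + 2 * i + 3 * g + 2 + (3 * (1 + i) + 3 * (ι + s))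
    lem₃ = solve-∀

  3h≡k+i : 3 * h ≡ suc (suc k₂) + i
  3h≡k+i = lem i g
    where
    lem : ∀ i g → 3 * (2 + i + g) ≡ 6 + 2 * i + 3 * g + i
    lem = solve-∀

  -- The pairs left over by `clique-case`, three in all: K_{2,2} for `i = s = 1`, the path for
  -- `i = 2`, `s = 1`, and K_{3,4} for `i = s = 2`. Each has maximum degree `2 * s`.
  few-cliques : i ≤ 2 → ∀ j s → j + s ≡ τ → 1 ≤ s → s ≤ i → LowPattern (suc (suc k₂)) j (2 * s)
  few-cliques i≤2 j s e s≥1 s≤i = split i s i≤2 s≥1 s≤i refl (trans k≡τ+suc-h (cong (_+ suc h) (≡-sym e))) (≤-reflexive 3h≡k+i)
    where
    split : ∀ i s → i ≤ 2 → 1 ≤ s → s ≤ i → ∀ {k h} → h ≡ 2 + i + g → k ≡ j + s + suc h → 3 * h ≤ k + i → LowPattern k j (2 * s)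
    split 1 1 _ _ _ {k} {h} refl k≡ h≤ = bipartite-low k j 2 2 2 ≤-refl ≤-refl (bipartite₂₂-universal k j h (trans k≡ (lem j h)) h≤ (m≤m+n 3 g))
      where
      lem : ∀ j h → j + 1 + suc h ≡ j + (2 + h)
      lem = solve-∀
    split 2 1 _ _ _ {k} {h} refl k≡ h≤ = path₅-low k j (path₅-universal k j h (trans k≡ (lem j h)) h≤ (m≤m+n 4 g))
      where
      lem : ∀ j h → j + 1 + suc h ≡ j + (2 + h)
      lem = solve-∀
    split 2 2 _ _ _ {k} {h} refl k≡ h≤ = bipartite-low k j 3 4 4 (n≤1+n 3) ≤-refl (bipartite₃₄-universal k j h (trans k≡ (lem j h)) h≤ (m≤m+n 4 g))
      where
      lem : ∀ j h → j + 2 + suc h ≡ j + (3 + h)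
      lem = solve-∀
    split 0 0 _ () _
    split 0 (suc _) _ _ ()
    split 1 (suc (suc s)) _ _ (s≤s ())
    split 2 (suc (suc (suc s))) _ _ (s≤s (s≤s ()))
    split (suc (suc (suc i))) s (s≤s (s≤s ())) _ _

  lows : i ≤ 2 → ∀ j s → j + s ≡ τ → 1 ≤ s → suc s ≤ h → LowPattern (suc (suc k₂)) j (2 * s)
  lows i≤2 j s e s≥1 s<h = case i <? s of λ
    { (yes i<s) → clique-case j s e i<s s<h
    ; (no i≮s) → few-cliques i≤2 j s e s≥1 (≮⇒≥ i≮s) }

  3h≤k+2 : i ≤ 2 → 3 * h ≤ suc (suc k₂) + 2
  3h≤k+2 i≤2 = ≤-trans (≤-reflexive 3h≡k+i) (+-monoʳ-≤ (suc (suc k₂)) i≤2)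

  -- For `i ≤ 1` the second class has at least `h` vertices whenever the largest has exactly `h`, so
  -- averaging with one neighbour applies; for `i = 2` this fails and `star₂` averages with two.
  star₁ : i ≤ 1 → Universal (suc (suc k₂)) τ (bipartite 1 1)
  star₁ i≤1 = star-universal 1 _ τ h k≡τ+suc-h (3h≤k+2 (≤-trans i≤1 (n≤1+n 1))) (s≤s z≤n)
      (λ b k≤ → let h≤b = half-≤ (linear 0 (k≤ ⊕ i≤1) (lem b i g)) in ≤-trans (s≤s z≤n) h≤b , ≤-trans h≤b (≤-reflexive (≡-sym (*-identityˡ b)))) (s≤s z≤n)
    where
    lem : ∀ b i g → 2 + i + g + (2 + i + g) + (2 + i + g + (b + b) + 1) + 0 ≡ suc (b + b) + (6 + 2 * i + 3 * g + i)
    lem = solve-∀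

  star₂ : i ≤ 2 → Universal (suc (suc k₂)) τ (bipartite 1 2)
  star₂ i≤2 = star-universal 2 _ τ h k≡τ+suc-h (3h≤k+2 i≤2) (s≤s (s≤s z≤n))
      (λ b k≤ → let h≤2b = linear (2 + g) k≤ (lem b i g) in positive b h≤2b , h≤2b) (s≤s z≤n)
    where
    lem : ∀ b i g → 2 + i + g + (2 + i + g + (b + b)) + (2 + g) ≡ 2 * b + (6 + 2 * i + 3 * g)
    lem = solve-∀
    positive : ∀ b → h ≤ 2 * b → 1 ≤ b
    positive (suc b) _ = s≤s z≤n

  matching : i ≡ 2 → Universal (suc (suc k₂)) τ matching₂
  matching i≡2 = matching₂-universal _ τ h k≡τ+suc-h (3h≤k+2 (≤-reflexive i≡2)) (≤-trans (≤-reflexive (≡-sym (cong (2 +_) i≡2))) (m≤m+n (2 + i) g))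

  contains : (π : Fin n → ℕ) → Sorted π → (G₀ : Graph n) → Realizes π G₀ → 2 * (τ * n) + 1 ≤ ∑ π + suc τ * τ →
    i ≤ 1 ⊎ (i ≡ 2 × 2 * (τ * n) + 3 ≤ ∑ π + suc τ * τ) → Contains (suc (suc k₂)) π
  contains π sorted G₀ real₀ big (inj₁ i≤1) = Positive.contains-all k₂ t'' h E k≡τ+suc-h k≤N large₁ (large-step {n} {h} {k₂} {t''} step₀ step₁) large₃
    π sorted G₀ real₀ big (lows (≤-trans i≤1 (n≤1+n 1))) T≤N (star₁ i≤1)
  contains π sorted G₀ real₀ big (inj₂ (i≡2 , big')) = Positive.contains-all⁺ k₂ t'' h E k≡τ+suc-h k≤N large₁ (large-step {n} {h} {k₂} {t''} step₀ step₁) large₃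
    π sorted G₀ real₀ big (lows (≤-reflexive i≡2)) T≤N (star₂ (≤-reflexive i≡2)) (matching i≡2) big'

-- The extremal sequence

-- Distance 1 or 2, the adjacency of the square of a path. The recursion on both arguments makes
-- deletion of vertex 0 return the same graph definitionally, which `path²-isTwoTree` uses.
near : ℕ → ℕ → Bool
near (suc a) (suc b) = near a b
near 0 1 = true
near 0 2 = true
near 1 0 = true
near 2 0 = true
near _ _ = false

near-sym : ∀ a b → near a b ≡ near b a
near-sym (suc a) (suc b) = near-sym a b
near-sym 0 0 = refl
near-sym 0 1 = refl
near-sym 0 2 = refl
near-sym 0 (suc (suc (suc b))) = refl
near-sym 1 0 = refl
near-sym 2 0 = refl
near-sym (suc (suc (suc a))) 0 = refl

near-irrefl : ∀ a → near a a ≡ false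
near-irrefl zero = refl
near-irrefl (suc a) = near-irrefl a

path² : ∀ k → Graph k
path² k = record
  { adj = λ i j → near (toℕ i) (toℕ j)
  ; sym = λ i j → near-sym (toℕ i) (toℕ j)
  ; irrefl = λ i → near-irrefl (toℕ i) }

path²-isTwoTree : ∀ m → IsTwoTree (3 + m) (path² (3 + m))
path²-isTwoTree zero = base (path² 3) λ
  { zero zero a≢b → ⊥-elim (a≢b refl)
  ; zero (suc zero) _ → refl
  ; zero (suc (suc zero)) _ → refl
  ; (suc zero) zero _ → refl
  ; (suc zero) (suc zero) a≢b → ⊥-elim (a≢b refl)
  ; (suc zero) (suc (suc zero)) _ → refl
  ; (suc (suc zero)) zero _ → refl
  ; (suc (suc zero)) (suc zero) _ → refl
  ; (suc (suc zero)) (suc (suc zero)) a≢b → ⊥-elim (a≢b refl) }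
path²-isTwoTree (suc m) = step (path² (4 + m)) zero two adjacent (path²-isTwoTree m)
  where
  two : deg (path² (4 + m)) zero ≡ 2
  two = trans (deg≡# (path² (4 + m)) zero) (trans (∑-suc _) (trans (∑-suc _) (cong suc (trans (∑-suc _) (cong suc (#-zero {p = λ i → near 0 (toℕ (suc (suc (suc i))))} (λ _ → refl)))))))
  adjacent : ∀ (a b : Fin (4 + m)) → near 0 (toℕ a) ≡ true → near 0 (toℕ b) ≡ true → a ≢ b → near (toℕ a) (toℕ b) ≡ true
  adjacent (suc zero) (suc zero) _ _ a≢b = ⊥-elim (a≢b refl)
  adjacent (suc zero) (suc (suc zero)) _ _ _ = refl
  adjacent (suc (suc zero)) (suc zero) _ _ _ = refl
  adjacent (suc (suc zero)) (suc (suc zero)) _ _ a≢b = ⊥-elim (a≢b refl)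

EdgeFree : ∀ {k} → (Fin k → Bool) → Set
EdgeFree Y = ∀ a b → near (toℕ a) (toℕ b) ≡ true → Y a ≡ true → Y b ≡ true → ⊥

AtMostOneEdge : ∀ {k} → (Fin k → Bool) → Set
AtMostOneEdge Y = ∀ a b c d → near (toℕ a) (toℕ b) ≡ true → Y a ≡ true → Y b ≡ true →
  near (toℕ c) (toℕ d) ≡ true → Y c ≡ true → Y d ≡ true → c ≡ a ⊎ c ≡ b

shift₃ : ∀ {k} → (Fin (3 + k) → Bool) → Fin k → Bool
shift₃ Y i = Y (suc (suc (suc i)))

#-suc : ∀ {k} (Y : Fin (suc k) → Bool) → # Y ≡ ⟦ Y zero ⟧ + # (Y ∘ suc)
#-suc Y = ∑-suc _

#-suc₃ : ∀ {k} (Y : Fin (3 + k) → Bool) → # Y ≡ ⟦ Y zero ⟧ + (⟦ Y (suc zero) ⟧ + (⟦ Y (suc (suc zero)) ⟧ + # (shift₃ Y)))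
#-suc₃ Y = trans (#-suc Y) (cong (⟦ Y zero ⟧ +_) (trans (#-suc (Y ∘ suc)) (cong (⟦ Y (suc zero) ⟧ +_) (#-suc (λ i → Y (suc (suc i)))))))

-- Three consecutive vertices form a triangle, so every block of three contains at most one member
-- of `Y`.
sparse : ∀ {k} (Y : Fin k → Bool) → EdgeFree Y → 3 * # Y ≤ k + 2
sparse {0} Y ind = ≤-trans (*-monoʳ-≤ 3 (#≤n Y)) z≤n
sparse {1} Y ind = *-monoʳ-≤ 3 (#≤n Y)
sparse {2} Y ind = ≤-trans (*-monoʳ-≤ 3 (#≤1 Y one)) (n≤1+n 3)
  where
  one : ∀ i j → Y i ≡ true → Y j ≡ true → i ≡ j
  one zero zero _ _ = refl
  one zero (suc zero) yi yj = ⊥-elim (ind zero (suc zero) refl yi yj)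
  one (suc zero) zero yi yj = ⊥-elim (ind zero (suc zero) refl yj yi)
  one (suc zero) (suc zero) _ _ = refl
sparse {suc (suc (suc k))} Y ind = subst (λ z → 3 * z ≤ 3 + k + 2) (≡-sym (#-suc₃ Y))
    (add (Y zero) (Y (suc zero)) (Y (suc (suc zero))) (ind zero (suc zero) refl) (ind zero (suc (suc zero)) refl) (ind (suc zero) (suc (suc zero)) refl))
  where
  rest : 3 * # (shift₃ Y) ≤ k + 2
  rest = sparse (shift₃ Y) λ a b → ind (suc (suc (suc a))) (suc (suc (suc b)))
  one-more : ∀ {r} → 3 * r ≤ k + 2 → 3 * (1 + r) ≤ 3 + k + 2
  one-more {r} le = ≤-trans (≤-reflexive (*-suc 3 r)) (+-monoʳ-≤ 3 le)
  add : ∀ p q r → (p ≡ true → q ≡ true → ⊥) → (p ≡ true → r ≡ true → ⊥) → (q ≡ true → r ≡ true → ⊥) →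
    3 * (⟦ p ⟧ + (⟦ q ⟧ + (⟦ r ⟧ + # (shift₃ Y)))) ≤ 3 + k + 2
  add true true _ pq _ _ = ⊥-elim (pq refl refl)
  add true false true _ pr _ = ⊥-elim (pr refl refl)
  add false true true _ _ qr = ⊥-elim (qr refl refl)
  add true false false _ _ _ = one-more rest
  add false true false _ _ _ = one-more rest
  add false false true _ _ _ = one-more rest
  add false false false _ _ _ = ≤-trans rest (m≤n+m (k + 2) 3)

-- If the first three vertices contain the edge, then the fourth is not in Y and the rest is independent.
almost-sparse : ∀ m {k} → k ≡ 1 + m * 3 → (Y : Fin k → Bool) → AtMostOneEdge Y → # Y ≤ suc m
almost-sparse zero refl Y one = #≤n Y
almost-sparse (suc m) refl Y one = subst (_≤ suc (suc m)) (≡-sym (#-suc₃ Y)) (cases (bool (Y v₀)) (bool (Y v₁)) (bool (Y v₂)))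
  where
  v₀ v₁ v₂ v₃ : Fin (1 + suc m * 3)
  v₀ = zero
  v₁ = suc zero
  v₂ = suc (suc zero)
  v₃ = suc (suc (suc zero))
  Y₃ : Fin (1 + m * 3) → Bool
  Y₃ = shift₃ Y
  inherited : # Y₃ ≤ suc m
  inherited = almost-sparse m refl Y₃ λ a b c d ab ya yb cd yc yd → map-inj (one (suc (suc (suc a))) (suc (suc (suc b))) (suc (suc (suc c))) (suc (suc (suc d))) ab ya yb cd yc yd)
    where
    map-inj : ∀ {a b c : Fin (1 + m * 3)} → _≡_ {A = Fin (1 + suc m * 3)} (suc (suc (suc c))) (suc (suc (suc a))) ⊎ _≡_ {A = Fin (1 + suc m * 3)} (suc (suc (suc c))) (suc (suc (suc b))) → c ≡ a ⊎ c ≡ b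
    map-inj (inj₁ refl) = inj₁ refl
    map-inj (inj₂ refl) = inj₂ refl
  module _ (a b : Fin (1 + suc m * 3)) (a<3 : toℕ a < 3) (b<3 : toℕ b < 3) (ab : near (toℕ a) (toℕ b) ≡ true) (ya : Y a ≡ true) (yb : Y b ≡ true) where
    far : ∀ (c : Fin (1 + suc m * 3)) → 3 ≤ toℕ c → ∀ d → near (toℕ c) (toℕ d) ≡ true → Y c ≡ true → Y d ≡ true → ⊥
    far c 3≤c d cd yc yd = [ (λ { refl → <⇒≱ a<3 3≤c }) , (λ { refl → <⇒≱ b<3 3≤c }) ]′ (one a b c d ab ya yb cd yc yd)
    -- v₃ is adjacent to v₁ and v₂, one of which lies on the edge.
    v₃-free : ∀ w → near 3 (toℕ w) ≡ true → Y w ≡ true → Y v₃ ≡ false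
    v₃-free w e yw = ¬true⇒false λ y₃ → far v₃ ≤-refl w e y₃ yw
    tail : Y v₃ ≡ false → # Y₃ ≤ m
    tail y₃ = s≤s⁻¹ (*-cancelˡ-< 3 _ (suc m) (≤-trans (s≤s (≤-trans (≤-reflexive (cong (3 *_) (trans (#-suc Y₃) (cong (_+ # (Y₃ ∘ suc)) (⟦⟧-false y₃)))))
        (sparse (Y₃ ∘ suc) λ c d cd yc yd → far (suc (suc (suc (suc c)))) (s≤s (s≤s (s≤s z≤n))) (suc (suc (suc (suc d)))) cd yc yd)))
        (≤-reflexive (lem m))))
      where
      lem : ∀ m → suc (m * 3 + 2) ≡ 3 * suc m
      lem = solve-∀
  total : ∀ {p q r} → Y v₀ ≡ p → Y v₁ ≡ q → Y v₂ ≡ r → ⟦ p ⟧ + (⟦ q ⟧ + (⟦ r ⟧ + # Y₃)) ≤ suc (suc m) → ⟦ Y v₀ ⟧ + (⟦ Y v₁ ⟧ + (⟦ Y v₂ ⟧ + # Y₃)) ≤ suc (suc m)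
  total refl refl refl le = le
  cases : Y v₀ ≡ true ⊎ Y v₀ ≡ false → Y v₁ ≡ true ⊎ Y v₁ ≡ false → Y v₂ ≡ true ⊎ Y v₂ ≡ false →
    ⟦ Y v₀ ⟧ + (⟦ Y v₁ ⟧ + (⟦ Y v₂ ⟧ + # Y₃)) ≤ suc (suc m)
  cases (inj₁ y₀) (inj₁ y₁) (inj₁ y₂) = [ (λ ()) , (λ ()) ]′ (one v₀ v₁ v₂ v₀ refl y₀ y₁ refl y₂ y₀)
  cases (inj₁ y₀) (inj₁ y₁) (inj₂ y₂) = total y₀ y₁ y₂ (s≤s (s≤s (tail v₀ v₁ (s≤s z≤n) (s≤s (s≤s z≤n)) refl y₀ y₁ (v₃-free v₀ v₁ (s≤s z≤n) (s≤s (s≤s z≤n)) refl y₀ y₁ v₁ refl y₁))))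
  cases (inj₁ y₀) (inj₂ y₁) (inj₁ y₂) = total y₀ y₁ y₂ (s≤s (s≤s (tail v₀ v₂ (s≤s z≤n) ≤-refl refl y₀ y₂ (v₃-free v₀ v₂ (s≤s z≤n) ≤-refl refl y₀ y₂ v₂ refl y₂))))
  cases (inj₂ y₀) (inj₁ y₁) (inj₁ y₂) = total y₀ y₁ y₂ (s≤s (s≤s (tail v₁ v₂ (s≤s (s≤s z≤n)) ≤-refl refl y₁ y₂ (v₃-free v₁ v₂ (s≤s (s≤s z≤n)) ≤-refl refl y₁ y₂ v₂ refl y₂))))
  cases (inj₁ y₀) (inj₂ y₁) (inj₂ y₂) = total y₀ y₁ y₂ (s≤s inherited)
  cases (inj₂ y₀) (inj₁ y₁) (inj₂ y₂) = total y₀ y₁ y₂ (s≤s inherited)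
  cases (inj₂ y₀) (inj₂ y₁) (inj₁ y₂) = total y₀ y₁ y₂ (s≤s inherited)
  cases (inj₂ y₀) (inj₂ y₁) (inj₂ y₂) = total y₀ y₁ y₂ (≤-trans inherited (n≤1+n _))

#-preimage : ∀ {k n} (p : Fin n → Bool) (f : Fin k → Fin n) → Injective _≡_ _≡_ f → # (λ a → p (f a)) ≤ # p
#-preimage p f f-inj = begin
  # (λ a → p (f a)) ≤⟨ ∑-mono (λ a → ≤-trans (indicator (p (f a)) λ e → f a , ∧-true e (==-refl (f a))) ≤-refl) ⟩
  ## (λ a y → p y ∧ (f a == y)) ≡⟨ ##-swap (λ a y → p y ∧ (f a == y)) ⟩
  ## (λ y a → p y ∧ (f a == y)) ≤⟨ ∑-mono fibre ⟩
  # p ∎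
  where
  open ≤-Reasoning
  indicator : ∀ b {q : Fin _ → Bool} → (b ≡ true → ∃ λ i → q i ≡ true) → ⟦ b ⟧ ≤ # q
  indicator false _ = z≤n
  indicator true h = ∃⇒0<# (proj₁ (h refl)) (proj₂ (h refl))
  fibre : ∀ y → # (λ a → p y ∧ (f a == y)) ≤ ⟦ p y ⟧
  fibre y with p y
  ... | false = ≤-reflexive (#-zero λ _ → refl)
  ... | true = #≤1 _ λ i j ei ej → f-inj (trans (==⇒≡ {i = f i} ei) (≡-sym (==⇒≡ {i = f j} ej)))

-- K_τ joined to a clique on c + 1 further vertices and to the isolated remaining ones.
module Extremal (τ c n' : ℕ) (τ+c≤n' : τ + c ≤ n') where

  n m : ℕ
  n = suc n'
  m = suc (τ + c)

  m≤n : m ≤ n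
  m≤n = s≤s τ+c≤n'

  τ≤m : τ ≤ m
  τ≤m = ≤-trans (m≤m+n τ c) (n≤1+n _)

  top core : Fin n → Bool
  top x = toℕ x <ᵇ τ
  core x = toℕ x <ᵇ m

  top⇒core : ∀ x → top x ≡ true → core x ≡ true
  top⇒core x t = <ᵇ-true (<-≤-trans (<ᵇ-true⁻ {n = τ} t) τ≤m)

  joined : Fin n → Fin n → Bool
  joined x y = top x ∨ (top y ∨ (core x ∧ core y))

  joined-sym : ∀ x y → joined x y ≡ joined y x
  joined-sym x y with top x | top y
  ... | true | true = refl
  ... | true | false = refl
  ... | false | true = refl
  ... | false | false = ∧-comm (core x) (core y)

  ==-sym : ∀ (x y : Fin n) → (x == y) ≡ (y == x)
  ==-sym x y with bool (y == x)
  ... | inj₁ e = trans (cong (x ==_) (==⇒≡ {i = y} e)) (trans (==-refl x) (≡-sym e))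
  ... | inj₂ e = trans (≢⇒== {i = x} {y} λ { refl → true≢false (==-refl x) e }) (≡-sym e)

  G : Graph n
  G = record
    { adj = λ x y → joined x y ∧ not (x == y)
    ; sym = λ x y → cong₂ (λ a b → a ∧ not b) (joined-sym x y) (==-sym x y)
    ; irrefl = λ x → ¬true⇒false λ e → true≢false (==-refl x) (not⇒false (∧-snd {joined x x} e)) }

  degree : Bool → Bool → ℕ
  degree true _ = n'
  degree false true = τ + c
  degree false false = τ

  π : Fin n → ℕ
  π x = degree (top x) (core x)

  realizes : ∀ x → deg G x ≡ π x
  realizes x = trans (deg≡# G x) (cases (bool (top x)) (bool (core x)))
    where
    cases : top x ≡ true ⊎ top x ≡ false → core x ≡ true ⊎ core x ≡ false → # (adj G x) ≡ π x
    cases (inj₁ t) _ = suc-injective (begin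
      suc (# (adj G x)) ≡⟨ cong suc (#-cong λ y → cong (λ b → (b ∨ (top y ∨ (core x ∧ core y))) ∧ not (x == y)) t) ⟩
      suc (# (λ y → true ∧ not (x == y))) ≡⟨ ≡-sym (#-remove (λ _ → true) x refl) ⟩
      # {n} (λ _ → true) ≡⟨ #-⊤ n ⟩
      suc n' ≡⟨ cong (λ b → suc (degree b (core x))) (≡-sym t) ⟩
      suc (π x) ∎)
      where open ≡-Reasoning
    cases (inj₂ t) (inj₁ b) = suc-injective (begin
      suc (# (adj G x)) ≡⟨ cong suc (#-cong λ y → cong (_∧ not (x == y)) (into-core y)) ⟩
      suc (# (λ y → core y ∧ not (x == y))) ≡⟨ ≡-sym (#-remove core x b) ⟩
      # core ≡⟨ #-below m m≤n ⟩
      suc (τ + c) ≡⟨ cong₂ (λ a b → suc (degree a b)) (≡-sym t) (≡-sym b) ⟩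
      suc (π x) ∎)
      where
      open ≡-Reasoning
      absorb : ∀ {p q} → (p ≡ true → q ≡ true) → p ∨ q ≡ q
      absorb {true} h = ≡-sym (h refl)
      absorb {false} h = refl
      into-core : ∀ y → joined x y ≡ core y
      into-core y = trans (cong₂ (λ a b → a ∨ (top y ∨ (b ∧ core y))) t b) (absorb (top⇒core y))
    cases (inj₂ t) (inj₂ b) = begin
      # (adj G x) ≡⟨ #-cong only-top ⟩
      # top ≡⟨ #-below τ (≤-trans τ≤m m≤n) ⟩
      τ ≡⟨ cong₂ degree (≡-sym t) (≡-sym b) ⟩
      π x ∎
      where
      open ≡-Reasoning
      drop : ∀ p q → (p ≡ true → q ≡ false) → (p ∨ false) ∧ not q ≡ p
      drop true q h rewrite h refl = refl
      drop false q h = refl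
      only-top : ∀ y → adj G x y ≡ top y
      only-top y = trans (cong₂ (λ a b → (a ∨ (top y ∨ (b ∧ core y))) ∧ not (x == y)) t b)
        (drop (top y) (x == y) λ ty → ≢⇒== {i = x} {y} λ { refl → true≢false ty t })

  sorted : Sorted π
  sorted x y x≤y with bool (top y) | bool (core y) | bool (top x) | bool (core x)
  ... | _ | _ | inj₁ tx | _ rewrite tx = below (top y) (core y)
    where
    below : ∀ a b → degree a b ≤ n'
    below true _ = ≤-refl
    below false true = τ+c≤n'
    below false false = ≤-trans (m≤m+n τ c) τ+c≤n'
  ... | inj₁ ty | _ | inj₂ tx | _ = ⊥-elim (<⇒≱ (<ᵇ-true⁻ {n = τ} ty) (≤-trans (<ᵇ-false⁻ {toℕ x} {τ} tx) x≤y))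
  ... | inj₂ ty | _ | inj₂ tx | inj₁ bx rewrite ty | tx | bx = below (core y)
    where
    below : ∀ b → degree false b ≤ τ + c
    below true = ≤-refl
    below false = m≤m+n τ c
  ... | inj₂ ty | inj₁ by | inj₂ tx | inj₂ bx = ⊥-elim (<⇒≱ (<ᵇ-true⁻ {n = m} by) (≤-trans (<ᵇ-false⁻ {toℕ x} {m} bx) x≤y))
  ... | inj₂ ty | inj₂ by | inj₂ tx | inj₂ bx rewrite ty | tx | bx | by = ≤-refl

  -- The excess `suc c * c` is 0 for `c = 0` and 2 for `c = 1`: the two values of 1 - (-1)^i in the
  -- bound.
  sum : ∑ π + suc τ * τ ≡ 2 * (τ * n) + suc c * c
  -- Adding `τ + c` at each top vertex makes the degree an affine expression in the indicators of
  -- `top` and `core`, without subtraction.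
  sum = +-cancelʳ-≡ (τ * (τ + c)) _ _ (begin
      ∑ π + suc τ * τ + τ * (τ + c) ≡⟨ lem₁ (∑ π) (suc τ * τ) (τ * (τ + c)) ⟩
      ∑ π + τ * (τ + c) + suc τ * τ ≡⟨ cong (_+ suc τ * τ) counted ⟩
      τ * n' + m * c + n * τ + suc τ * τ ≡⟨ lem₂ τ n' c ⟩
      2 * (τ * n) + suc c * c + τ * (τ + c) ∎)
    where
    open ≡-Reasoning
    counted : ∑ π + τ * (τ + c) ≡ τ * n' + m * c + n * τ
    counted = begin
      ∑ π + τ * (τ + c) ≡⟨ cong (∑ π +_) (≡-sym (trans (∑-guard top (τ + c)) (cong (_* (τ + c)) (#-below τ (≤-trans τ≤m m≤n))))) ⟩
      ∑ π + ∑ (λ x → ⟦ top x ⟧ * (τ + c)) ≡⟨ ≡-sym (∑-distrib-+ π _) ⟩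
      ∑ (λ x → π x + ⟦ top x ⟧ * (τ + c)) ≡⟨ ∑-cong (λ x → pointwise (top x) (core x) (top⇒core x)) ⟩
      ∑ (λ x → ⟦ top x ⟧ * n' + ⟦ core x ⟧ * c + τ) ≡⟨ ∑+ (∑+ (trans (∑-guard top n') (cong (_* n') (#-below τ (≤-trans τ≤m m≤n)))) (trans (∑-guard core c) (cong (_* c) (#-below m m≤n)))) (∑-const n τ) ⟩
      τ * n' + m * c + n * τ ∎
      where
      pointwise : ∀ t b → (t ≡ true → b ≡ true) → degree t b + ⟦ t ⟧ * (τ + c) ≡ ⟦ t ⟧ * n' + ⟦ b ⟧ * c + τ
      pointwise true false h = case h refl of λ ()
      pointwise true true _ = lem n' τ c
        where
        lem : ∀ n τ c → n + 1 * (τ + c) ≡ 1 * n + 1 * c + τ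
        lem = solve-∀
      pointwise false true _ = lem τ c
        where
        lem : ∀ τ c → τ + c + 0 ≡ 1 * c + τ
        lem = solve-∀
      pointwise false false _ = +-identityʳ τ
    lem₁ : ∀ a b c → a + b + c ≡ a + c + b
    lem₁ = solve-∀
    lem₂ : ∀ τ n' c → τ * n' + suc (τ + c) * c + suc n' * τ + suc τ * τ ≡ 2 * (τ * suc n') + suc c * c + τ * (τ + c)
    lem₂ = solve-∀

  module _ (G' : Graph n) (real : ∀ x → deg G' x ≡ π x) where

    dominating : ∀ x → top x ≡ true → ∀ y → x ≢ y → adj G' x y ≡ true
    dominating x t y x≢y = [ id , (λ e → ⊥-elim (<-irrefl refl (too-few e))) ]′ (bool (adj G' x y))
      where
      too-few : adj G' x y ≡ false → n' < n'
      too-few e = s≤s⁻¹ (begin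
        suc (suc n') ≡⟨ cong (λ b → suc (suc (degree b (core x)))) (≡-sym t) ⟩
        suc (suc (π x)) ≡⟨ cong (2 +_) (≡-sym (trans (≡-sym (deg≡# G' x)) (real x))) ⟩
        suc (suc (# (adj G' x))) ≤⟨ s≤s (s≤s (#-mono λ z xz → ∧-true (∧-true refl (not-true (≢⇒== (adj⇒≢ G' xz)))) (not-true (≢⇒== {i = y} λ { refl → true≢false xz e })))) ⟩
        suc (suc (# (λ z → (true ∧ not (x == z)) ∧ not (y == z)))) ≡⟨ cong suc (≡-sym (#-remove (λ z → true ∧ not (x == z)) y (not-true (≢⇒== x≢y)))) ⟩
        suc (# (λ z → true ∧ not (x == z))) ≡⟨ ≡-sym (#-remove (λ _ → true) x refl) ⟩
        # {n} (λ _ → true) ≡⟨ #-⊤ n ⟩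
        suc n' ∎)
        where open ≤-Reasoning

    -- Outside the core the degree `τ` is used up by the `τ` dominating vertices. So in every
    -- realization the edges outside the top stay inside the core.
    edge⇒core : ∀ x y → top x ≡ false → top y ≡ false → adj G' x y ≡ true → core x ≡ true
    edge⇒core x y tx ty xy = [ id , (λ b → ⊥-elim (<-irrefl refl (too-many b))) ]′ (bool (core x))
      where
      too-many : core x ≡ false → τ < τ
      too-many b = begin
        suc τ ≡⟨ cong suc (≡-sym (#-below τ (≤-trans τ≤m m≤n))) ⟩
        suc (# top) ≤⟨ s≤s (#-mono λ z tz → ∧-true (adj-sym G' (dominating z tz x λ { refl → true≢false tz tx })) (not-true (≢⇒== {i = y} λ { refl → true≢false tz ty }))) ⟩
        suc (# (λ z → adj G' x z ∧ not (y == z))) ≡⟨ ≡-sym (#-remove (adj G' x) y xy) ⟩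
        # (adj G' x) ≡⟨ trans (≡-sym (deg≡# G' x)) (real x) ⟩
        π x ≡⟨ cong₂ degree tx b ⟩
        τ ∎
        where open ≤-Reasoning

    module _ {k h} (k≡ : k ≡ τ + suc h) (emb : path² k ⊆G G') where

      f : Fin k → Fin n
      f = proj₁ emb

      Y : Fin k → Bool
      Y a = not (top (f a))

      #Y : suc h ≤ # Y
      #Y = +-cancelˡ-≤ τ (suc h) (# Y) (begin
        τ + suc h ≡⟨ ≡-sym k≡ ⟩
        k ≡⟨ ≡-sym (#-compl (λ a → top (f a))) ⟩
        # (λ a → top (f a)) + # Y ≤⟨ +-monoˡ-≤ (# Y) (≤-trans (#-preimage top f (proj₁ (proj₂ emb))) (#-below-≤ {n} τ)) ⟩
        τ + # Y ∎)
        where open ≤-Reasoning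

      end-interval : ∀ a b → near (toℕ a) (toℕ b) ≡ true → Y a ≡ true → Y b ≡ true → τ ≤ toℕ (f a) × toℕ (f a) ≤ τ + c
      end-interval a b ab ya yb = <ᵇ-false⁻ {toℕ (f a)} {τ} (not⇒false ya) ,
        s≤s⁻¹ (<ᵇ-true⁻ {n = m} (edge⇒core (f a) (f b) (not⇒false ya) (not⇒false yb) (proj₂ (proj₂ emb) a b ab)))

      end-interval′ : ∀ a b → near (toℕ a) (toℕ b) ≡ true → Y a ≡ true → Y b ≡ true → τ ≤ toℕ (f b) × toℕ (f b) ≤ τ + c
      end-interval′ a b ab ya yb = end-interval b a (trans (near-sym (toℕ b) (toℕ a)) ab) yb ya

      f-injective : ∀ {a b} → toℕ (f a) ≡ toℕ (f b) → a ≡ b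
      f-injective e = proj₁ (proj₂ emb) (toℕ-injective e)

      distinct : ∀ a b → near (toℕ a) (toℕ b) ≡ true → toℕ (f a) ≢ toℕ (f b)
      distinct a b ab e = true≢false ab (subst (λ z → near (toℕ a) (toℕ z) ≡ false) (f-injective e) (near-irrefl (toℕ a)))

      independent : c ≡ 0 → EdgeFree Y
      independent c≡0 a b ab ya yb = distinct a b ab (trans (only (end-interval a b ab ya yb)) (≡-sym (only (end-interval′ a b ab ya yb))))
        where
        only : ∀ {z} → τ ≤ z × z ≤ τ + c → z ≡ τ
        only (p , q) = ≤-antisym (≤-trans q (≤-reflexive (trans (cong (τ +_) c≡0) (+-identityʳ τ)))) p

      one-edge : c ≡ 1 → AtMostOneEdge Y
      one-edge c≡1 a b d e ab ya yb de yd ye = pigeon (two (end-interval a b ab ya yb)) (two (end-interval′ a b ab ya yb)) (two (end-interval d e de yd ye))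
        where
        two : ∀ {z} → τ ≤ z × z ≤ τ + c → z ≡ τ ⊎ z ≡ suc τ
        two {z} (p , q) with z ≟ τ
        ... | yes e = inj₁ e
        ... | no ne = inj₂ (≤-antisym (≤-trans q (≤-reflexive (trans (cong (τ +_) c≡1) (+-comm τ 1)))) (≤∧≢⇒< p (ne ∘ ≡-sym)))
        pigeon : toℕ (f a) ≡ τ ⊎ toℕ (f a) ≡ suc τ → toℕ (f b) ≡ τ ⊎ toℕ (f b) ≡ suc τ → toℕ (f d) ≡ τ ⊎ toℕ (f d) ≡ suc τ → d ≡ a ⊎ d ≡ b
        pigeon (inj₁ p) (inj₁ q) _ = ⊥-elim (distinct a b ab (trans p (≡-sym q)))
        pigeon (inj₂ p) (inj₂ q) _ = ⊥-elim (distinct a b ab (trans p (≡-sym q)))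
        pigeon (inj₁ p) (inj₂ q) (inj₁ r) = inj₁ (f-injective (trans r (≡-sym p)))
        pigeon (inj₁ p) (inj₂ q) (inj₂ r) = inj₂ (f-injective (trans r (≡-sym q)))
        pigeon (inj₂ p) (inj₁ q) (inj₁ r) = inj₂ (f-injective (trans r (≡-sym q)))
        pigeon (inj₂ p) (inj₁ q) (inj₂ r) = inj₁ (f-injective (trans r (≡-sym p)))

      no-room₀ : c ≡ 0 → k < suc (3 * h) → ⊥
      no-room₀ c≡0 lt = <⇒≱ lt (linear 0 (sparse Y (independent c≡0) ⊕ *-monoʳ-≤ 3 #Y) (lem h k (# Y)))
        where
        lem : ∀ h k y → suc (3 * h) + (k + 2 + 3 * y) + 0 ≡ k + (3 * y + 3 * suc h)
        lem = solve-∀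

      no-room₁ : c ≡ 1 → ∀ p → k ≡ 1 + p * 3 → h ≡ suc p → ⊥
      no-room₁ c≡1 p k≡1+3p h≡ = <-irrefl refl (≤-trans (≤-trans (≤-reflexive (cong suc (≡-sym h≡))) #Y) (almost-sparse p k≡1+3p Y (one-edge c≡1)))

-- The integer bound

open import Data.Integer using (+_; _>_)

euclid : ∀ x r q → r < 3 → x ≡ r + q * 3 → x % 3 ≡ r × x / 3 ≡ q
euclid x r q r<3 refl = rem , *-cancelʳ-≡ _ q 3 (+-cancelˡ-≡ r _ _ (≡-sym (trans (m≡m%n+[m/n]*n x 3) (cong (λ z → z + x / 3 * 3) rem))))
  where
  rem : (r + q * 3) % 3 ≡ r
  rem = trans ([m+kn]%n≡m%n r q 3) (m<n⇒m%n≡m r<3)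

N-rem₀ : ∀ k q → k % 3 ≡ 0 → k / 3 ≡ q → N k ≡ 20 * (q * q) ∸ q
N-rem₀ k q e refl with k % 3 | e
... | _ | refl = refl

N-rem₁ : ∀ k q → k % 3 ≡ 1 → k / 3 ≡ q → N k ≡ 20 * (q * q) + 23 * q + 5
N-rem₁ k q e refl with k % 3 | e
... | _ | refl = refl

N-rem₂ : ∀ k q → k % 3 ≡ 2 → k / 3 ≡ q → N k ≡ 20 * (q * q) + 31 * q + 12
N-rem₂ k q e refl with k % 3 | e
... | _ | refl = refl

-- One polynomial through all three formulas: `i` equal to 0, 1, 2 stands for the residues 0, 2, 1
-- of k, and for `i = 2` the quotient is `3 + g` rather than `2 + g`.
N-value : ∀ i g → i ≤ 2 → N (6 + 2 * i + 3 * g) ≡ 78 + 79 * g + 20 * (g * g) + 64 * i + 32 * (i * g) + 12 * (i * i)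
N-value 0 g _ = let r , q = euclid (6 + 3 * g) 0 (2 + g) (s≤s z≤n) (lem₁ g) in
  trans (N-rem₀ (6 + 3 * g) (2 + g) r q) (trans (cong (λ z → z ∸ (2 + g)) (lem₂ g)) (m+n∸n≡m _ (2 + g)))
  where
  lem₁ : ∀ g → 6 + 3 * g ≡ 0 + (2 + g) * 3
  lem₁ = solve-∀
  lem₂ : ∀ g → 20 * ((2 + g) * (2 + g)) ≡ 78 + 79 * g + 20 * (g * g) + 64 * 0 + 32 * (0 * g) + 12 * (0 * 0) + (2 + g)
  lem₂ = solve-∀
N-value 1 g _ = let r , q = euclid (8 + 3 * g) 2 (2 + g) ≤-refl (lem₁ g) in trans (N-rem₂ (8 + 3 * g) (2 + g) r q) (lem₂ g)
  where
  lem₁ : ∀ g → 8 + 3 * g ≡ 2 + (2 + g) * 3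
  lem₁ = solve-∀
  lem₂ : ∀ g → 20 * ((2 + g) * (2 + g)) + 31 * (2 + g) + 12 ≡ 78 + 79 * g + 20 * (g * g) + 64 * 1 + 32 * (1 * g) + 12 * (1 * 1)
  lem₂ = solve-∀
N-value 2 g _ = let r , q = euclid (10 + 3 * g) 1 (3 + g) (s≤s (s≤s z≤n)) (lem₁ g) in trans (N-rem₁ (10 + 3 * g) (3 + g) r q) (lem₂ g)
  where
  lem₁ : ∀ g → 10 + 3 * g ≡ 1 + (3 + g) * 3
  lem₁ = solve-∀
  lem₂ : ∀ g → 20 * ((3 + g) * (3 + g)) + 23 * (3 + g) + 5 ≡ 78 + 79 * g + 20 * (g * g) + 64 * 2 + 32 * (2 * g) + 12 * (2 * 2)
  lem₂ = solve-∀
N-value (suc (suc (suc i))) g (s≤s (s≤s ()))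

two-thirds : ∀ i g → i ≤ 2 → (2 * (6 + 2 * i + 3 * g)) / 3 ≡ suc (3 + i + 2 * g)
two-thirds i g i≤2 = proj₂ (euclid (2 * (6 + 2 * i + 3 * g)) i (4 + i + 2 * g) (s≤s i≤2) (lem i g))
  where
  lem : ∀ i g → 2 * (6 + 2 * i + 3 * g) ≡ i + (4 + i + 2 * g) * 3
  lem = solve-∀

sign : ∀ i g → i ≤ 2 → let s = + 1 ℤ.- negOnePow ((6 + 2 * i + 3 * g) % 3) in (i ≤ 1 × s ≡ + 0) ⊎ (i ≡ 2 × s ≡ + 2)
sign 0 g _ = inj₁ (z≤n , cong (λ r → + 1 ℤ.- negOnePow r) (proj₁ (euclid (6 + 3 * g) 0 (2 + g) (s≤s z≤n) (lem g))))
  where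
  lem : ∀ g → 6 + 3 * g ≡ 0 + (2 + g) * 3
  lem = solve-∀
sign 1 g _ = inj₁ (≤-refl , cong (λ r → + 1 ℤ.- negOnePow r) (proj₁ (euclid (8 + 3 * g) 2 (2 + g) ≤-refl (lem g))))
  where
  lem : ∀ g → 8 + 3 * g ≡ 2 + (2 + g) * 3
  lem = solve-∀
sign 2 g _ = inj₂ (refl , cong (λ r → + 1 ℤ.- negOnePow r) (proj₁ (euclid (10 + 3 * g) 1 (3 + g) (s≤s (s≤s z≤n)) (lem g))))
  where
  lem : ∀ g → 10 + 3 * g ≡ 1 + (3 + g) * 3
  lem = solve-∀
sign (suc (suc (suc i))) g (s≤s (s≤s ()))

-- The bound as a difference of two natural numbers, with the sign term replaced by `β`. Moving the
-- subtracted one to the other side turns every later comparison into one of natural numbers.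
bound-value : ∀ k n τ β → (2 * k) / 3 ≡ suc τ → + 1 ℤ.- negOnePow (k % 3) ≡ + β →
  bound k n ≡ + (2 * (τ * n) + β) ℤ.- + (suc τ * τ)
bound-value k n τ β t≡ β≡ = begin
  bound k n ≡⟨ cong (λ t → (+ 2) ℤ.* + t ℤ.* (+ n) ℤ.- (+ 2) ℤ.* (+ n) ℤ.- + t ℤ.* + t ℤ.+ + t ℤ.+ (+ 1) ℤ.- negOnePow (k % 3)) t≡ ⟩
  (+ 2) ℤ.* (+ 1 ℤ.+ + τ) ℤ.* (+ n) ℤ.- (+ 2) ℤ.* (+ n) ℤ.- (+ 1 ℤ.+ + τ) ℤ.* (+ 1 ℤ.+ + τ) ℤ.+ (+ 1 ℤ.+ + τ) ℤ.+ (+ 1) ℤ.- negOnePow (k % 3)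
    ≡⟨ lem (+ τ) (+ n) (negOnePow (k % 3)) ⟩
  (+ 2) ℤ.* (+ τ ℤ.* + n) ℤ.+ (+ 1 ℤ.- negOnePow (k % 3)) ℤ.- (+ 1 ℤ.+ + τ) ℤ.* + τ
    ≡⟨ cong₂ (λ a b → a ℤ.- b) (cong₂ ℤ._+_ (trans (cong ((+ 2) ℤ.*_) (≡-sym (ℤₚ.pos-* τ n))) (≡-sym (ℤₚ.pos-* 2 (τ * n)))) β≡) (≡-sym (ℤₚ.pos-* (suc τ) τ)) ⟩
  + (2 * (τ * n) + β) ℤ.- + (suc τ * τ) ∎
  where
  open ≡-Reasoning
  lem : ∀ τ n e → (+ 2) ℤ.* (+ 1 ℤ.+ τ) ℤ.* n ℤ.- (+ 2) ℤ.* n ℤ.- (+ 1 ℤ.+ τ) ℤ.* (+ 1 ℤ.+ τ) ℤ.+ (+ 1 ℤ.+ τ) ℤ.+ (+ 1) ℤ.- e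
    ≡ (+ 2) ℤ.* (τ ℤ.* n) ℤ.+ (+ 1 ℤ.- e) ℤ.- (+ 1 ℤ.+ τ) ℤ.* τ
  lem = ℤ-solve-∀

>-pos⇒< : ∀ {S P Q} → + S > + P ℤ.- + Q → P < S + Q
>-pos⇒< {S} {P} {Q} gt = ℤₚ.drop‿+<+ (subst (λ z → z ℤ.< + S ℤ.+ + Q) (lem (+ P) (+ Q)) (ℤₚ.+-monoˡ-< (+ Q) gt))
  where
  lem : ∀ p q → p ℤ.- q ℤ.+ q ≡ p
  lem = ℤ-solve-∀

≡⇒pos-≡ : ∀ {S P Q} → S + Q ≡ P → + S ≡ + P ℤ.- + Q
≡⇒pos-≡ {S} {P} {Q} refl = lem (+ S) (+ Q)
  where
  lem : ∀ s q → s ≡ s ℤ.+ q ℤ.- q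
  lem = ℤ-solve-∀

-- The numbers `6 + 2 * i + 3 * g` are 6 and everything from 8 on; 7 is the gap.
decompose : ∀ k → k ≡ 6 ⊎ 8 ≤ k → ∃ λ i → ∃ λ g → i ≤ 2 × k ≡ 6 + 2 * i + 3 * g
decompose k (inj₁ refl) = 0 , 0 , z≤n , refl
decompose k (inj₂ 8≤k) = let i , g , i≤2 , e = from-8 (k ∸ 8) in i , g , i≤2 , trans (≡-sym (m+[n∸m]≡n 8≤k)) e
  where
  from-8 : ∀ m → ∃ λ i → ∃ λ g → i ≤ 2 × 8 + m ≡ 6 + 2 * i + 3 * g
  from-8 0 = 1 , 0 , n≤1+n 1 , refl
  from-8 1 = 0 , 1 , z≤n , refl
  from-8 2 = 2 , 0 , ≤-refl , refl
  from-8 (suc (suc (suc m))) = let i , g , i≤2 , e = from-8 m in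
      i , suc g , i≤2 , trans (lem₁ m) (trans (cong (λ z → 3 + z) e) (lem₂ i g))
    where
    lem₁ : ∀ m → 8 + suc (suc (suc m)) ≡ 3 + (8 + m)
    lem₁ = solve-∀
    lem₂ : ∀ i g → 3 + (6 + 2 * i + 3 * g) ≡ 6 + 2 * i + 3 * suc g
    lem₂ = solve-∀

-- Both halves of the theorem for k = 6 + 2i + 3g

Attained : ℕ → ℕ → Set
Attained k n = Σ (Fin n → ℕ) λ π → Graphic π × + σ π ≡ bound k n ×
    (∀ (G : Graph n) → Realization π G → ¬ (∀ (H : Graph k) → IsTwoTree k H → H ⊆G G))

module Main (i g : ℕ) (i≤2 : i ≤ 2) where

  k τ : ℕ
  k = 6 + 2 * i + 3 * g
  τ = 3 + i + 2 * g

  sufficient : ∀ n → N k ≤ n → (π : Fin n → ℕ) → Graphic π → + σ π > bound k n → Contains k π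
  sufficient n N≤n π (sorted , G₀ , real₀) gt = contains (sign i g i≤2)
    where
    large : 78 + 79 * g + 20 * (g * g) + 64 * i + 32 * (i * g) + 12 * (i * i) ≤ n
    large = subst (λ z → z ≤ n) (N-value i g i≤2) N≤n
    over : ∀ {β} → + 1 ℤ.- negOnePow (k % 3) ≡ + β → 2 * (τ * n) + β < ∑ π + suc τ * τ
    over {β} s = subst (λ z → 2 * (τ * n) + β < z + suc τ * τ) (σ≡∑ π)
      (>-pos⇒< {σ π} {2 * (τ * n) + β} {suc τ * τ} (subst (λ z → + σ π > z) (bound-value k n τ β (two-thirds i g i≤2) s) gt))
    contains : (i ≤ 1 × _) ⊎ (i ≡ 2 × _) → Contains k π
    contains (inj₁ (i≤1 , s)) = Family.contains i g n large π sorted G₀ real₀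
      (≤-trans (≤-reflexive (lem (2 * (τ * n)))) (over s)) (inj₁ i≤1)
      where
      lem : ∀ a → a + 1 ≡ suc (a + 0)
      lem = solve-∀
    contains (inj₂ (i≡2 , s)) = Family.contains i g n large π sorted G₀ real₀
      (≤-trans (≤-by 2 (lem (2 * (τ * n)))) (over s)) (inj₂ (i≡2 , ≤-trans (≤-reflexive (+-suc (2 * (τ * n)) 2)) (over s)))
      where
      lem : ∀ a → a + 1 + 2 ≡ suc (a + 2)
      lem = solve-∀

  sharp : ∀ n → N k ≤ n → Attained k n
  sharp n N≤n = go n (≤-trans (Family.T≤N i g n (subst (λ z → z ≤ n) (N-value i g i≤2) N≤n)) ≤-refl) (sign i g i≤2)
    where
    h : ℕ
    h = 2 + i + g
    k≡ : k ≡ τ + suc h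
    k≡ = lem i g
      where
      lem : ∀ i g → 6 + 2 * i + 3 * g ≡ 3 + i + 2 * g + suc (2 + i + g)
      lem = solve-∀
    tree : IsTwoTree k (path² k)
    tree = path²-isTwoTree (3 + 2 * i + 3 * g)
    example : ∀ n' c (le : τ + c ≤ n') → + 1 ℤ.- negOnePow (k % 3) ≡ + (suc c * c) →
      (∀ G' → Realization (Extremal.π τ c n' le) G' → path² k ⊆G G' → ⊥) →
      Attained k (suc n')
    example n' c le s none = E.π , (E.sorted , E.G , E.realizes) ,
        trans (≡⇒pos-≡ (trans (cong (λ z → z + suc τ * τ) (σ≡∑ E.π)) E.sum)) (≡-sym (bound-value k (suc n') τ (suc c * c) (two-thirds i g i≤2) s)) ,
        λ G' real all → none G' real (all (path² k) tree)
      where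
      module E = Extremal τ c n' le
    go : ∀ n → τ + 4 ≤ n → (i ≤ 1 × _) ⊎ (i ≡ 2 × _) → Attained k n
    go (suc n') le (inj₁ (i≤1 , s)) = example n' 0 room s λ G' real emb →
        Extremal.no-room₀ τ 0 n' room G' real k≡ emb refl (≤-by i (lem i g))
      where
      room : τ + 0 ≤ n'
      room = s≤s⁻¹ (≤-trans (≤-by 3 (solve₀ τ)) le)
        where
        solve₀ : ∀ τ → suc (τ + 0) + 3 ≡ τ + 4
        solve₀ = solve-∀
      lem : ∀ i g → suc (6 + 2 * i + 3 * g) + i ≡ suc (3 * (2 + i + g))
      lem = solve-∀
    go (suc n') le (inj₂ (i≡2 , s)) = example n' 1 room s λ G' real emb →
        Extremal.no-room₁ τ 1 n' room G' real k≡ emb refl (3 + g) (trans (cong (λ z → 6 + 2 * z + 3 * g) i≡2) (lem g)) (cong (λ z → 2 + z + g) i≡2)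
      where
      room : τ + 1 ≤ n'
      room = s≤s⁻¹ (≤-trans (≤-by 2 (solve₁ τ)) le)
        where
        solve₁ : ∀ τ → suc (τ + 1) + 2 ≡ τ + 4
        solve₁ = solve-∀
      lem : ∀ g → 6 + 2 * 2 + 3 * g ≡ 1 + (3 + g) * 3
      lem = solve-∀

theorem1p5 : ∀ (k : ℕ) → (k ≡ 6 ⊎ 8 ≤ k) →
    (∀ (n : ℕ) → N k ≤ n → (π : Fin n → ℕ) → Graphic π → + σ π > bound k n →
    Σ (Graph n) λ G → Realization π G × (∀ (H : Graph k) → IsTwoTree k H → H ⊆G G))
    × (∀ (n : ℕ) → N k ≤ n →
    Σ (Fin n → ℕ) λ π → Graphic π × + σ π ≡ bound k n ×
    (∀ (G : Graph n) → Realization π G → ¬ (∀ (H : Graph k) → IsTwoTree k H → H ⊆G G)))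
theorem1p5 k hk with decompose k hk
... | i , g , i≤2 , refl = sufficient , sharp
  where open Main i g i≤2
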